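{- Let $d\ge1$ and let $\Delta=\operatorname{conv}(v_1,\ldots,v_{2d})\subset\mathbb{R}^{2d-1}$ be a $(2d-1)$-dimensional lattice simplex whose codimension-$1$ facets are basic lattice simplices. Then the following are equivalent: (1) for all $k=1,\ldots,d-1$, every lattice point $x\in k\Delta\cap\mathbb{Z}^{2d-1}$, written as $x=\sum_i\lambda_iv_i$ with $\lambda_i\ge0$, $\sum_i\lambda_i=k$, has all $\lambda_i\in\mathbb{Z}$; (2) for all $k=1,\ldots,d-1$, $\mathrm{Int}(k\Delta)\cap\mathbb{Z}^{2d-1}=\emptyset$; (3) $h^*_\Delta=1+(n-1)t^d$ for some integer $n\ge1$; (4) $\Delta\cong\Delta(a_1,\ldots,a_{d-1},n)$ for some integers $a_1,\ldots,a_{d-1},n$ with $n>0$ and $\gcd(a_1\cdots a_{d-1},n)=1$; (5) $\Delta\cong\Delta_1*\cdots*\Delta_d$ for some $1$-dimensional lattice simplices $\Delta_1,\ldots,\Delta_d\subset\mathbb{R}^d$.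
   Context: Basic simplex: $\operatorname{conv}(w_1,\ldots,w_{k+1})\subset\mathbb{R}^m$ with $w_1-w_{k+1},\ldots,w_k-w_{k+1}$ part of a lattice basis of $\mathbb{Z}^m$. $h^*$-polynomial: with $w_j=(v_j,1)$ and $\mathrm{Par}(\Delta)=\{\sum_j\lambda_jw_j:0\le\lambda_j<1\}$, $h^*_\Delta=\sum_kh^*_kt^k$ where $h^*_k$ is the number of lattice points of $\mathrm{Par}(\Delta)$ with last coordinate $k$. Cayley polytope: for lattice polytopes $\Sigma_1,\ldots,\Sigma_r\subset\mathbb{R}^d$ ($r\le d$), $\Sigma_1*\cdots*\Sigma_r=\operatorname{conv}(e_1\times\Sigma_1,\ldots,e_r\times\Sigma_r)\subset\mathbb{R}^r\times\mathbb{R}^d$, lying in $H=\{x:x_1+\cdots+x_r=1\}$ with lattice $H\cap\mathbb{Z}^{r+d}$. For integers $a_1,\ldots,a_{d-1},n$ with $n>0$ and $\gcd(a_1\cdots a_{d-1},n)=1$, $\Delta(a_1,\ldots,a_{d-1},n):=\Delta_1*\cdots*\Delta_d\subset\mathbb{R}^{2d}$ with $\Delta_i=\operatorname{conv}(0,e_i)\subset\mathbb{R}^d$ for $i\le d-1$ and $\Delta_d=\operatorname{conv}(0,(a_1,\ldots,a_{d-1},n))\subset\mathbb{R}^d$. For $P\subset H$ ($r=d$), $\Delta\cong P$ means there is an affine isomorphism $\varphi:\mathbb{R}^{2d-1}\to H$ with $\varphi(\mathbb{Z}^{2d-1})=H\cap\mathbb{Z}^{2d}$ and $\varphi(\Delta)=P$.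 -}

module Defs where

open import Data.Nat as ℕ using (ℕ; zero; suc; _≡ᵇ_; _∸_)
open import Data.Integer as ℤ using (ℤ; +_)
open import Data.Integer.GCD using (gcd)
open import Data.Rational as ℚ using (ℚ; 0ℚ; 1ℚ; _/_)
open import Data.Fin as Fin using (Fin; zero; suc; inject₁; fromℕ; punchIn)
open import Data.Vec as Vec using (Vec; []; _∷_; _++_; tabulate; lookup; replicate; take)
open import Data.Sum using (_⊎_; inj₁; inj₂)
open import Data.Product using (Σ; ∃; _×_; _,_; proj₁; proj₂)
open import Data.Bool using (if_then_else_)
open import Data.List using (List; length)
open import Data.List.Membership.Propositional using (_∈_)
open import Data.List.Relation.Unary.Unique.Propositional using (Unique)
open import Function using (_∘_)
open import Relation.Binary.PropositionalEquality using (_≡_; _≢_)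
open import Relation.Nullary using (¬_; does)

ι : ℤ → ℚ
ι z = z / 1

Σℚ : ∀ {n} → (Fin n → ℚ) → ℚ
Σℚ {zero}  f = 0ℚ
Σℚ {suc n} f = f zero ℚ.+ Σℚ (f ∘ suc)

Σℤ : ∀ {n} → (Fin n → ℤ) → ℤ
Σℤ {zero}  f = + 0
Σℤ {suc n} f = f zero ℤ.+ Σℤ (f ∘ suc)

Πℤ : ∀ {n} → (Fin n → ℤ) → ℤ
Πℤ {zero}  f = + 1
Πℤ {suc n} f = f zero ℤ.* Πℤ (f ∘ suc)

IsInt : ℚ → Set
IsInt q = ∃ λ (z : ℤ) → q ≡ ι z

Pt : ℕ → Set
Pt m = Vec ℤ m

PtQ : ℕ → Set
PtQ m = Vec ℚ m

unit : ∀ {m} → Fin m → Pt m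
unit i = tabulate (λ c → if does (c Fin.≟ i) then + 1 else + 0)

caseLast : ∀ {e} {A : Set} → (Fin e → A) → A → Fin (suc e) → A
caseLast {zero}  f x zero    = x
caseLast {suc e} f x zero    = f zero
caseLast {suc e} f x (suc i) = caseLast (f ∘ suc) x i

combQ : ∀ {k m} → (Fin k → ℚ) → (Fin k → Pt m) → PtQ m
combQ λ' g = tabulate (λ c → Σℚ (λ i → λ' i ℚ.* ι (lookup (g i) c)))

combZ : ∀ {k m} → (Fin k → ℤ) → (Fin k → Pt m) → Pt m
combZ c g = tabulate (λ r → Σℤ (λ i → c i ℤ.* lookup (g i) r))

_-ᵥ_ : ∀ {m} → Pt m → Pt m → Pt m
x -ᵥ y = Vec.zipWith ℤ._-_ x y

IsLatticeBasis : ∀ {m} → (Fin m → Pt m) → Set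
IsLatticeBasis {m} b =
  (∀ (x : Pt m) → ∃ λ (c : Fin m → ℤ) → combZ c b ≡ x) ×
  (∀ (c : Fin m → ℤ) → combZ c b ≡ replicate m (+ 0) → ∀ i → c i ≡ + 0)

PartOfLatticeBasis : ∀ {k m} → (Fin k → Pt m) → Set
PartOfLatticeBasis {k} {m} w =
  Σ (Fin m → Pt m) λ b → IsLatticeBasis b ×
    Σ (Fin k → Fin m) λ f → (∀ i j → f i ≡ f j → i ≡ j) × (∀ i → b (f i) ≡ w i)

IsBasicSimplex : ∀ {k m} → (Fin (suc k) → Pt m) → Set
IsBasicSimplex {k} w = PartOfLatticeBasis (λ i → w (inject₁ i) -ᵥ w (fromℕ k))

-- Simplices and convex hulls (membership tested on rational points)

AffinelyIndependent : ∀ {k m} → (Fin k → Pt m) → Set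
AffinelyIndependent {k} {m} v =
  ∀ (λ' : Fin k → ℚ) → combQ λ' v ≡ replicate m 0ℚ → Σℚ λ' ≡ 0ℚ → ∀ i → λ' i ≡ 0ℚ

InScaledConv : ∀ {k m} → ℚ → (Fin k → Pt m) → PtQ m → Set
InScaledConv t g y =
  ∃ λ (λ' : Fin _ → ℚ) → (∀ i → 0ℚ ℚ.≤ λ' i) × Σℚ λ' ≡ t × combQ λ' g ≡ y

InConv : ∀ {k m} → (Fin k → Pt m) → PtQ m → Set
InConv = InScaledConv 1ℚ

-- y lies in the interior of S ⊆ ℝ^m (S given by its rational points):
-- some sup-norm ball of positive radius around y lies in S
InInterior : ∀ {m} → (PtQ m → Set) → PtQ m → Set
InInterior {m} S y =
  ∃ λ (ε : ℚ) → 0ℚ ℚ.< ε ×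
    (∀ (z : PtQ m) → (∀ c → ℚ.∣ lookup z c ℚ.- lookup y c ∣ ℚ.< ε) → S z)

HasCard : {A : Set} → (A → Set) → ℕ → Set
HasCard {A} P n =
  Σ (List A) λ l → Unique l × (∀ x → (x ∈ l → P x) × (P x → x ∈ l)) × length l ≡ n

-- lattice points of Par(Δ) with last coordinate k  (points of ℤ^{m+1} as (x , h))
ParAt : ∀ {k m} → (Fin k → Pt m) → ℕ → Pt m × ℤ → Set
ParAt v k (x , h) =
  h ≡ + k ×
  ∃ λ (λ' : Fin _ → ℚ) → (∀ i → 0ℚ ℚ.≤ λ' i × λ' i ℚ.< 1ℚ) ×
    combQ λ' v ≡ Vec.map ι x × Σℚ λ' ≡ ι h

HStarIs : ∀ {k m} → (Fin k → Pt m) → (ℕ → ℕ) → Set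
HStarIs v c = ∀ (k : ℕ) → HasCard (ParAt v k) (c k)

coeff-1+[n-1]t^d : ℕ → ℕ → ℕ → ℕ
coeff-1+[n-1]t^d n d k =
  (if k ≡ᵇ 0 then 1 else 0) ℕ.+ (if k ≡ᵇ d then n ∸ 1 else 0)

-- generators e_i × Σ_i of Σ_1 * ⋯ * Σ_r for segments Σ_i = conv(p_i , q_i) ⊂ ℝ^d
CayleyGens : ∀ {r d} → (Fin r → Pt d × Pt d) → Fin (r ℕ.+ r) → Pt (r ℕ.+ d)
CayleyGens {r} seg i with Fin.splitAt r i
... | inj₁ j = unit j ++ proj₁ (seg j)
... | inj₂ j = unit j ++ proj₂ (seg j)

InCayley : ∀ {r d} → (Fin r → Pt d × Pt d) → PtQ (r ℕ.+ d) → Set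
InCayley seg = InConv (CayleyGens seg)

record AffZ (m N : ℕ) : Set where
  field
    A : Fin N → Fin m → ℤ
    b : Pt N

applyQ : ∀ {m N} → AffZ m N → PtQ m → PtQ N
applyQ φ x = tabulate (λ r → ι (lookup (AffZ.b φ) r) ℚ.+ Σℚ (λ c → ι (AffZ.A φ r c) ℚ.* lookup x c))

applyZ : ∀ {m N} → AffZ m N → Pt m → Pt N
applyZ φ x = tabulate (λ r → lookup (AffZ.b φ) r ℤ.+ Σℤ (λ c → AffZ.A φ r c ℤ.* lookup x c))

InHQ : ∀ r {d} → PtQ (r ℕ.+ d) → Set
InHQ r y = Σℚ (lookup (take r y)) ≡ 1ℚ

InHZ : ∀ r {d} → Pt (r ℕ.+ d) → Set
InHZ r z = Σℤ (lookup (take r z)) ≡ + 1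

IsLatticeIsoOntoH : ∀ {m} r {d} → AffZ m (r ℕ.+ d) → Set
IsLatticeIsoOntoH {m} r {d} φ =
  (∀ (x : PtQ m) → InHQ r (applyQ φ x)) ×
  (∀ (x x' : PtQ m) → applyQ φ x ≡ applyQ φ x' → x ≡ x') ×
  (∀ (z : Pt (r ℕ.+ d)) → InHZ r z → ∃ λ (x : Pt m) → applyZ φ x ≡ z)

IsoToH : ∀ {k m} r {d} → (Fin k → Pt m) → (PtQ (r ℕ.+ d) → Set) → Set
IsoToH {k} {m} r {d} v P =
  ∃ λ (φ : AffZ m (r ℕ.+ d)) → IsLatticeIsoOntoH r φ ×
    (∀ (y : PtQ (r ℕ.+ d)) →
       ((∃ λ (x : PtQ m) → InConv v x × applyQ φ x ≡ y) → P y) ×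
       (P y → ∃ λ (x : PtQ m) → InConv v x × applyQ φ x ≡ y))

-- the segments of Δ(a_1,…,a_{d-1},n), d = suc e:
-- Δ_i = conv(0, e_i) for i ≤ d-1, Δ_d = conv(0, (a_1,…,a_{d-1},n))
segsΔ : ∀ {e} → (Fin e → ℤ) → ℤ → Fin (suc e) → Pt (suc e) × Pt (suc e)
segsΔ {e} a n i =
  replicate (suc e) (+ 0) , caseLast (λ j → unit (inject₁ j)) (tabulate (caseLast a n)) i

-- The five conditions of Theorem 2.5, for d = suc e, a simplex
-- Δ = conv(v_1,…,v_{2d}) ⊂ ℝ^{2d-1}, 2d-1 = suc (2 * e).

module _ (e : ℕ) (v : Fin (suc (suc (2 ℕ.* e))) → Pt (suc (2 ℕ.* e))) where

  Cond1 : Set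
  Cond1 = ∀ (k : ℕ) → 1 ℕ.≤ k → k ℕ.≤ e →
    ∀ (x : Pt (suc (2 ℕ.* e))) (λ' : Fin (suc (suc (2 ℕ.* e))) → ℚ) →
      (∀ i → 0ℚ ℚ.≤ λ' i) → Σℚ λ' ≡ ι (+ k) → combQ λ' v ≡ Vec.map ι x →
      ∀ i → IsInt (λ' i)

  Cond2 : Set
  Cond2 = ∀ (k : ℕ) → 1 ℕ.≤ k → k ℕ.≤ e →
    ∀ (x : Pt (suc (2 ℕ.* e))) → ¬ InInterior (InScaledConv (ι (+ k)) v) (Vec.map ι x)

  Cond3 : Set
  Cond3 = ∃ λ (n : ℕ) → 1 ℕ.≤ n × HStarIs v (coeff-1+[n-1]t^d n (suc e))

  Cond4 : Set
  Cond4 = ∃ λ (a : Fin e → ℤ) → ∃ λ (n : ℤ) →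
    ℤ.+ 0 ℤ.< n × gcd (Πℤ a) n ≡ + 1 × IsoToH (suc e) v (InCayley (segsΔ a n))

  Cond5 : Set
  Cond5 = ∃ λ (seg : Fin (suc e) → Pt (suc e) × Pt (suc e)) →
    (∀ i → proj₁ (seg i) ≢ proj₂ (seg i)) × IsoToH (suc e) v (InCayley seg)

{-# OPTIONS --safe #-}

-- The barycentric coordinates of a lattice point of height k lie in (1/n)ℤ, where n is the normalised
-- volume, and since the facets are basic they are integral as soon as one of them vanishes. Modulo the
-- vertices the lattice is cyclic, generated by a point with coordinates bᵢ/n, bᵢ prime to n. Reducing
-- coordinates modulo 1 compares (1), (2) and (3). For (5) ⇒ (1), the Cayley coordinates of a lattice point
-- of height k < d are natural numbers with sum k, so one of them vanishes and the point lies on a facet.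
--
-- Under (1), the representatives in Par(Δ) of s and -s times the generator both have height at least d,
-- and their heights add up to 2d; hence Σᵢ {s bᵢ / n} = d for 0 < s < n. So the odd function
-- c = Σᵢ ([bᵢ] - [-bᵢ]) on (ℤ/n)^× has vanishing sawtooth sums, which forces c = 0: the bᵢ pair off into
-- opposite residues, and the pairs are the segments of (4).
--
-- That c = 0 is the nonvanishing of B₁(χ) for odd χ, proved here with finite sums of rationals only.
-- Let R(x) = Σₐ c(a) c(ax). The sawtooth relations say that R annihilates the kernels cot(πxm/M), which
-- rational rotations approximate, and letting M grow gives Σ_{m<N} R(xm)/m = O(1/N²) when n ∣ N. With
-- X = τ¹⁰, the sums Σ u(k) u(k′) R(xm) R(xm′) (X - mkm′k′)₊² over m, k, m′, k′, where u is the indicator of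
-- the residues prime to n, are then O(τ²⁴ log⁴ τ) by the hyperbola method. Sorted by gcd(m, m′), their sum
-- over x becomes a sum of squares which is at least a constant times τ²⁵ Σₓ R(x)², so R = 0.

module Submission where

open import Defs
open import Data.Nat as ℕ using (ℕ; zero; suc; z≤n; s≤s; NonZero)
import Data.Nat.Properties as ℕₚ
open import Data.Nat.DivMod using (_/_; _%_; m≡m%n+[m/n]*n; m%n<n; m<n⇒m%n≡m; [m+kn]%n≡m%n; %-distribˡ-*; %-distribˡ-+; m%n%n≡m%n; m/n*n≤m; %-remove-+ʳ)
open import Data.Nat.Divisibility using (_∣_; _∣?_; divides)
import Data.Nat.Divisibility as ℕd
open import Data.Nat.GCD using (gcd; module Bézout; gcd[m,n]∣m; gcd[m,n]∣n)
open import Data.Nat.Coprimality as Cop using (Coprime; coprime?)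
open import Data.Integer as ℤ using (ℤ; -[1+_])
import Data.Integer.Properties as ℤₚ
open import Data.Rational as ℚ using (ℚ; 0ℚ; 1ℚ; ½; _+_; _*_; _-_; -_; _≤_; _<_; ∣_∣; mkℚ)
open import Data.Rational.Properties hiding (_≟_)
open import Data.Rational.Properties using () renaming (_≟_ to _≟ℚ_)
open import Data.Product using (Σ; ∃; ∃₂; _×_; _,_; proj₁; proj₂)
open import Data.Sum using (_⊎_; inj₁; inj₂; [_,_]′)
open import Data.Empty using (⊥)
open import Data.Maybe using (just; nothing)
open import Data.Unit using (tt)
import Data.Nat.Tactic.RingSolver as ℕring
open import Function using (_∘_)
open import Level using (0ℓ)
open import Relation.Binary.PropositionalEquality
open import Relation.Binary.Definitions using (tri<; tri≈; tri>)
open import Relation.Nullary using (¬_; Dec; yes; no; contradiction)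
open import Tactic.RingSolver using (solve-∀)
open import Tactic.RingSolver.Core.AlmostCommutativeRing using (AlmostCommutativeRing; fromCommutativeRing)

open import Data.Fin as Fin using (Fin; zero; suc; inject₁; fromℕ; punchIn; punchOut; _↑ˡ_; _↑ʳ_; splitAt)
import Data.Fin.Properties as Finₚ
open import Data.Vec as Vec using (Vec; lookup; tabulate; replicate; take)
import Data.Vec.Properties as Vecₚ
open import Data.Bool as Bool using (true; false; if_then_else_)
open import Data.List using ([]; _∷_; applyUpTo)
open import Relation.Nullary using (does)
open import Data.Fin.Relation.Unary.Top using (view; ‵fromℕ; ‵inject₁)
import Data.Integer.DivMod as ℤdm
open import Data.List.Properties using (length-applyUpTo)
open import Data.List.Membership.Propositional using (_∈_)
open import Data.List.Membership.Propositional.Properties using (∈-applyUpTo⁺; ∈-applyUpTo⁻)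
open import Data.List.Relation.Unary.Any using (here)
open import Data.List.Relation.Unary.AllPairs using ([]; _∷_)
open import Data.List.Relation.Unary.All using ([])
open import Data.List.Relation.Unary.Unique.Propositional.Properties using (applyUpTo⁺₁)
import Data.Integer.Divisibility.Signed as ℤd

-- Two points shape the analytic part. Without characters there are no Gauss sums; `R` therefore
-- carries two copies of c. Summed against a kernel, one copy meets the sawtooth and the other takes
-- the place of a Gauss sum. The growth comparison is an elementary form of Ingham's proof that L(1,
-- χ) ≠ 0. For the principal character u, L(s, u)² L(s, χ) L(s, χ̄) is L(2s, u) times the Dirichlet
-- series with coefficients u(m) |Σ χ(d)|², the inner sum being over d ∣ m. Vanishing of L(1, χ)
-- would cancel the double pole at s = 1, whereas the squares preserve the pole of L(2s, u) at s =
-- 1/2, of order X^(5/2) for the weight (X - m)². The tenth power balances two errors: a divisor sum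
-- with step h, cut at D, costs X³/(h D²) + h² D³, and at h = X^(1/2) the two agree for D =
-- X^(3/10). With X = τ¹⁰ the cut is a multiple of τ³, and the total X^(12/5) = τ²⁴, up to
-- logarithms, stays below X^(5/2) = τ²⁵. The logarithms are absorbed by making τ itself an eighth
-- power.

ℚ-ring : AlmostCommutativeRing 0ℓ 0ℓ
ℚ-ring = fromCommutativeRing +-*-commutativeRing isZero
  where
  isZero : ∀ x → _
  isZero x with 0ℚ ≟ℚ x
  ... | yes p = just p
  ... | no _  = nothing

-- Ordered-field arithmetic of the rationals

2ℚ 3ℚ 4ℚ : ℚ
2ℚ = ι (ℤ.+ 2)
3ℚ = ι (ℤ.+ 3)
4ℚ = ι (ℤ.+ 4)

0≤1 : 0ℚ ≤ 1ℚ
0≤1 = nonNegative⁻¹ 1ℚ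

≤-by : ∀ {p q} r → 0ℚ ≤ r → q ≡ p + r → p ≤ q
≤-by {p} r h refl = subst (_≤ p + r) (+-identityʳ p) (+-monoʳ-≤ p h)

<-by : ∀ {p q} r → 0ℚ < r → q ≡ p + r → p < q
<-by {p} r h refl = subst (_< p + r) (+-identityʳ p) (+-monoʳ-< p h)

0≤-sub : ∀ {p q} → p ≤ q → 0ℚ ≤ q - p
0≤-sub {p} {q} h = subst (_≤ q - p) (+-inverseʳ p) (+-monoˡ-≤ (- p) h)

0<-sub : ∀ {p q} → p < q → 0ℚ < q - p
0<-sub {p} {q} h = subst (_< q - p) (+-inverseʳ p) (+-monoˡ-< (- p) h)

0≤+ : ∀ {p q} → 0ℚ ≤ p → 0ℚ ≤ q → 0ℚ ≤ p + q
0≤+ h k = +-mono-≤ h k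

0≤* : ∀ {p q} → 0ℚ ≤ p → 0ℚ ≤ q → 0ℚ ≤ p * q
0≤* {p} {q} h k = nonNegative⁻¹ (p * q)
  {{nonNeg*nonNeg⇒nonNeg p {{ℚ.nonNegative h}} q {{ℚ.nonNegative k}}}}

0<* : ∀ {p q} → 0ℚ < p → 0ℚ < q → 0ℚ < p * q
0<* {p} {q} h k = positive⁻¹ (p * q) {{pos*pos⇒pos p {{ℚ.positive h}} q {{ℚ.positive k}}}}

*-monoˡ : ∀ {p q} r → 0ℚ ≤ r → p ≤ q → r * p ≤ r * q
*-monoˡ r h = *-monoˡ-≤-nonNeg r {{ℚ.nonNegative h}}

*-monoʳ : ∀ {p q} r → 0ℚ ≤ r → p ≤ q → p * r ≤ q * r
*-monoʳ r h = *-monoʳ-≤-nonNeg r {{ℚ.nonNegative h}}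

*-mono : ∀ {p q r s} → 0ℚ ≤ p → 0ℚ ≤ r → p ≤ q → r ≤ s → p * r ≤ q * s
*-mono {p} {q} {r} {s} 0p 0r h k = ≤-trans (*-monoˡ p 0p k) (*-monoʳ s (≤-trans 0r k) h)

*-cancelˡ : ∀ {p q} r → 0ℚ < r → r * p ≤ r * q → p ≤ q
*-cancelˡ r h = *-cancelˡ-≤-pos r {{ℚ.positive h}}

0≤sq : ∀ p → 0ℚ ≤ p * p
0≤sq p with ≤-total 0ℚ p
... | inj₁ h = 0≤* h h
... | inj₂ h = subst (0ℚ ≤_) (neg-sq p) (0≤* h′ h′)
  where
  h′ : 0ℚ ≤ - p
  h′ = neg-antimono-≤ h
  neg-sq : ∀ p → - p * - p ≡ p * p
  neg-sq = solve-∀ ℚ-ring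

∣∣≤⇒≤ : ∀ {p K} → ∣ p ∣ ≤ K → p ≤ K
∣∣≤⇒≤ {p} h with ∣p∣≡p∨∣p∣≡-p p
... | inj₁ e = subst (_≤ _) e h
... | inj₂ e with ≤-total 0ℚ p
...   | inj₁ 0p = subst (_≤ _) (0≤p⇒∣p∣≡p 0p) h
...   | inj₂ p0 = ≤-trans p0 (≤-trans (0≤∣p∣ p) h)

p≤∣p∣ : ∀ p → p ≤ ∣ p ∣
p≤∣p∣ p = ∣∣≤⇒≤ ≤-refl

∣∣-lub : ∀ {p K} → p ≤ K → - p ≤ K → ∣ p ∣ ≤ K
∣∣-lub {p} h k with ∣p∣≡p∨∣p∣≡-p p
... | inj₁ e = subst (_≤ _) (sym e) h
... | inj₂ e = subst (_≤ _) (sym e) k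

∣*∣≤ : ∀ {p q K L} → ∣ p ∣ ≤ K → ∣ q ∣ ≤ L → ∣ p * q ∣ ≤ K * L
∣*∣≤ {p} {q} h k = subst (_≤ _) (sym (∣p*q∣≡∣p∣*∣q∣ p q)) (*-mono (0≤∣p∣ p) (0≤∣p∣ q) h k)

∣+∣≤ : ∀ {p q K L} → ∣ p ∣ ≤ K → ∣ q ∣ ≤ L → ∣ p + q ∣ ≤ K + L
∣+∣≤ {p} {q} h k = ≤-trans (∣p+q∣≤∣p∣+∣q∣ p q) (+-mono-≤ h k)

∣-∣≤ : ∀ {p q K L} → ∣ p ∣ ≤ K → ∣ q ∣ ≤ L → ∣ p - q ∣ ≤ K + L
∣-∣≤ {p} {q} h k = ≤-trans (∣p-q∣≤∣p∣+∣q∣ p q) (+-mono-≤ h k)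

0≤⇒∣∣≤ : ∀ {p K} → 0ℚ ≤ p → p ≤ K → ∣ p ∣ ≤ K
0≤⇒∣∣≤ 0p h = subst (_≤ _) (sym (0≤p⇒∣p∣≡p 0p)) h

-- Integers and natural numbers inside the rationals

ι-+ : ∀ a b → ι (a ℤ.+ b) ≡ ι a + ι b
ι-+ a b = toℚᵘ-injective (begin
  ℚ.toℚᵘ (ι (a ℤ.+ b))                  ≈⟨ toℚᵘ-fromℚᵘ (ℚᵘ.mkℚᵘ (a ℤ.+ b) 0) ⟩
  ℚᵘ.mkℚᵘ (a ℤ.+ b) 0                   ≈⟨ ℚᵘ.*≡* (cong (ℤ._* (ℤ.+ 1)) (sym (cong₂ ℤ._+_ (ℤₚ.*-identityʳ a) (ℤₚ.*-identityʳ b)))) ⟩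
  ℚᵘ.mkℚᵘ a 0 ℚᵘ.+ ℚᵘ.mkℚᵘ b 0          ≈⟨ ℚᵘₚ.+-cong (ℚᵘₚ.≃-sym (toℚᵘ-fromℚᵘ (ℚᵘ.mkℚᵘ a 0))) (ℚᵘₚ.≃-sym (toℚᵘ-fromℚᵘ (ℚᵘ.mkℚᵘ b 0))) ⟩
  ℚ.toℚᵘ (ι a) ℚᵘ.+ ℚ.toℚᵘ (ι b)        ≈⟨ ℚᵘₚ.≃-sym (toℚᵘ-homo-+ (ι a) (ι b)) ⟩
  ℚ.toℚᵘ (ι a + ι b)                    ∎)
  where
  import Data.Rational.Unnormalised as ℚᵘ
  import Data.Rational.Unnormalised.Properties as ℚᵘₚ
  open ℚᵘₚ.≃-Reasoning

ι-* : ∀ a b → ι (a ℤ.* b) ≡ ι a * ι b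
ι-* a b = toℚᵘ-injective (begin
  ℚ.toℚᵘ (ι (a ℤ.* b))                  ≈⟨ toℚᵘ-fromℚᵘ (ℚᵘ.mkℚᵘ (a ℤ.* b) 0) ⟩
  ℚᵘ.mkℚᵘ a 0 ℚᵘ.* ℚᵘ.mkℚᵘ b 0          ≈⟨ ℚᵘₚ.*-cong (ℚᵘₚ.≃-sym (toℚᵘ-fromℚᵘ (ℚᵘ.mkℚᵘ a 0))) (ℚᵘₚ.≃-sym (toℚᵘ-fromℚᵘ (ℚᵘ.mkℚᵘ b 0))) ⟩
  ℚ.toℚᵘ (ι a) ℚᵘ.* ℚ.toℚᵘ (ι b)        ≈⟨ ℚᵘₚ.≃-sym (toℚᵘ-homo-* (ι a) (ι b)) ⟩
  ℚ.toℚᵘ (ι a * ι b)                    ∎)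
  where
  import Data.Rational.Unnormalised as ℚᵘ
  import Data.Rational.Unnormalised.Properties as ℚᵘₚ
  open ℚᵘₚ.≃-Reasoning

ι-mono-≤ : ∀ {a b} → a ℤ.≤ b → ι a ≤ ι b
ι-mono-≤ {a} {b} h = toℚᵘ-cancel-≤ (ℚᵘₚ.≤-respˡ-≃ (ℚᵘₚ.≃-sym (toℚᵘ-fromℚᵘ (ℚᵘ.mkℚᵘ a 0)))
  (ℚᵘₚ.≤-respʳ-≃ (ℚᵘₚ.≃-sym (toℚᵘ-fromℚᵘ (ℚᵘ.mkℚᵘ b 0))) (ℚᵘ.*≤* (ℤₚ.*-monoʳ-≤-nonNeg (ℤ.+ 1) h))))
  where
  import Data.Rational.Unnormalised as ℚᵘ
  import Data.Rational.Unnormalised.Properties as ℚᵘₚ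

ι-cancel-≤ : ∀ {a b} → ι a ≤ ι b → a ℤ.≤ b
ι-cancel-≤ {a} {b} h = subst₂ ℤ._≤_ (ℤₚ.*-identityʳ a) (ℤₚ.*-identityʳ b) (ℚᵘₚ.drop-*≤*
  (ℚᵘₚ.≤-respˡ-≃ (toℚᵘ-fromℚᵘ (ℚᵘ.mkℚᵘ a 0))
  (ℚᵘₚ.≤-respʳ-≃ (toℚᵘ-fromℚᵘ (ℚᵘ.mkℚᵘ b 0)) (toℚᵘ-mono-≤ h))))
  where
  import Data.Rational.Unnormalised as ℚᵘ
  import Data.Rational.Unnormalised.Properties as ℚᵘₚ

ι-injective : ∀ {a b} → ι a ≡ ι b → a ≡ b
ι-injective h = ℤₚ.≤-antisym (ι-cancel-≤ (≤-reflexive h)) (ι-cancel-≤ (≤-reflexive (sym h)))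

ι-neg : ∀ a → ι (ℤ.- a) ≡ - ι a
ι-neg a = begin
  ι (ℤ.- a)                     ≡⟨ lem (ι (ℤ.- a)) (ι a) ⟩
  (ι (ℤ.- a) + ι a) - ι a       ≡⟨ cong (_- ι a) (trans (sym (ι-+ (ℤ.- a) a)) (cong ι (ℤₚ.+-inverseˡ a))) ⟩
  0ℚ - ι a                      ≡⟨ +-identityˡ (- ι a) ⟩
  - ι a                         ∎
  where
  open ≡-Reasoning
  lem : ∀ x y → x ≡ (x + y) - y
  lem = solve-∀ ℚ-ring

ι-- : ∀ a b → ι (a ℤ.- b) ≡ ι a - ι b
ι-- a b = trans (ι-+ a (ℤ.- b)) (cong (ι a +_) (ι-neg b))

infix 9 #_
abstract
  #_ : ℕ → ℚ
  # n = ι (ℤ.+ n)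

  #≡ι : ∀ n → # n ≡ ι (ℤ.+ n)
  #≡ι n = refl

  #0≡0 : # 0 ≡ 0ℚ
  #0≡0 = refl

  #1≡1 : # 1 ≡ 1ℚ
  #1≡1 = refl

  #2≡2 : # 2 ≡ 2ℚ
  #2≡2 = refl

  #-+ : ∀ m n → # (m ℕ.+ n) ≡ # m + # n
  #-+ m n = ι-+ (ℤ.+ m) (ℤ.+ n)

  #-* : ∀ m n → # (m ℕ.* n) ≡ # m * # n
  #-* m n = trans (cong ι (ℤₚ.pos-* m n)) (ι-* (ℤ.+ m) (ℤ.+ n))

  #-mono : ∀ {m n} → m ℕ.≤ n → # m ≤ # n
  #-mono h = ι-mono-≤ (ℤ.+≤+ h)

  #-cancel : ∀ {m n} → # m ≤ # n → m ℕ.≤ n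
  #-cancel h = ℤₚ.drop‿+≤+ (ι-cancel-≤ h)

  archimedean : ∀ q → ∃ λ N → q ≤ # N
  archimedean q@(mkℚ (ℤ.+ a) d _) = a , toℚᵘ-cancel-≤ (ℚᵘₚ.≤-respʳ-≃ (ℚᵘₚ.≃-sym (toℚᵘ-fromℚᵘ (ℚᵘ.mkℚᵘ (ℤ.+ a) 0)))
    (ℚᵘ.*≤* (ℤₚ.*-monoˡ-≤-nonNeg (ℤ.+ a) (ℤ.+≤+ (s≤s z≤n)))))
    where
    import Data.Rational.Unnormalised as ℚᵘ
    import Data.Rational.Unnormalised.Properties as ℚᵘₚ
  archimedean q@(mkℚ -[1+ a ] d _) = 0 , <⇒≤ (negative⁻¹ q)

#-suc : ∀ n → # (suc n) ≡ # n + 1ℚ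
#-suc n = trans (cong #_ (ℕₚ.+-comm 1 n)) (trans (#-+ n 1) (cong (# n +_) #1≡1))

#≥0 : ∀ n → 0ℚ ≤ # n
#≥0 n = subst (_≤ # n) #0≡0 (#-mono z≤n)

#≥1 : ∀ {n} → 1 ℕ.≤ n → 1ℚ ≤ # n
#≥1 {n} h = subst (_≤ # n) #1≡1 (#-mono h)

0<1 : 0ℚ < 1ℚ
0<1 = positive⁻¹ 1ℚ

#>0 : ∀ {n} → 1 ℕ.≤ n → 0ℚ < # n
#>0 h = <-≤-trans 0<1 (#≥1 h)

#-∸ : ∀ {m n} → n ℕ.≤ m → # (m ℕ.∸ n) ≡ # m - # n
#-∸ {m} {n} h = begin
  # (m ℕ.∸ n)                 ≡⟨ lem (# (m ℕ.∸ n)) (# n) ⟩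
  (# (m ℕ.∸ n) + # n) - # n   ≡⟨ cong (_- # n) (trans (sym (#-+ (m ℕ.∸ n) n)) (cong #_ (ℕₚ.m∸n+n≡m h))) ⟩
  # m - # n                   ∎
  where
  open ≡-Reasoning
  lem : ∀ x y → x ≡ (x + y) - y
  lem = solve-∀ ℚ-ring

-- Inverses

>⇒≢ : ∀ {q} → 0ℚ < q → q ≢ 0ℚ
>⇒≢ h refl = <-irrefl refl h

abstract
  -- With inv 0 = 0.
  inv : ℚ → ℚ
  inv q with q ≟ℚ 0ℚ
  ... | yes _ = 0ℚ
  ... | no p  = ℚ.1/_ q {{ℚ.≢-nonZero p}}

  inv-0 : inv 0ℚ ≡ 0ℚ
  inv-0 = refl

  inv-r : ∀ {q} → q ≢ 0ℚ → q * inv q ≡ 1ℚ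
  inv-r {q} h with q ≟ℚ 0ℚ
  ... | yes p = contradiction p h
  ... | no p  = *-inverseʳ q {{ℚ.≢-nonZero p}}

  inv-pos : ∀ {q} → 0ℚ < q → 0ℚ < inv q
  inv-pos {q} h with q ≟ℚ 0ℚ
  ... | yes p = contradiction p (>⇒≢ h)
  ... | no p  = positive⁻¹ (ℚ.1/_ q {{ℚ.≢-nonZero p}}) {{1/pos⇒pos q {{ℚ.positive h}}}}

inv-r> : ∀ {q} → 0ℚ < q → q * inv q ≡ 1ℚ
inv-r> h = inv-r (>⇒≢ h)

inv-nonneg : ∀ {q} → 0ℚ ≤ q → 0ℚ ≤ inv q
inv-nonneg {q} h with q ≟ℚ 0ℚ
... | yes p = subst (λ z → 0ℚ ≤ inv z) (sym p) (≤-reflexive (sym inv-0))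
... | no p  = <⇒≤ (inv-pos (≤∧≢⇒<′ h))
  where
  ≤∧≢⇒<′ : 0ℚ ≤ q → 0ℚ < q
  ≤∧≢⇒<′ h with <-cmp 0ℚ q
  ... | tri< l _ _ = l
  ... | tri≈ _ e _ = contradiction (sym e) p
  ... | tri> _ _ g = contradiction (≤-<-trans h g) (<-irrefl refl)

≤-inv : ∀ {p q r} → 0ℚ < r → p * r ≤ q → p ≤ q * inv r
≤-inv {p} {q} {r} h k = subst (_≤ q * inv r) eq (*-monoʳ (inv r) (<⇒≤ (inv-pos h)) k)
  where
  lem : ∀ p r i → p * r * i ≡ p * (r * i)
  lem = solve-∀ ℚ-ring
  eq : p * r * inv r ≡ p
  eq = trans (lem p r (inv r)) (trans (cong (p *_) (inv-r> h)) (*-identityʳ p))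

inv-≤ : ∀ {p q r} → 0ℚ < r → p ≤ q * r → p * inv r ≤ q
inv-≤ {p} {q} {r} h k = subst (p * inv r ≤_) eq (*-monoʳ (inv r) (<⇒≤ (inv-pos h)) k)
  where
  lem : ∀ p r i → p * r * i ≡ p * (r * i)
  lem = solve-∀ ℚ-ring
  eq : q * r * inv r ≡ q
  eq = trans (lem q r (inv r)) (trans (cong (q *_) (inv-r> h)) (*-identityʳ q))

inv-anti : ∀ {p q} → 0ℚ < p → p ≤ q → inv q ≤ inv p
inv-anti {p} {q} h k = subst (_≤ inv p) (*-identityˡ (inv q)) (inv-≤ (<-≤-trans h k)
  (subst (_≤ inv p * q) (trans (*-comm (inv p) p) (inv-r> h)) (*-monoˡ (inv p) (<⇒≤ (inv-pos h)) k)))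

inv-unique : ∀ {p q} → p * q ≡ 1ℚ → inv p ≡ q
inv-unique {p} {q} h = begin
  inv p            ≡⟨ sym (*-identityʳ _) ⟩
  inv p * 1ℚ       ≡⟨ cong (inv p *_) (sym h) ⟩
  inv p * (p * q)  ≡⟨ lem (inv p) p q ⟩
  p * inv p * q    ≡⟨ cong (_* q) (inv-r p≢0) ⟩
  1ℚ * q           ≡⟨ *-identityˡ q ⟩
  q                ∎
  where
  open ≡-Reasoning
  lem : ∀ i p q → i * (p * q) ≡ p * i * q
  lem = solve-∀ ℚ-ring
  p≢0 : p ≢ 0ℚ
  p≢0 refl = 1≢0 (trans (sym h) (*-zeroˡ q))

inv-* : ∀ p q → inv (p * q) ≡ inv p * inv q
inv-* p q = go (p ≟ℚ 0ℚ) (q ≟ℚ 0ℚ)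
  where
  lem : ∀ p q i j → p * q * (i * j) ≡ (p * i) * (q * j)
  lem = solve-∀ ℚ-ring
  go : Dec (p ≡ 0ℚ) → Dec (q ≡ 0ℚ) → inv (p * q) ≡ inv p * inv q
  go (yes refl) _ = trans (cong inv (*-zeroˡ q)) (trans inv-0 (trans (sym (*-zeroˡ (inv q))) (cong (_* inv q) (sym inv-0))))
  go (no _) (yes refl) = trans (cong inv (*-zeroʳ p)) (trans inv-0 (trans (sym (*-zeroʳ (inv p))) (cong (inv p *_) (sym inv-0))))
  go (no a) (no b) = inv-unique {p * q} {inv p * inv q} (trans (lem p q (inv p) (inv q)) (cong₂ _*_ (inv-r a) (inv-r b)))

-- Finite sums over initial segments

∑ : ℕ → (ℕ → ℚ) → ℚ
∑ zero    f = 0ℚ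
∑ (suc n) f = ∑ n f + f n

∑-cong : ∀ N {f g} → (∀ i → i ℕ.< N → f i ≡ g i) → ∑ N f ≡ ∑ N g
∑-cong zero    h = refl
∑-cong (suc N) h = cong₂ _+_ (∑-cong N (λ i l → h i (ℕₚ.m<n⇒m<1+n l))) (h N (ℕₚ.n<1+n N))

∑-cong′ : ∀ N {f g} → (∀ i → f i ≡ g i) → ∑ N f ≡ ∑ N g
∑-cong′ N h = ∑-cong N (λ i _ → h i)

∑-zero : ∀ N {f} → (∀ i → i ℕ.< N → f i ≡ 0ℚ) → ∑ N f ≡ 0ℚ
∑-zero zero    h = refl
∑-zero (suc N) h = cong₂ _+_ (∑-zero N (λ i l → h i (ℕₚ.m<n⇒m<1+n l))) (h N (ℕₚ.n<1+n N))

∑-+ : ∀ N f g → ∑ N (λ i → f i + g i) ≡ ∑ N f + ∑ N g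
∑-+ zero    f g = refl
∑-+ (suc N) f g = trans (cong (_+ (f N + g N)) (∑-+ N f g)) (lem (∑ N f) (∑ N g) (f N) (g N))
  where
  lem : ∀ a b c d → a + b + (c + d) ≡ a + c + (b + d)
  lem = solve-∀ ℚ-ring

∑-*ˡ : ∀ N k f → ∑ N (λ i → k * f i) ≡ k * ∑ N f
∑-*ˡ zero    k f = sym (*-zeroʳ k)
∑-*ˡ (suc N) k f = trans (cong (_+ k * f N) (∑-*ˡ N k f)) (sym (*-distribˡ-+ k (∑ N f) (f N)))

∑-*ʳ : ∀ N k f → ∑ N (λ i → f i * k) ≡ ∑ N f * k
∑-*ʳ N k f = trans (∑-cong′ N (λ i → *-comm (f i) k)) (trans (∑-*ˡ N k f) (*-comm k (∑ N f)))

∑-neg : ∀ N f → ∑ N (λ i → - f i) ≡ - ∑ N f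
∑-neg zero    f = refl
∑-neg (suc N) f = trans (cong (_+ - f N) (∑-neg N f)) (sym (neg-distrib-+ (∑ N f) (f N)))

∑-- : ∀ N f g → ∑ N (λ i → f i - g i) ≡ ∑ N f - ∑ N g
∑-- N f g = trans (∑-+ N f (λ i → - g i)) (cong (∑ N f +_) (∑-neg N g))

∑-swap : ∀ M N (f : ℕ → ℕ → ℚ) → ∑ M (λ i → ∑ N (f i)) ≡ ∑ N (λ j → ∑ M (λ i → f i j))
∑-swap zero    N f = sym (∑-zero N (λ _ _ → refl))
∑-swap (suc M) N f = trans (cong (_+ ∑ N (f M)) (∑-swap M N f)) (sym (∑-+ N (λ j → ∑ M (λ i → f i j)) (f M)))

∑-mono : ∀ N {f g} → (∀ i → i ℕ.< N → f i ≤ g i) → ∑ N f ≤ ∑ N g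
∑-mono zero    h = ≤-refl
∑-mono (suc N) h = +-mono-≤ (∑-mono N (λ i l → h i (ℕₚ.m<n⇒m<1+n l))) (h N (ℕₚ.n<1+n N))

∑-nonneg : ∀ N {f} → (∀ i → i ℕ.< N → 0ℚ ≤ f i) → 0ℚ ≤ ∑ N f
∑-nonneg zero    h = ≤-refl
∑-nonneg (suc N) h = 0≤+ (∑-nonneg N (λ i l → h i (ℕₚ.m<n⇒m<1+n l))) (h N (ℕₚ.n<1+n N))

∑-abs : ∀ N {f g} → (∀ i → i ℕ.< N → ∣ f i ∣ ≤ g i) → ∣ ∑ N f ∣ ≤ ∑ N g
∑-abs zero    h = ≤-refl
∑-abs (suc N) h = ∣+∣≤ (∑-abs N (λ i l → h i (ℕₚ.m<n⇒m<1+n l))) (h N (ℕₚ.n<1+n N))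

∑-const : ∀ N k → ∑ N (λ _ → k) ≡ # N * k
∑-const zero    k = sym (trans (cong (_* k) #0≡0) (*-zeroˡ k))
∑-const (suc N) k = trans (cong (_+ k) (∑-const N k)) (trans (lem (# N) k) (cong (_* k) (sym (#-suc N))))
  where
  lem : ∀ a k → a * k + k ≡ (a + 1ℚ) * k
  lem = solve-∀ ℚ-ring

∑-bound : ∀ N {f K} → (∀ i → i ℕ.< N → ∣ f i ∣ ≤ K) → ∣ ∑ N f ∣ ≤ # N * K
∑-bound N {f} {K} h = subst (∣ ∑ N f ∣ ≤_) (∑-const N K) (∑-abs N h)

∑-split : ∀ M N f → ∑ (M ℕ.+ N) f ≡ ∑ M f + ∑ N (λ i → f (M ℕ.+ i))
∑-split M zero    f = trans (cong (λ k → ∑ k f) (ℕₚ.+-identityʳ M)) (sym (+-identityʳ _))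
∑-split M (suc N) f = trans (cong (λ k → ∑ k f) (ℕₚ.+-suc M N))
  (trans (cong (_+ f (M ℕ.+ N)) (∑-split M N f)) (+-assoc (∑ M f) (∑ N (λ i → f (M ℕ.+ i))) (f (M ℕ.+ N))))

∑-extend : ∀ {M N} f → M ℕ.≤ N → (∀ i → M ℕ.≤ i → f i ≡ 0ℚ) → ∑ N f ≡ ∑ M f
∑-extend {M} {N} f h z = begin
  ∑ N f                                            ≡⟨ cong (λ k → ∑ k f) (sym (ℕₚ.m+[n∸m]≡n h)) ⟩
  ∑ (M ℕ.+ (N ℕ.∸ M)) f                            ≡⟨ ∑-split M (N ℕ.∸ M) f ⟩
  ∑ M f + ∑ (N ℕ.∸ M) (λ i → f (M ℕ.+ i))          ≡⟨ cong (∑ M f +_) (∑-zero (N ℕ.∸ M) (λ i _ → z _ (ℕₚ.m≤m+n M i))) ⟩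
  ∑ M f + 0ℚ                                       ≡⟨ +-identityʳ _ ⟩
  ∑ M f                                            ∎
  where open ≡-Reasoning

∑-single : ∀ N {f} j → j ℕ.< N → (∀ i → i ℕ.< N → i ≢ j → f i ≡ 0ℚ) → ∑ N f ≡ f j
∑-single (suc N) {f} j l z with j ℕ.≟ N
... | yes refl = trans (cong (_+ f N) (∑-zero N (λ i i<N → z i (ℕₚ.m<n⇒m<1+n i<N) (λ { refl → ℕₚ.<-irrefl refl i<N })))) (+-identityˡ _)
... | no j≢N = trans (cong₂ _+_ (∑-single N j (ℕₚ.≤∧≢⇒< (ℕₚ.≤-pred l) j≢N) (λ i i<N → z i (ℕₚ.m<n⇒m<1+n i<N))) (z N (ℕₚ.n<1+n N) (λ e → j≢N (sym e)))) (+-identityʳ _)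

∑-block : ∀ q n f → ∑ (q ℕ.* n) f ≡ ∑ q (λ j → ∑ n (λ c → f (j ℕ.* n ℕ.+ c)))
∑-block zero    n f = refl
∑-block (suc q) n f = trans (cong (λ k → ∑ k f) (ℕₚ.+-comm n (q ℕ.* n)))
  (trans (∑-split (q ℕ.* n) n f) (cong (_+ ∑ n (λ c → f (q ℕ.* n ℕ.+ c))) (∑-block q n f)))

∑-first : ∀ N f → ∑ (suc N) f ≡ f 0 + ∑ N (f ∘ suc)
∑-first zero    f = +-comm 0ℚ (f 0)
∑-first (suc N) f = trans (cong (_+ f (suc N)) (∑-first N f)) (+-assoc (f 0) (∑ N (f ∘ suc)) (f (suc N)))

∑-term≤ : ∀ N {f} j → j ℕ.< N → (∀ i → i ℕ.< N → 0ℚ ≤ f i) → f j ≤ ∑ N f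
∑-term≤ (suc N) {f} j l z with j ℕ.≟ N
... | yes refl = ≤-by (∑ N f) (∑-nonneg N (λ i l → z i (ℕₚ.m<n⇒m<1+n l))) (+-comm (∑ N f) (f N))
... | no j≢N = ≤-trans (∑-term≤ N j (ℕₚ.≤∧≢⇒< (ℕₚ.≤-pred l) j≢N) (λ i l → z i (ℕₚ.m<n⇒m<1+n l)))
                       (≤-by (f N) (z N (ℕₚ.n<1+n N)) refl)

-- Indicators, periodic functions and sums over residues

χ : ∀ {P : Set} → Dec P → ℚ
χ (yes _) = 1ℚ
χ (no _)  = 0ℚ

χ-yes : ∀ {P : Set} (d : Dec P) → P → χ d ≡ 1ℚ
χ-yes (yes _) p = refl
χ-yes (no ¬p) p = contradiction p ¬p

χ-no : ∀ {P : Set} (d : Dec P) → ¬ P → χ d ≡ 0ℚ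
χ-no (yes p) ¬p = contradiction p ¬p
χ-no (no _)  ¬p = refl

χ-⇔ : ∀ {P Q : Set} (d : Dec P) (d′ : Dec Q) → (P → Q) → (Q → P) → χ d ≡ χ d′
χ-⇔ (yes p) d′ f g = sym (χ-yes d′ (f p))
χ-⇔ (no ¬p) d′ f g = sym (χ-no d′ (λ q → ¬p (g q)))

χ≥0 : ∀ {P : Set} (d : Dec P) → 0ℚ ≤ χ d
χ≥0 (yes _) = 0≤1
χ≥0 (no _)  = ≤-refl

χ≤1 : ∀ {P : Set} (d : Dec P) → χ d ≤ 1ℚ
χ≤1 (yes _) = ≤-refl
χ≤1 (no _)  = 0≤1

Per : ℕ → (ℕ → ℚ) → Set
Per L φ = ∀ j → φ (j ℕ.+ L) ≡ φ j

per-mult : ∀ {L φ} → Per L φ → ∀ k j → φ (j ℕ.+ k ℕ.* L) ≡ φ j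
per-mult {L} {φ} p zero    j = cong φ (ℕₚ.+-identityʳ j)
per-mult {L} {φ} p (suc k) j = begin
  φ (j ℕ.+ (L ℕ.+ k ℕ.* L))  ≡⟨ cong φ (lem j L (k ℕ.* L)) ⟩
  φ (j ℕ.+ k ℕ.* L ℕ.+ L)    ≡⟨ p _ ⟩
  φ (j ℕ.+ k ℕ.* L)          ≡⟨ per-mult {L} {φ} p k j ⟩
  φ j                        ∎
  where
  open ≡-Reasoning
  lem : ∀ a b c → a ℕ.+ (b ℕ.+ c) ≡ a ℕ.+ c ℕ.+ b
  lem = ℕring.solve-∀

per-% : ∀ {L φ} .{{_ : NonZero L}} → Per L φ → ∀ j → φ j ≡ φ (j % L)
per-% {L} {φ} p j = trans (cong φ (m≡m%n+[m/n]*n j L)) (per-mult {L} {φ} p (j / L) (j % L))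

per-≡ : ∀ {L φ} .{{_ : NonZero L}} → Per L φ → ∀ {i j} → i % L ≡ j % L → φ i ≡ φ j
per-≡ {L} {φ} p {i} {j} e = trans (per-% {L} {φ} p i) (trans (cong φ e) (sym (per-% {L} {φ} p j)))

%-*-cong : ∀ L .{{_ : NonZero L}} b {a a′} → a % L ≡ a′ % L → (b ℕ.* a) % L ≡ (b ℕ.* a′) % L
%-*-cong L b {a} {a′} e = trans (%-distribˡ-* b a L)
  (trans (cong (λ z → (b % L ℕ.* z) % L) e) (sym (%-distribˡ-* b a′ L)))

%-+-cong : ∀ L .{{_ : NonZero L}} {a a′} b → a % L ≡ a′ % L → (a ℕ.+ b) % L ≡ (a′ ℕ.+ b) % L
%-+-cong L {a} {a′} b e = trans (%-distribˡ-+ a b L)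
  (trans (cong (λ z → (z ℕ.+ b % L) % L) e) (sym (%-distribˡ-+ a′ b L)))

-- Insert the indicator of `i ≡ π j` and exchange the sums: each `i` is then met by exactly one `j`,
-- namely `ρ i`.
∑-bij : ∀ L (π ρ : ℕ → ℕ) f → (∀ j → j ℕ.< L → π j ℕ.< L) → (∀ i → i ℕ.< L → ρ i ℕ.< L) →
        (∀ j → j ℕ.< L → ρ (π j) ≡ j) → (∀ i → i ℕ.< L → π (ρ i) ≡ i) → ∑ L (λ j → f (π j)) ≡ ∑ L f
∑-bij L π ρ f π< ρ< ρπ πρ = begin
  ∑ L (λ j → f (π j))                               ≡⟨ ∑-cong L expand ⟩
  ∑ L (λ j → ∑ L (λ i → χ (i ℕ.≟ π j) * f i))       ≡⟨ ∑-swap L L (λ j i → χ (i ℕ.≟ π j) * f i) ⟩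
  ∑ L (λ i → ∑ L (λ j → χ (i ℕ.≟ π j) * f i))       ≡⟨ ∑-cong L collapse ⟩
  ∑ L f                                             ∎
  where
  open ≡-Reasoning
  expand : ∀ j → j ℕ.< L → f (π j) ≡ ∑ L (λ i → χ (i ℕ.≟ π j) * f i)
  expand j l = sym (trans
    (∑-single L (π j) (π< j l) (λ i _ ne → trans (cong (_* f i) (χ-no (i ℕ.≟ π j) ne)) (*-zeroˡ (f i))))
    (trans (cong (_* f (π j)) (χ-yes (π j ℕ.≟ π j) refl)) (*-identityˡ (f (π j)))))
  collapse : ∀ i → i ℕ.< L → ∑ L (λ j → χ (i ℕ.≟ π j) * f i) ≡ f i
  collapse i l = trans
    (∑-single L (ρ i) (ρ< i l) (λ j j< ne → trans (cong (_* f i) (χ-no (i ℕ.≟ π j)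
       (λ e → ne (trans (sym (ρπ j j<)) (cong ρ (sym e)))))) (*-zeroˡ (f i))))
    (trans (cong (_* f i) (χ-yes (i ℕ.≟ π (ρ i)) (sym (πρ i l)))) (*-identityˡ (f i)))

coprime-inverse : ∀ L .{{_ : NonZero L}} k → Coprime k L → ∃ λ k̄ → (k̄ ℕ.* k) % L ≡ 1 % L
coprime-inverse L k cop with Cop.coprime-Bézout cop
... | Bézout.+- x y eq = x , trans (cong (_% L) (sym eq)) ([m+kn]%n≡m%n 1 y L)
-- Here `1 + x k = y L`, so `x k ≡ -1` and `x` inverts `-k`. As natural numbers carry no sign, the
-- witness is `x² k`: its product with `k` is `(x k)² ≡ 1`.
... | Bézout.-+ x y eq = x ℕ.* k ℕ.* x , (begin
  (w ℕ.* x ℕ.* k) % L                 ≡⟨ cong (_% L) (ℕₚ.*-assoc w x k) ⟩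
  (w ℕ.* w) % L                       ≡⟨ sym ([m+kn]%n≡m%n (w ℕ.* w) y L) ⟩
  (w ℕ.* w ℕ.+ y ℕ.* L) % L           ≡⟨ cong (λ z → (w ℕ.* w ℕ.+ z) % L) (sym eq) ⟩
  (w ℕ.* w ℕ.+ (1 ℕ.+ w)) % L         ≡⟨ cong (_% L) (lem w) ⟩
  (1 ℕ.+ w ℕ.* (1 ℕ.+ w)) % L         ≡⟨ cong (λ z → (1 ℕ.+ z) % L) (trans (cong (w ℕ.*_) eq) (sym (ℕₚ.*-assoc w y L))) ⟩
  (1 ℕ.+ w ℕ.* y ℕ.* L) % L           ≡⟨ [m+kn]%n≡m%n 1 (w ℕ.* y) L ⟩
  1 % L                               ∎)
  where
  open ≡-Reasoning
  w = x ℕ.* k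
  lem : ∀ w → w ℕ.* w ℕ.+ (1 ℕ.+ w) ≡ 1 ℕ.+ w ℕ.* (1 ℕ.+ w)
  lem = ℕring.solve-∀

-- Multiplication by a unit permutes the residues modulo `L`; its inverse is multiplication by `k̄`.
∑-dilate : ∀ L .{{_ : NonZero L}} {φ} k → Per L φ → Coprime k L → ∑ L (λ j → φ (k ℕ.* j)) ≡ ∑ L φ
∑-dilate L {φ} k p cop = trans (∑-cong′ L (λ j → per-% {L} {φ} p (k ℕ.* j)))
  (∑-bij L (λ j → (k ℕ.* j) % L) (λ i → (k̄ ℕ.* i) % L) φ
    (λ j _ → m%n<n (k ℕ.* j) L) (λ i _ → m%n<n (k̄ ℕ.* i) L) (λ j → cancel k̄ k kk j) (λ i → cancel k k̄ kk′ i))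
  where
  k̄ = proj₁ (coprime-inverse L k cop)
  kk = proj₂ (coprime-inverse L k cop)
  kk′ : (k ℕ.* k̄) % L ≡ 1 % L
  kk′ = trans (cong (_% L) (ℕₚ.*-comm k k̄)) kk
  open ≡-Reasoning
  cancel : ∀ a b → (a ℕ.* b) % L ≡ 1 % L → ∀ j → j ℕ.< L → (a ℕ.* ((b ℕ.* j) % L)) % L ≡ j
  cancel a b e j l = begin
    (a ℕ.* ((b ℕ.* j) % L)) % L  ≡⟨ %-*-cong L a (m%n%n≡m%n (b ℕ.* j) L) ⟩
    (a ℕ.* (b ℕ.* j)) % L        ≡⟨ cong (_% L) (trans (sym (ℕₚ.*-assoc a b j)) (ℕₚ.*-comm (a ℕ.* b) j)) ⟩
    (j ℕ.* (a ℕ.* b)) % L        ≡⟨ %-*-cong L j e ⟩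
    (j ℕ.* 1) % L                ≡⟨ cong (_% L) (ℕₚ.*-identityʳ j) ⟩
    j % L                        ≡⟨ m<n⇒m%n≡m l ⟩
    j                            ∎

∑-shift : ∀ L {φ} → Per L φ → ∀ y → ∑ L (λ j → φ (y ℕ.+ j)) ≡ ∑ L φ
∑-shift L {φ} p zero    = refl
∑-shift L {φ} p (suc y) = trans (begin
  ∑ L (λ j → φ (suc y ℕ.+ j))                           ≡⟨ ∑-cong′ L (λ j → cong φ (sym (ℕₚ.+-suc y j))) ⟩
  ∑ L (λ j → φ (y ℕ.+ suc j))                           ≡⟨ lem (φ (y ℕ.+ 0)) (∑ L (λ j → φ (y ℕ.+ suc j))) ⟩
  φ (y ℕ.+ 0) + ∑ L (λ j → φ (y ℕ.+ suc j)) - φ (y ℕ.+ 0)   ≡⟨ cong (_- φ (y ℕ.+ 0)) (sym (∑-first L (λ j → φ (y ℕ.+ j)))) ⟩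
  ∑ L (λ j → φ (y ℕ.+ j)) + φ (y ℕ.+ L) - φ (y ℕ.+ 0)   ≡⟨ cong₂ (λ a b → ∑ L (λ j → φ (y ℕ.+ j)) + a - φ b) (p y) (ℕₚ.+-identityʳ y) ⟩
  ∑ L (λ j → φ (y ℕ.+ j)) + φ y - φ y                   ≡⟨ lem′ (∑ L (λ j → φ (y ℕ.+ j))) (φ y) ⟩
  ∑ L (λ j → φ (y ℕ.+ j))                               ∎) (∑-shift L {φ} p y)
  where
  open ≡-Reasoning
  lem : ∀ a b → b ≡ a + b - a
  lem = solve-∀ ℚ-ring
  lem′ : ∀ a b → a + b - b ≡ a
  lem′ = solve-∀ ℚ-ring

∑-periods : ∀ q L {φ} → Per L φ → ∑ (q ℕ.* L) φ ≡ # q * ∑ L φ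
∑-periods q L {φ} p = trans (∑-block q L φ) (trans
  (∑-cong′ q (λ j → ∑-cong′ L (λ c → trans (cong φ (ℕₚ.+-comm (j ℕ.* L) c)) (per-mult {L} {φ} p j c))))
  (∑-const q (∑ L φ)))

-- Sawtooth sums for multiples of the modulus

module _ (n l : ℕ) {{_ : NonZero n}} {{_ : NonZero l}} {{_ : NonZero (l ℕ.* n)}} where

  private
    θ : ℕ → ℕ → ℚ
    θ ρ j = # ((ρ ℕ.+ j ℕ.* n) % (l ℕ.* n))

    θ-per : ∀ ρ → Per l (θ ρ)
    θ-per ρ j = cong #_ (trans (cong (_% (l ℕ.* n)) (lem ρ j l n)) ([m+kn]%n≡m%n (ρ ℕ.+ j ℕ.* n) 1 (l ℕ.* n)))
      where
      lem : ∀ x j l n → x ℕ.+ (j ℕ.+ l) ℕ.* n ≡ x ℕ.+ j ℕ.* n ℕ.+ 1 ℕ.* (l ℕ.* n)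
      lem = ℕring.solve-∀

    ∑θ : ∀ ρ → ρ ℕ.< n → ∑ l (θ ρ) ≡ # l * # ρ + ∑ l (λ j → # (j ℕ.* n))
    ∑θ ρ ρ<n = trans (∑-cong l (λ j j<l → trans (cong #_ (m<n⇒m%n≡m (small j j<l))) (#-+ ρ (j ℕ.* n))))
               (trans (∑-+ l (λ _ → # ρ) (λ j → # (j ℕ.* n))) (cong (_+ ∑ l (λ j → # (j ℕ.* n))) (∑-const l (# ρ))))
      where
      small : ∀ j → j ℕ.< l → ρ ℕ.+ j ℕ.* n ℕ.< l ℕ.* n
      small j j<l = ℕₚ.<-≤-trans (ℕₚ.+-monoˡ-< (j ℕ.* n) ρ<n) (ℕₚ.*-monoˡ-≤ n j<l)

  -- The distribution relation of the sawtooth: as `k` is prime to `l`, the numbers `a + k j n`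
  -- modulo `l n` are the `l` residues congruent to `a` modulo `n`, each taken once.
  ∑-%-class : ∀ k a → Coprime k l →
    ∑ l (λ j → # ((a ℕ.+ k ℕ.* j ℕ.* n) % (l ℕ.* n))) ≡ # l * # (a % n) + ∑ l (λ j → # (j ℕ.* n))
  ∑-%-class k a cop = trans (∑-cong′ l (λ j → cong (λ z → # (z % (l ℕ.* n))) (eq j)))
    (trans (∑-dilate l {λ j → θ (a % n) (a / n ℕ.+ j)} k
              (λ j → trans (cong (θ (a % n)) (sym (ℕₚ.+-assoc (a / n) j l))) (θ-per (a % n) (a / n ℕ.+ j))) cop)
    (trans (∑-shift l {θ (a % n)} (θ-per (a % n)) (a / n)) (∑θ (a % n) (m%n<n a n))))
    where
    lem : ∀ x d z n → x ℕ.+ d ℕ.* n ℕ.+ z ℕ.* n ≡ x ℕ.+ (d ℕ.+ z) ℕ.* n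
    lem = ℕring.solve-∀
    eq : ∀ j → a ℕ.+ k ℕ.* j ℕ.* n ≡ a % n ℕ.+ (a / n ℕ.+ k ℕ.* j) ℕ.* n
    eq j = trans (cong (ℕ._+ k ℕ.* j ℕ.* n) (m≡m%n+[m/n]*n a n)) (lem (a % n) (a / n) (k ℕ.* j) n)

-- Large moduli are needed because the cotangent kernel resembles 1/m only when the modulus is
-- large. Sorting the arguments by their class modulo `n`, the distribution relation leaves a
-- multiple of a sawtooth sum modulo `n` and a multiple of `∑ n c`.
sawtooth-lift : ∀ n {{_ : NonZero n}} {c} → Per n c → ∑ n c ≡ 0ℚ →
  (∀ k → ∑ n (λ a → c a * # ((k ℕ.* a) % n)) ≡ 0ℚ) →
  ∀ l {{_ : NonZero l}} {{_ : NonZero (l ℕ.* n)}} k → ∑ (l ℕ.* n) (λ a → c a * # ((k ℕ.* a) % (l ℕ.* n))) ≡ 0ℚ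
sawtooth-lift n {c} c-per c-sum c-saw l k = begin
  ∑ (l ℕ.* n) (λ a → c a * # ((k ℕ.* a) % (l ℕ.* n)))
    ≡⟨ ∑-block l n (λ a → c a * # ((k ℕ.* a) % (l ℕ.* n))) ⟩
  ∑ l (λ j → ∑ n (λ a → c (j ℕ.* n ℕ.+ a) * # ((k ℕ.* (j ℕ.* n ℕ.+ a)) % (l ℕ.* n))))
    ≡⟨ ∑-cong′ l (λ j → ∑-cong′ n (λ a → cong₂ _*_
         (trans (cong c (ℕₚ.+-comm (j ℕ.* n) a)) (per-mult {n} {c} c-per j a)) (scale j a))) ⟩
  ∑ l (λ j → ∑ n (λ a → c a * (# g * w a j)))
    ≡⟨ ∑-swap l n (λ j a → c a * (# g * w a j)) ⟩
  ∑ n (λ a → ∑ l (λ j → c a * (# g * w a j)))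
    ≡⟨ ∑-cong′ n inner ⟩
  ∑ n (λ a → # g * # g * # l′ * (c a * # ((k′ ℕ.* a) % n)) + # g * # g * C * c a)
    ≡⟨ ∑-+ n (λ a → # g * # g * # l′ * (c a * # ((k′ ℕ.* a) % n))) (λ a → # g * # g * C * c a) ⟩
  ∑ n (λ a → # g * # g * # l′ * (c a * # ((k′ ℕ.* a) % n))) + ∑ n (λ a → # g * # g * C * c a)
    ≡⟨ cong₂ _+_ (trans (∑-*ˡ n (# g * # g * # l′) (λ a → c a * # ((k′ ℕ.* a) % n))) (trans (cong (# g * # g * # l′ *_) (c-saw k′)) (*-zeroʳ (# g * # g * # l′))))
                 (trans (∑-*ˡ n (# g * # g * C) c) (trans (cong (# g * # g * C *_) c-sum) (*-zeroʳ (# g * # g * C)))) ⟩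
  0ℚ + 0ℚ ≡⟨ refl ⟩
  0ℚ ∎
  where
  open ≡-Reasoning
  -- The multiplier `k` need not be prime to `l`. Dividing both by `g` turns residues modulo `l n`
  -- into `g` times residues modulo `l′ n`, and the sum over `j` then runs through `g` periods.
  g = gcd k l
  g≢0 : g ≢ 0
  g≢0 e = ℕ.≢-nonZero⁻¹ l (Data.Nat.GCD.gcd[m,n]≡0⇒n≡0 k e)
  instance
    g-nz : NonZero g
    g-nz = ℕ.≢-nonZero g≢0
  k′ = k / g
  l′ = l / g
  k≡ : k ≡ k′ ℕ.* g
  k≡ = sym (Data.Nat.DivMod.m/n*n≡m (gcd[m,n]∣m k l))
  l≡ : l ≡ l′ ℕ.* g
  l≡ = sym (Data.Nat.DivMod.m/n*n≡m (gcd[m,n]∣n k l))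
  instance
    l′-nz : NonZero l′
    l′-nz = ℕ.≢-nonZero (λ e → ℕ.≢-nonZero⁻¹ l (trans l≡ (cong (ℕ._* g) e)))
    l′n-nz : NonZero (l′ ℕ.* n)
    l′n-nz = ℕₚ.m*n≢0 l′ n
    l′ng-nz : NonZero (l′ ℕ.* n ℕ.* g)
    l′ng-nz = ℕₚ.m*n≢0 (l′ ℕ.* n) g
  C = ∑ l′ (λ j → # (j ℕ.* n))
  w : ℕ → ℕ → ℚ
  w a j = # ((k′ ℕ.* a ℕ.+ k′ ℕ.* j ℕ.* n) % (l′ ℕ.* n))
  w-per : ∀ a → Per l′ (w a)
  w-per a j = cong #_ (trans (cong (_% (l′ ℕ.* n)) (lem (k′ ℕ.* a) k′ j l′ n)) ([m+kn]%n≡m%n (k′ ℕ.* a ℕ.+ k′ ℕ.* j ℕ.* n) k′ (l′ ℕ.* n)))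
    where
    lem : ∀ x k j l n → x ℕ.+ k ℕ.* (j ℕ.+ l) ℕ.* n ≡ x ℕ.+ k ℕ.* j ℕ.* n ℕ.+ k ℕ.* (l ℕ.* n)
    lem = ℕring.solve-∀
  scale : ∀ j a → # ((k ℕ.* (j ℕ.* n ℕ.+ a)) % (l ℕ.* n)) ≡ # g * w a j
  scale j a = trans (cong #_ (begin
    (k ℕ.* (j ℕ.* n ℕ.+ a)) % (l ℕ.* n)                                  ≡⟨ Data.Nat.DivMod.%-congˡ (trans (cong (ℕ._* (j ℕ.* n ℕ.+ a)) k≡) (lem k′ g j n a)) ⟩
    ((k′ ℕ.* a ℕ.+ k′ ℕ.* j ℕ.* n) ℕ.* g) % (l ℕ.* n)                    ≡⟨ Data.Nat.DivMod.%-congʳ (trans (cong (ℕ._* n) l≡) (lem₂ l′ g n)) ⟩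
    ((k′ ℕ.* a ℕ.+ k′ ℕ.* j ℕ.* n) ℕ.* g) % (l′ ℕ.* n ℕ.* g)             ≡⟨ sym (Data.Nat.DivMod.m%n*o≡m*o%[n*o] (k′ ℕ.* a ℕ.+ k′ ℕ.* j ℕ.* n) (l′ ℕ.* n) g) ⟩
    (k′ ℕ.* a ℕ.+ k′ ℕ.* j ℕ.* n) % (l′ ℕ.* n) ℕ.* g                     ∎))
    (trans (#-* ((k′ ℕ.* a ℕ.+ k′ ℕ.* j ℕ.* n) % (l′ ℕ.* n)) g) (*-comm (w a j) (# g)))
    where
    lem : ∀ k g j n a → k ℕ.* g ℕ.* (j ℕ.* n ℕ.+ a) ≡ (k ℕ.* a ℕ.+ k ℕ.* j ℕ.* n) ℕ.* g
    lem = ℕring.solve-∀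
    lem₂ : ∀ l g n → l ℕ.* g ℕ.* n ≡ l ℕ.* n ℕ.* g
    lem₂ = ℕring.solve-∀
  inner : ∀ a → ∑ l (λ j → c a * (# g * w a j)) ≡ # g * # g * # l′ * (c a * # ((k′ ℕ.* a) % n)) + # g * # g * C * c a
  inner a = begin
    ∑ l (λ j → c a * (# g * w a j))      ≡⟨ ∑-*ˡ l (c a) (λ j → # g * w a j) ⟩
    c a * ∑ l (λ j → # g * w a j)        ≡⟨ cong (c a *_) (∑-*ˡ l (# g) (w a)) ⟩
    c a * (# g * ∑ l (w a))              ≡⟨ cong (λ z → c a * (# g * ∑ z (w a))) (trans l≡ (ℕₚ.*-comm l′ g)) ⟩
    c a * (# g * ∑ (g ℕ.* l′) (w a))     ≡⟨ cong (λ z → c a * (# g * z)) (∑-periods g l′ {w a} (w-per a)) ⟩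
    c a * (# g * (# g * ∑ l′ (w a)))     ≡⟨ cong (λ z → c a * (# g * (# g * z))) (∑-%-class n l′ k′ (k′ ℕ.* a) (Cop.coprime-/gcd k l)) ⟩
    c a * (# g * (# g * (# l′ * # ((k′ ℕ.* a) % n) + C)))  ≡⟨ lem (c a) (# g) (# l′) (# ((k′ ℕ.* a) % n)) C ⟩
    # g * # g * # l′ * (c a * # ((k′ ℕ.* a) % n)) + # g * # g * C * c a ∎
    where
    lem : ∀ c g l x C → c * (g * (g * (l * x + C))) ≡ g * g * l * (c * x) + g * g * C * c
    lem = solve-∀ ℚ-ring

coprime-* : ∀ {a b m} → Coprime a m → Coprime b m → Coprime (a ℕ.* b) m
coprime-* {a} {b} {m} ca cb {d} (d∣ab , d∣m) = cb (Cop.coprime-divisor cda d∣ab , d∣m)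
  where
  cda : Coprime d a
  cda (e∣d , e∣a) = ca (e∣a , ℕd.∣-trans e∣d d∣m)

-- Multiplying by a permutes the residues prime to M, so the sawtooth relations annihilate
-- the Dirichlet kernels of the multiplicative autocorrelation of c.
module _ (M : ℕ) {{_ : NonZero M}} (c : ℕ → ℚ) (c-per : Per M c) (c-supp : ∀ a → ¬ Coprime a M → c a ≡ 0ℚ) where

  autocorr : ℕ → ℚ
  autocorr m = ∑ M (λ a → c a * c (a ℕ.* m))

  sawtooth-annihilates : (∀ k → ∑ M (λ a → c a * # ((k ℕ.* a) % M)) ≡ 0ℚ) → ∀ {s} → Per M s → ∀ x → Coprime x M →
    ∑ M (λ m → autocorr (x ℕ.* m) * ∑ M (λ r → # r * s (r ℕ.* m))) ≡ 0ℚ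
  sawtooth-annihilates c-saw {s} s-per x cop-x = begin
    ∑ M (λ m → autocorr (x ℕ.* m) * K m)
      ≡⟨ ∑-cong′ M (λ m → sym (∑-*ʳ M (K m) (λ a → c a * c (a ℕ.* (x ℕ.* m))))) ⟩
    ∑ M (λ m → ∑ M (λ a → c a * c (a ℕ.* (x ℕ.* m)) * K m))
      ≡⟨ ∑-swap M M (λ m a → c a * c (a ℕ.* (x ℕ.* m)) * K m) ⟩
    ∑ M (λ a → ∑ M (λ m → c a * c (a ℕ.* (x ℕ.* m)) * K m))
      ≡⟨ ∑-cong′ M (λ a → trans (∑-cong′ M (λ m → *-assoc (c a) (c (a ℕ.* (x ℕ.* m))) (K m))) (∑-*ˡ M (c a) (λ m → c (a ℕ.* (x ℕ.* m)) * K m))) ⟩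
    ∑ M (λ a → c a * ∑ M (λ m → c (a ℕ.* (x ℕ.* m)) * K m))
      ≡⟨ ∑-cong′ M (λ a → step a (coprime? a M)) ⟩
    ∑ M (λ a → c a * ∑ M (λ r → # ((x ℕ.* r ℕ.* a) % M) * Q r))
      ≡⟨ ∑-cong′ M (λ a → sym (∑-*ˡ M (c a) (λ r → # ((x ℕ.* r ℕ.* a) % M) * Q r))) ⟩
    ∑ M (λ a → ∑ M (λ r → c a * (# ((x ℕ.* r ℕ.* a) % M) * Q r)))
      ≡⟨ ∑-swap M M (λ a r → c a * (# ((x ℕ.* r ℕ.* a) % M) * Q r)) ⟩
    ∑ M (λ r → ∑ M (λ a → c a * (# ((x ℕ.* r ℕ.* a) % M) * Q r)))
      ≡⟨ ∑-zero M (λ r _ → trans (∑-cong′ M (λ a → sym (*-assoc (c a) (# ((x ℕ.* r ℕ.* a) % M)) (Q r))))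
           (trans (∑-*ʳ M (Q r) (λ a → c a * # ((x ℕ.* r ℕ.* a) % M))) (trans (cong (_* Q r) (c-saw (x ℕ.* r))) (*-zeroˡ (Q r))))) ⟩
    0ℚ ∎
    where
    open ≡-Reasoning
    K Q : ℕ → ℚ
    K m = ∑ M (λ r → # r * s (r ℕ.* m))
    Q r = ∑ M (λ m → c m * s (r ℕ.* m))
    -- Replacing `r` by `b r` permutes the residues; afterwards `m` enters only through the product
    -- `b m`.
    K-dilate : ∀ b → Coprime b M → ∀ m → K m ≡ ∑ M (λ r → # ((b ℕ.* r) % M) * s (r ℕ.* (b ℕ.* m)))
    K-dilate b cop m = trans (∑-cong M (λ r l → cong (λ z → # z * s (r ℕ.* m)) (sym (m<n⇒m%n≡m l))))
      (trans (sym (∑-dilate M {λ r → # (r % M) * s (r ℕ.* m)} b per cop))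
             (∑-cong′ M (λ r → cong (λ z → # ((b ℕ.* r) % M) * s z) (lem b r m))))
      where
      lem : ∀ b r m → b ℕ.* r ℕ.* m ≡ r ℕ.* (b ℕ.* m)
      lem = ℕring.solve-∀
      lem₂ : ∀ j M m → (j ℕ.+ M) ℕ.* m ≡ j ℕ.* m ℕ.+ m ℕ.* M
      lem₂ = ℕring.solve-∀
      per : Per M (λ r → # (r % M) * s (r ℕ.* m))
      per j = cong₂ (λ y z → # y * z) (Data.Nat.DivMod.[m+n]%n≡m%n j M) (trans (cong s (lem₂ j M m)) (per-mult {M} {s} s-per m (j ℕ.* m)))
    step : ∀ a → Dec (Coprime a M) → c a * ∑ M (λ m → c (a ℕ.* (x ℕ.* m)) * K m) ≡ c a * ∑ M (λ r → # ((x ℕ.* r ℕ.* a) % M) * Q r)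
    step a (no ¬cop) = trans (cong (_* ∑ M (λ m → c (a ℕ.* (x ℕ.* m)) * K m)) (c-supp a ¬cop))
      (trans (*-zeroˡ (∑ M (λ m → c (a ℕ.* (x ℕ.* m)) * K m))) (sym (trans (cong (_* ∑ M (λ r → # ((x ℕ.* r ℕ.* a) % M) * Q r)) (c-supp a ¬cop)) (*-zeroˡ (∑ M (λ r → # ((x ℕ.* r ℕ.* a) % M) * Q r))))))
    step a (yes cop) = cong (c a *_) (begin
      ∑ M (λ m → c (a ℕ.* (x ℕ.* m)) * K m)
        ≡⟨ ∑-cong′ M (λ m → cong₂ _*_ (cong c (sym (ℕₚ.*-assoc a x m))) (K-dilate b cop-b m)) ⟩
      ∑ M (λ m → c (b ℕ.* m) * ∑ M (λ r → # ((b ℕ.* r) % M) * s (r ℕ.* (b ℕ.* m))))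
        ≡⟨ ∑-cong′ M (λ m → sym (∑-*ˡ M (c (b ℕ.* m)) (λ r → # ((b ℕ.* r) % M) * s (r ℕ.* (b ℕ.* m))))) ⟩
      ∑ M (λ m → ∑ M (λ r → c (b ℕ.* m) * (# ((b ℕ.* r) % M) * s (r ℕ.* (b ℕ.* m)))))
        ≡⟨ ∑-swap M M (λ m r → c (b ℕ.* m) * (# ((b ℕ.* r) % M) * s (r ℕ.* (b ℕ.* m)))) ⟩
      ∑ M (λ r → ∑ M (λ m → c (b ℕ.* m) * (# ((b ℕ.* r) % M) * s (r ℕ.* (b ℕ.* m)))))
        -- Renaming `b m` as `m` separates the two copies of `c`: one is collected in `Q`, where a
        -- Gauss sum would stand, and the other is left with the weight `(x r a) % M`, which `c-saw`
        -- annihilates.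
        ≡⟨ ∑-cong′ M (λ r → ∑-dilate M {λ m → c m * (# ((b ℕ.* r) % M) * s (r ℕ.* m))} b (per r) cop-b) ⟩
      ∑ M (λ r → ∑ M (λ m → c m * (# ((b ℕ.* r) % M) * s (r ℕ.* m))))
        ≡⟨ ∑-cong′ M (λ r → trans (∑-cong′ M (λ m → lem (c m) (# ((b ℕ.* r) % M)) (s (r ℕ.* m)))) (∑-*ˡ M (# ((b ℕ.* r) % M)) (λ m → c m * s (r ℕ.* m)))) ⟩
      ∑ M (λ r → # ((b ℕ.* r) % M) * Q r)
        ≡⟨ ∑-cong′ M (λ r → cong (λ z → # (z % M) * Q r) (lem₂ a x r)) ⟩
      ∑ M (λ r → # ((x ℕ.* r ℕ.* a) % M) * Q r) ∎)
      where
      b = a ℕ.* x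
      cop-b : Coprime b M
      cop-b = coprime-* {a} {x} {M} cop cop-x
      lem : ∀ c y z → c * (y * z) ≡ y * (c * z)
      lem = solve-∀ ℚ-ring
      lem₂ : ∀ a x r → a ℕ.* x ℕ.* r ≡ x ℕ.* r ℕ.* a
      lem₂ = ℕring.solve-∀
      lem₃ : ∀ r j M → r ℕ.* (j ℕ.+ M) ≡ r ℕ.* j ℕ.+ r ℕ.* M
      lem₃ = ℕring.solve-∀
      per : ∀ r → Per M (λ m → c m * (# ((b ℕ.* r) % M) * s (r ℕ.* m)))
      per r j = cong₂ (λ y z → y * (# ((b ℕ.* r) % M) * z)) (c-per j) (trans (cong s (lem₃ r j M)) (per-mult {M} {s} s-per r (r ℕ.* j)))

-- Rational rotations

-- `C k` and `S k` are cosine and sine of the `k`-fold multiple of a fixed angle. Only the addition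
-- formulas and the unit norm are recorded, so all values are rational and the angle itself never
-- appears.
record Rotation : Set where
  field
    C S     : ℕ → ℚ
    C-0     : C 0 ≡ 1ℚ
    S-0     : S 0 ≡ 0ℚ
    C-+     : ∀ a b → C (a ℕ.+ b) ≡ C a * C b - S a * S b
    S-+     : ∀ a b → S (a ℕ.+ b) ≡ S a * C b + C a * S b
    unitary : ∀ a → C a * C a + S a * S a ≡ 1ℚ

dilate : ℕ → Rotation → Rotation
dilate L ρ = record
  { C = λ m → C (m ℕ.* L) ; S = λ m → S (m ℕ.* L) ; C-0 = C-0 ; S-0 = S-0
  ; C-+ = λ a b → trans (cong C (ℕₚ.*-distribʳ-+ L a b)) (C-+ (a ℕ.* L) (b ℕ.* L))
  ; S-+ = λ a b → trans (cong S (ℕₚ.*-distribʳ-+ L a b)) (S-+ (a ℕ.* L) (b ℕ.* L))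
  ; unitary = λ a → unitary (a ℕ.* L) }
  where open Rotation ρ

sq≤1⇒≤1 : ∀ q → q * q ≤ 1ℚ → q ≤ 1ℚ
sq≤1⇒≤1 q h with ≤-total q 1ℚ
... | inj₁ l = l
... | inj₂ l = ≤-trans (subst (_≤ q * q) (*-identityʳ q) (*-monoˡ q (≤-trans 0≤1 l) l)) h

sq≤1⇒∣∣≤1 : ∀ q → q * q ≤ 1ℚ → ∣ q ∣ ≤ 1ℚ
sq≤1⇒∣∣≤1 q h = ∣∣-lub (sq≤1⇒≤1 q h) (sq≤1⇒≤1 (- q) (subst (_≤ 1ℚ) (sym (lem q)) h))
  where
  lem : ∀ q → - q * - q ≡ q * q
  lem = solve-∀ ℚ-ring

module RotationProperties (ρ : Rotation) where
  open Rotation ρ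

  ∣C∣≤1 : ∀ a → ∣ C a ∣ ≤ 1ℚ
  ∣C∣≤1 a = sq≤1⇒∣∣≤1 (C a) (≤-by (S a * S a) (0≤sq (S a)) (sym (unitary a)))

  ∣S∣≤1 : ∀ a → ∣ S a ∣ ≤ 1ℚ
  ∣S∣≤1 a = sq≤1⇒∣∣≤1 (S a) (≤-by (C a * C a) (0≤sq (C a)) (trans (sym (unitary a)) (+-comm (C a * C a) (S a * S a))))

  C≤1 : ∀ a → C a ≤ 1ℚ
  C≤1 a = ∣∣≤⇒≤ (∣C∣≤1 a)

  S≤1 : ∀ a → S a ≤ 1ℚ
  S≤1 a = ∣∣≤⇒≤ (∣S∣≤1 a)

  S-sub : ∀ a b → S a ≡ S (a ℕ.+ b) * C b - C (a ℕ.+ b) * S b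
  S-sub a b = sym (trans (cong₂ (λ y z → y * C b - z * S b) (S-+ a b) (C-+ a b))
    (trans (lem (S a) (C a) (S b) (C b)) (trans (cong (S a *_) (unitary b)) (*-identityʳ (S a)))))
    where
    lem : ∀ sa ca sb cb → (sa * cb + ca * sb) * cb - (ca * cb - sa * sb) * sb ≡ sa * (cb * cb + sb * sb)
    lem = solve-∀ ℚ-ring

  C-sub : ∀ a b → C a ≡ C (a ℕ.+ b) * C b + S (a ℕ.+ b) * S b
  C-sub a b = sym (trans (cong₂ (λ y z → z * C b + y * S b) (S-+ a b) (C-+ a b))
    (trans (lem (S a) (C a) (S b) (C b)) (trans (cong (C a *_) (unitary b)) (*-identityʳ (C a)))))
    where
    lem : ∀ sa ca sb cb → (ca * cb - sa * sb) * cb + (sa * cb + ca * sb) * sb ≡ ca * (cb * cb + sb * sb)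
    lem = solve-∀ ℚ-ring

  S-two-step : ∀ a b → S (a ℕ.+ b ℕ.+ b) + S a ≡ 2ℚ * C b * S (a ℕ.+ b)
  S-two-step a b = trans (cong₂ _+_ (S-+ (a ℕ.+ b) b) (S-sub a b)) (lem (S (a ℕ.+ b)) (C (a ℕ.+ b)) (S b) (C b))
    where
    lem : ∀ s c sb cb → s * cb + c * sb + (s * cb - c * sb) ≡ 2ℚ * cb * s
    lem = solve-∀ ℚ-ring

  C-two-step : ∀ a b → C (a ℕ.+ b ℕ.+ b) + C a ≡ 2ℚ * C b * C (a ℕ.+ b)
  C-two-step a b = trans (cong₂ _+_ (C-+ (a ℕ.+ b) b) (C-sub a b)) (lem (S (a ℕ.+ b)) (C (a ℕ.+ b)) (S b) (C b))
    where
    lem : ∀ s c sb cb → c * cb - s * sb + (c * cb + s * sb) ≡ 2ℚ * cb * c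
    lem = solve-∀ ℚ-ring

  S-two-step′ : ∀ a b → S (a ℕ.+ b ℕ.+ b) ≡ S a + 2ℚ * C (a ℕ.+ b) * S b
  S-two-step′ a b = trans (S-+ (a ℕ.+ b) b) (trans (lem (S (a ℕ.+ b)) (C (a ℕ.+ b)) (S b) (C b)) (cong (_+ 2ℚ * C (a ℕ.+ b) * S b) (sym (S-sub a b))))
    where
    lem : ∀ s c sb cb → s * cb + c * sb ≡ s * cb - c * sb + 2ℚ * c * sb
    lem = solve-∀ ℚ-ring

  S-double : ∀ a → S (a ℕ.+ a) ≡ 2ℚ * S a * C a
  S-double a = trans (S-+ a a) (lem (S a) (C a))
    where
    lem : ∀ s c → s * c + c * s ≡ 2ℚ * s * c
    lem = solve-∀ ℚ-ring

  1-C-double : ∀ a → 1ℚ - C (a ℕ.+ a) ≡ 2ℚ * (S a * S a)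
  1-C-double a = trans (cong₂ _-_ (sym (unitary a)) (C-+ a a)) (lem (S a) (C a))
    where
    lem : ∀ s c → c * c + s * s - (c * c - s * s) ≡ 2ℚ * (s * s)
    lem = solve-∀ ℚ-ring

  ∣S∣-sublinear : ∀ k → ∣ S k ∣ ≤ # k * ∣ S 1 ∣
  ∣S∣-sublinear zero    = ≤-reflexive (trans (cong ∣_∣ S-0) (sym (trans (cong (_* ∣ S 1 ∣) #0≡0) (*-zeroˡ ∣ S 1 ∣))))
  ∣S∣-sublinear (suc k) = subst₂ _≤_ (cong (λ z → ∣ z ∣) (sym (trans (cong S (ℕₚ.+-comm 1 k)) (S-+ k 1))))
    (trans (lem (# k) ∣ S 1 ∣) (cong (_* ∣ S 1 ∣) (sym (#-suc k))))
    (∣+∣≤ (∣*∣≤ (∣S∣-sublinear k) (∣C∣≤1 1)) (∣*∣≤ (∣C∣≤1 k) ≤-refl))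
    where
    lem : ∀ k s → k * s * 1ℚ + 1ℚ * s ≡ (k + 1ℚ) * s
    lem = solve-∀ ℚ-ring

  private
    E : ℕ → ℚ
    E k = 1ℚ - C k

    E≥0 : ∀ k → 0ℚ ≤ E k
    E≥0 k = 0≤-sub (C≤1 k)

    -- By the two-step recurrence each increment of `E` exceeds the one before by
    -- `2 E 1 - 2 E 1 E (k + 1)`, hence by at most `2 E 1`. Adding up the increments gives the
    -- quadratic bound below.
    E-step : ∀ k → E (suc k) - E k ≤ (2ℚ * # k + 1ℚ) * E 1
    E-step zero = ≤-reflexive (trans (cong (λ z → E 1 - (1ℚ - z)) C-0) (trans (lem (E 1)) (cong (λ z → (2ℚ * z + 1ℚ) * E 1) (sym #0≡0))))
      where
      lem : ∀ e → e - (1ℚ - 1ℚ) ≡ (2ℚ * 0ℚ + 1ℚ) * e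
      lem = solve-∀ ℚ-ring
    E-step (suc k) = ≤-by ((2ℚ * # k + 1ℚ) * E 1 - (E (suc k) - E k) + 2ℚ * (E 1 * E (suc k)))
      (0≤+ (0≤-sub (E-step k)) (0≤* (#≥0′) (0≤* (E≥0 1) (E≥0 (suc k)))))
      (trans (cong (λ z → (2ℚ * z + 1ℚ) * E 1) (#-suc k))
        (lem (# k) (C 1) (C k) (C (suc k)) (C (suc (suc k))) two))
      where
      #≥0′ : 0ℚ ≤ 2ℚ
      #≥0′ = nonNegative⁻¹ 2ℚ
      two : C (suc (suc k)) ≡ 2ℚ * C 1 * C (suc k) - C k
      two = trans (lem₀ (C (suc (suc k))) (C k)) (cong (_- C k) (trans
        (cong (λ z → C z + C k) (sym (trans (ℕₚ.+-comm (k ℕ.+ 1) 1) (cong suc (ℕₚ.+-comm k 1)))))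
        (trans (C-two-step k 1) (cong (λ z → 2ℚ * C 1 * C z) (ℕₚ.+-comm k 1)))))
        where
        lem₀ : ∀ a b → a ≡ a + b - b
        lem₀ = solve-∀ ℚ-ring
      lem′ : ∀ k c₁ ck csk → (2ℚ * (k + 1ℚ) + 1ℚ) * (1ℚ - c₁) ≡ (1ℚ - (2ℚ * c₁ * csk - ck)) - (1ℚ - csk)
             + ((2ℚ * k + 1ℚ) * (1ℚ - c₁) - ((1ℚ - csk) - (1ℚ - ck)) + 2ℚ * ((1ℚ - c₁) * (1ℚ - csk)))
      lem′ = solve-∀ ℚ-ring
      lem : ∀ k c₁ ck csk cssk → cssk ≡ 2ℚ * c₁ * csk - ck → (2ℚ * (k + 1ℚ) + 1ℚ) * (1ℚ - c₁) ≡ (1ℚ - cssk) - (1ℚ - csk)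
             + ((2ℚ * k + 1ℚ) * (1ℚ - c₁) - ((1ℚ - csk) - (1ℚ - ck)) + 2ℚ * ((1ℚ - c₁) * (1ℚ - csk)))
      lem k c₁ ck csk _ refl = lem′ k c₁ ck csk

  1-C-quadratic : ∀ k → 1ℚ - C k ≤ # k * # k * (1ℚ - C 1)
  1-C-quadratic zero = ≤-reflexive (trans (cong (λ z → 1ℚ - z) C-0) (sym (trans (cong (λ z → z * z * (1ℚ - C 1)) #0≡0) (lem (1ℚ - C 1)))))
    where
    lem : ∀ e → 0ℚ * 0ℚ * e ≡ 1ℚ - 1ℚ
    lem = solve-∀ ℚ-ring
  1-C-quadratic (suc k) = ≤-by ((# k * # k * E 1 - E k) + ((2ℚ * # k + 1ℚ) * E 1 - (E (suc k) - E k)))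
      (0≤+ (0≤-sub (1-C-quadratic k)) (0≤-sub (E-step k)))
      (trans (cong (λ z → z * z * E 1) (#-suc k)) (lem (# k) (E 1) (E k) (E (suc k))))
    where
    lem : ∀ k e₁ ek esk → (k + 1ℚ) * (k + 1ℚ) * e₁ ≡ esk + ((k * k * e₁ - ek) + ((2ℚ * k + 1ℚ) * e₁ - (esk - ek)))
    lem = solve-∀ ℚ-ring

-- The rotation by 2 arctan (1/T), and its first quarter turn
module Quarter (T : ℕ) (2≤T : 2 ℕ.≤ T) where

  private
    t = # T
    2≤t : 2ℚ ≤ t
    2≤t = subst (_≤ t) #2≡2 (#-mono 2≤T)
    1≤t : 1ℚ ≤ t
    1≤t = #≥1 (ℕₚ.≤-trans (s≤s z≤n) 2≤T)
    0≤t : 0ℚ ≤ t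
    0≤t = #≥0 T
    dn = t * t + 1ℚ
    dn>0 : 0ℚ < dn
    dn>0 = <-≤-trans 0<1 (≤-by (t * t) (0≤sq t) (+-comm (t * t) 1ℚ))
    r = inv dn
    r>0 : 0ℚ < r
    r>0 = inv-pos dn>0
    dnr : dn * r ≡ 1ℚ
    dnr = inv-r> dn>0

  x y : ℚ
  x = (t * t - 1ℚ) * r
  y = 2ℚ * t * r

  private
    xy-unit : x * x + y * y ≡ 1ℚ
    xy-unit = trans (lem t r) (trans (cong₂ _*_ dnr dnr) (*-identityʳ 1ℚ))
      where
      lem : ∀ t r → (t * t - 1ℚ) * r * ((t * t - 1ℚ) * r) + 2ℚ * t * r * (2ℚ * t * r) ≡ (t * t + 1ℚ) * r * ((t * t + 1ℚ) * r)
      lem = solve-∀ ℚ-ring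
    co si : ℕ → ℚ
    co zero    = 1ℚ
    co (suc k) = co k * x - si k * y
    si zero    = 0ℚ
    si (suc k) = si k * x + co k * y
    co-+ : ∀ a b → co (a ℕ.+ b) ≡ co a * co b - si a * si b
    si-+ : ∀ a b → si (a ℕ.+ b) ≡ si a * co b + co a * si b
    co-+ a zero    = trans (cong co (ℕₚ.+-identityʳ a)) (lem (co a) (si a))
      where
      lem : ∀ c s → c ≡ c * 1ℚ - s * 0ℚ
      lem = solve-∀ ℚ-ring
    co-+ a (suc b) = trans (cong co (ℕₚ.+-suc a b)) (trans (cong₂ (λ p q → p * x - q * y) (co-+ a b) (si-+ a b)) (lem (co a) (si a) (co b) (si b) x y))
      where
      lem : ∀ ca sa cb sb x y → (ca * cb - sa * sb) * x - (sa * cb + ca * sb) * y ≡ ca * (cb * x - sb * y) - sa * (sb * x + cb * y)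
      lem = solve-∀ ℚ-ring
    si-+ a zero    = trans (cong si (ℕₚ.+-identityʳ a)) (lem (co a) (si a))
      where
      lem : ∀ c s → s ≡ s * 1ℚ + c * 0ℚ
      lem = solve-∀ ℚ-ring
    si-+ a (suc b) = trans (cong si (ℕₚ.+-suc a b)) (trans (cong₂ (λ p q → q * x + p * y) (co-+ a b) (si-+ a b)) (lem (co a) (si a) (co b) (si b) x y))
      where
      lem : ∀ ca sa cb sb x y → (sa * cb + ca * sb) * x + (ca * cb - sa * sb) * y ≡ sa * (cb * x - sb * y) + ca * (sb * x + cb * y)
      lem = solve-∀ ℚ-ring
    un : ∀ a → co a * co a + si a * si a ≡ 1ℚ
    un zero    = refl
    un (suc a) = trans (lem (co a) (si a) x y) (trans (cong₂ _*_ (un a) xy-unit) (*-identityʳ 1ℚ))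
      where
      lem : ∀ c s x y → (c * x - s * y) * (c * x - s * y) + (s * x + c * y) * (s * x + c * y) ≡ (c * c + s * s) * (x * x + y * y)
      lem = solve-∀ ℚ-ring

  ω : Rotation
  ω = record { C = co ; S = si ; C-0 = refl ; S-0 = refl ; C-+ = co-+ ; S-+ = si-+ ; unitary = un }

  open Rotation ω public
  open RotationProperties ω public

  C-1 : C 1 ≡ x
  C-1 = lem x y
    where
    lem : ∀ x y → 1ℚ * x - 0ℚ * y ≡ x
    lem = solve-∀ ℚ-ring

  S-1 : S 1 ≡ y
  S-1 = lem x y
    where
    lem : ∀ x y → 0ℚ * x + 1ℚ * y ≡ y
    lem = solve-∀ ℚ-ring

  y>0 : 0ℚ < y
  y>0 = 0<* (0<* (positive⁻¹ 2ℚ) (<-≤-trans 0<1 1≤t)) r>0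

  y≥0 : 0ℚ ≤ y
  y≥0 = <⇒≤ y>0

  yT≤2 : y * # T ≤ 2ℚ
  yT≤2 = ≤-by (2ℚ * r) (0≤* (nonNegative⁻¹ 2ℚ) (<⇒≤ r>0)) (trans (trans (sym (*-identityʳ 2ℚ)) (cong (2ℚ *_) (sym dnr))) (lem t r))
    where
    lem : ∀ t r → 2ℚ * ((t * t + 1ℚ) * r) ≡ 2ℚ * t * r * t + 2ℚ * r
    lem = solve-∀ ℚ-ring

  1-x : (1ℚ - x) * (# T * # T + 1ℚ) ≡ 2ℚ
  1-x = trans (lem t r) (trans (cong (λ z → t * t + 1ℚ - (t * t - 1ℚ) * z) dnr) (lem₂ (t * t)))
    where
    lem : ∀ t r → (1ℚ - (t * t - 1ℚ) * r) * (t * t + 1ℚ) ≡ t * t + 1ℚ - (t * t - 1ℚ) * ((t * t + 1ℚ) * r)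
    lem = solve-∀ ℚ-ring
    lem₂ : ∀ a → a + 1ℚ - (a - 1ℚ) * 1ℚ ≡ 2ℚ
    lem₂ = solve-∀ ℚ-ring

  1-x≤y : 1ℚ - x ≤ y
  1-x≤y = *-cancelˡ dn dn>0 (≤-by (2ℚ * (t - 1ℚ)) (0≤* (nonNegative⁻¹ 2ℚ) (0≤-sub 1≤t))
    (trans (lem t r) (trans (cong (λ z → 2ℚ * t * z) dnr) (trans (lem₂ t) (cong (_+ 2ℚ * (t - 1ℚ)) (sym (trans (*-comm dn (1ℚ - x)) 1-x)))))))
    where
    lem : ∀ t r → (t * t + 1ℚ) * (2ℚ * t * r) ≡ 2ℚ * t * ((t * t + 1ℚ) * r)
    lem = solve-∀ ℚ-ring
    lem₂ : ∀ t → 2ℚ * t * 1ℚ ≡ 2ℚ + 2ℚ * (t - 1ℚ)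
    lem₂ = solve-∀ ℚ-ring

  ½≤x : ½ ≤ x
  ½≤x = *-cancelˡ dn dn>0 (≤-by (½ * ((t - 2ℚ) * (t + 2ℚ)) + ½) (0≤+ (0≤* (nonNegative⁻¹ ½) (0≤* (0≤-sub 2≤t) (0≤+ 0≤t (nonNegative⁻¹ 2ℚ)))) (nonNegative⁻¹ ½))
    (trans (lem t r) (trans (cong (λ z → (t * t - 1ℚ) * z) dnr) (lem₂ t))))
    where
    lem : ∀ t r → (t * t + 1ℚ) * ((t * t - 1ℚ) * r) ≡ (t * t - 1ℚ) * ((t * t + 1ℚ) * r)
    lem = solve-∀ ℚ-ring
    lem₂ : ∀ t → (t * t - 1ℚ) * 1ℚ ≡ (t * t + 1ℚ) * ½ + (½ * ((t - 2ℚ) * (t + 2ℚ)) + ½)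
    lem₂ = solve-∀ ℚ-ring

  x≥0 : 0ℚ ≤ x
  x≥0 = ≤-trans (nonNegative⁻¹ ½) ½≤x

  x≤1 : x ≤ 1ℚ
  x≤1 = subst (_≤ 1ℚ) C-1 (C≤1 1)

  -- While `C` is positive, the formula for two steps makes `S` grow along each parity class. Both
  -- starting values are at least `y`, the second because `x ≥ ½`.
  S-lower : ∀ j → (∀ i → i ℕ.≤ j → 0ℚ < C i) → y ≤ S (suc j)
  S-lower zero          h = ≤-reflexive (sym S-1)
  S-lower (suc zero)    h = ≤-by (2ℚ * (x - ½) * y) (0≤* (0≤* (nonNegative⁻¹ 2ℚ) (0≤-sub ½≤x)) y≥0)
      (trans (S-double 1) (trans (cong₂ (λ a b → 2ℚ * a * b) S-1 C-1) (lem x y)))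
    where
    lem : ∀ x y → 2ℚ * y * x ≡ y + 2ℚ * (x - ½) * y
    lem = solve-∀ ℚ-ring
  S-lower (suc (suc j)) h = ≤-trans (S-lower j (λ i l → h i (ℕₚ.≤-trans l (ℕₚ.≤-trans (ℕₚ.n≤1+n j) (ℕₚ.n≤1+n (suc j))))))
      (≤-by (2ℚ * C (suc (suc j)) * y) (0≤* (0≤* (nonNegative⁻¹ 2ℚ) (<⇒≤ (h (suc (suc j)) ℕₚ.≤-refl))) y≥0)
        (trans (cong S (eq₂ j)) (trans (S-two-step′ (suc j) 1) (cong₂ (λ a b → S (suc j) + 2ℚ * C a * b) (eq₁ j) S-1))))
    where
    eq₁ : ∀ j → suc j ℕ.+ 1 ≡ suc (suc j)
    eq₁ = ℕring.solve-∀
    eq₂ : ∀ j → suc (suc (suc j)) ≡ suc j ℕ.+ 1 ℕ.+ 1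
    eq₂ = ℕring.solve-∀

  -- Every further step lowers `C` by at least `y²`, since `S ≥ y` and `x ≤ 1`. So `C` cannot stay
  -- positive, and the search for the quarter turn succeeds.
  C-upper : ∀ k → (∀ i → i ℕ.≤ k → 0ℚ < C i) → C (suc k) ≤ 1ℚ - # k * (y * y)
  C-upper zero    h = ≤-trans (≤-reflexive C-1) (≤-trans x≤1 (≤-reflexive (sym (trans (cong (λ z → 1ℚ - z * (y * y)) #0≡0) (lem (y * y))))))
    where
    lem : ∀ a → 1ℚ - 0ℚ * a ≡ 1ℚ
    lem = solve-∀ ℚ-ring
  C-upper (suc k) h = ≤-by ((1ℚ - # k * (y * y) - C (suc k)) + (C (suc k) * (1ℚ - x) + (S (suc k) - y) * y))
      (0≤+ (0≤-sub (C-upper k (λ i l → h i (ℕₚ.m≤n⇒m≤1+n l))))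
           (0≤+ (0≤* (<⇒≤ (h (suc k) ℕₚ.≤-refl)) (0≤-sub x≤1)) (0≤* (0≤-sub (S-lower k (λ i l → h i (ℕₚ.m≤n⇒m≤1+n l)))) y≥0)))
      (trans (cong (λ z → 1ℚ - z * (y * y)) (#-suc k)) (lem (# k) x y (C (suc k)) (S (suc k))))
    where
    lem : ∀ k x y c s → 1ℚ - (k + 1ℚ) * (y * y) ≡ c * x - s * y + ((1ℚ - k * (y * y) - c) + (c * (1ℚ - x) + (s - y) * y))
    lem = solve-∀ ℚ-ring

  search : ∀ N → (∀ i → i ℕ.≤ N → 0ℚ < C i) ⊎ (∃ λ q → (∀ i → i ℕ.≤ q → 0ℚ < C i) × C (suc q) ≤ 0ℚ)
  search zero = inj₁ (λ { zero _ → 0<1 })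
  search (suc N) with search N
  ... | inj₂ r = inj₂ r
  ... | inj₁ h with C (suc N) ≤? 0ℚ
  ...   | yes p = inj₂ (N , h , p)
  ...   | no ¬p = inj₁ λ i l → [ (λ i<sN → h i (ℕₚ.≤-pred i<sN)) , (λ e → subst (λ z → 0ℚ < C z) (sym e) (≰⇒> ¬p)) ]′ (ℕₚ.m≤n⇒m<n∨m≡n l)

  quarter : ∃ λ q → (∀ i → i ℕ.≤ q → 0ℚ < C i) × C (suc q) ≤ 0ℚ
  quarter with archimedean (inv (y * y))
  ... | N , N≥ with search (suc N)
  ...   | inj₂ r = r
  ...   | inj₁ h = contradiction (<-≤-trans (h (suc N) ℕₚ.≤-refl) (≤-trans (C-upper N (λ i l → h i (ℕₚ.m≤n⇒m≤1+n l))) neg)) (<-irrefl refl)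
    where
    y²>0 : 0ℚ < y * y
    y²>0 = 0<* y>0 y>0
    neg : 1ℚ - # N * (y * y) ≤ 0ℚ
    neg = ≤-by (# N * (y * y) - 1ℚ) (0≤-sub (subst (_≤ # N * (y * y)) (trans (*-comm (inv (y * y)) (y * y)) (inv-r> y²>0)) (*-monoʳ (y * y) (<⇒≤ y²>0) N≥)))
                (lem (# N * (y * y)))
      where
      lem : ∀ a → 0ℚ ≡ 1ℚ - a + (a - 1ℚ)
      lem = solve-∀ ℚ-ring

-- A near half turn and the cotangent kernel

private
  cotangent-ring-1 : ∀ G y i d → 2ℚ * G * i * y * d ≡ 2ℚ * (G * y) * (d * i)
  cotangent-ring-1 = solve-∀ ℚ-ring
  cotangent-ring-2 : ∀ c s x y → y ≡ - (c * x - s * y) + (c * x + (1ℚ - s) * y)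
  cotangent-ring-2 = solve-∀ ℚ-ring
  cotangent-ring-3 : ∀ c s → c * c + s * s + (c * c - s * s) ≡ 2ℚ * (c * c)
  cotangent-ring-3 = solve-∀ ℚ-ring
  cotangent-ring-4 : ∀ c s cr sr → 1ℚ + (c * cr + s * sr) ≡ (1ℚ + c) * cr + (1ℚ - cr) + s * sr
  cotangent-ring-4 = solve-∀ ℚ-ring
  cotangent-ring-5 : ∀ m y → (4ℚ + m) * y ≡ 2ℚ * y * 1ℚ + m * y + 2ℚ * y * 1ℚ
  cotangent-ring-5 = solve-∀ ℚ-ring
  cotangent-ring-6 : ∀ m y → (4ℚ + m * m) * y ≡ 2ℚ * y * 1ℚ + 1ℚ * (m * y) + (2ℚ + m * (m - 1ℚ)) * y
  cotangent-ring-6 = solve-∀ ℚ-ring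
  cotangent-ring-7 : ∀ q t → 0ℚ ≡ 1ℚ + (t * t - (q + q) * (q + q) + ((2ℚ * (q * q) - (t * t + 1ℚ)) + 2ℚ * (q * q)))
  cotangent-ring-7 = solve-∀ ℚ-ring
  cotangent-ring-8 : ∀ a t u → a * (0ℚ + 0ℚ * 0ℚ) ≡ u * 0ℚ - 0ℚ * t
  cotangent-ring-8 = solve-∀ ℚ-ring
  cotangent-ring-9 : ∀ s n a b g → s * a - n * b + (2ℚ - g) * (s * b) ≡ s * a - n * b + (2ℚ * s * b - s * (g * b))
  cotangent-ring-9 = solve-∀ ℚ-ring
  cotangent-ring-10 : ∀ n a b c → (n + 1ℚ) * a - n * b + (2ℚ * (n + 1ℚ) * b - (n + 1ℚ) * (c + a)) ≡ (n + 1ℚ + 1ℚ) * b - (n + 1ℚ) * c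
  cotangent-ring-10 = solve-∀ ℚ-ring
  cotangent-ring-11 : ∀ q → q ≡ ½ * (q + q)
  cotangent-ring-11 = solve-∀ ℚ-ring
  cotangent-ring-12 : ∀ k d → (k + 1ℚ) * (4ℚ * d) ≡ 2ℚ * d * 1ℚ + 1ℚ * (k * (4ℚ * d)) + 2ℚ * d
  cotangent-ring-12 = solve-∀ ℚ-ring
  cotangent-ring-13 : ∀ c s ca sa → 1ℚ - (c * ca - s * sa) ≡ (1ℚ - ca) + ca * (1ℚ - c) + s * sa
  cotangent-ring-13 = solve-∀ ℚ-ring
  cotangent-ring-14 : ∀ k d → k * (4ℚ * d) + 1ℚ * (2ℚ * d) + 2ℚ * d * 1ℚ ≡ (k + 1ℚ) * (4ℚ * d)
  cotangent-ring-14 = solve-∀ ℚ-ring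
  cotangent-ring-15 : ∀ sj cj sa ca → sj * ca + cj * sa - sj ≡ cj * sa - sj * (1ℚ - ca)
  cotangent-ring-15 = solve-∀ ℚ-ring
  cotangent-ring-16 : ∀ k e → 1ℚ * (k * e) + 1ℚ * (k * e) ≡ 2ℚ * k * e
  cotangent-ring-16 = solve-∀ ℚ-ring
  cotangent-ring-17 : ∀ sj cj sa ca → sa * cj - ca * sj + sj ≡ sa * cj + (1ℚ - ca) * sj
  cotangent-ring-17 = solve-∀ ℚ-ring
  cotangent-ring-18 : ∀ k e → k * e * 1ℚ + k * e * 1ℚ ≡ 2ℚ * k * e
  cotangent-ring-18 = solve-∀ ℚ-ring
  cotangent-ring-19 : ∀ a b → a - b ≡ - (b - a)
  cotangent-ring-19 = solve-∀ ℚ-ring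
  cotangent-ring-20 : ∀ r a b → r * (a - b) ≡ r * a - r * b
  cotangent-ring-20 = solve-∀ ℚ-ring
  cotangent-ring-21 : ∀ a b c → a - b + (b + c) ≡ a - - c
  cotangent-ring-21 = solve-∀ ℚ-ring
  cotangent-ring-22 : ∀ a b → a * - b ≡ - (a * b)
  cotangent-ring-22 = solve-∀ ℚ-ring
  cotangent-ring-23 : ∀ a b → a - - b ≡ a + b
  cotangent-ring-23 = solve-∀ ℚ-ring
  cotangent-ring-24 : ∀ μ e → μ * (2ℚ * μ * e) + μ * (μ * e) ≡ 3ℚ * (μ * μ) * e
  cotangent-ring-24 = solve-∀ ℚ-ring
  cotangent-ring-25 : ∀ c → 2ℚ - 2ℚ * c ≡ 2ℚ * (1ℚ - c)
  cotangent-ring-25 = solve-∀ ℚ-ring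
  cotangent-ring-26 : ∀ s → 2ℚ * (2ℚ * s) ≡ 4ℚ * s
  cotangent-ring-26 = solve-∀ ℚ-ring
  cotangent-ring-27 : ∀ μ a n b p → μ * a - n * b + 2ℚ * μ * p ≡ μ * (a + 2ℚ * p) - n * b
  cotangent-ring-27 = solve-∀ ℚ-ring
  cotangent-ring-28 : ∀ s c → 2ℚ * s * c ≡ s + 2ℚ * (c - ½) * s
  cotangent-ring-28 = solve-∀ ℚ-ring
  cotangent-ring-29 : ∀ c s → ½ + ½ * (c * c - s * s) ≡ c * c + ½ * (1ℚ - (c * c + s * s))
  cotangent-ring-29 = solve-∀ ℚ-ring
  cotangent-ring-30 : ∀ a → a + ½ * (1ℚ - 1ℚ) ≡ a
  cotangent-ring-30 = solve-∀ ℚ-ring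
  cotangent-ring-31 : ∀ s c → s * s ≡ (c * c + s * s - 1ℚ) + (1ℚ - c * c)
  cotangent-ring-31 = solve-∀ ℚ-ring
  cotangent-ring-32 : ∀ c → (1ℚ - 1ℚ) + (1ℚ - c * c) ≡ 1ℚ - c + (1ℚ - c) * c
  cotangent-ring-32 = solve-∀ ℚ-ring
  cotangent-ring-33 : ∀ a → a ≡ 1ℚ + (a - 1ℚ)
  cotangent-ring-33 = solve-∀ ℚ-ring
  cotangent-ring-34 : ∀ c → 1ℚ - c ≡ 1ℚ + (1ℚ - (1ℚ + c))
  cotangent-ring-34 = solve-∀ ℚ-ring
  cotangent-ring-35 : ∀ s c k μ i → (4ℚ * (s * s) * k + 2ℚ * μ * (s * c)) * (½ * (i * i)) ≡ 2ℚ * k * ((s * i) * (s * i)) + μ * (c * i) * (s * i)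
  cotangent-ring-35 = solve-∀ ℚ-ring
  cotangent-ring-36 : ∀ a e → 2ℚ * (a * a) * e ≡ 3ℚ * a * e * (½ * a) + ½ * (a * a) * e
  cotangent-ring-36 = solve-∀ ℚ-ring
  cotangent-ring-37 : ∀ k μ c → 2ℚ * k * (1ℚ * 1ℚ) + μ * c * 1ℚ ≡ 2ℚ * k + μ * c
  cotangent-ring-37 = solve-∀ ℚ-ring
  cotangent-ring-38 : ∀ a b k c → (a - k) - (b + k) + (2ℚ * k + c) ≡ a - b + c
  cotangent-ring-38 = solve-∀ ℚ-ring
  cotangent-ring-39 : ∀ μ d → μ * (μ * (2ℚ * (μ * μ) * (4ℚ * d))) + μ * (μ * (2ℚ * (μ * μ) * (4ℚ * d) + 2ℚ * (μ * μ) * (4ℚ * d))) + 2ℚ * (μ * μ * (μ * μ)) * (4ℚ * d) ≡ ι (ℤ.+ 32) * (μ * μ * (μ * μ)) * d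
  cotangent-ring-39 = solve-∀ ℚ-ring
  cotangent-ring-40 : ∀ c s c₁ s₁ i j → (c * c₁ - s * s₁) * j * (s * i) + (c * c + s * s) * (s₁ * (i * j)) ≡ c * i * ((s * c₁ + c * s₁) * j)
  cotangent-ring-40 = solve-∀ ℚ-ring
  cotangent-ring-41 : ∀ a → 1ℚ - 0ℚ * a ≡ 1ℚ
  cotangent-ring-41 = solve-∀ ℚ-ring
  cotangent-ring-42 : ∀ k x y c s → 1ℚ - (k + 1ℚ) * (y * y) ≡ c * x - s * y + ((1ℚ - k * (y * y) - c) + (c * (1ℚ - x) + (s - y) * y))
  cotangent-ring-42 = solve-∀ ℚ-ring
  cotangent-ring-43 : ∀ a b → 0ℚ * a * b ≡ 0ℚ
  cotangent-ring-43 = solve-∀ ℚ-ring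
  cotangent-ring-44 : ∀ m s c → m * s * c + c * s ≡ (m + 1ℚ) * s * c
  cotangent-ring-44 = solve-∀ ℚ-ring
  cotangent-ring-45 : ∀ a b → a ≡ a - b + b
  cotangent-ring-45 = solve-∀ ℚ-ring
  cotangent-ring-46 : ∀ m s c i → m * s * c * i ≡ c * i * s * m
  cotangent-ring-46 = solve-∀ ℚ-ring
  cotangent-ring-47 : ∀ m c₁ c s i j → m * j * (m * (1ℚ - c₁)) ≡ j - c * i * s + ((m * m * (1ℚ - c₁) - (1ℚ - c)) * j + c * (s * i - j))
  cotangent-ring-47 = solve-∀ ℚ-ring

-- A rational rotation cannot in general divide a half turn into `M` equal parts. The signs in the
-- first quadrant are therefore required exactly, the position after `M` steps only to within `δ`.
NearHalfTurn : Rotation → ℕ → ℚ → Set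
NearHalfTurn ρ M δ = (∀ m → 1 ℕ.≤ m → m ℕ.+ m ℕ.< M → 0ℚ < C m × 0ℚ < S m) × ∣ 1ℚ + C M ∣ ≤ δ × ∣ S M ∣ ≤ δ
  where open Rotation ρ

-- An M-th part of a half turn, to precision δ: a suitable power of a very small rational rotation.
near-half-turn : ∀ M → 1 ℕ.≤ M → ∀ δ → 0ℚ < δ → ∃ λ ρ → NearHalfTurn ρ M δ
near-half-turn M 1≤M δ δ>0 = dilate L ω , positivity , small-C , small-S
  where
  instance
    M-nz : NonZero M
    M-nz = ℕ.>-nonZero 1≤M
  -- The total error is at most `G y`: 4 y for stopping just past the quarter turn, M² y for the
  -- remainder of `2 Q` modulo `M`. As `y ≤ 2 / T`, the choice of `T₀` gives `G y ≤ δ`; the summand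
  -- `M + 1` of `T` secures `M ≤ 2 Q`.
  G = 4ℚ + # M * # M
  T₀ = proj₁ (archimedean (2ℚ * G * inv δ))
  T = T₀ ℕ.+ (M ℕ.+ 1)
  2≤T : 2 ℕ.≤ T
  2≤T = ℕₚ.≤-trans (ℕₚ.+-monoˡ-≤ 1 1≤M) (ℕₚ.m≤n+m (M ℕ.+ 1) T₀)
  open Quarter T 2≤T
  q = proj₁ quarter
  Q = suc q
  C>0 : ∀ i → i ℕ.≤ q → 0ℚ < C i
  C>0 = proj₁ (proj₂ quarter)
  CQ≤0 : C Q ≤ 0ℚ
  CQ≤0 = proj₂ (proj₂ quarter)
  -- `2 Q` small steps make nearly a half turn, so `L` of them make nearly an `M`-th part of it. The
  -- fewer than `M` steps left over are tiny.
  L = (Q ℕ.+ Q) / M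
  r = (Q ℕ.+ Q) % M
  0≤2 : 0ℚ ≤ 2ℚ
  0≤2 = nonNegative⁻¹ 2ℚ
  split : M ℕ.* L ℕ.+ r ≡ Q ℕ.+ Q
  split = sym (trans (m≡m%n+[m/n]*n (Q ℕ.+ Q) M) (trans (ℕₚ.+-comm r (L ℕ.* M)) (cong (ℕ._+ r) (ℕₚ.*-comm L M))))
  Gy≤δ : G * y ≤ δ
  Gy≤δ = *-cancelˡ 2ℚ (positive⁻¹ 2ℚ) (subst₂ _≤_ (lem G y (inv δ) δ (inv-r> δ>0)) refl (*-monoʳ δ (<⇒≤ δ>0) 
           (≤-trans (*-monoʳ y y≥0 (≤-trans (proj₂ (archimedean (2ℚ * G * inv δ))) (#-mono (ℕₚ.m≤m+n T₀ (M ℕ.+ 1))))) (subst (_≤ 2ℚ) (*-comm y (# T)) yT≤2))))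
    where
    lem : ∀ G y i d → d * i ≡ 1ℚ → 2ℚ * G * i * y * d ≡ 2ℚ * (G * y)
    lem G y i d e = trans (cotangent-ring-1 G y i d) (trans (cong (2ℚ * (G * y) *_) e) (*-identityʳ (2ℚ * (G * y))))
  ∣CQ∣≤y : ∣ C Q ∣ ≤ y
  ∣CQ∣≤y = ∣∣-lub (≤-trans CQ≤0 y≥0) (≤-by (C q * x + (1ℚ - S q) * y) (0≤+ (0≤* (<⇒≤ (C>0 q ℕₚ.≤-refl)) x≥0) (0≤* (0≤-sub (S≤1 q)) y≥0)) (cotangent-ring-2 (C q) (S q) x y))
  y≤1 : y ≤ 1ℚ
  y≤1 = subst (_≤ 1ℚ) S-1 (S≤1 1)
  1+C2Q : ∣ 1ℚ + C (Q ℕ.+ Q) ∣ ≤ 2ℚ * y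
  1+C2Q = subst (λ z → ∣ z ∣ ≤ 2ℚ * y) (sym (trans (cong₂ _+_ (sym (unitary Q)) (C-+ Q Q)) (cotangent-ring-3 (C Q) (S Q))))
    (∣*∣≤ {2ℚ} {C Q * C Q} ≤-refl (≤-trans (∣*∣≤ {C Q} {C Q} ∣CQ∣≤y ∣CQ∣≤y) (subst (y * y ≤_) (*-identityʳ y) (*-monoˡ y y≥0 y≤1))))
  S2Q : ∣ S (Q ℕ.+ Q) ∣ ≤ 2ℚ * y
  S2Q = subst (λ z → ∣ z ∣ ≤ 2ℚ * y) (sym (S-double Q))
    (subst (∣ 2ℚ * S Q * C Q ∣ ≤_) (cong (_* y) (*-identityʳ 2ℚ)) (∣*∣≤ {2ℚ * S Q} {C Q} (∣*∣≤ {2ℚ} {S Q} ≤-refl (∣S∣≤1 Q)) ∣CQ∣≤y))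
  r≤M : # r ≤ # M
  r≤M = #-mono (ℕₚ.<⇒≤ (m%n<n (Q ℕ.+ Q) M))
  1-Cr : ∣ 1ℚ - C r ∣ ≤ # M * # M * y
  1-Cr = 0≤⇒∣∣≤ (0≤-sub (C≤1 r)) (≤-trans (1-C-quadratic r) (*-mono (0≤* (#≥0 r) (#≥0 r)) (0≤-sub (C≤1 1))
    (*-mono (#≥0 r) (#≥0 r) r≤M r≤M) (subst (λ z → 1ℚ - z ≤ y) (sym C-1) 1-x≤y)))
  Sr : ∣ S r ∣ ≤ # M * y
  Sr = ≤-trans (∣S∣-sublinear r) (*-mono (#≥0 r) (0≤∣p∣ (S 1)) r≤M (subst (λ z → ∣ z ∣ ≤ y) (sym S-1) (0≤⇒∣∣≤ y≥0 ≤-refl)))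
  a = M ℕ.* L
  small-C : ∣ 1ℚ + C a ∣ ≤ δ
  small-C = ≤-trans (subst (λ z → ∣ z ∣ ≤ 2ℚ * y * 1ℚ + # M * # M * y + 2ℚ * y * 1ℚ)
      (sym (trans (cong (1ℚ +_) (trans (C-sub a r) (cong₂ (λ u v → C u * C r + S v * S r) split split))) (cotangent-ring-4 (C (Q ℕ.+ Q)) (S (Q ℕ.+ Q)) (C r) (S r))))
      (∣+∣≤ (∣+∣≤ (∣*∣≤ 1+C2Q (∣C∣≤1 r)) 1-Cr) (∣*∣≤ S2Q (∣S∣≤1 r))))
      (subst (_≤ δ) (cotangent-ring-5 (# M * # M) y) Gy≤δ)
  small-S : ∣ S a ∣ ≤ δ
  small-S = ≤-trans (subst (λ z → ∣ z ∣ ≤ 2ℚ * y * 1ℚ + 1ℚ * (# M * y))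
      (sym (trans (S-sub a r) (cong₂ (λ u v → S u * C r - C v * S r) split split)))
      (∣-∣≤ (∣*∣≤ S2Q (∣C∣≤1 r)) (∣*∣≤ (∣C∣≤1 (Q ℕ.+ Q)) Sr)))
      (≤-trans (≤-by ((2ℚ + # M * (# M - 1ℚ)) * y) (0≤* (0≤+ 0≤2 (0≤* (#≥0 M) (0≤-sub (#≥1 1≤M)))) y≥0) (cotangent-ring-6 (# M) y)) Gy≤δ)
  -- At the quarter turn `1 ≤ 1 - C Q ≤ Q² (1 - x) = 2 Q² / (T² + 1)`, hence `T² + 1 ≤ 2 Q²`. But `2
  -- Q < M ≤ T` would give `4 Q² ≤ T²`.
  M≤2Q : M ℕ.≤ Q ℕ.+ Q
  M≤2Q = ℕₚ.≮⇒≥ λ 2Q<M → contradiction (<-≤-trans 0<1 (≤-by {1ℚ} (# T * # T - z * z + ((2ℚ * (# Q * # Q) - (# T * # T + 1ℚ)) + 2ℚ * (# Q * # Q)))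
                  (0≤+ (0≤-sub (*-mono (#≥0 (Q ℕ.+ Q)) (#≥0 (Q ℕ.+ Q)) (z≤t 2Q<M) (z≤t 2Q<M))) (0≤+ (0≤-sub T²≤) (0≤* 0≤2 (0≤sq (# Q))))) (trans (cotangent-ring-7 (# Q) (# T)) (cong (λ w → 1ℚ + (# T * # T - w * w + ((2ℚ * (# Q * # Q) - (# T * # T + 1ℚ)) + 2ℚ * (# Q * # Q)))) (sym (#-+ Q Q)))))) (<-irrefl refl)
    where
    z = # (Q ℕ.+ Q)
    z≤t : Q ℕ.+ Q ℕ.< M → z ≤ # T
    z≤t 2Q<M = #-mono (ℕₚ.≤-trans (ℕₚ.<⇒≤ 2Q<M) (ℕₚ.≤-trans (ℕₚ.m≤m+n M 1) (ℕₚ.m≤n+m (M ℕ.+ 1) T₀)))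
    T²≤ : # T * # T + 1ℚ ≤ 2ℚ * (# Q * # Q)
    T²≤ = subst₂ _≤_ (*-identityˡ (# T * # T + 1ℚ)) (trans (*-assoc (# Q * # Q) (1ℚ - x) (# T * # T + 1ℚ)) (trans (cong (# Q * # Q *_) 1-x) (*-comm (# Q * # Q) 2ℚ)))
       (*-monoʳ {1ℚ} (# T * # T + 1ℚ) (0≤+ (0≤sq (# T)) 0≤1) (≤-trans (≤-by {1ℚ} (- C Q) (neg-antimono-≤ CQ≤0) refl)
          (subst (λ w → 1ℚ - C Q ≤ # Q * # Q * (1ℚ - w)) C-1 (1-C-quadratic Q))))
  L≥1 : 1 ℕ.≤ L
  L≥1 = Data.Nat.DivMod.m≥n⇒m/n>0 M≤2Q
  positivity : ∀ m → 1 ℕ.≤ m → m ℕ.+ m ℕ.< M → 0ℚ < C (m ℕ.* L) × 0ℚ < S (m ℕ.* L)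
  positivity m 1≤m 2m<M = C>0 (m ℕ.* L) mL≤q , pos (m ℕ.* L) (ℕₚ.*-mono-≤ 1≤m L≥1) mL≤q
    where
    2mL : m ℕ.* L ℕ.+ m ℕ.* L ℕ.< Q ℕ.+ Q
    2mL = ℕₚ.<-≤-trans (subst (ℕ._< M ℕ.* L) (ℕₚ.*-distribʳ-+ L m m) (ℕₚ.*-monoˡ-< L {{ℕ.>-nonZero L≥1}} 2m<M))
            (subst (M ℕ.* L ℕ.≤_) split (ℕₚ.m≤m+n (M ℕ.* L) r))
    mL≤q : m ℕ.* L ℕ.≤ q
    mL≤q = ℕₚ.≮⇒≥ λ q<mL → ℕₚ.≤⇒≯ (ℕₚ.+-mono-≤ q<mL q<mL) 2mL
    pos : ∀ j → 1 ℕ.≤ j → j ℕ.≤ q → 0ℚ < S j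
    pos (suc j) _ l = <-≤-trans y>0 (S-lower j (λ i i≤j → C>0 i (ℕₚ.≤-trans i≤j (ℕₚ.≤-trans (ℕₚ.n≤1+n j) l))))

-- Summation by parts

-- The factor `2 - γ` turns `t` into its negated second difference, so the sum weighted by `r`
-- telescopes. For t r = sin (r θ) and γ = 2 cos θ this yields the cotangent.
∑-recurrence : ∀ (t : ℕ → ℚ) γ → t 0 ≡ 0ℚ → (∀ r → t (suc (suc r)) + t r ≡ γ * t (suc r)) →
  ∀ N → (2ℚ - γ) * ∑ (suc N) (λ r → # r * t r) ≡ # (suc N) * t N - # N * t (suc N)
∑-recurrence t γ t0 rec zero = trans (cong₂ (λ a b → (2ℚ - γ) * (0ℚ + a * b)) #0≡0 t0) (trans (cotangent-ring-8 (2ℚ - γ) (t 1) (# 1)) (sym (cong₂ (λ a b → # 1 * b - a * t 1) #0≡0 t0)))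
∑-recurrence t γ t0 rec (suc N) = begin
  (2ℚ - γ) * (∑ (suc N) f + # (suc N) * t (suc N))                       ≡⟨ *-distribˡ-+ (2ℚ - γ) (∑ (suc N) f) (# (suc N) * t (suc N)) ⟩
  (2ℚ - γ) * ∑ (suc N) f + (2ℚ - γ) * (# (suc N) * t (suc N))           ≡⟨ cong (_+ (2ℚ - γ) * (# (suc N) * t (suc N))) (∑-recurrence t γ t0 rec N) ⟩
  # (suc N) * t N - # N * t (suc N) + (2ℚ - γ) * (# (suc N) * t (suc N)) ≡⟨ cotangent-ring-9 (# (suc N)) (# N) (t N) (t (suc N)) γ ⟩
  # (suc N) * t N - # N * t (suc N) + (2ℚ * # (suc N) * t (suc N) - # (suc N) * (γ * t (suc N))) ≡⟨ cong (λ z → # (suc N) * t N - # N * t (suc N) + (2ℚ * # (suc N) * t (suc N) - # (suc N) * z)) (sym (rec N)) ⟩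
  # (suc N) * t N - # N * t (suc N) + (2ℚ * # (suc N) * t (suc N) - # (suc N) * (t (suc (suc N)) + t N)) ≡⟨ cong (λ z → z * t N - # N * t (suc N) + (2ℚ * z * t (suc N) - z * (t (suc (suc N)) + t N))) (#-suc N) ⟩
  (# N + 1ℚ) * t N - # N * t (suc N) + (2ℚ * (# N + 1ℚ) * t (suc N) - (# N + 1ℚ) * (t (suc (suc N)) + t N)) ≡⟨ cotangent-ring-10 (# N) (t N) (t (suc N)) (t (suc (suc N))) ⟩
  (# N + 1ℚ + 1ℚ) * t (suc N) - (# N + 1ℚ) * t (suc (suc N))            ≡⟨ cong₂ (λ a b → a * t (suc N) - b * t (suc (suc N))) (sym (trans (#-suc (suc N)) (cong (_+ 1ℚ) (#-suc N)))) (sym (#-suc N)) ⟩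
  # (suc (suc N)) * t (suc N) - # (suc N) * t (suc (suc N))             ∎
  where
  open ≡-Reasoning
  f : ℕ → ℚ
  f r = # r * t r

∑-rev : ∀ N g → ∑ N (λ i → g (N ℕ.∸ suc i)) ≡ ∑ N g
∑-rev zero    g = refl
∑-rev (suc N) g = trans (∑-first N (λ i → g (N ℕ.∸ i))) (trans (cong (g N +_) (∑-rev N g)) (+-comm (g N) (∑ N g)))

self-neg : ∀ q → q ≡ - q → q ≡ 0ℚ
self-neg q e = trans (cotangent-ring-11 q) (trans (cong (λ z → ½ * (q + z)) e) (trans (cong (½ *_) (+-inverseʳ q)) (*-zeroʳ ½)))

-- The kernel Σ r s(rm), s(j) = sin(2πj/M), is a multiple of cot(πm/M)
module CotangentKernel (M : ℕ) (5≤M : 5 ℕ.≤ M) (δ : ℚ) (δ≥0 : 0ℚ ≤ δ) (δ≤1 : δ ≤ 1ℚ) (ρ : Rotation) (nht : NearHalfTurn ρ M δ) where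
  open Rotation ρ
  open RotationProperties ρ

  C>0 : ∀ m → m ℕ.+ m ℕ.< M → 0ℚ < C m
  C>0 zero    l = subst (0ℚ <_) (sym C-0) 0<1
  C>0 (suc m) l = proj₁ (proj₁ nht (suc m) (s≤s z≤n) l)

  S>0 : ∀ m → 1 ℕ.≤ m → m ℕ.+ m ℕ.< M → 0ℚ < S m
  S>0 m 1≤m l = proj₂ (proj₁ nht m 1≤m l)

  private
    0≤2 : 0ℚ ≤ 2ℚ
    0≤2 = nonNegative⁻¹ 2ℚ
    instance
      M-nz : NonZero M
      M-nz = ℕ.>-nonZero (ℕₚ.≤-trans (s≤s z≤n) 5≤M)
    S1>0 : 0ℚ < S 1
    S1>0 = S>0 1 (s≤s z≤n) (ℕₚ.≤-trans (s≤s (s≤s (s≤s z≤n))) 5≤M)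
    C1>0 : 0ℚ < C 1
    C1>0 = C>0 1 (ℕₚ.≤-trans (s≤s (s≤s (s≤s z≤n))) 5≤M)
    M₂ = M ℕ.+ M
    ε₀ = 4ℚ * δ

    S-M₂ : ∣ S M₂ ∣ ≤ 2ℚ * δ
    S-M₂ = subst (λ z → ∣ z ∣ ≤ 2ℚ * δ) (sym (S-double M)) (subst (∣ 2ℚ * S M * C M ∣ ≤_) (*-identityʳ (2ℚ * δ)) (∣*∣≤ {2ℚ * S M} {C M} (∣*∣≤ {2ℚ} {S M} ≤-refl (proj₂ (proj₂ nht))) (∣C∣≤1 M)))

    C-M₂ : ∣ 1ℚ - C M₂ ∣ ≤ 2ℚ * δ
    C-M₂ = subst (λ z → ∣ z ∣ ≤ 2ℚ * δ) (sym (1-C-double M)) (∣*∣≤ {2ℚ} {S M * S M} ≤-refl (subst (∣ S M * S M ∣ ≤_) (*-identityʳ δ) (∣*∣≤ (proj₂ (proj₂ nht)) (∣S∣≤1 M))))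

    -- A full turn of `2 M` steps misses the identity by at most `2 δ` in each coordinate, and the
    -- addition formulas add up the errors of successive turns.
    turns-S : ∀ k → ∣ S (k ℕ.* M₂) ∣ ≤ # k * ε₀
    turns-S zero    = ≤-reflexive (trans (cong ∣_∣ S-0) (sym (trans (cong (_* ε₀) #0≡0) (*-zeroˡ ε₀))))
    turns-S (suc k) = subst (λ z → ∣ z ∣ ≤ # (suc k) * ε₀) (sym (S-+ M₂ (k ℕ.* M₂)))
      (≤-trans (∣+∣≤ (∣*∣≤ S-M₂ (∣C∣≤1 (k ℕ.* M₂))) (∣*∣≤ (∣C∣≤1 M₂) (turns-S k)))
        (≤-by (2ℚ * δ) (0≤* 0≤2 δ≥0) (trans (cong (_* ε₀) (#-suc k)) (cotangent-ring-12 (# k) δ))))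

    turns-C : ∀ k → ∣ 1ℚ - C (k ℕ.* M₂) ∣ ≤ # k * ε₀
    turns-C zero    = ≤-reflexive (trans (cong (λ z → ∣ 1ℚ - z ∣) C-0) (sym (trans (cong (_* ε₀) #0≡0) (*-zeroˡ ε₀))))
    turns-C (suc k) = subst (λ z → ∣ z ∣ ≤ # (suc k) * ε₀) (sym (trans (cong (λ z → 1ℚ - z) (C-+ M₂ (k ℕ.* M₂))) (cotangent-ring-13 (C M₂) (S M₂) (C A) (S A))))
      (subst (∣ (1ℚ - C A) + C A * (1ℚ - C M₂) + S M₂ * S A ∣ ≤_) (trans (cotangent-ring-14 (# k) δ) (cong (_* ε₀) (sym (#-suc k))))
        (∣+∣≤ (∣+∣≤ (turns-C k) (∣*∣≤ (∣C∣≤1 A) C-M₂)) (∣*∣≤ S-M₂ (∣S∣≤1 A))))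
      where
      A = k ℕ.* M₂

    s : ℕ → ℚ
    s j = S (j ℕ.+ j)

    s-shift : ∀ j k → ∣ s (j ℕ.+ k ℕ.* M) - s j ∣ ≤ 2ℚ * # k * ε₀
    s-shift j k = subst (λ z → ∣ z ∣ ≤ 2ℚ * # k * ε₀) (sym (trans (cong (λ z → S z - s j) (eq j k M)) (trans (cong (_- s j) (S-+ (j ℕ.+ j) A)) (cotangent-ring-15 (S (j ℕ.+ j)) (C (j ℕ.+ j)) (S A) (C A)))))
      (subst (∣ C (j ℕ.+ j) * S A - S (j ℕ.+ j) * (1ℚ - C A) ∣ ≤_) (cotangent-ring-16 (# k) ε₀)
        (∣-∣≤ (∣*∣≤ (∣C∣≤1 (j ℕ.+ j)) (turns-S k)) (∣*∣≤ (∣S∣≤1 (j ℕ.+ j)) (turns-C k))))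
      where
      A = k ℕ.* M₂
      eq : ∀ j k M → j ℕ.+ k ℕ.* M ℕ.+ (j ℕ.+ k ℕ.* M) ≡ j ℕ.+ j ℕ.+ k ℕ.* (M ℕ.+ M)
      eq = ℕring.solve-∀

    s-reflect : ∀ i j k → i ℕ.+ j ≡ k ℕ.* M → ∣ s i + s j ∣ ≤ 2ℚ * # k * ε₀
    s-reflect i j k e = subst (λ z → ∣ z ∣ ≤ 2ℚ * # k * ε₀) (sym (trans (cong (_+ s j) (trans (S-sub (i ℕ.+ i) (j ℕ.+ j)) (cong₂ (λ u v → S u * C (j ℕ.+ j) - C v * S (j ℕ.+ j)) eq eq))) (cotangent-ring-17 (S (j ℕ.+ j)) (C (j ℕ.+ j)) (S A) (C A))))
      (subst (∣ S A * C (j ℕ.+ j) + (1ℚ - C A) * S (j ℕ.+ j) ∣ ≤_) (cotangent-ring-18 (# k) ε₀)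
        (∣+∣≤ (∣*∣≤ (turns-S k) (∣C∣≤1 (j ℕ.+ j))) (∣*∣≤ (turns-C k) (∣S∣≤1 (j ℕ.+ j)))))
      where
      A = k ℕ.* M₂
      eq₀ : ∀ i j → i ℕ.+ i ℕ.+ (j ℕ.+ j) ≡ i ℕ.+ j ℕ.+ (i ℕ.+ j)
      eq₀ = ℕring.solve-∀
      eq₁ : ∀ k M → k ℕ.* M ℕ.+ k ℕ.* M ≡ k ℕ.* (M ℕ.+ M)
      eq₁ = ℕring.solve-∀
      eq : i ℕ.+ i ℕ.+ (j ℕ.+ j) ≡ A
      eq = trans (eq₀ i j) (trans (cong₂ ℕ._+_ e e) (eq₁ k M))

    μ = # M
    μ≥0 : 0ℚ ≤ μ
    μ≥0 = #≥0 M
    ε₀≥0 : 0ℚ ≤ ε₀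
    ε₀≥0 = 0≤* (nonNegative⁻¹ 4ℚ) δ≥0
    μ≥1 : 1ℚ ≤ μ
    μ≥1 = #≥1 (ℕₚ.≤-trans (s≤s z≤n) 5≤M)
    2με₀ = 2ℚ * (μ * μ) * ε₀

    K : ℕ → ℚ
    K m = ∑ M (λ r → # r * s (r ℕ.* m))

  -- Annihilation is available only for exactly periodic functions, and `s` is periodic only up to
  -- an error; `s̃` repeats its first `M` values.
  s̃ : ℕ → ℚ
  s̃ j = s (j % M)

  s̃-per : Per M s̃
  s̃-per j = cong s (Data.Nat.DivMod.[m+n]%n≡m%n j M)

  K̃ : ℕ → ℚ
  K̃ m = ∑ M (λ r → # r * s̃ (r ℕ.* m))

  private
    s̃-near : ∀ r m → r ℕ.< M → m ℕ.≤ M → ∣ s̃ (r ℕ.* m) - s (r ℕ.* m) ∣ ≤ 2με₀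
    s̃-near r m r<M m≤M = subst (_≤ 2με₀) (∣-p∣≡∣p∣ (s̃ j - s j)) (subst (λ z → ∣ z ∣ ≤ 2με₀)
      (trans (cong (λ z → s z - s̃ j) (sym (m≡m%n+[m/n]*n j M))) (cotangent-ring-19 (s j) (s̃ j)))
      (≤-trans (s-shift (j % M) (j / M)) (*-monoʳ ε₀ ε₀≥0 (*-monoˡ 2ℚ 0≤2 j/M≤))))
      where
      j = r ℕ.* m
      j/M≤ : # (j / M) ≤ μ * μ
      j/M≤ = ≤-trans (#-mono (Data.Nat.DivMod.m/n≤m j M)) (subst (_≤ μ * μ) (sym (#-* r m)) (*-mono (#≥0 r) (#≥0 m) (#-mono (ℕₚ.<⇒≤ r<M)) (#-mono m≤M)))

    weighted : ∀ {f g : ℕ → ℚ} {κ} → (∀ r → r ℕ.< M → ∣ f r - g r ∣ ≤ κ) → ∣ ∑ M (λ r → # r * f r) - ∑ M (λ r → # r * g r) ∣ ≤ μ * (μ * κ)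
    weighted {f} {g} {κ} h = subst (λ z → ∣ z ∣ ≤ μ * (μ * κ)) (trans (∑-cong′ M (λ r → cotangent-ring-20 (# r) (f r) (g r))) (∑-- M (λ r → # r * f r) (λ r → # r * g r)))
      (∑-bound M (λ r l → ∣*∣≤ {# r} {f r - g r} (0≤⇒∣∣≤ (#≥0 r) (#-mono (ℕₚ.<⇒≤ l))) (h r l)))

    K̃-near : ∀ m → m ℕ.≤ M → ∣ K̃ m - K m ∣ ≤ μ * (μ * 2με₀)
    K̃-near m m≤M = weighted (λ r l → s̃-near r m l m≤M)

    K̃-reflect : ∀ m → m ℕ.≤ M → ∣ K̃ (M ℕ.∸ m) + K m ∣ ≤ μ * (μ * (2με₀ + 2με₀))
    K̃-reflect m m≤M = subst (λ z → ∣ z ∣ ≤ μ * (μ * (2με₀ + 2με₀))) eq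
      (weighted {λ r → s̃ (r ℕ.* (M ℕ.∸ m))} {λ r → - s (r ℕ.* m)} (λ r l → subst (λ z → ∣ z ∣ ≤ 2με₀ + 2με₀) (cotangent-ring-21 (s̃ (r ℕ.* (M ℕ.∸ m))) (s (r ℕ.* (M ℕ.∸ m))) (s (r ℕ.* m)))
        (∣+∣≤ (s̃-near r (M ℕ.∸ m) l (ℕₚ.m∸n≤m M m)) (≤-trans (s-reflect (r ℕ.* (M ℕ.∸ m)) (r ℕ.* m) r (trans (sym (ℕₚ.*-distribˡ-+ r (M ℕ.∸ m) m)) (cong (r ℕ.*_) (ℕₚ.m∸n+n≡m m≤M))))
           (*-monoʳ ε₀ ε₀≥0 (*-monoˡ 2ℚ 0≤2 (≤-trans (#-mono (ℕₚ.<⇒≤ l)) (subst (_≤ μ * μ) (*-identityʳ μ) (*-monoˡ μ μ≥0 μ≥1)))))))))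
      where
      eq : K̃ (M ℕ.∸ m) - ∑ M (λ r → # r * - s (r ℕ.* m)) ≡ K̃ (M ℕ.∸ m) + K m
      eq = trans (cong (λ z → K̃ (M ℕ.∸ m) - z) (trans (∑-cong′ M (λ r → cotangent-ring-22 (# r) (s (r ℕ.* m)))) (∑-neg M (λ r → # r * s (r ℕ.* m))))) (cotangent-ring-23 (K̃ (M ℕ.∸ m)) (K m))

    -- In `∑-recurrence` with `γ = 2 C (2 m)` the boundary values are nearly `t (M - 1) = - s m` and
    -- `t M = 0`. So `K m` is close to -(M/2) cot(πm/M).
    K-closed : ∀ m → m ℕ.≤ M → ∣ 4ℚ * (S m * S m) * K m + 2ℚ * μ * (S m * C m) ∣ ≤ 3ℚ * (μ * μ) * ε₀
    K-closed m m≤M = subst (λ z → ∣ z ∣ ≤ 3ℚ * (μ * μ) * ε₀) (sym eq)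
      (≤-trans (∣-∣≤ (∣*∣≤ {μ} {s (N ℕ.* m) + s m} (0≤⇒∣∣≤ μ≥0 ≤-refl) (≤-trans (s-reflect (N ℕ.* m) m m (trans (ℕₚ.+-comm (N ℕ.* m) m) (trans (cong (ℕ._* m) (ℕₚ.suc-pred M)) (ℕₚ.*-comm M m)))) (*-monoʳ ε₀ ε₀≥0 (*-monoˡ 2ℚ 0≤2 m≤μ))))
                   (∣*∣≤ {# N} {s (M ℕ.* m)} (0≤⇒∣∣≤ (#≥0 N) (#-mono {N} {M} (ℕₚ.pred[n]≤n {M}))) (≤-trans (subst (λ z → ∣ z ∣ ≤ # m * ε₀) (cong S (eqM M m)) (turns-S m)) (*-monoʳ ε₀ ε₀≥0 m≤μ))))
               (≤-reflexive (cotangent-ring-24 (μ) ε₀)))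
      where
      N = ℕ.pred M
      m≤μ : # m ≤ μ
      m≤μ = #-mono m≤M
      t : ℕ → ℚ
      t r = s (r ℕ.* m)
      eqM : ∀ M m → m ℕ.* (M ℕ.+ M) ≡ M ℕ.* m ℕ.+ M ℕ.* m
      eqM = ℕring.solve-∀
      rec : ∀ r → t (suc (suc r)) + t r ≡ 2ℚ * C (m ℕ.+ m) * t (suc r)
      rec r = subst₂ (λ u v → S u + t r ≡ 2ℚ * C (m ℕ.+ m) * S v) (e₁ r m) (e₂ r m) (S-two-step (r ℕ.* m ℕ.+ r ℕ.* m) (m ℕ.+ m))
        where
        e₁ : ∀ r m → r ℕ.* m ℕ.+ r ℕ.* m ℕ.+ (m ℕ.+ m) ℕ.+ (m ℕ.+ m) ≡ (m ℕ.+ (m ℕ.+ r ℕ.* m)) ℕ.+ (m ℕ.+ (m ℕ.+ r ℕ.* m))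
        e₁ = ℕring.solve-∀
        e₂ : ∀ r m → r ℕ.* m ℕ.+ r ℕ.* m ℕ.+ (m ℕ.+ m) ≡ (m ℕ.+ r ℕ.* m) ℕ.+ (m ℕ.+ r ℕ.* m)
        e₂ = ℕring.solve-∀
      lem₁ : ∀ s2 c → 1ℚ - c ≡ 2ℚ * s2 → 2ℚ - 2ℚ * c ≡ 4ℚ * s2
      lem₁ s2 c e = trans (cotangent-ring-25 c) (trans (cong (2ℚ *_) e) (cotangent-ring-26 s2))
      closed : 4ℚ * (S m * S m) * K m ≡ μ * t N - # N * t M
      closed = trans (cong (_* K m) (sym (lem₁ (S m * S m) (C (m ℕ.+ m)) (1-C-double m))))
        (subst (λ z → (2ℚ - 2ℚ * C (m ℕ.+ m)) * ∑ z (λ r → # r * t r) ≡ # z * t N - # N * t z) (ℕₚ.suc-pred M) (∑-recurrence t (2ℚ * C (m ℕ.+ m)) S-0 rec N))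
      eq : 4ℚ * (S m * S m) * K m + 2ℚ * μ * (S m * C m) ≡ μ * (s (N ℕ.* m) + s m) - # N * s (M ℕ.* m)
      eq = trans (cong (_+ 2ℚ * μ * (S m * C m)) closed) (trans (cotangent-ring-27 μ (t N) (# N) (t M) (S m * C m))
             (cong (λ z → μ * (t N + z) - # N * t M) (trans (sym (*-assoc 2ℚ (S m) (C m))) (sym (S-double m)))))

  S-lower : ∀ m → 1 ℕ.≤ m → m ℕ.+ m ℕ.< M → S 1 ≤ S m
  S-lower (suc zero)          _ l = ≤-refl
  S-lower (suc (suc zero))    _ l = ≤-by (2ℚ * (C 1 - ½) * S 1) (0≤* (0≤* 0≤2 (0≤-sub ½≤C1)) (<⇒≤ S1>0)) (trans (S-double 1) (cotangent-ring-28 (S 1) (C 1)))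
    where
    ½≤C1 : ½ ≤ C 1
    ½≤C1 = ≤-trans (≤-by (½ * C 2) (0≤* (nonNegative⁻¹ ½) (<⇒≤ (C>0 2 l))) (sym (trans (cong (λ z → ½ + ½ * z) (C-+ 1 1)) (trans (cotangent-ring-29 (C 1) (S 1)) (trans (cong (λ z → C 1 * C 1 + ½ * (1ℚ - z)) (unitary 1)) (cotangent-ring-30 (C 1 * C 1)))))))
              (subst (C 1 * C 1 ≤_) (*-identityʳ (C 1)) (*-monoˡ (C 1) (<⇒≤ C1>0) (C≤1 1)))
  S-lower (suc (suc (suc m))) _ l = ≤-trans (S-lower (suc m) (s≤s z≤n) (ℕₚ.≤-<-trans (ℕₚ.+-mono-≤ m+1≤ m+1≤) l))
      (≤-by (2ℚ * C (suc (suc m)) * S 1) (0≤* (0≤* 0≤2 (<⇒≤ (C>0 (suc (suc m)) (ℕₚ.≤-<-trans (ℕₚ.+-mono-≤ m+2≤ m+2≤) l)))) (<⇒≤ S1>0))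
        (trans (cong S (eq₂ m)) (trans (S-two-step′ (suc m) 1) (cong (λ a → S (suc m) + 2ℚ * C a * S 1) (eq₁ m)))))
    where
    m+2≤ : suc (suc m) ℕ.≤ suc (suc (suc m))
    m+2≤ = ℕₚ.n≤1+n _
    m+1≤ : suc m ℕ.≤ suc (suc (suc m))
    m+1≤ = ℕₚ.≤-trans (ℕₚ.n≤1+n _) m+2≤
    eq₁ : ∀ j → suc j ℕ.+ 1 ≡ suc (suc j)
    eq₁ = ℕring.solve-∀
    eq₂ : ∀ j → suc (suc (suc j)) ≡ suc j ℕ.+ 1 ℕ.+ 1
    eq₂ = ℕring.solve-∀

  1-C1≤S1² : 1ℚ - C 1 ≤ S 1 * S 1
  1-C1≤S1² = ≤-by ((1ℚ - C 1) * C 1) (0≤* (0≤-sub (C≤1 1)) (<⇒≤ C1>0)) (trans (cotangent-ring-31 (S 1) (C 1)) (trans (cong (λ z → (z - 1ℚ) + (1ℚ - C 1 * C 1)) (unitary 1)) (cotangent-ring-32 (C 1))))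

  private
    -- After `M` steps `C M ≤ 0`, so `1 ≤ 1 - C M ≤ M² (1 - C 1) ≤ M² S(1)²`. This bounds the loss
    -- in dividing the closed form by `S m * S m`.
    S1²-lower : 1ℚ ≤ μ * μ * (S 1 * S 1)
    S1²-lower = ≤-trans (≤-by (1ℚ - C M - 1ℚ) (0≤-sub 1≤1-CM) (cotangent-ring-33 (1ℚ - C M))) (≤-trans (1-C-quadratic M) (*-monoˡ (μ * μ) (0≤sq μ) 1-C1≤S1²))
      where
      1≤1-CM : 1ℚ ≤ 1ℚ - C M
      1≤1-CM = ≤-by (1ℚ - (1ℚ + C M)) (0≤-sub (≤-trans (∣∣≤⇒≤ (proj₁ (proj₂ nht))) δ≤1)) (cotangent-ring-34 (C M))

  κ : ℕ → ℚ
  κ m = C m * inv (S m)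

  private
    i²≤ : ∀ m → 1 ℕ.≤ m → m ℕ.+ m ℕ.< M → inv (S m) * inv (S m) ≤ μ * μ
    i²≤ m 1≤m l = subst (_≤ μ * μ) (trans (*-identityˡ (inv (S m * S m))) (inv-* (S m) (S m)))
      (inv-≤ (0<* Sm>0 Sm>0) (≤-trans S1²-lower (*-monoˡ (μ * μ) (0≤sq μ) (*-mono (<⇒≤ S1>0) (<⇒≤ S1>0) (S-lower m 1≤m l) (S-lower m 1≤m l)))))
      where
      Sm>0 = S>0 m 1≤m l

    2K+μκ : ∀ m → 1 ℕ.≤ m → m ℕ.+ m ℕ.< M → ∣ 2ℚ * K m + μ * κ m ∣ ≤ 2ℚ * (μ * μ * (μ * μ)) * ε₀
    2K+μκ m 1≤m l = subst (λ z → ∣ z ∣ ≤ 2ℚ * (μ * μ * (μ * μ)) * ε₀) eq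
      (≤-trans (∣*∣≤ {4ℚ * (S m * S m) * K m + 2ℚ * μ * (S m * C m)} {½ * (i * i)} (K-closed m (ℕₚ.≤-trans (ℕₚ.m≤m+n m m) (ℕₚ.<⇒≤ l)))
                      (0≤⇒∣∣≤ (0≤* (nonNegative⁻¹ ½) (0≤sq i)) (*-monoˡ ½ (nonNegative⁻¹ ½) (i²≤ m 1≤m l))))
        (≤-by (½ * (μ * μ * (μ * μ)) * ε₀) (0≤* (0≤* (nonNegative⁻¹ ½) (0≤* (0≤sq μ) (0≤sq μ))) ε₀≥0) (cotangent-ring-36 (μ * μ) ε₀)))
      where
      i = inv (S m)
      si : S m * i ≡ 1ℚ
      si = inv-r> (S>0 m 1≤m l)
      eq : (4ℚ * (S m * S m) * K m + 2ℚ * μ * (S m * C m)) * (½ * (i * i)) ≡ 2ℚ * K m + μ * κ m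
      eq = trans (cotangent-ring-35 (S m) (C m) (K m) μ i) (trans (cong (λ z → 2ℚ * K m * (z * z) + μ * κ m * z) si) (cotangent-ring-37 (K m) μ (κ m)))

  -- `K̃ m` and `K̃ (M - m)` are near `-(M/2) κ m` and its negative; their difference is what an odd
  -- function sees when its sum is folded at `M/2`. The factor M⁴ is harmless because `δ` is chosen
  -- after `M`.
  K̃-cot : ∀ m → 1 ℕ.≤ m → m ℕ.+ m ℕ.< M → ∣ K̃ m - K̃ (M ℕ.∸ m) + # M * κ m ∣ ≤ ι (ℤ.+ 32) * (# M * # M * (# M * # M)) * δ
  K̃-cot m 1≤m l = subst (λ z → ∣ z ∣ ≤ ι (ℤ.+ 32) * (μ * μ * (μ * μ)) * δ) (cotangent-ring-38 (K̃ m) (K̃ (M ℕ.∸ m)) (K m) (μ * κ m))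
      (subst (∣ (K̃ m - K m) - (K̃ (M ℕ.∸ m) + K m) + (2ℚ * K m + μ * κ m) ∣ ≤_) (cotangent-ring-39 μ δ)
        (∣+∣≤ (∣-∣≤ (K̃-near m m≤M) (K̃-reflect m m≤M)) (2K+μκ m 1≤m l)))
    where
    m≤M = ℕₚ.≤-trans (ℕₚ.m≤m+n m m) (ℕₚ.<⇒≤ l)

  κ≥0 : ∀ m → m ℕ.+ m ℕ.< M → 0ℚ ≤ κ m
  κ≥0 zero    l = ≤-reflexive (sym (trans (cong (λ z → C 0 * inv z) S-0) (trans (cong (C 0 *_) inv-0) (*-zeroʳ (C 0)))))
  κ≥0 (suc m) l = 0≤* (<⇒≤ (C>0 (suc m) l)) (<⇒≤ (inv-pos (S>0 (suc m) (s≤s z≤n) l)))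

  -- The subtraction formula gives `κ m - κ (m + 1) = S 1 / (S m * S (m + 1))`.
  κ-decreasing : ∀ m → 1 ℕ.≤ m → suc m ℕ.+ suc m ℕ.< M → κ (suc m) ≤ κ m
  κ-decreasing m 1≤m l = ≤-by (S 1 * (i * j)) (0≤* (<⇒≤ S1>0) (0≤* (<⇒≤ (inv-pos Sm>0)) (<⇒≤ (inv-pos Sm′>0)))) (sym eq)
    where
    l′ : m ℕ.+ m ℕ.< M
    l′ = ℕₚ.≤-<-trans (ℕₚ.+-mono-≤ (ℕₚ.n≤1+n m) (ℕₚ.n≤1+n m)) l
    Sm>0 = S>0 m 1≤m l′
    Sm′>0 = S>0 (suc m) (s≤s z≤n) l
    i = inv (S m)
    j = inv (S (suc m))
    si = inv-r> Sm>0
    sj = inv-r> Sm′>0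
    S-suc : S (suc m) ≡ S m * C 1 + C m * S 1
    S-suc = trans (cong S (ℕₚ.+-comm 1 m)) (S-+ m 1)
    C-suc : C (suc m) ≡ C m * C 1 - S m * S 1
    C-suc = trans (cong C (ℕₚ.+-comm 1 m)) (C-+ m 1)
    open ≡-Reasoning
    eq : κ (suc m) + S 1 * (i * j) ≡ κ m
    eq = begin
      C (suc m) * j + S 1 * (i * j)                                       ≡⟨ cong₂ _+_ (sym (*-identityʳ (C (suc m) * j))) (sym (*-identityˡ (S 1 * (i * j)))) ⟩
      C (suc m) * j * 1ℚ + 1ℚ * (S 1 * (i * j))                           ≡⟨ cong₂ (λ u v → C (suc m) * j * u + v * (S 1 * (i * j))) (sym si) (sym (unitary m)) ⟩
      C (suc m) * j * (S m * i) + (C m * C m + S m * S m) * (S 1 * (i * j)) ≡⟨ cong (λ z → z * j * (S m * i) + (C m * C m + S m * S m) * (S 1 * (i * j))) C-suc ⟩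
      (C m * C 1 - S m * S 1) * j * (S m * i) + (C m * C m + S m * S m) * (S 1 * (i * j)) ≡⟨ cotangent-ring-40 (C m) (S m) (C 1) (S 1) i j ⟩
      C m * i * ((S m * C 1 + C m * S 1) * j)                             ≡⟨ cong (λ z → C m * i * (z * j)) (sym S-suc) ⟩
      C m * i * (S (suc m) * j)                                           ≡⟨ trans (cong (C m * i *_) sj) (*-identityʳ (C m * i)) ⟩
      C m * i                                                             ∎

  C-upper : ∀ k → suc k ℕ.+ suc k ℕ.< M → C (suc k) ≤ 1ℚ - # k * (S 1 * S 1)
  C-upper zero    l = ≤-trans (C≤1 1) (≤-reflexive (sym (trans (cong (λ z → 1ℚ - z * (S 1 * S 1)) #0≡0) (cotangent-ring-41 (S 1 * S 1)))))
  C-upper (suc k) l = ≤-by ((1ℚ - # k * (S 1 * S 1) - C (suc k)) + (C (suc k) * (1ℚ - C 1) + (S (suc k) - S 1) * S 1))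
      (0≤+ (0≤-sub (C-upper k l′)) (0≤+ (0≤* (<⇒≤ (C>0 (suc k) l′)) (0≤-sub (C≤1 1))) (0≤* (0≤-sub (S-lower (suc k) (s≤s z≤n) l′)) (<⇒≤ S1>0))))
      (trans (cong (λ z → 1ℚ - z * (S 1 * S 1)) (#-suc k)) (trans (cotangent-ring-42 (# k) (C 1) (S 1) (C (suc k)) (S (suc k)))
        (cong (_+ ((1ℚ - # k * (S 1 * S 1) - C (suc k)) + (C (suc k) * (1ℚ - C 1) + (S (suc k) - S 1) * S 1))) (sym (trans (cong C (ℕₚ.+-comm 1 (suc k))) (C-+ (suc k) 1))))))
    where
    l′ : suc k ℕ.+ suc k ℕ.< M
    l′ = ℕₚ.≤-<-trans (ℕₚ.+-mono-≤ (ℕₚ.n≤1+n (suc k)) (ℕₚ.n≤1+n (suc k))) l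

  -- The analogue of m sin θ ≤ tan(mθ), by induction through the addition formula. Together with
  -- `∣ S m ∣ ≤ m ∣ S 1 ∣` it squeezes `κ m * S 1` towards `1 / m`.
  mS1C≤S : ∀ m → m ℕ.+ m ℕ.< M → # m * S 1 * C m ≤ S m
  mS1C≤S zero    l = ≤-reflexive (trans (cong (λ z → z * S 1 * C 0) #0≡0) (trans (cotangent-ring-43 (S 1) (C 0)) (sym S-0)))
  mS1C≤S (suc m) l = subst₂ _≤_ (trans (cotangent-ring-44 (# m) (S 1) (C (suc m))) (cong (λ z → z * S 1 * C (suc m)) (sym (#-suc m)))) (sym (trans (cong S (ℕₚ.+-comm 1 m)) (S-+ m 1)))
      (+-mono-≤ (≤-trans (*-monoˡ (# m * S 1) (0≤* (#≥0 m) (<⇒≤ S1>0)) C′≤) (subst (_≤ S m * C 1) (*-assoc (# m * S 1) (C m) (C 1)) (*-monoʳ (C 1) (<⇒≤ C1>0) (mS1C≤S m l′))))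
                (≤-trans (*-monoʳ (S 1) (<⇒≤ S1>0) C′≤) (subst (C m * C 1 * S 1 ≤_) (cong (_* S 1) (*-identityʳ (C m))) (*-monoʳ (S 1) (<⇒≤ S1>0) (*-monoˡ (C m) (<⇒≤ (C>0 m l′)) (C≤1 1))))))
    where
    l′ : m ℕ.+ m ℕ.< M
    l′ = ℕₚ.≤-<-trans (ℕₚ.+-mono-≤ (ℕₚ.n≤1+n m) (ℕₚ.n≤1+n m)) l
    Sm≥0 : ∀ m → m ℕ.+ m ℕ.< M → 0ℚ ≤ S m
    Sm≥0 zero    _ = ≤-reflexive (sym S-0)
    Sm≥0 (suc m) l = <⇒≤ (S>0 (suc m) (s≤s z≤n) l)
    C′≤ : C (suc m) ≤ C m * C 1
    C′≤ = ≤-by (S m * S 1) (0≤* (Sm≥0 m l′) (<⇒≤ S1>0)) (trans (cotangent-ring-45 (C m * C 1) (S m * S 1)) (cong (_+ S m * S 1) (sym (trans (cong C (ℕₚ.+-comm 1 m)) (C-+ m 1)))))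

  κ-upper : ∀ m → 1 ℕ.≤ m → m ℕ.+ m ℕ.< M → κ m * S 1 ≤ inv (# m)
  κ-upper m 1≤m l = subst (κ m * S 1 ≤_) (*-identityˡ (inv (# m))) (≤-inv (#>0 1≤m)
      (subst (_≤ 1ℚ) (cotangent-ring-46 (# m) (S 1) (C m) (inv (S m))) (inv-≤ (S>0 m 1≤m l) (subst (# m * S 1 * C m ≤_) (sym (*-identityˡ (S m))) (mS1C≤S m l)))))

  κ-lower : ∀ m → 1 ℕ.≤ m → m ℕ.+ m ℕ.< M → inv (# m) - κ m * S 1 ≤ # m * (1ℚ - C 1)
  κ-lower m 1≤m l = ≤-by ((# m * # m * (1ℚ - C 1) - (1ℚ - C m)) * j + C m * (S 1 * i - j))
      (0≤+ (0≤* (0≤-sub (1-C-quadratic m)) (<⇒≤ j>0)) (0≤* (<⇒≤ (C>0 m l)) (0≤-sub j≤)))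
      (trans (sym (*-identityˡ (# m * (1ℚ - C 1)))) (trans (cong (_* (# m * (1ℚ - C 1))) (sym mj)) (cotangent-ring-47 (# m) (C 1) (C m) (S 1) i j)))
    where
    i = inv (S m)
    j = inv (# m)
    j>0 = inv-pos (#>0 1≤m)
    mj : # m * j ≡ 1ℚ
    mj = inv-r> (#>0 1≤m)
    Sm≤ : S m ≤ # m * S 1
    Sm≤ = ≤-trans (p≤∣p∣ (S m)) (subst (λ z → ∣ S m ∣ ≤ # m * z) (0≤p⇒∣p∣≡p (<⇒≤ S1>0)) (∣S∣-sublinear m))
    j≤ : j ≤ S 1 * i
    j≤ = ≤-inv (S>0 m 1≤m l) (subst (_≤ S 1) (*-comm (S m) j) (inv-≤ (#>0 1≤m) (subst (S m ≤_) (*-comm (# m) (S 1)) Sm≤)))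

-- From cotangent sums to sums of reciprocals

≤-ε : ∀ {p q} → (∀ ε → 0ℚ < ε → p ≤ q + ε) → p ≤ q
≤-ε {p} {q} h with p ≤? q
... | yes l = l
... | no ¬l = contradiction (<-≤-trans ½d>0 (≤-by {½ * (p - q)} (q + ½ * (p - q) - p) (0≤-sub (h (½ * (p - q)) ½d>0)) (lem p q))) (<-irrefl refl)
  where
  ½d>0 : 0ℚ < ½ * (p - q)
  ½d>0 = 0<* (positive⁻¹ ½) (0<-sub (≰⇒> ¬l))
  lem : ∀ p q → 0ℚ ≡ ½ * (p - q) + (q + ½ * (p - q) - p)
  lem = solve-∀ ℚ-ring

∑-telescope : ∀ N (k : ℕ → ℚ) → ∑ N (λ i → k i - k (suc i)) ≡ k 0 - k N
∑-telescope zero    k = sym (+-inverseʳ (k 0))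
∑-telescope (suc N) k = trans (cong (_+ (k N - k (suc N))) (∑-telescope N k)) (lem (k 0) (k N) (k (suc N)))
  where
  lem : ∀ a b c → a - b + (b - c) ≡ a - c
  lem = solve-∀ ℚ-ring

∑-abel : ∀ N (a k : ℕ → ℚ) → ∑ (suc N) (λ i → a i * k i) ≡ ∑ (suc N) a * k N + ∑ N (λ i → ∑ (suc i) a * (k i - k (suc i)))
∑-abel zero    a k = lem (a 0) (k 0)
  where
  lem : ∀ a k → 0ℚ + a * k ≡ (0ℚ + a) * k + 0ℚ
  lem = solve-∀ ℚ-ring
∑-abel (suc N) a k = trans (cong (_+ a (suc N) * k (suc N)) (∑-abel N a k))
  (lem (∑ (suc N) a) (k N) (k (suc N)) (a (suc N)) (∑ N (λ i → ∑ (suc i) a * (k i - k (suc i)))))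
  where
  lem : ∀ A k k′ a t → A * k + t + a * k′ ≡ (A + a) * k′ + (t + A * (k - k′))
  lem = solve-∀ ℚ-ring

∑-abel-bound : ∀ N (a k : ℕ → ℚ) {P} → (∀ i → ∣ ∑ i a ∣ ≤ P) → (∀ i → i ℕ.< N → k (suc i) ≤ k i) → 0ℚ ≤ k N →
  ∣ ∑ (suc N) (λ i → a i * k i) ∣ ≤ P * k 0
∑-abel-bound N a k {P} h dec k≥0 = subst₂ _≤_ (cong ∣_∣ (sym (∑-abel N a k))) eq
  (∣+∣≤ (∣*∣≤ (h (suc N)) (0≤⇒∣∣≤ k≥0 ≤-refl)) (∑-abs N (λ i l → ∣*∣≤ (h (suc i)) (0≤⇒∣∣≤ (0≤-sub (dec i l)) ≤-refl))))
  where
  lem : ∀ P a b → P * b + P * (a - b) ≡ P * a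
  lem = solve-∀ ℚ-ring
  eq : P * k N + ∑ N (λ i → P * (k i - k (suc i))) ≡ P * k 0
  eq = trans (cong (P * k N +_) (trans (∑-*ˡ N P (λ i → k i - k (suc i))) (cong (P *_) (∑-telescope N k)))) (lem P (k 0) (k N))

halve : ∀ M → ∃ λ h → M ≡ h ℕ.+ h ⊎ suc M ≡ h ℕ.+ h
halve zero = 0 , inj₁ refl
halve (suc M) with halve M
... | h , inj₁ e = suc h , inj₂ (cong suc (trans (cong suc e) (sym (ℕₚ.+-suc h h))))
... | h , inj₂ e = h , inj₁ e

half≤ : ∀ M h → M ≡ h ℕ.+ h ⊎ suc M ≡ h ℕ.+ h → h ℕ.≤ M
half≤ M h       (inj₁ refl) = ℕₚ.m≤m+n h h
half≤ M (suc h) (inj₂ e)    = subst (suc h ℕ.≤_) (sym (ℕₚ.suc-injective e)) (ℕₚ.m≤n+m (suc h) h)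

-- Reflecting `m` to `M - m` folds the upper half onto the lower with opposite sign. For even `M` a
-- middle term remains over, and oddness makes `R` vanish there.
half-sum : ∀ M h → M ≡ h ℕ.+ h ⊎ suc M ≡ h ℕ.+ h → (R k : ℕ → ℚ) → R 0 ≡ 0ℚ → (∀ m → m ℕ.≤ M → R (M ℕ.∸ m) ≡ - R m) →
  ∑ M (λ m → R m * k m) ≡ ∑ h (λ m → R m * (k m - k (M ℕ.∸ m)))
half-sum M h hM R k R0 odd = begin
  ∑ M g                                              ≡⟨ cong (λ z → ∑ z g) (sym (ℕₚ.m+[n∸m]≡n h≤M)) ⟩
  ∑ (h ℕ.+ N) g                                      ≡⟨ ∑-split h N g ⟩
  ∑ h g + ∑ N (λ i → g (h ℕ.+ i))                    ≡⟨ cong (∑ h g +_) (sym (∑-rev N (λ i → g (h ℕ.+ i)))) ⟩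
  ∑ h g + ∑ N (λ i → g (h ℕ.+ (N ℕ.∸ suc i)))        ≡⟨ cong (∑ h g +_) (∑-cong N (λ i l → refl-term i l)) ⟩
  ∑ h g + ∑ N (λ i → G (suc i))                      ≡⟨ cong (∑ h g +_) (trans (sym (+-identityˡ (∑ N (λ i → G (suc i))))) (cong (_+ ∑ N (λ i → G (suc i))) (sym G0))) ⟩
  ∑ h g + (G 0 + ∑ N (λ i → G (suc i)))              ≡⟨ cong (∑ h g +_) (trans (sym (∑-first N G)) (tail hM)) ⟩
  ∑ h g + ∑ h G                                      ≡⟨ sym (∑-+ h g G) ⟩
  ∑ h (λ m → g m + G m)                              ≡⟨ ∑-cong′ h (λ m → lem (R m) (k m) (k (M ℕ.∸ m))) ⟩
  ∑ h (λ m → R m * (k m - k (M ℕ.∸ m)))              ∎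
  where
  open ≡-Reasoning
  g G : ℕ → ℚ
  g m = R m * k m
  G m = - R m * k (M ℕ.∸ m)
  N = M ℕ.∸ h
  lem : ∀ r a b → r * a + - r * b ≡ r * (a - b)
  lem = solve-∀ ℚ-ring
  lem₀ : ∀ b → - 0ℚ * b ≡ 0ℚ
  lem₀ = solve-∀ ℚ-ring
  G0 : G 0 ≡ 0ℚ
  G0 = trans (cong (λ z → - z * k M) R0) (lem₀ (k M))
  h≤M : h ℕ.≤ M
  h≤M = half≤ M h hM
  refl-term : ∀ i → i ℕ.< N → g (h ℕ.+ (N ℕ.∸ suc i)) ≡ G (suc i)
  refl-term i l = trans (cong g idx) (cong (_* k (M ℕ.∸ suc i)) (odd (suc i) (ℕₚ.≤-trans l (ℕₚ.m∸n≤m M h))))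
    where
    idx : h ℕ.+ (N ℕ.∸ suc i) ≡ M ℕ.∸ suc i
    idx = trans (sym (ℕₚ.+-∸-assoc h l)) (cong (ℕ._∸ suc i) (ℕₚ.m+[n∸m]≡n h≤M))
  tail : M ≡ h ℕ.+ h ⊎ suc M ≡ h ℕ.+ h → ∑ (suc N) G ≡ ∑ h G
  tail (inj₁ e) = trans (cong (λ z → ∑ (suc z) G) N≡h) (trans (cong (∑ h G +_) Gh) (+-identityʳ (∑ h G)))
    where
    N≡h : N ≡ h
    N≡h = trans (cong (ℕ._∸ h) e) (ℕₚ.m+n∸m≡n h h)
    Rh : R h ≡ 0ℚ
    Rh = self-neg (R h) (trans (cong R (sym N≡h)) (odd h h≤M))
    Gh : G h ≡ 0ℚ
    Gh = trans (cong (λ z → - z * k (M ℕ.∸ h)) Rh) (lem₀ (k (M ℕ.∸ h)))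
  tail (inj₂ e) = cong (λ z → ∑ z G) (trans (sym (ℕₚ.+-∸-assoc 1 h≤M)) (trans (cong (ℕ._∸ h) e) (ℕₚ.m+n∸m≡n h h)))

Annihilates : ℕ → (ℕ → ℚ) → Set
Annihilates M R = ∀ {s} → Per M s → ∑ M (λ m → R m * ∑ M (λ r → # r * s (r ℕ.* m))) ≡ 0ℚ

module _ (R : ℕ → ℚ) {B P} (R0 : R 0 ≡ 0ℚ) (B≥0 : 0ℚ ≤ B) (∣R∣≤B : ∀ m → ∣ R m ∣ ≤ B) (P≥0 : 0ℚ ≤ P) (∣∑R∣≤P : ∀ j → ∣ ∑ j R ∣ ≤ P)
         (large : ∀ N → ∃ λ M → N ℕ.≤ M × (∀ m → m ℕ.≤ M → R (M ℕ.∸ m) ≡ - R m) × Annihilates M R) where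

  private module Estimate (D : ℕ) (1≤D : 1 ℕ.≤ D) (ε : ℚ) (ε>0 : 0ℚ < ε) where
    0≤2 : 0ℚ ≤ 2ℚ
    0≤2 = nonNegative⁻¹ 2ℚ
    -- With `h` at least `N₀ + 2` one gets `1 - C 1 ≤ S(1)² ≤ 1 / N₀` whenever `N₀` is positive.
    -- Passing from `κ m * S 1` to `1 / m` below `D` then costs at most `ε`.
    N₀ = proj₁ (archimedean (B * (# D * # D) * inv ε))
    N₀≥ : B * (# D * # D) ≤ ε * # N₀
    N₀≥ = subst₂ _≤_ (trans (lem (B * (# D * # D)) (inv ε) ε) (trans (cong (B * (# D * # D) *_) (inv-r> ε>0)) (*-identityʳ (B * (# D * # D))))) refl
            (*-monoˡ ε (<⇒≤ ε>0) (proj₂ (archimedean (B * (# D * # D) * inv ε))))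
      where
      lem : ∀ b i e → e * (b * i) ≡ b * (e * i)
      lem = solve-∀ ℚ-ring
    k₀ = N₀ ℕ.+ (D ℕ.+ 5)
    Mdata = large (k₀ ℕ.+ k₀)
    M = proj₁ Mdata
    2k₀≤M : k₀ ℕ.+ k₀ ℕ.≤ M
    2k₀≤M = proj₁ (proj₂ Mdata)
    k₀≤M : k₀ ℕ.≤ M
    k₀≤M = ℕₚ.≤-trans (ℕₚ.m≤m+n k₀ k₀) 2k₀≤M
    5≤k₀ : 5 ℕ.≤ k₀
    5≤k₀ = ℕₚ.≤-trans (ℕₚ.m≤n+m 5 D) (ℕₚ.m≤n+m (D ℕ.+ 5) N₀)
    5≤M : 5 ℕ.≤ M
    5≤M = ℕₚ.≤-trans 5≤k₀ k₀≤M
    1≤M : 1 ℕ.≤ M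
    1≤M = ℕₚ.≤-trans (s≤s z≤n) 5≤M
    odd = proj₁ (proj₂ (proj₂ Mdata))
    annih : Annihilates M R
    annih = proj₂ (proj₂ (proj₂ Mdata))
    h = proj₁ (halve M)
    hM = proj₂ (halve M)
    k₀≤h : k₀ ℕ.≤ h
    k₀≤h with k₀ ℕ.≤? h
    ... | yes l = l
    ... | no ¬l = contradiction 2k₀≤M (ℕₚ.<⇒≱ (ℕₚ.≤-<-trans M≤2h (ℕₚ.+-mono-< (ℕₚ.≰⇒> ¬l) (ℕₚ.≰⇒> ¬l))))
      where
      M≤2h : M ℕ.≤ h ℕ.+ h
      M≤2h = [ ℕₚ.≤-reflexive , (λ e → ℕₚ.≤-trans (ℕₚ.n≤1+n M) (ℕₚ.≤-reflexive e)) ]′ hM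
    half : ∀ m → m ℕ.< h → m ℕ.+ m ℕ.< M
    half m l with hM
    ... | inj₁ e = subst (m ℕ.+ m ℕ.<_) (sym e) (ℕₚ.+-mono-< l l)
    ... | inj₂ e = ℕₚ.≤-pred (subst (suc (suc (m ℕ.+ m)) ℕ.≤_) (sym e) (subst (ℕ._≤ h ℕ.+ h) (cong suc (ℕₚ.+-suc m m)) (ℕₚ.+-mono-≤ l l)))
    μ = # M
    μ>0 : 0ℚ < μ
    μ>0 = #>0 1≤M
    e₀ = ι (ℤ.+ 32) * (μ * μ * (μ * μ))
    e₀≥0 : 0ℚ ≤ e₀
    e₀≥0 = 0≤* (nonNegative⁻¹ (ι (ℤ.+ 32))) (0≤* (0≤sq μ) (0≤sq μ))
    -- Averaged over the fewer than `M` terms, the kernel error is `B * e₀ * δ`; with `δ = 1 / W` it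
    -- is at most `ε`, and `δ ≤ 1`.
    W = 1ℚ + B * e₀ * inv ε
    iε≥0 : 0ℚ ≤ inv ε
    iε≥0 = <⇒≤ (inv-pos ε>0)
    W≥1 : 1ℚ ≤ W
    W≥1 = ≤-by (B * e₀ * inv ε) (0≤* (0≤* B≥0 e₀≥0) iε≥0) refl
    W>0 : 0ℚ < W
    W>0 = <-≤-trans 0<1 W≥1
    δ = inv W
    δ>0 : 0ℚ < δ
    δ>0 = inv-pos W>0
    δ≤1 : δ ≤ 1ℚ
    δ≤1 = subst₂ _≤_ (*-identityˡ δ) refl (inv-≤ {1ℚ} {1ℚ} W>0 (subst (1ℚ ≤_) (sym (*-identityˡ W)) W≥1))
    Be₀δ≤ε : B * (e₀ * δ) ≤ ε
    Be₀δ≤ε = subst₂ _≤_ (trans (lem B e₀ (inv ε) δ ε) (trans (cong (B * (e₀ * δ) *_) (inv-r> ε>0)) (*-identityʳ (B * (e₀ * δ))))) (*-identityʳ ε) (*-monoˡ ε (<⇒≤ ε>0)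
      (inv-≤ {B * e₀ * inv ε} {1ℚ} W>0 (subst (B * e₀ * inv ε ≤_) (sym (*-identityˡ W)) (≤-by 1ℚ 0≤1 (+-comm 1ℚ (B * e₀ * inv ε))))))
      where
      lem : ∀ b e i d ε → ε * (b * e * i * d) ≡ b * (e * d) * (ε * i)
      lem = solve-∀ ℚ-ring
    ρdata = near-half-turn M 1≤M δ δ>0
    ρ = proj₁ ρdata
    open CotangentKernel M 5≤M δ (<⇒≤ δ>0) δ≤1 ρ (proj₂ ρdata)
    open Rotation ρ using (C; S; S-0)
    open RotationProperties ρ using (S≤1; C≤1)

    -- The folded sum of `R` against `K̃` is exactly zero; `K̃-cot` trades that kernel for `- M κ`,
    -- and only its error survives.
    ∑Rκ : ∣ ∑ h (λ m → R m * κ m) ∣ ≤ ε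
    ∑Rκ = ≤-trans (*-cancelˡ μ μ>0 (subst₂ _≤_ eq refl (≤-trans (∑-bound h bound) (*-monoʳ (B * (e₀ * δ)) (0≤* B≥0 (0≤* e₀≥0 (<⇒≤ δ>0))) (#-mono h≤M))))) Be₀δ≤ε
      where
      h≤M : h ℕ.≤ M
      h≤M = half≤ M h hM
      term : ℕ → ℚ
      term m = R m * (K̃ m - K̃ (M ℕ.∸ m) + μ * κ m)
      bound : ∀ m → m ℕ.< h → ∣ term m ∣ ≤ B * (e₀ * δ)
      bound zero    l = ≤-trans (≤-reflexive (cong ∣_∣ (trans (cong (_* (K̃ 0 - K̃ M + μ * κ 0)) R0) (*-zeroˡ (K̃ 0 - K̃ M + μ * κ 0))))) (0≤* B≥0 (0≤* e₀≥0 (<⇒≤ δ>0)))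
      bound (suc m) l = ∣*∣≤ (∣R∣≤B (suc m)) (K̃-cot (suc m) (s≤s z≤n) (half (suc m) l))
      lem : ∀ r a b → r * (a + b) ≡ r * a + r * b
      lem = solve-∀ ℚ-ring
      lem₂ : ∀ r a b → r * (a * b) ≡ a * (r * b)
      lem₂ = solve-∀ ℚ-ring
      sum : ∑ h term ≡ μ * ∑ h (λ m → R m * κ m)
      sum = trans (∑-cong′ h (λ m → lem (R m) (K̃ m - K̃ (M ℕ.∸ m)) (μ * κ m))) (trans (∑-+ h (λ m → R m * (K̃ m - K̃ (M ℕ.∸ m))) (λ m → R m * (μ * κ m)))
        (trans (cong₂ _+_ (trans (sym (half-sum M h hM R K̃ R0 odd)) (annih {s̃} s̃-per)) (trans (∑-cong′ h (λ m → lem₂ (R m) μ (κ m))) (∑-*ˡ h μ (λ m → R m * κ m)))) (+-identityˡ (μ * ∑ h (λ m → R m * κ m)))))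
      eq : ∣ ∑ h term ∣ ≡ μ * ∣ ∑ h (λ m → R m * κ m) ∣
      eq = trans (cong ∣_∣ sum) (trans (∣p*q∣≡∣p∣*∣q∣ μ (∑ h (λ m → R m * κ m))) (cong (_* ∣ ∑ h (λ m → R m * κ m) ∣) (0≤p⇒∣p∣≡p (<⇒≤ μ>0))))

    D<h : D ℕ.< h
    D<h = ℕₚ.≤-trans (ℕₚ.≤-trans (subst (suc D ℕ.≤_) (ℕₚ.+-comm 5 D) (s≤s (ℕₚ.m≤n+m D 4))) (ℕₚ.m≤n+m (D ℕ.+ 5) N₀)) k₀≤h
    N = h ℕ.∸ suc D
    h≡ : h ≡ D ℕ.+ suc N
    h≡ = sym (trans (ℕₚ.+-suc D N) (ℕₚ.m+[n∸m]≡n D<h))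

    -- Abel summation against the decreasing `κ`. The partial sums from `D` on are differences of
    -- two partial sums from 0, hence `2 P`.
    tail≤ : ∣ ∑ (suc N) (λ i → R (D ℕ.+ i) * κ (D ℕ.+ i)) ∣ ≤ 2ℚ * P * κ D
    tail≤ = subst (λ z → ∣ ∑ (suc N) (λ i → R (D ℕ.+ i) * κ (D ℕ.+ i)) ∣ ≤ 2ℚ * P * κ z) (ℕₚ.+-identityʳ D)
      (∑-abel-bound N (λ i → R (D ℕ.+ i)) (λ i → κ (D ℕ.+ i)) part
        (λ i l → subst (λ z → κ z ≤ κ (D ℕ.+ i)) (sym (ℕₚ.+-suc D i)) (κ-decreasing (D ℕ.+ i) (ℕₚ.≤-trans 1≤D (ℕₚ.m≤m+n D i)) (half (suc (D ℕ.+ i)) (subst₂ ℕ._≤_ (cong suc (ℕₚ.+-suc D i)) (sym (trans h≡ (ℕₚ.+-suc D N))) (s≤s (ℕₚ.+-monoʳ-≤ D l))))))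
        (κ≥0 (D ℕ.+ N) (half (D ℕ.+ N) (subst (suc (D ℕ.+ N) ℕ.≤_) (sym (trans h≡ (ℕₚ.+-suc D N))) ℕₚ.≤-refl))))
      where
      part : ∀ i → ∣ ∑ i (λ j → R (D ℕ.+ j)) ∣ ≤ 2ℚ * P
      part i = subst₂ _≤_ (cong ∣_∣ (trans (cong (_- ∑ D R) (∑-split D i R)) (lem (∑ D R) (∑ i (λ j → R (D ℕ.+ j)))))) (lem₂ P) (∣-∣≤ (∣∑R∣≤P (D ℕ.+ i)) (∣∑R∣≤P D))
        where
        lem : ∀ a b → a + b - a ≡ b
        lem = solve-∀ ℚ-ring
        lem₂ : ∀ p → p + p ≡ 2ℚ * p
        lem₂ = solve-∀ ℚ-ring

    head≤ : ∣ ∑ D (λ m → R m * κ m) ∣ ≤ ε + 2ℚ * P * κ D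
    head≤ = subst (_≤ ε + 2ℚ * P * κ D) (cong ∣_∣ (trans (cong (_- ∑ (suc N) (λ i → R (D ℕ.+ i) * κ (D ℕ.+ i))) (trans (cong (λ z → ∑ z (λ m → R m * κ m)) h≡) (∑-split D (suc N) (λ m → R m * κ m)))) (lem (∑ D (λ m → R m * κ m)) (∑ (suc N) (λ i → R (D ℕ.+ i) * κ (D ℕ.+ i))))))
      (∣-∣≤ ∑Rκ tail≤)
      where
      lem : ∀ a b → a + b - b ≡ a
      lem = solve-∀ ℚ-ring

    halfD : ∀ m → m ℕ.≤ D → m ℕ.+ m ℕ.< M
    halfD m l = half m (ℕₚ.≤-<-trans l D<h)
    S1≥0 : 0ℚ ≤ S 1
    S1≥0 = <⇒≤ (S>0 1 (s≤s z≤n) (halfD 1 1≤D))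
    E = 1ℚ - C 1
    E≥0 : 0ℚ ≤ E
    E≥0 = 0≤-sub (C≤1 1)

    E-small : B * (# D * # D) * E ≤ ε
    E-small = ≤-trans (*-monoʳ E E≥0 (≤-trans N₀≥ (*-monoˡ ε (<⇒≤ ε>0) (#-mono N₀≤j))))
      (subst₂ _≤_ (sym (*-assoc ε (# j) E)) (*-identityʳ ε) (*-monoˡ ε (<⇒≤ ε>0) (≤-trans (*-monoˡ (# j) (#≥0 j) 1-C1≤S1²) jS1²≤1)))
      where
      j = h ℕ.∸ 2
      2≤h : 2 ℕ.≤ h
      2≤h = ℕₚ.≤-trans (ℕₚ.≤-trans (s≤s (s≤s z≤n)) 5≤k₀) k₀≤h
      h≡j : h ≡ suc (suc j)
      h≡j = sym (ℕₚ.m+[n∸m]≡n 2≤h)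
      N₀≤j : N₀ ℕ.≤ j
      N₀≤j = ℕₚ.≤-pred (ℕₚ.≤-pred (subst (suc (suc N₀) ℕ.≤_) h≡j (ℕₚ.≤-trans (subst (ℕ._≤ k₀) (ℕₚ.+-comm N₀ 2) (ℕₚ.+-monoʳ-≤ N₀ (ℕₚ.≤-trans (s≤s (s≤s z≤n)) (ℕₚ.m≤n+m 5 D)))) k₀≤h)))
      lj : suc j ℕ.< h
      lj = subst (suc j ℕ.<_) (sym h≡j) ℕₚ.≤-refl
      jS1²≤1 : # j * (S 1 * S 1) ≤ 1ℚ
      jS1²≤1 = ≤-by (1ℚ - # j * (S 1 * S 1)) (≤-trans (<⇒≤ (C>0 (suc j) (half (suc j) lj))) (C-upper j (half (suc j) lj))) (lem (# j * (S 1 * S 1)))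
        where
        lem : ∀ a → 1ℚ ≡ a + (1ℚ - a)
        lem = solve-∀ ℚ-ring

    diff≤ : ∣ ∑ D (λ m → R m * (inv (# m) - κ m * S 1)) ∣ ≤ B * (# D * # D) * E
    diff≤ = subst (∣ ∑ D (λ m → R m * (inv (# m) - κ m * S 1)) ∣ ≤_) (lem (# D) B E) (∑-bound D bound)
      where
      lem : ∀ d b e → d * (b * (d * e)) ≡ b * (d * d) * e
      lem = solve-∀ ℚ-ring
      bound : ∀ m → m ℕ.< D → ∣ R m * (inv (# m) - κ m * S 1) ∣ ≤ B * (# D * E)
      bound zero    l = ≤-trans (≤-reflexive (cong ∣_∣ (trans (cong (_* (inv (# 0) - κ 0 * S 1)) R0) (*-zeroˡ (inv (# 0) - κ 0 * S 1))))) (0≤* B≥0 (0≤* (#≥0 D) E≥0))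
      bound (suc m) l = ∣*∣≤ (∣R∣≤B (suc m)) (0≤⇒∣∣≤ (0≤-sub (κ-upper (suc m) (s≤s z≤n) (halfD (suc m) (ℕₚ.<⇒≤ l))))
        (≤-trans (κ-lower (suc m) (s≤s z≤n) (halfD (suc m) (ℕₚ.<⇒≤ l))) (*-monoʳ E E≥0 (#-mono (ℕₚ.<⇒≤ l)))))

    result : ∣ ∑ D (λ m → R m * inv (# m)) ∣ ≤ 2ℚ * P * inv (# D) + (ε + ε)
    result = subst (λ z → ∣ z ∣ ≤ 2ℚ * P * inv (# D) + (ε + ε)) (sym eq)
      (≤-trans (∣+∣≤ (∣*∣≤ head≤ (0≤⇒∣∣≤ S1≥0 ≤-refl)) (≤-trans diff≤ E-small))
        (≤-by (ε * (1ℚ - S 1) + 2ℚ * P * (inv (# D) - κ D * S 1)) (0≤+ (0≤* (<⇒≤ ε>0) (0≤-sub (S≤1 1))) (0≤* (0≤* 0≤2 P≥0) (0≤-sub (κ-upper D 1≤D (halfD D ℕₚ.≤-refl)))))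
          (lem₂ ε (S 1) P (inv (# D)) (κ D))))
      where
      lem : ∀ r i k s → r * i ≡ r * k * s + r * (i - k * s)
      lem = solve-∀ ℚ-ring
      lem₂ : ∀ e s p i k → 2ℚ * p * i + (e + e) ≡ (e + 2ℚ * p * k) * s + e + (e * (1ℚ - s) + 2ℚ * p * (i - k * s))
      lem₂ = solve-∀ ℚ-ring
      eq : ∑ D (λ m → R m * inv (# m)) ≡ ∑ D (λ m → R m * κ m) * S 1 + ∑ D (λ m → R m * (inv (# m) - κ m * S 1))
      eq = trans (∑-cong′ D (λ m → lem (R m) (inv (# m)) (κ m) (S 1))) (trans (∑-+ D (λ m → R m * κ m * S 1) (λ m → R m * (inv (# m) - κ m * S 1)))
             (cong (_+ ∑ D (λ m → R m * (inv (# m) - κ m * S 1))) (∑-*ʳ D (S 1) (λ m → R m * κ m))))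

  -- The sum up to `D` does not see the modulus `M`, which `Estimate` is free to enlarge as its `ε`
  -- shrinks.
  reciprocal-sum-weak : ∀ D → 1 ℕ.≤ D → ∣ ∑ D (λ m → R m * inv (# m)) ∣ ≤ 2ℚ * P * inv (# D)
  reciprocal-sum-weak D 1≤D = ≤-ε (λ ε ε>0 → subst (λ z → ∣ ∑ D (λ m → R m * inv (# m)) ∣ ≤ 2ℚ * P * inv (# D) + z) (lem ε)
      (Estimate.result D 1≤D (½ * ε) (0<* (positive⁻¹ ½) ε>0)))
    where
    lem : ∀ e → ½ * e + ½ * e ≡ e
    lem = solve-∀ ℚ-ring

-- Iterated partial sums of a periodic function

module Primitives (n : ℕ) {{_ : NonZero n}} (f : ℕ → ℚ) (f-per : Per n f) (f-sum : ∑ n f ≡ 0ℚ) (f-moment : ∑ n (λ i → # i * f i) ≡ 0ℚ)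
                  {B} (B≥0 : 0ℚ ≤ B) (∣f∣≤B : ∀ i → ∣ f i ∣ ≤ B) where
  F G : ℕ → ℚ
  F j = ∑ j f
  G j = ∑ j (λ i → F (suc i))

  F-per : Per n F
  F-per j = trans (∑-split j n f) (trans (cong (F j +_) (trans (∑-shift n {f} f-per j) f-sum)) (+-identityʳ (F j)))

  -- Exchange the two summations. At `n` both terms vanish, by `f-sum` and `f-moment`; so the second
  -- primitive is periodic too, and bounded.
  G-closed : ∀ N → G N ≡ # N * F N - ∑ N (λ i → # i * f i)
  G-closed zero    = sym (lem (# 0))
    where
    lem : ∀ a → a * 0ℚ - 0ℚ ≡ 0ℚ
    lem = solve-∀ ℚ-ring
  G-closed (suc N) = trans (cong (_+ F (suc N)) (G-closed N)) (trans (lem (# N) (F N) (f N) (∑ N (λ i → # i * f i)))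
      (cong (λ z → z * F (suc N) - ∑ (suc N) (λ i → # i * f i)) (sym (#-suc N))))
    where
    lem : ∀ n F f s → n * F - s + (F + f) ≡ (n + 1ℚ) * (F + f) - (s + n * f)
    lem = solve-∀ ℚ-ring

  G-n : G n ≡ 0ℚ
  G-n = trans (G-closed n) (trans (cong₂ (λ a b → # n * a - b) f-sum f-moment) (trans (cong (_- 0ℚ) (*-zeroʳ (# n))) refl))

  G-per : Per n G
  G-per j = trans (cong G (ℕₚ.+-comm j n)) (trans (∑-split n j (λ i → F (suc i))) (trans (cong₂ _+_ G-n (∑-cong′ j (λ i → trans (cong (λ z → F (suc z)) (ℕₚ.+-comm n i)) (F-per (suc i))))) (+-identityˡ (G j))))

  P Q : ℚ
  P = # n * B
  Q = # n * P

  P≥0 : 0ℚ ≤ P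
  P≥0 = 0≤* (#≥0 n) B≥0
  Q≥0 : 0ℚ ≤ Q
  Q≥0 = 0≤* (#≥0 n) P≥0

  ∣F∣≤P : ∀ j → ∣ F j ∣ ≤ P
  ∣F∣≤P j = subst (λ z → ∣ z ∣ ≤ P) (sym (per-% {n} {F} F-per j)) (≤-trans (∑-bound (j % n) (λ i _ → ∣f∣≤B i)) (*-monoʳ B B≥0 (#-mono (ℕₚ.<⇒≤ (m%n<n j n)))))

  ∣G∣≤Q : ∀ j → ∣ G j ∣ ≤ Q
  ∣G∣≤Q j = subst (λ z → ∣ z ∣ ≤ Q) (sym (per-% {n} {G} G-per j)) (≤-trans (∑-bound (j % n) (λ i _ → ∣F∣≤P (suc i))) (*-monoʳ P P≥0 (#-mono (ℕₚ.<⇒≤ (m%n<n j n)))))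

  -- Summation by parts, twice. For convex `φ` the second differences are nonnegative and telescope,
  -- so the bound on `G` loses nothing to absolute values.
  abel² : ∀ N (φ : ℕ → ℚ) → ∑ N (λ i → f i * φ i) ≡ F N * φ N - G N * (φ (suc N) - φ N) + ∑ N (λ i → G (suc i) * (φ (suc (suc i)) - 2ℚ * φ (suc i) + φ i))
  abel² zero    φ = lem (φ 0) (φ 1)
    where
    lem : ∀ a b → 0ℚ ≡ 0ℚ * a - 0ℚ * (b - a) + 0ℚ
    lem = solve-∀ ℚ-ring
  abel² (suc N) φ = trans (cong (_+ f N * φ N) (abel² N φ)) (lem (F N) (f N) (G N) (φ N) (φ (suc N)) (φ (suc (suc N))) (∑ N (λ i → G (suc i) * (φ (suc (suc i)) - 2ℚ * φ (suc i) + φ i))))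
    where
    lem : ∀ F f G a b c s → F * a - G * (b - a) + s + f * a ≡ (F + f) * b - (G + (F + f)) * (c - b) + (s + (G + (F + f)) * (c - 2ℚ * b + a))
    lem = solve-∀ ℚ-ring

  inv-diff : ∀ {a} → 0ℚ < a → inv a - inv (a + 1ℚ) ≡ inv a * inv (a + 1ℚ)
  inv-diff {a} a>0 = trans (cong₂ _-_ (trans (sym (*-identityʳ i)) (cong (i *_) (sym e₂))) (trans (sym (*-identityʳ j)) (cong (j *_) (sym e₁)))) (lem a i j)
    where
    i = inv a
    j = inv (a + 1ℚ)
    e₁ = inv-r> a>0
    e₂ = inv-r> (<-≤-trans a>0 (≤-by 1ℚ 0≤1 refl))
    lem : ∀ a i j → i * ((a + 1ℚ) * j) - j * (a * i) ≡ i * j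
    lem = solve-∀ ℚ-ring

  -- By the weak bound the full sum tends to 0, so the sum up to `D` is minus the tail. As `D` is a
  -- multiple of the period, `F` and `G` start afresh from 0 in the tail, leaving the second
  -- differences of 1/m, whose total is at most 1/D².
  reciprocal-sum : (∀ D → 1 ℕ.≤ D → ∣ ∑ D (λ m → f m * inv (# m)) ∣ ≤ 2ℚ * P * inv (# D)) →
    ∀ q → 1 ℕ.≤ q → ∣ ∑ (q ℕ.* n) (λ m → f m * inv (# m)) ∣ ≤ Q * (inv (# (q ℕ.* n)) * inv (# (q ℕ.* n)))
  reciprocal-sum weak q 1≤q = ≤-ε λ ε ε>0 → ≤-trans (estimate (N ε ε>0))
       (subst (_≤ Q * (inv (# D) * inv (# D)) + ε) (+-comm (Q * (inv (# D) * inv (# D))) (W * φ (N ε ε>0))) (+-monoʳ-≤ (Q * (inv (# D) * inv (# D))) (small ε ε>0)))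
    where
    D = q ℕ.* n
    1≤D : 1 ℕ.≤ D
    1≤D = ℕₚ.*-mono-≤ 1≤q (ℕ.>-nonZero⁻¹ n)
    φ : ℕ → ℚ
    φ i = inv (# (D ℕ.+ i))
    D+i>0 : ∀ i → 0ℚ < # (D ℕ.+ i)
    D+i>0 i = #>0 (ℕₚ.≤-trans 1≤D (ℕₚ.m≤m+n D i))
    φ>0 : ∀ i → 0ℚ < φ i
    φ>0 i = inv-pos (D+i>0 i)
    #suc : ∀ i → # (D ℕ.+ suc i) ≡ # (D ℕ.+ i) + 1ℚ
    #suc i = trans (cong #_ (ℕₚ.+-suc D i)) (#-suc (D ℕ.+ i))
    φ-diff : ∀ i → φ i - φ (suc i) ≡ φ i * φ (suc i)
    φ-diff i = subst (λ z → φ i - inv z ≡ φ i * inv z) (sym (#suc i)) (inv-diff (D+i>0 i))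
    φ-anti : ∀ i → φ (suc i) ≤ φ i
    φ-anti i = ≤-by (φ i - φ (suc i)) (subst (0ℚ ≤_) (sym (φ-diff i)) (0≤* (<⇒≤ (φ>0 i)) (<⇒≤ (φ>0 (suc i))))) (lem (φ i) (φ (suc i)))
      where
      lem : ∀ a b → a ≡ b + (a - b)
      lem = solve-∀ ℚ-ring
    Δ² : ℕ → ℚ
    Δ² i = φ (suc (suc i)) - 2ℚ * φ (suc i) + φ i
    Δ²≥0 : ∀ i → 0ℚ ≤ Δ² i
    Δ²≥0 i = subst (0ℚ ≤_) (trans (lem (φ i) (φ (suc i)) (φ (suc (suc i)))) (trans (cong₂ _-_ (sym (φ-diff i)) (sym (φ-diff (suc i)))) (lem₂ (φ i) (φ (suc i)) (φ (suc (suc i))))))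
        (0≤* (<⇒≤ (φ>0 (suc i))) (0≤-sub (≤-trans (φ-anti (suc i)) (φ-anti i))))
      where
      lem : ∀ p q r → q * (p - r) ≡ p * q - q * r
      lem = solve-∀ ℚ-ring
      lem₂ : ∀ p q r → (p - q) - (q - r) ≡ r - 2ℚ * q + p
      lem₂ = solve-∀ ℚ-ring
    ∑Δ² : ∀ N → ∑ N Δ² ≡ (φ 0 - φ 1) - (φ N - φ (suc N))
    ∑Δ² N = trans (∑-cong′ N (λ i → lem (φ i) (φ (suc i)) (φ (suc (suc i))))) (∑-telescope N (λ i → φ i - φ (suc i)))
      where
      lem : ∀ p q r → r - 2ℚ * q + p ≡ (p - q) - (q - r)
      lem = solve-∀ ℚ-ring
    φ₀ : φ 0 ≡ inv (# D)
    φ₀ = cong (λ z → inv (# z)) (ℕₚ.+-identityʳ D)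
    ∑Δ²≤ : ∀ N → ∑ N Δ² ≤ inv (# D) * inv (# D)
    ∑Δ²≤ N = subst₂ _≤_ (sym (∑Δ² N)) (cong₂ _*_ φ₀ φ₀) (≤-by (φ 0 * (φ 0 - φ 1) + (φ N - φ (suc N)))
        (0≤+ (0≤* (<⇒≤ (φ>0 0)) (0≤-sub (φ-anti 0))) (0≤-sub (φ-anti N)))
        (trans (lem (φ 0) (φ 1)) (trans (cong (λ z → z + φ 0 * (φ 0 - φ 1)) (sym (φ-diff 0))) (lem₂ (φ 0 - φ 1) (φ 0 * (φ 0 - φ 1)) (φ N - φ (suc N))))))
      where
      lem : ∀ a b → a * a ≡ a * b + a * (a - b)
      lem = solve-∀ ℚ-ring
      lem₂ : ∀ u v w → u + v ≡ u - w + (v + w)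
      lem₂ = solve-∀ ℚ-ring
    W = 2ℚ * P + (P + Q)
    estimate : ∀ N → ∣ ∑ D (λ m → f m * inv (# m)) ∣ ≤ W * φ N + Q * (inv (# D) * inv (# D))
    estimate N = subst₂ _≤_ (cong ∣_∣ (trans (cong (_- T) (∑-split D N (λ m → f m * inv (# m)))) (lem (∑ D (λ m → f m * inv (# m))) T))) (lem₂ P (φ N) Q (Q * (inv (# D) * inv (# D))))
        (∣-∣≤ (weak (D ℕ.+ N) (ℕₚ.≤-trans 1≤D (ℕₚ.m≤m+n D N))) T≤)
      where
      T = ∑ N (λ i → f (D ℕ.+ i) * φ i)
      lem : ∀ a b → a + b - b ≡ a
      lem = solve-∀ ℚ-ring
      lem₂ : ∀ p x q r → 2ℚ * p * x + (p * x + q * x + r) ≡ (2ℚ * p + (p + q)) * x + r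
      lem₂ = solve-∀ ℚ-ring
      T≡ : T ≡ F N * φ N - G N * (φ (suc N) - φ N) + ∑ N (λ i → G (suc i) * Δ² i)
      T≡ = trans (∑-cong′ N (λ i → cong (_* φ i) (trans (cong f (ℕₚ.+-comm D i)) (per-mult {n} {f} f-per q i)))) (abel² N φ)
      T≤ : ∣ T ∣ ≤ P * φ N + Q * φ N + Q * (inv (# D) * inv (# D))
      T≤ = subst (λ z → ∣ z ∣ ≤ P * φ N + Q * φ N + Q * (inv (# D) * inv (# D))) (sym T≡)
        (∣+∣≤ (∣-∣≤ (∣*∣≤ (∣F∣≤P N) (0≤⇒∣∣≤ (<⇒≤ (φ>0 N)) ≤-refl))
                    (∣*∣≤ (∣G∣≤Q N) (∣∣-lub (≤-trans (≤-by (φ N - φ (suc N)) (0≤-sub (φ-anti N)) (l₁ (φ (suc N)) (φ N))) (<⇒≤ (φ>0 N))) (≤-by (φ (suc N)) (<⇒≤ (φ>0 (suc N))) (l₂ (φ (suc N)) (φ N))))))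
              (≤-trans (∑-abs N (λ i _ → ∣*∣≤ (∣G∣≤Q (suc i)) (0≤⇒∣∣≤ (Δ²≥0 i) ≤-refl))) (subst (_≤ Q * (inv (# D) * inv (# D))) (sym (∑-*ˡ N Q Δ²)) (*-monoˡ Q Q≥0 (∑Δ²≤ N)))))
        where
        l₁ : ∀ a b → 0ℚ ≡ a - b + (b - a)
        l₁ = solve-∀ ℚ-ring
        l₂ : ∀ a b → b ≡ - (a - b) + a
        l₂ = solve-∀ ℚ-ring
    N : ∀ ε → 0ℚ < ε → ℕ
    N ε ε>0 = proj₁ (archimedean (W * inv ε))
    small : ∀ ε (ε>0 : 0ℚ < ε) → W * φ (N ε ε>0) ≤ ε
    small ε ε>0 = inv-≤ (D+i>0 (N ε ε>0)) (≤-trans (subst₂ _≤_ (trans (lem W (inv ε) ε) (trans (cong (W *_) (inv-r> ε>0)) (*-identityʳ W))) refl (*-monoˡ ε (<⇒≤ ε>0) (proj₂ (archimedean (W * inv ε)))))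
        (*-monoˡ ε (<⇒≤ ε>0) (#-mono (ℕₚ.m≤n+m (N ε ε>0) D))))
      where
      lem : ∀ w i e → e * (w * i) ≡ w * (e * i)
      lem = solve-∀ ℚ-ring

-- Smoothed sums

-- Truncated subtraction supplies the positive part in (X - y)₊².
w : ℕ → ℕ → ℚ
w X y = # (X ℕ.∸ y) * # (X ℕ.∸ y)

w-vanish : ∀ {X y} → X ℕ.≤ y → w X y ≡ 0ℚ
w-vanish {X} {y} l = trans (cong (λ z → # z * # z) (ℕₚ.m≤n⇒m∸n≡0 l)) (trans (cong (λ z → z * z) #0≡0) refl)

w-≥0 : ∀ X y → 0ℚ ≤ w X y
w-≥0 X y = 0≤sq (# (X ℕ.∸ y))

pow3 : ℚ → ℚ
pow3 x = x * (x * x)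

⅓ ⅙ : ℚ
⅓ = ℤ.+ 1 ℚ./ 3
⅙ = ℤ.+ 1 ℚ./ 6

-- The quadratic Euler-Maclaurin main term of Σ_l (Z - H l)², where i = 1/H
em : ℚ → ℚ → ℚ → ℚ
em H i z = z * z * z * i * ⅓ + z * z * ½ + z * H * ⅙

-- `em` solves this difference equation exactly, so its error in a sum of squares depends only on
-- the residue of the starting point modulo `H`.
em-step : ∀ H i z → H * i ≡ 1ℚ → em H i (z + H) ≡ (z + H) * (z + H) + em H i z
em-step H i z e = trans (lem H i z) (trans (cong (λ a → (z + H) * (z + H) + em H i z + (a - 1ℚ) * (z * z + z * H + H * H * ⅓)) e) (lem₂ ((z + H) * (z + H) + em H i z) (z * z + z * H + H * H * ⅓)))
  where
  lem : ∀ H i z → (z + H) * (z + H) * (z + H) * i * ⅓ + (z + H) * (z + H) * ½ + (z + H) * H * ⅙ ≡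
        (z + H) * (z + H) + (z * z * z * i * ⅓ + z * z * ½ + z * H * ⅙) + (H * i - 1ℚ) * (z * z + z * H + H * H * ⅓)
  lem = solve-∀ ℚ-ring
  lem₂ : ∀ a b → a + (1ℚ - 1ℚ) * b ≡ a
  lem₂ = solve-∀ ℚ-ring

module _ (H : ℕ) (1≤H : 1 ℕ.≤ H) where
  private
    η = # H
    i = inv η
    η>0 : 0ℚ < η
    η>0 = #>0 1≤H
    η≥0 = <⇒≤ η>0
    i≥0 : 0ℚ ≤ i
    i≥0 = <⇒≤ (inv-pos η>0)
    ηi : η * i ≡ 1ℚ
    ηi = inv-r> η>0

  -- The coefficients ⅓, ½ and ⅙ add up to 1.
  em-small : ∀ z → ∣ z ∣ ≤ η → ∣ em η i z ∣ ≤ η * η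
  em-small z h = ≤-trans (∣+∣≤ (∣+∣≤ (∣*∣≤ {z * z * z * i} {⅓} (∣*∣≤ {z * z * z} {i} (∣*∣≤ {z * z} {z} (∣*∣≤ {z} {z} h h) h) (0≤⇒∣∣≤ i≥0 ≤-refl)) ≤-refl) (∣*∣≤ {z * z} {½} (∣*∣≤ {z} {z} h h) ≤-refl))
                        (∣*∣≤ {z * η} {⅙} (∣*∣≤ {z} {η} h (0≤⇒∣∣≤ η≥0 ≤-refl)) ≤-refl))
                 (≤-reflexive (trans (lem η i) (trans (cong (λ a → η * η * a * ⅓ + η * η * ½ + η * η * ⅙) ηi) (lem₂ (η * η)))))
    where
    lem : ∀ h i → h * h * h * i * ⅓ + h * h * ½ + h * h * ⅙ ≡ h * h * (h * i) * ⅓ + h * h * ½ + h * h * ⅙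
    lem = solve-∀ ℚ-ring
    lem₂ : ∀ a → a * 1ℚ * ⅓ + a * ½ + a * ⅙ ≡ a
    lem₂ = solve-∀ ℚ-ring

  private
    base : ∀ L Z → Z ℕ.< H → 1 ℕ.≤ L → ∑ L (λ l → w Z (H ℕ.* l)) ≡ # Z * # Z
    base (suc L) Z l _ = trans (∑-first L (λ l → w Z (H ℕ.* l))) (trans (cong₂ _+_ (cong (λ z → # (Z ℕ.∸ z) * # (Z ℕ.∸ z)) (ℕₚ.*-zeroʳ H))
      (∑-zero L (λ j _ → w-vanish {Z} {H ℕ.* suc j} (ℕₚ.≤-trans (ℕₚ.<⇒≤ l) (ℕₚ.m≤m*n H (suc j)))))) (+-identityʳ (# Z * # Z)))

    base-bound : ∀ Z → Z ℕ.< H → ∣ # Z * # Z - em η i (# Z) ∣ ≤ η * η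
    base-bound Z l = ∣∣-lub
      (≤-trans (≤-by (em η i ζ) em≥0 (l₁ (ζ * ζ) (em η i ζ))) ζ²≤)
      (≤-trans (≤-by (ζ * ζ) (0≤sq ζ) (l₂ (ζ * ζ) (em η i ζ))) (∣∣≤⇒≤ (em-small ζ (0≤⇒∣∣≤ ζ≥0 ζ≤η))))
      where
      ζ = # Z
      ζ≥0 = #≥0 Z
      ζ≤η : ζ ≤ η
      ζ≤η = #-mono (ℕₚ.<⇒≤ l)
      ζ²≤ : ζ * ζ ≤ η * η
      ζ²≤ = *-mono ζ≥0 ζ≥0 ζ≤η ζ≤η
      em≥0 : 0ℚ ≤ em η i ζ
      em≥0 = 0≤+ (0≤+ (0≤* (0≤* (0≤* (0≤sq ζ) ζ≥0) i≥0) (nonNegative⁻¹ ⅓)) (0≤* (0≤sq ζ) (nonNegative⁻¹ ½))) (0≤* (0≤* ζ≥0 η≥0) (nonNegative⁻¹ ⅙))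
      l₁ : ∀ z e → z ≡ z - e + e
      l₁ = solve-∀ ℚ-ring
      l₂ : ∀ z e → e ≡ - (z - e) + z
      l₂ = solve-∀ ℚ-ring

    progression : ∀ q r L → r ℕ.< H → r ℕ.+ q ℕ.* H ℕ.< L → ∑ L (λ l → w (r ℕ.+ q ℕ.* H) (H ℕ.* l)) - em η i (# (r ℕ.+ q ℕ.* H)) ≡ # r * # r - em η i (# r)
    progression zero    r L l l′ = trans (cong (λ z → ∑ L (λ l → w z (H ℕ.* l)) - em η i (# z)) (ℕₚ.+-identityʳ r)) (cong (_- em η i (# r)) (base L r l (ℕₚ.≤-trans (s≤s z≤n) l′)))
    progression (suc q) r zero    l ()
    progression (suc q) r (suc L) l l′ = trans (cong₂ _-_ (trans (∑-first L (λ l → w Z′ (H ℕ.* l))) (cong₂ _+_ first (∑-cong′ L (λ j → cong (λ z → # z * # z) (shift j)))))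
        (trans (cong (λ z → em η i (# z)) Z′≡) (trans (cong (em η i) (#-+ Z H)) (em-step η i (# Z) ηi))))
        (trans (lem ((# Z + η) * (# Z + η)) (∑ L (λ l → w Z (H ℕ.* l))) (em η i (# Z))) (progression q r L l Z<L))
      where
      Z = r ℕ.+ q ℕ.* H
      Z′ = r ℕ.+ suc q ℕ.* H
      eq : ∀ r q H → r ℕ.+ (H ℕ.+ q ℕ.* H) ≡ r ℕ.+ q ℕ.* H ℕ.+ H
      eq = ℕring.solve-∀
      Z′≡ : Z′ ≡ Z ℕ.+ H
      Z′≡ = eq r q H
      first : w Z′ (H ℕ.* 0) ≡ (# Z + η) * (# Z + η)
      first = trans (cong (λ z → # (Z′ ℕ.∸ z) * # (Z′ ℕ.∸ z)) (ℕₚ.*-zeroʳ H)) (cong (λ z → z * z) (trans (cong #_ Z′≡) (#-+ Z H)))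
      shift : ∀ j → Z′ ℕ.∸ H ℕ.* suc j ≡ Z ℕ.∸ H ℕ.* j
      shift j = trans (cong₂ ℕ._∸_ (trans Z′≡ (ℕₚ.+-comm Z H)) (ℕₚ.*-suc H j)) (ℕₚ.[m+n]∸[m+o]≡n∸o H Z (H ℕ.* j))
      Z<L : Z ℕ.< L
      Z<L = ℕₚ.≤-pred (ℕₚ.≤-trans (s≤s (subst (ℕ._≤ Z′) (trans (ℕₚ.+-comm Z 1) refl) (subst (Z ℕ.+ 1 ℕ.≤_) (sym Z′≡) (ℕₚ.+-monoʳ-≤ Z 1≤H)))) l′)
      lem : ∀ a s e → a + s - (a + e) ≡ s - e
      lem = solve-∀ ℚ-ring

  ∑-squares : ∀ L Z → Z ℕ.< L → ∣ ∑ L (λ l → w Z (H ℕ.* l)) - em (# H) (inv (# H)) (# Z) ∣ ≤ # H * # H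
  ∑-squares L Z l = subst (λ z → ∣ ∑ L (λ l → w z (H ℕ.* l)) - em η i (# z) ∣ ≤ η * η) (sym (m≡m%n+[m/n]*n Z H))
    (subst (λ z → ∣ z ∣ ≤ η * η) (sym (progression (Z / H) (Z % H) L (m%n<n Z H) (subst (ℕ._< L) (m≡m%n+[m/n]*n Z H) l))) (base-bound (Z % H) (m%n<n Z H)))
    where
    instance
      H-nz : NonZero H
      H-nz = ℕ.>-nonZero 1≤H

module _ (n : ℕ) (1≤n : 1 ℕ.≤ n) where
  private
    ν = inv (# n)
    nν : # n * ν ≡ 1ℚ
    nν = inv-r> (#>0 1≤n)
    ν≥0 : 0ℚ ≤ ν
    ν≥0 = <⇒≤ (inv-pos (#>0 1≤n))

  αᶜ : ℚ
  αᶜ = ν * ⅓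
  βᶜ γᶜ : ℕ → ℚ
  βᶜ c = ½ - # c * ν
  γᶜ c = # c * # c * ν - # c + # n * ⅙

  -- Euler-Maclaurin with step `h n` at `X - h c`, expanded in powers of `X`: degrees 3, 2 and 1
  -- give the main terms, and the part free of `X` is `rest` times h².
  ∑-class : ∀ X h c N → 1 ℕ.≤ h → c ℕ.≤ n → X ℕ.< N →
    ∣ ∑ N (λ l → w X (h ℕ.* (l ℕ.* n ℕ.+ c))) - (αᶜ * (pow3 (# X) * inv (# h)) + βᶜ c * (# X * # X) + γᶜ c * (# X * # h)) ∣ ≤ 2ℚ * (# n * # n) * (# h * # h)
  ∑-class X h c N 1≤h c≤n X<N = subst (λ z → ∣ z ∣ ≤ 2ℚ * (# n * # n) * (η * η)) eq
      (subst (∣ (∑ N (λ l → w (X ℕ.∸ h ℕ.* c) (H ℕ.* l)) - em (# H) (inv (# H)) z) + rest * (η * η) ∣ ≤_) bd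
        (∣+∣≤ main (∣*∣≤ {rest} {η * η} rest≤ (0≤⇒∣∣≤ (0≤sq η) ≤-refl))))
    where
    η = # h
    i = inv η
    ηi : η * i ≡ 1ℚ
    ηi = inv-r> (#>0 1≤h)
    H = h ℕ.* n
    1≤H : 1 ℕ.≤ H
    1≤H = ℕₚ.*-mono-≤ 1≤h 1≤n
    x = # X
    κ = # c
    κ≤n : κ ≤ # n
    κ≤n = #-mono c≤n
    ∣κ∣≤ : ∣ κ ∣ ≤ # n
    ∣κ∣≤ = 0≤⇒∣∣≤ (#≥0 c) κ≤n
    z = x - η * κ
    rest = κ * κ * ½ - κ * κ * κ * ν * ⅓ - κ * # n * ⅙
    reindex : ∀ l → X ℕ.∸ h ℕ.* (l ℕ.* n ℕ.+ c) ≡ X ℕ.∸ h ℕ.* c ℕ.∸ H ℕ.* l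
    reindex l = trans (cong (X ℕ.∸_) (e h l n c)) (sym (ℕₚ.∸-+-assoc X (h ℕ.* c) (H ℕ.* l)))
      where
      e : ∀ h l n c → h ℕ.* (l ℕ.* n ℕ.+ c) ≡ h ℕ.* c ℕ.+ h ℕ.* n ℕ.* l
      e = ℕring.solve-∀
    Z = X ℕ.∸ h ℕ.* c
    main : ∣ ∑ N (λ l → w Z (H ℕ.* l)) - em (# H) (inv (# H)) z ∣ ≤ # H * # H
    main with h ℕ.* c ℕ.≤? X
    ... | yes l = subst (λ y → ∣ ∑ N (λ l → w Z (H ℕ.* l)) - em (# H) (inv (# H)) y ∣ ≤ # H * # H) (trans (#-∸ l) (cong (λ y → x - y) (#-* h c)))
                    (∑-squares H 1≤H N Z (ℕₚ.≤-<-trans (ℕₚ.m∸n≤m X (h ℕ.* c)) X<N))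
    -- If `h c > X`, all weights are 0 and `Z` is truncated to 0. The true `z` is negative with
    -- `∣ z ∣ ≤ h n`, where `em` itself is within the error.
    ... | no ¬l = subst (_≤ # H * # H) (sym (trans (cong (λ y → ∣ y - em (# H) (inv (# H)) z ∣) (∑-zero N (λ l _ → w-vanish {Z} {H ℕ.* l} (subst (ℕ._≤ H ℕ.* l) (sym (ℕₚ.m≤n⇒m∸n≡0 hc≥X)) z≤n))))
                    (trans (cong ∣_∣ (+-identityˡ (- em (# H) (inv (# H)) z))) (∣-p∣≡∣p∣ (em (# H) (inv (# H)) z)))))
                    (em-small H 1≤H z (∣∣-lub (≤-trans (≤-by (η * κ - x) (0≤-sub x≤hc) (l₁ x (η * κ))) (#≥0 H))
                       (≤-trans (≤-by x (#≥0 X) (l₂ x (η * κ))) (subst (η * κ ≤_) (sym (#-* h n)) (*-monoˡ η (#≥0 h) κ≤n)))))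
      where
      hc≥X : X ℕ.≤ h ℕ.* c
      hc≥X = ℕₚ.<⇒≤ (ℕₚ.≰⇒> ¬l)
      x≤hc : x ≤ η * κ
      x≤hc = subst (x ≤_) (#-* h c) (#-mono hc≥X)
      l₁ : ∀ x y → 0ℚ ≡ x - y + (y - x)
      l₁ = solve-∀ ℚ-ring
      l₂ : ∀ x y → y ≡ - (x - y) + x
      l₂ = solve-∀ ℚ-ring
    rest≤ : ∣ rest ∣ ≤ # n * # n
    rest≤ = ≤-trans (∣-∣≤ (∣-∣≤ (∣*∣≤ {κ * κ} {½} (∣*∣≤ {κ} {κ} ∣κ∣≤ ∣κ∣≤) ≤-refl) (∣*∣≤ {κ * κ * κ * ν} {⅓} (∣*∣≤ {κ * κ * κ} {ν} (∣*∣≤ {κ * κ} {κ} (∣*∣≤ {κ} {κ} ∣κ∣≤ ∣κ∣≤) ∣κ∣≤) (0≤⇒∣∣≤ ν≥0 ≤-refl)) ≤-refl)) (∣*∣≤ {κ * # n} {⅙} (∣*∣≤ {κ} {# n} ∣κ∣≤ (0≤⇒∣∣≤ (#≥0 n) ≤-refl)) ≤-refl))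
        (≤-reflexive (trans (l₁ (# n) ν) (trans (cong (λ a → # n * # n * ½ + # n * # n * a * ⅓ + # n * # n * ⅙) nν) (l₂ (# n * # n)))))
      where
      l₁ : ∀ n v → n * n * ½ + n * n * n * v * ⅓ + n * n * ⅙ ≡ n * n * ½ + n * n * (n * v) * ⅓ + n * n * ⅙
      l₁ = solve-∀ ℚ-ring
      l₂ : ∀ a → a * ½ + a * 1ℚ * ⅓ + a * ⅙ ≡ a
      l₂ = solve-∀ ℚ-ring
    bd : # H * # H + # n * # n * (η * η) ≡ 2ℚ * (# n * # n) * (η * η)
    bd = trans (cong (λ y → y * y + # n * # n * (η * η)) (#-* h n)) (l (# n) η)
      where
      l : ∀ n e → e * n * (e * n) + n * n * (e * e) ≡ 2ℚ * (n * n) * (e * e)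
      l = solve-∀ ℚ-ring
    lem : ∀ x e k n i v → (x - e * k) * (x - e * k) * (x - e * k) * (i * v) * ⅓ + (x - e * k) * (x - e * k) * ½ + (x - e * k) * (e * n) * ⅙ - (k * k * ½ - k * k * k * v * ⅓ - k * n * ⅙) * (e * e) ≡
            v * ⅓ * (x * (x * x) * i) + (½ - k * v) * (x * x) + (k * k * v - k + n * ⅙) * (x * e) + (e * i - 1ℚ) * (x * (e * (k * (k * v))) - x * (x * (k * v)) - ⅓ * (e * (e * (k * (k * (k * v))))))
    lem = solve-∀ ℚ-ring
    eq : (∑ N (λ l → w Z (H ℕ.* l)) - em (# H) (inv (# H)) z) + rest * (η * η) ≡ ∑ N (λ l → w X (h ℕ.* (l ℕ.* n ℕ.+ c))) - (αᶜ * (pow3 x * i) + βᶜ c * (x * x) + γᶜ c * (x * η))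
    eq = trans (cong (λ y → (y - em (# H) (inv (# H)) z) + rest * (η * η)) (∑-cong′ N (λ l → cong (λ y → # y * # y) (sym (reindex l)))))
      (trans (l₁ (∑ N (λ l → w X (h ℕ.* (l ℕ.* n ℕ.+ c)))) (em (# H) (inv (# H)) z) (rest * (η * η)))
        (cong (λ y → ∑ N (λ l → w X (h ℕ.* (l ℕ.* n ℕ.+ c))) - y)
          (trans (cong₂ (λ a b → em a b z - rest * (η * η)) (#-* h n) (trans (cong inv (#-* h n)) (inv-* η (# n))))
            (trans (lem x η κ (# n) i ν) (trans (cong (λ y → αᶜ * (pow3 x * i) + βᶜ c * (x * x) + γᶜ c * (x * η) + (y - 1ℚ) * (x * (η * (κ * (κ * ν))) - x * (x * (κ * ν)) - ⅓ * (η * (η * (κ * (κ * (κ * ν))))))) ηi)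
               (l₂ (αᶜ * (pow3 x * i) + βᶜ c * (x * x) + γᶜ c * (x * η)) (x * (η * (κ * (κ * ν))) - x * (x * (κ * ν)) - ⅓ * (η * (η * (κ * (κ * (κ * ν)))))))))))) 
      where
      l₁ : ∀ s e r → s - e + r ≡ s - (e - r)
      l₁ = solve-∀ ℚ-ring
      l₂ : ∀ a b → a + (1ℚ - 1ℚ) * b ≡ a
      l₂ = solve-∀ ℚ-ring

-- Divisor sums against the quadratic weight

private
  progression-ring-1 : ∀ a → a * a ≡ 0ℚ * 0ℚ - 2ℚ * (0ℚ * 0ℚ) + a * a
  progression-ring-1 = solve-∀ ℚ-ring
  progression-ring-2 : ∀ a g → 2ℚ * (g * g) ≡ (a - g - g) * (a - g - g) - 2ℚ * ((a - g) * (a - g)) + a * a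
  progression-ring-2 = solve-∀ ℚ-ring
  progression-ring-3 : ∀ b g → 2ℚ * (b * g) + (g * g - b * b) ≡ 0ℚ * 0ℚ - 2ℚ * (b * b) + (b + g) * (b + g)
  progression-ring-3 = solve-∀ ℚ-ring
  progression-ring-4 : ∀ g p q → g * (p + q) ≡ p * p - q * q + (g - (p - q)) * (p + q)
  progression-ring-4 = solve-∀ ℚ-ring
  progression-ring-5 : ∀ g x p q → 2ℚ * g * x ≡ g * (p + q) + (g * (x - p) + g * (x - q))
  progression-ring-5 = solve-∀ ℚ-ring
  progression-ring-6 : ∀ p q g → g ≡ p - q + (q + g - p)
  progression-ring-6 = solve-∀ ℚ-ring
  progression-ring-7 : ∀ e → (e + 1ℚ) * (e + 1ℚ) ≡ e * e + (e + 1ℚ) + e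
  progression-ring-7 = solve-∀ ℚ-ring
  progression-ring-8 : ∀ n h → n * (1ℚ * (2ℚ * (n * n) * (h * h))) ≡ 2ℚ * (n * (n * n)) * (h * h)
  progression-ring-8 = solve-∀ ℚ-ring
  progression-ring-9 : ∀ u a b c p q r → u * (a * p + b * q + c * r) ≡ u * a * p + u * b * q + u * c * r
  progression-ring-9 = solve-∀ ℚ-ring
  progression-ring-10 : ∀ u a b → u * (a - b) ≡ u * a - u * b
  progression-ring-10 = solve-∀ ℚ-ring
  progression-ring-11 : ∀ n i → n * (1ℚ * (i * ⅓)) ≡ n * i * ⅓
  progression-ring-11 = solve-∀ ℚ-ring
  progression-ring-12 : ∀ a b c → (a + b) * c ≡ a * c + b * c
  progression-ring-12 = solve-∀ ℚ-ring
  progression-ring-13 : ∀ f a y i j b g x h d → f * (a * (y * (i * j)) + b + g * (x * (h * d))) ≡ a * (y * i) * (f * j) + b * f + g * (x * h) * (d * f)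
  progression-ring-13 = solve-∀ ℚ-ring
  progression-ring-14 : ∀ a → a + 0ℚ + 0ℚ ≡ a
  progression-ring-14 = solve-∀ ℚ-ring
  progression-ring-15 : ∀ f a b → f * (a - b) ≡ f * a - f * b
  progression-ring-15 = solve-∀ ℚ-ring
  progression-ring-16 : ∀ a b → 0ℚ * a - 0ℚ * b ≡ 0ℚ
  progression-ring-16 = solve-∀ ℚ-ring
  progression-ring-17 : ∀ a b c → a * 0ℚ - b * (0ℚ - 0ℚ) + c ≡ c
  progression-ring-17 = solve-∀ ℚ-ring
  progression-ring-18 : ∀ p q r → r - 2ℚ * q + p ≡ (p - q) - (q - r)
  progression-ring-18 = solve-∀ ℚ-ring
  progression-ring-19 : ∀ a → a - (0ℚ - 0ℚ) ≡ a
  progression-ring-19 = solve-∀ ℚ-ring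
  progression-ring-20 : ∀ a b c → a * (b * c) ≡ b * (a * c)
  progression-ring-20 = solve-∀ ℚ-ring
  progression-ring-21 : ∀ Q h x i j → 2ℚ * Q * (h * x) * (x * (i * j) * (x * (i * j))) ≡ 2ℚ * Q * (x * (x * x) * (h * i * i) * (j * j))
  progression-ring-21 = solve-∀ ℚ-ring
  progression-ring-22 : ∀ q h k x → 1ℚ * (q * (2ℚ * (h * k) * x)) ≡ 2ℚ * q * (h * x) * k
  progression-ring-22 = solve-∀ ℚ-ring
  progression-ring-23 : ∀ a b c → a + c ≡ b + (a - b) + c
  progression-ring-23 = solve-∀ ℚ-ring
  progression-ring-24 : ∀ q v b y j h d → (3ℚ * q + 2ℚ * v * b) * (y * j + h * h * (d * (d * d))) ≡ y * (q * j) + d * (b * (2ℚ * v * (h * d * (h * d)))) + 2ℚ * q * (y * j) + (2ℚ * v * b * (y * j) + 3ℚ * q * (h * h * (d * (d * d))))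
  progression-ring-24 = solve-∀ ℚ-ring

-- The cases are where the truncation sets in; before it does, the second difference is `2 g²`.
w-convex : ∀ X g y → 0ℚ ≤ w X (y ℕ.+ g ℕ.+ g) - 2ℚ * w X (y ℕ.+ g) + w X y
w-convex X g y = subst₂ (λ p q → 0ℚ ≤ # q * # q - 2ℚ * (# p * # p) + # a * # a) (ℕₚ.∸-+-assoc X y g)
    (trans (cong (ℕ._∸ g) (ℕₚ.∸-+-assoc X y g)) (ℕₚ.∸-+-assoc X (y ℕ.+ g) g)) (go a)
  where
  a = X ℕ.∸ y
  0≤2 : 0ℚ ≤ 2ℚ
  0≤2 = nonNegative⁻¹ 2ℚ
  goal : ℕ → Set
  goal a = 0ℚ ≤ # (a ℕ.∸ g ℕ.∸ g) * # (a ℕ.∸ g ℕ.∸ g) - 2ℚ * (# (a ℕ.∸ g) * # (a ℕ.∸ g)) + # a * # a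
  go : ∀ a → goal a
  go a with g ℕ.≤? a
  ... | no ¬l = subst (λ z → 0ℚ ≤ # (z ℕ.∸ g) * # (z ℕ.∸ g) - 2ℚ * (# z * # z) + # a * # a) (sym (ℕₚ.m≤n⇒m∸n≡0 (ℕₚ.<⇒≤ (ℕₚ.≰⇒> ¬l))))
                 (subst₂ (λ p q → 0ℚ ≤ p * p - 2ℚ * (q * q) + # a * # a) (sym (trans (cong #_ (ℕₚ.0∸n≡0 g)) #0≡0)) (sym #0≡0) (subst (0ℚ ≤_) (progression-ring-1 (# a)) (0≤sq (# a))))
  ... | yes l with g ℕ.≤? (a ℕ.∸ g)
  ...   | yes l′ = subst₂ (λ p q → 0ℚ ≤ p * p - 2ℚ * (q * q) + # a * # a) (sym (trans (#-∸ l′) (cong (_- # g) (#-∸ l)))) (sym (#-∸ l)) (subst (0ℚ ≤_) (progression-ring-2 (# a) (# g)) (0≤* 0≤2 (0≤sq (# g))))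
  ...   | no ¬l′ = subst₂ (λ p q → 0ℚ ≤ p * p - 2ℚ * (# b * # b) + q * q) (sym (trans (cong #_ (ℕₚ.m≤n⇒m∸n≡0 b≤g)) #0≡0)) (sym a≡)
                     (subst (0ℚ ≤_) (progression-ring-3 (# b) (# g)) (0≤+ (0≤* 0≤2 (0≤* (#≥0 b) (#≥0 g))) (0≤-sub (*-mono (#≥0 b) (#≥0 b) (#-mono b≤g) (#-mono b≤g)))))
    where
    b = a ℕ.∸ g
    b≤g = ℕₚ.<⇒≤ (ℕₚ.≰⇒> ¬l′)
    a≡ : # a ≡ # b + # g
    a≡ = trans (cong #_ (sym (ℕₚ.m∸n+n≡m l))) (#-+ b g)

w-slope : ∀ X g y → w X y - w X (y ℕ.+ g) ≤ 2ℚ * # g * # X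
w-slope X g y = ≤-trans (≤-by ((# g - (p - q)) * (p + q)) (0≤* (0≤-sub p-q≤g) (0≤+ (#≥0 (X ℕ.∸ y)) (#≥0 (X ℕ.∸ (y ℕ.+ g))))) (progression-ring-4 (# g) p q))
    (≤-by (# g * (# X - p) + # g * (# X - q)) (0≤+ (0≤* (#≥0 g) (0≤-sub (#-mono (ℕₚ.m∸n≤m X y)))) (0≤* (#≥0 g) (0≤-sub (#-mono (ℕₚ.m∸n≤m X (y ℕ.+ g)))))) (progression-ring-5 (# g) (# X) p q))
  where
  p = # (X ℕ.∸ y)
  q = # (X ℕ.∸ (y ℕ.+ g))
  p-q≤g : p - q ≤ # g
  p-q≤g = ≤-by (q + # g - p) (0≤-sub (subst (p ≤_) (#-+ (X ℕ.∸ (y ℕ.+ g)) g) (#-mono (subst (X ℕ.∸ y ℕ.≤_) (ℕₚ.+-comm g (X ℕ.∸ (y ℕ.+ g))) (subst (λ z → X ℕ.∸ y ℕ.≤ g ℕ.+ z) (ℕₚ.∸-+-assoc X y g) (ℕₚ.m≤n+m∸n (X ℕ.∸ y) g)))))) (progression-ring-6 p q (# g))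

∑#≤ : ∀ E → ∑ (suc E) #_ ≤ # E * # E
∑#≤ zero    = ≤-reflexive (trans (cong (0ℚ +_) #0≡0) (sym (trans (cong (λ z → z * z) #0≡0) refl)))
∑#≤ (suc E) = ≤-trans (+-monoˡ-≤ (# (suc E)) (∑#≤ E)) (≤-by (# E) (#≥0 E) (trans (cong (λ z → z * z) (#-suc E)) (trans (progression-ring-7 (# E)) (cong (λ z → # E * # E + z + # E) (sym (#-suc E))))))

module SmoothBound (n : ℕ) {{_ : NonZero n}} (f : ℕ → ℚ) (f-per : Per n f) (f-sum : ∑ n f ≡ 0ℚ) (f-moment : ∑ n (λ i → # i * f i) ≡ 0ℚ)
    {B} (B≥0 : 0ℚ ≤ B) (∣f∣≤B : ∀ i → ∣ f i ∣ ≤ B) (f-0 : f 0 ≡ 0ℚ)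
    (u : ℕ → ℚ) (u-per : Per n u) (∣u∣≤1 : ∀ k → ∣ u k ∣ ≤ 1ℚ) (u-0 : u 0 ≡ 0ℚ) where

  open Primitives n f f-per f-sum f-moment B≥0 ∣f∣≤B

  private
    1≤n : 1 ℕ.≤ n
    1≤n = ℕ.>-nonZero⁻¹ n
    0≤2 : 0ℚ ≤ 2ℚ
    0≤2 = nonNegative⁻¹ 2ℚ
    ν³ = # n * (# n * # n)
    ν³≥0 : 0ℚ ≤ ν³
    ν³≥0 = 0≤* (#≥0 n) (0≤sq (# n))

  V : ℕ → ℕ → ℕ → ℚ
  V N X h = ∑ N (λ k → u k * w X (h ℕ.* k))

  A₂ : ℕ → ℕ → ℕ → ℚ
  A₂ N X h = ∑ N (λ d → f d * V N X (h ℕ.* d))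

  private
    α β γ : ℚ
    α = ∑ n (λ c → u c * αᶜ n 1≤n)
    β = ∑ n (λ c → u c * βᶜ n 1≤n c)
    γ = ∑ n (λ c → u c * γᶜ n 1≤n c)

    main : ℕ → ℕ → ℚ
    main X h = α * (pow3 (# X) * inv (# h)) + β * (# X * # X) + γ * (# X * # h)

    V-main : ∀ N X h → 1 ℕ.≤ h → X ℕ.< N → ∣ V N X h - main X h ∣ ≤ 2ℚ * ν³ * (# h * # h)
    V-main N X h 1≤h X<N = subst₂ _≤_ (cong ∣_∣ eq) (progression-ring-8 (# n) (# h)) (∑-bound n (λ c l → ∣*∣≤ (∣u∣≤1 c) (∑-class n 1≤n X h c N 1≤h (ℕₚ.<⇒≤ l) X<N)))
      where
      cls mn : ℕ → ℚ
      cls c = ∑ N (λ l → w X (h ℕ.* (l ℕ.* n ℕ.+ c)))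
      mn c = αᶜ n 1≤n * (pow3 (# X) * inv (# h)) + βᶜ n 1≤n c * (# X * # X) + γᶜ n 1≤n c * (# X * # h)
      V≡ : V N X h ≡ ∑ n (λ c → u c * cls c)
      V≡ = begin
        V N X h                                                                     ≡⟨ sym (∑-extend (λ k → u k * w X (h ℕ.* k)) (ℕₚ.m≤m*n N n) (λ k N≤k → trans (cong (u k *_) (w-vanish {X} {h ℕ.* k} (ℕₚ.≤-trans (ℕₚ.≤-trans (ℕₚ.<⇒≤ X<N) N≤k) (ℕₚ.m≤n*m k h {{ℕ.>-nonZero 1≤h}})))) (*-zeroʳ (u k)))) ⟩
        ∑ (N ℕ.* n) (λ k → u k * w X (h ℕ.* k))                                     ≡⟨ ∑-block N n (λ k → u k * w X (h ℕ.* k)) ⟩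
        ∑ N (λ l → ∑ n (λ c → u (l ℕ.* n ℕ.+ c) * w X (h ℕ.* (l ℕ.* n ℕ.+ c))))     ≡⟨ ∑-cong′ N (λ l → ∑-cong′ n (λ c → cong (_* w X (h ℕ.* (l ℕ.* n ℕ.+ c))) (trans (cong u (ℕₚ.+-comm (l ℕ.* n) c)) (per-mult {n} {u} u-per l c)))) ⟩
        ∑ N (λ l → ∑ n (λ c → u c * w X (h ℕ.* (l ℕ.* n ℕ.+ c))))                   ≡⟨ ∑-swap N n (λ l c → u c * w X (h ℕ.* (l ℕ.* n ℕ.+ c))) ⟩
        ∑ n (λ c → ∑ N (λ l → u c * w X (h ℕ.* (l ℕ.* n ℕ.+ c))))                   ≡⟨ ∑-cong′ n (λ c → ∑-*ˡ N (u c) (λ l → w X (h ℕ.* (l ℕ.* n ℕ.+ c)))) ⟩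
        ∑ n (λ c → u c * cls c)                                                     ∎
        where open ≡-Reasoning
      main≡ : ∑ n (λ c → u c * mn c) ≡ main X h
      main≡ = trans (∑-cong′ n (λ c → progression-ring-9 (u c) (αᶜ n 1≤n) (βᶜ n 1≤n c) (γᶜ n 1≤n c) (pow3 (# X) * inv (# h)) (# X * # X) (# X * # h)))
        (trans (∑-+ n (λ c → u c * αᶜ n 1≤n * (pow3 (# X) * inv (# h)) + u c * βᶜ n 1≤n c * (# X * # X)) (λ c → u c * γᶜ n 1≤n c * (# X * # h)))
          (cong₂ _+_ (trans (∑-+ n (λ c → u c * αᶜ n 1≤n * (pow3 (# X) * inv (# h))) (λ c → u c * βᶜ n 1≤n c * (# X * # X)))
                       (cong₂ _+_ (∑-*ʳ n (pow3 (# X) * inv (# h)) (λ c → u c * αᶜ n 1≤n)) (∑-*ʳ n (# X * # X) (λ c → u c * βᶜ n 1≤n c))))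
                     (∑-*ʳ n (# X * # h) (λ c → u c * γᶜ n 1≤n c))))
      eq : ∑ n (λ c → u c * (cls c - mn c)) ≡ V N X h - main X h
      eq = trans (∑-cong′ n (λ c → progression-ring-10 (u c) (cls c) (mn c))) (trans (∑-- n (λ c → u c * cls c) (λ c → u c * mn c)) (cong₂ _-_ (sym V≡) main≡))

    α≤1 : ∣ α ∣ ≤ 1ℚ
    α≤1 = ≤-trans (∑-bound n {λ c → u c * αᶜ n 1≤n} {1ℚ * αᶜ n 1≤n} (λ c _ → ∣*∣≤ (∣u∣≤1 c) (0≤⇒∣∣≤ (0≤* (inv-nonneg (#≥0 n)) (nonNegative⁻¹ ⅓)) ≤-refl)))
            (≤-trans (≤-reflexive (trans (progression-ring-11 (# n) (inv (# n))) (trans (cong (_* ⅓) (inv-r> (#>0 1≤n))) (*-identityˡ ⅓)))) (≤-by {⅓} (ℤ.+ 2 ℚ./ 3) (nonNegative⁻¹ (ℤ.+ 2 ℚ./ 3)) refl))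

    moment-periods : ∀ q → ∑ (q ℕ.* n) (λ d → # d * f d) ≡ 0ℚ
    moment-periods q = trans (∑-block q n (λ d → # d * f d)) (∑-zero q (λ j _ → trans (∑-cong′ n (λ c → trans (cong₂ _*_ (#-+ (j ℕ.* n) c) (trans (cong f (ℕₚ.+-comm (j ℕ.* n) c)) (per-mult {n} {f} f-per j c))) (progression-ring-12 (# (j ℕ.* n)) (# c) (f c))))
        (trans (∑-+ n (λ c → # (j ℕ.* n) * f c) (λ c → # c * f c)) (trans (cong₂ _+_ (trans (∑-*ˡ n (# (j ℕ.* n)) f) (trans (cong (# (j ℕ.* n) *_) f-sum) (*-zeroʳ (# (j ℕ.* n))))) f-moment) refl))))

  module _ (reciprocal : ∀ q → 1 ℕ.≤ q → ∣ ∑ (q ℕ.* n) (λ m → f m * inv (# m)) ∣ ≤ Q * (inv (# (q ℕ.* n)) * inv (# (q ℕ.* n))))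
           (N X h q : ℕ) (X<N : X ℕ.< N) (1≤h : 1 ℕ.≤ h) (1≤q : 1 ℕ.≤ q) where
    private
      D = q ℕ.* n
      1≤D : 1 ℕ.≤ D
      1≤D = ℕₚ.*-mono-≤ 1≤q 1≤n
      δ = # D
      x³ = pow3 (# X)
      x³≥0 : 0ℚ ≤ x³
      x³≥0 = 0≤* (#≥0 X) (0≤sq (# X))
      i = inv (# h)
      i≥0 : 0ℚ ≤ i
      i≥0 = inv-nonneg (#≥0 h)
      j² = inv δ * inv δ

      T₁ T₂ : ℚ
      T₁ = ∑ D (λ d → f d * V N X (h ℕ.* d))
      T₂ = ∑ N (λ e → f (D ℕ.+ e) * V N X (h ℕ.* (D ℕ.+ e)))

      A₂≡ : A₂ N X h ≡ T₁ + T₂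
      A₂≡ = trans (sym (∑-extend (λ d → f d * V N X (h ℕ.* d)) (ℕₚ.m≤n+m N D) vanish)) (∑-split D N (λ d → f d * V N X (h ℕ.* d)))
        where
        vanish : ∀ d → N ℕ.≤ d → f d * V N X (h ℕ.* d) ≡ 0ℚ
        vanish d N≤d = trans (cong (f d *_) (∑-zero N term)) (*-zeroʳ (f d))
          where
          term : ∀ k → k ℕ.< N → u k * w X (h ℕ.* d ℕ.* k) ≡ 0ℚ
          term zero    _ = trans (cong (_* w X (h ℕ.* d ℕ.* 0)) u-0) (*-zeroˡ (w X (h ℕ.* d ℕ.* 0)))
          term (suc k) _ = trans (cong (u (suc k) *_) (w-vanish {X} {h ℕ.* d ℕ.* suc k} (ℕₚ.≤-trans (ℕₚ.≤-trans (ℕₚ.<⇒≤ X<N) N≤d) (ℕₚ.≤-trans (ℕₚ.m≤n*m d h {{ℕ.>-nonZero 1≤h}}) (ℕₚ.m≤m*n (h ℕ.* d) (suc k)))))) (*-zeroʳ (u (suc k)))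

      M₁ : ℚ
      M₁ = ∑ D (λ d → f d * (α * (x³ * (i * inv (# d))) + β * (# X * # X) + γ * (# X * (# h * # d))))

      M₁≡ : M₁ ≡ α * (x³ * i) * ∑ D (λ d → f d * inv (# d))
      M₁≡ = trans (∑-cong′ D (λ d → progression-ring-13 (f d) α x³ i (inv (# d)) (β * (# X * # X)) γ (# X) (# h) (# d)))
        (trans (∑-+ D (λ d → α * (x³ * i) * (f d * inv (# d)) + β * (# X * # X) * f d) (λ d → γ * (# X * # h) * (# d * f d)))
        (trans (cong₂ _+_ (trans (∑-+ D (λ d → α * (x³ * i) * (f d * inv (# d))) (λ d → β * (# X * # X) * f d))
                  (cong₂ _+_ (∑-*ˡ D (α * (x³ * i)) (λ d → f d * inv (# d))) (trans (∑-*ˡ D (β * (# X * # X)) f) (trans (cong (β * (# X * # X) *_) (trans (∑-periods q n {f} f-per) (trans (cong (# q *_) f-sum) (*-zeroʳ (# q))))) (*-zeroʳ (β * (# X * # X)))))))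
               (trans (∑-*ˡ D (γ * (# X * # h)) (λ d → # d * f d)) (trans (cong (γ * (# X * # h) *_) (moment-periods q)) (*-zeroʳ (γ * (# X * # h))))))
          (progression-ring-14 (α * (x³ * i) * ∑ D (λ d → f d * inv (# d))))))

      M₁≤ : ∣ M₁ ∣ ≤ x³ * i * (Q * j²)
      M₁≤ = subst (λ z → ∣ z ∣ ≤ x³ * i * (Q * j²)) (sym M₁≡) (∣*∣≤ {α * (x³ * i)} {∑ D (λ d → f d * inv (# d))}
              (subst (∣ α * (x³ * i) ∣ ≤_) (*-identityˡ (x³ * i)) (∣*∣≤ α≤1 (0≤⇒∣∣≤ (0≤* x³≥0 i≥0) ≤-refl))) (reciprocal q 1≤q))

      hδ² = (# h * δ) * (# h * δ)

      T₁-M₁ : ∣ T₁ - M₁ ∣ ≤ δ * (B * (2ℚ * ν³ * hδ²))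
      T₁-M₁ = subst (λ z → ∣ z ∣ ≤ δ * (B * (2ℚ * ν³ * hδ²))) (∑-- D (λ d → f d * V N X (h ℕ.* d)) (λ d → f d * (α * (x³ * (i * inv (# d))) + β * (# X * # X) + γ * (# X * (# h * # d))))) (∑-bound D term)
        where
        bd≥0 : 0ℚ ≤ B * (2ℚ * ν³ * hδ²)
        bd≥0 = 0≤* B≥0 (0≤* (0≤* 0≤2 ν³≥0) (0≤sq (# h * δ)))
        term : ∀ d → d ℕ.< D → ∣ f d * V N X (h ℕ.* d) - f d * (α * (x³ * (i * inv (# d))) + β * (# X * # X) + γ * (# X * (# h * # d))) ∣ ≤ B * (2ℚ * ν³ * hδ²)
        term zero    _ = ≤-trans (≤-reflexive (cong ∣_∣ (trans (cong₂ (λ a b → a * V N X (h ℕ.* 0) - b * (α * (x³ * (i * inv (# 0))) + β * (# X * # X) + γ * (# X * (# h * # 0)))) f-0 f-0) (progression-ring-16 (V N X (h ℕ.* 0)) (α * (x³ * (i * inv (# 0))) + β * (# X * # X) + γ * (# X * (# h * # 0))))))) bd≥0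
        term d@(suc d′) l = subst (λ z → ∣ z ∣ ≤ B * (2ℚ * ν³ * hδ²)) (trans (progression-ring-15 (f d) (V N X (h ℕ.* d)) (main X (h ℕ.* d))) (cong (λ z → f d * V N X (h ℕ.* d) - f d * z) main≡))
            (∣*∣≤ (∣f∣≤B d) (≤-trans (V-main N X (h ℕ.* d) (ℕₚ.*-mono-≤ 1≤h (s≤s z≤n)) X<N)
              (subst (λ z → 2ℚ * ν³ * (z * z) ≤ 2ℚ * ν³ * hδ²) (sym (#-* h d)) (*-monoˡ (2ℚ * ν³) (0≤* 0≤2 ν³≥0) (*-mono (0≤* (#≥0 h) (#≥0 d)) (0≤* (#≥0 h) (#≥0 d)) hd≤ hd≤)))))
          where
          hd≤ : # h * # d ≤ # h * δ
          hd≤ = *-monoˡ (# h) (#≥0 h) (#-mono (ℕₚ.<⇒≤ l))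
          main≡ : main X (h ℕ.* d) ≡ α * (x³ * (i * inv (# d))) + β * (# X * # X) + γ * (# X * (# h * # d))
          main≡ = cong₂ (λ a b → α * (x³ * a) + β * (# X * # X) + γ * (# X * b)) (trans (cong inv (#-* h d)) (inv-* (# h) (# d))) (#-* h d)

      -- For `d ≥ D` the weight at `h d k` is 0 as soon as `k` exceeds `E`, so only the rows up to
      -- `E` contribute to the tail.
      E = (X / (h ℕ.* D)) {{ℕ.>-nonZero (ℕₚ.*-mono-≤ 1≤h 1≤D)}}
      E≤ : # E ≤ # X * (i * inv δ)
      E≤ = subst (# E ≤_) (cong (# X *_) (trans (cong inv (#-* h D)) (inv-* (# h) δ))) (≤-inv (#>0 (ℕₚ.*-mono-≤ 1≤h 1≤D)) (subst (_≤ # X) (#-* E (h ℕ.* D)) (#-mono (m/n*n≤m X (h ℕ.* D)))))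
        where instance _ = ℕ.>-nonZero (ℕₚ.*-mono-≤ 1≤h 1≤D)

      φ : ℕ → ℕ → ℚ
      φ k e = w X (h ℕ.* (D ℕ.+ e) ℕ.* k)

      row : ℕ → ℚ
      row k = ∑ N (λ e → f e * φ k e)

      -- Two summations by parts against the bounded `G`. The second differences of the weight are
      -- nonnegative by convexity and telescope to a single first difference, which `w-slope`
      -- bounds.
      row≤ : ∀ k → 1 ℕ.≤ k → ∣ row k ∣ ≤ Q * (2ℚ * # (h ℕ.* k) * # X)
      row≤ k 1≤k = subst (λ z → ∣ z ∣ ≤ Q * (2ℚ * # g * # X)) (sym row≡)
          (≤-trans (∑-abs N (λ e _ → ∣*∣≤ (∣G∣≤Q (suc e)) (0≤⇒∣∣≤ (Δ²≥0 e) ≤-refl)))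
            (subst (_≤ Q * (2ℚ * # g * # X)) (sym (trans (∑-*ˡ N Q Δ²) (cong (Q *_) ∑Δ²)))
              (*-monoˡ Q Q≥0 (subst (λ z → z ≤ 2ℚ * # g * # X) (sym (cong₂ _-_ (ψ≡ 0) (ψ≡+ 0))) (w-slope X g (g ℕ.* (D ℕ.+ 0)))))))
        where
        g = h ℕ.* k
        1≤g : 1 ℕ.≤ g
        1≤g = ℕₚ.*-mono-≤ 1≤h 1≤k
        ψ = φ k
        ψ≡ : ∀ e → ψ e ≡ w X (g ℕ.* (D ℕ.+ e))
        ψ≡ e = cong (w X) (lem h (D ℕ.+ e) k)
          where
          lem : ∀ a b c → a ℕ.* b ℕ.* c ≡ a ℕ.* c ℕ.* b
          lem = ℕring.solve-∀
        ψ≡+ : ∀ e → ψ (suc e) ≡ w X (g ℕ.* (D ℕ.+ e) ℕ.+ g)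
        ψ≡+ e = trans (ψ≡ (suc e)) (cong (w X) (lem g D e))
          where
          lem : ∀ g D e → g ℕ.* (D ℕ.+ suc e) ≡ g ℕ.* (D ℕ.+ e) ℕ.+ g
          lem = ℕring.solve-∀
        ψ≡++ : ∀ e → ψ (suc (suc e)) ≡ w X (g ℕ.* (D ℕ.+ e) ℕ.+ g ℕ.+ g)
        ψ≡++ e = trans (ψ≡+ (suc e)) (cong (w X) (lem g D e))
          where
          lem : ∀ g D e → g ℕ.* (D ℕ.+ suc e) ℕ.+ g ≡ g ℕ.* (D ℕ.+ e) ℕ.+ g ℕ.+ g
          lem = ℕring.solve-∀
        ψ-N : ∀ e → N ℕ.≤ e → ψ e ≡ 0ℚ
        ψ-N e N≤e = trans (ψ≡ e) (w-vanish {X} {g ℕ.* (D ℕ.+ e)} (ℕₚ.≤-trans (ℕₚ.≤-trans (ℕₚ.<⇒≤ X<N) N≤e) (ℕₚ.≤-trans (ℕₚ.m≤n+m e D) (ℕₚ.m≤n*m (D ℕ.+ e) g {{ℕ.>-nonZero 1≤g}}))))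
        Δ² : ℕ → ℚ
        Δ² e = ψ (suc (suc e)) - 2ℚ * ψ (suc e) + ψ e
        Δ²≥0 : ∀ e → 0ℚ ≤ Δ² e
        Δ²≥0 e = subst (0ℚ ≤_) (sym (trans (cong₂ (λ a b → a - 2ℚ * b + ψ e) (ψ≡++ e) (ψ≡+ e)) (cong (λ a → w X (g ℕ.* (D ℕ.+ e) ℕ.+ g ℕ.+ g) - 2ℚ * w X (g ℕ.* (D ℕ.+ e) ℕ.+ g) + a) (ψ≡ e)))) (w-convex X g (g ℕ.* (D ℕ.+ e)))
        row≡ : row k ≡ ∑ N (λ e → G (suc e) * Δ² e)
        row≡ = trans (abel² N ψ) (trans (cong₂ (λ a b → F N * a - G N * (b - a) + ∑ N (λ e → G (suc e) * Δ² e)) (ψ-N N ℕₚ.≤-refl) (ψ-N (suc N) (ℕₚ.n≤1+n N))) (progression-ring-17 (F N) (G N) (∑ N (λ e → G (suc e) * Δ² e))))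
        ∑Δ² : ∑ N Δ² ≡ ψ 0 - ψ 1
        ∑Δ² = trans (∑-cong′ N (λ e → progression-ring-18 (ψ e) (ψ (suc e)) (ψ (suc (suc e))))) (trans (∑-telescope N (λ e → ψ e - ψ (suc e))) (trans (cong₂ (λ a b → ψ 0 - ψ 1 - (a - b)) (ψ-N N ℕₚ.≤-refl) (ψ-N (suc N) (ℕₚ.n≤1+n N))) (progression-ring-19 (ψ 0 - ψ 1))))

      row-vanish : ∀ k → suc E ℕ.≤ k → row k ≡ 0ℚ
      row-vanish k E<k = ∑-zero N (λ e _ → trans (cong (f e *_) (w-vanish {X} {h ℕ.* (D ℕ.+ e) ℕ.* k} (ℕₚ.<⇒≤ (ℕₚ.<-≤-trans X< (ℕₚ.*-monoˡ-≤ k (ℕₚ.*-monoʳ-≤ h (ℕₚ.m≤m+n D e))))))) (*-zeroʳ (f e)))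
        where
        instance _ = ℕ.>-nonZero (ℕₚ.*-mono-≤ 1≤h 1≤D)
        X< : X ℕ.< h ℕ.* D ℕ.* k
        X< = ℕₚ.<-≤-trans (subst (ℕ._< suc E ℕ.* (h ℕ.* D)) (sym (m≡m%n+[m/n]*n X (h ℕ.* D))) (ℕₚ.+-monoˡ-< (E ℕ.* (h ℕ.* D)) (m%n<n X (h ℕ.* D))))
               (subst (suc E ℕ.* (h ℕ.* D) ℕ.≤_) (ℕₚ.*-comm k (h ℕ.* D)) (ℕₚ.*-monoˡ-≤ (h ℕ.* D) E<k))

      T₂≡ : T₂ ≡ ∑ N (λ k → u k * row k)
      T₂≡ = begin
        ∑ N (λ e → f (D ℕ.+ e) * ∑ N (λ k → u k * φ k e))      ≡⟨ ∑-cong′ N (λ e → cong (_* ∑ N (λ k → u k * φ k e)) (trans (cong f (ℕₚ.+-comm D e)) (per-mult {n} {f} f-per q e))) ⟩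
        ∑ N (λ e → f e * ∑ N (λ k → u k * φ k e))              ≡⟨ ∑-cong′ N (λ e → sym (∑-*ˡ N (f e) (λ k → u k * φ k e))) ⟩
        ∑ N (λ e → ∑ N (λ k → f e * (u k * φ k e)))            ≡⟨ ∑-swap N N (λ e k → f e * (u k * φ k e)) ⟩
        ∑ N (λ k → ∑ N (λ e → f e * (u k * φ k e)))            ≡⟨ ∑-cong′ N (λ k → trans (∑-cong′ N (λ e → progression-ring-20 (f e) (u k) (φ k e))) (∑-*ˡ N (u k) (λ e → f e * φ k e))) ⟩
        ∑ N (λ k → u k * row k)                                ∎
        where
        open ≡-Reasoning

      T₂≤ : ∣ T₂ ∣ ≤ 2ℚ * Q * (x³ * i * j²)
      T₂≤ = subst (λ z → ∣ z ∣ ≤ 2ℚ * Q * (x³ * i * j²)) (sym T₂E)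
          (≤-trans (∑-abs (suc E) term) (≤-trans (≤-reflexive (∑-*ˡ (suc E) (2ℚ * Q * (# h * # X)) #_))
            (≤-trans (*-monoˡ (2ℚ * Q * (# h * # X)) (0≤* (0≤* 0≤2 Q≥0) (0≤* (#≥0 h) (#≥0 X))) (≤-trans (∑#≤ E) (*-mono (#≥0 E) (#≥0 E) E≤ E≤)))
              (≤-reflexive (trans (progression-ring-21 Q (# h) (# X) i (inv δ)) (trans (cong (λ a → 2ℚ * Q * (x³ * (a * i) * j²)) (inv-r> (#>0 1≤h))) (cong (λ a → 2ℚ * Q * (x³ * a * j²)) (*-identityˡ i))))))))
        where
        T₂E : T₂ ≡ ∑ (suc E) (λ k → u k * row k)
        T₂E = trans T₂≡ (trans (sym (∑-extend (λ k → u k * row k) (ℕₚ.m≤n+m N (suc E)) big)) (∑-extend (λ k → u k * row k) (ℕₚ.m≤m+n (suc E) N) (λ k l → trans (cong (u k *_) (row-vanish k l)) (*-zeroʳ (u k)))))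
          where
          instance _ = ℕ.>-nonZero (ℕₚ.*-mono-≤ 1≤h 1≤D)
          big : ∀ k → N ℕ.≤ k → u k * row k ≡ 0ℚ
          big k N≤k = trans (cong (u k *_) (row-vanish k (ℕₚ.≤-trans (s≤s (Data.Nat.DivMod.m/n≤m X (h ℕ.* D))) (ℕₚ.≤-trans X<N N≤k)))) (*-zeroʳ (u k))
        term : ∀ k → k ℕ.< suc E → ∣ u k * row k ∣ ≤ 2ℚ * Q * (# h * # X) * # k
        term zero    _ = ≤-trans (≤-reflexive (cong ∣_∣ (trans (cong (_* row 0) u-0) (*-zeroˡ (row 0))))) (0≤* (0≤* (0≤* 0≤2 Q≥0) (0≤* (#≥0 h) (#≥0 X))) (#≥0 0))
        term k@(suc k′) _ = subst (∣ u k * row k ∣ ≤_) (trans (cong (λ z → 1ℚ * (Q * (2ℚ * z * # X))) (#-* h k)) (progression-ring-22 Q (# h) (# k) (# X))) (∣*∣≤ (∣u∣≤1 k) (row≤ k (s≤s z≤n)))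

    -- The sum over `d` is cut at `D = q n`. Below the cut, Euler-Maclaurin in `k` gives main terms
    -- proportional to 1/d, 1 and d: over full periods `f` annihilates the last two and leaves
    -- O(1/D²) of the first; the remainder costs h² D³. Above the cut `d` is summed first, using the
    -- convexity of the weight.
    A₂-bound : ∣ A₂ N X h ∣ ≤ (3ℚ * Q + 2ℚ * (# n * (# n * # n)) * B) * (pow3 (# X) * inv (# h) * (inv (# (q ℕ.* n)) * inv (# (q ℕ.* n))) + # h * # h * pow3 (# (q ℕ.* n)))
    A₂-bound = subst (λ z → ∣ z ∣ ≤ (3ℚ * Q + 2ℚ * ν³ * B) * (x³ * i * j² + # h * # h * pow3 δ)) (sym (trans A₂≡ (progression-ring-23 T₁ M₁ T₂)))
        (≤-trans (∣+∣≤ (∣+∣≤ M₁≤ T₁-M₁) T₂≤)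
          (≤-by (2ℚ * ν³ * B * (x³ * i * j²) + 3ℚ * Q * (# h * # h * pow3 δ))
            (0≤+ (0≤* (0≤* (0≤* 0≤2 ν³≥0) B≥0) (0≤* (0≤* x³≥0 i≥0) (0≤sq (inv δ)))) (0≤* (0≤* (nonNegative⁻¹ 3ℚ) Q≥0) (0≤* (0≤sq (# h)) (0≤* (#≥0 D) (0≤sq δ)))))
            (progression-ring-24 Q ν³ B (x³ * i) j² (# h) δ)))

-- The hyperbola method

private
  hyperbola-ring-1 : ∀ a c b → a * (c * b) ≡ c * (a * b)
  hyperbola-ring-1 = solve-∀ ℚ-ring
  hyperbola-ring-2 : ∀ a → - a ≡ - 1ℚ * a
  hyperbola-ring-2 = solve-∀ ℚ-ring
  hyperbola-ring-3 : ∀ a h → a * h * h ≡ a * (h * h)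
  hyperbola-ring-3 = solve-∀ ℚ-ring
  hyperbola-ring-4 : ∀ b k i h → b * (k * i * h) ≡ b * k * h * i
  hyperbola-ring-4 = solve-∀ ℚ-ring
  hyperbola-ring-5 : ∀ y c i j → y * (c * c) * (i * j * (i * j)) ≡ y * (j * j) * ((c * i) * (c * i))
  hyperbola-ring-5 = solve-∀ ℚ-ring
  hyperbola-ring-6 : ∀ y → y * (1ℚ * 1ℚ) ≡ y
  hyperbola-ring-6 = solve-∀ ℚ-ring
  hyperbola-ring-7 : ∀ a → a * (1ℚ * 1ℚ) ≡ a
  hyperbola-ring-7 = solve-∀ ℚ-ring
  hyperbola-ring-8 : ∀ c n → c * n * (c * n * (c * n)) ≡ n * (n * n) * (c * (c * c))
  hyperbola-ring-8 = solve-∀ ℚ-ring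
  hyperbola-ring-9 : ∀ g → g ≡ 1ℚ * g + 1ℚ * g - 1ℚ * 1ℚ * g
  hyperbola-ring-9 = solve-∀ ℚ-ring
  hyperbola-ring-10 : ∀ g → g ≡ 1ℚ * g + 0ℚ * g - 1ℚ * 0ℚ * g
  hyperbola-ring-10 = solve-∀ ℚ-ring
  hyperbola-ring-11 : ∀ g → g ≡ 0ℚ * g + 1ℚ * g - 0ℚ * 1ℚ * g
  hyperbola-ring-11 = solve-∀ ℚ-ring
  hyperbola-ring-12 : ∀ t i d → (t * t * (t * (t * t)) * (t * t * (t * (t * t)))) * ((t * t * (t * (t * t)) * (t * t * (t * (t * t)))) * (t * t * (t * (t * t)) * (t * t * (t * (t * t))))) * i * d
         ≡ (t * (t * t) * (t * (t * t) * (t * (t * t)))) * ((t * (t * t) * (t * (t * t) * (t * (t * t)))) * (t * (t * t) * (t * (t * t)))) * i * (t * (t * t) * (t * (t * t))) * d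
  hyperbola-ring-12 = solve-∀ ℚ-ring
  hyperbola-ring-13 : ∀ a i d → a * (a * a) * d * i ≡ a * a * d * (a * i)
  hyperbola-ring-13 = solve-∀ ℚ-ring
  hyperbola-ring-14 : ∀ t n i → t * t * (t * (t * t)) * (t * t * (t * (t * t)) * (t * t * (t * (t * t)))) * (n * (t * (t * t) * (t * (t * t) * (t * (t * t))))) * i
         ≡ n * ((t * (t * t) * (t * (t * t) * (t * (t * t)))) * ((t * (t * t) * (t * (t * t) * (t * (t * t)))) * (t * (t * t) * (t * (t * t))))) * i
  hyperbola-ring-14 = solve-∀ ℚ-ring
  hyperbola-ring-15 : ∀ n y i → (ι (ℤ.+ 8) + n) * y * i ≡ y * i + n * y * i + ι (ℤ.+ 7) * (y * i)
  hyperbola-ring-15 = solve-∀ ℚ-ring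
  hyperbola-ring-16 : ∀ s p q → (s * p + s * q - p * q) * (s * p + s * q - p * q) ≡ s * s * (p * p) * 1ℚ + (s * s * 1ℚ + p * p - 2ℚ * s * p) * (q * q) + (2ℚ * (s * s) * p - 2ℚ * s * (p * p)) * q
  hyperbola-ring-16 = solve-∀ ℚ-ring
  hyperbola-ring-17 : ∀ g → 1ℚ * 1ℚ * g ≡ g
  hyperbola-ring-17 = solve-∀ ℚ-ring
  hyperbola-ring-18 : ∀ s a b → s * s - a * b ≡ s * (s - a) + s * (s - b) - (s - a) * (s - b)
  hyperbola-ring-18 = solve-∀ ℚ-ring
  hyperbola-ring-19 : ∀ g → 1ℚ * 0ℚ * g ≡ 0ℚ
  hyperbola-ring-19 = solve-∀ ℚ-ring
  hyperbola-ring-20 : ∀ s w p → s * s * w * 0ℚ + (s * s * 1ℚ + w - 2ℚ * s * p) * 0ℚ + (2ℚ * (s * s) * p - 2ℚ * s * w) * 0ℚ ≡ 0ℚ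
  hyperbola-ring-20 = solve-∀ ℚ-ring
  hyperbola-ring-21 : ∀ c g → 0ℚ * c * g ≡ 0ℚ
  hyperbola-ring-21 = solve-∀ ℚ-ring
  hyperbola-ring-22 : ∀ s c w p → s * s * 0ℚ * c + (s * s * 0ℚ + 0ℚ - 2ℚ * s * 0ℚ) * w + (2ℚ * (s * s) * 0ℚ - 2ℚ * s * 0ℚ) * p ≡ 0ℚ
  hyperbola-ring-22 = solve-∀ ℚ-ring
  hyperbola-ring-23 : ∀ s² s a₀ a₁ a₂ → s² * a₂ * a₀ + (s² * a₀ + a₂ - 2ℚ * s * a₁) * a₂ + (2ℚ * s² * a₁ - 2ℚ * s * a₂) * a₁ ≡ 2ℚ * s² * (a₂ * a₀) + a₂ * a₂ + 2ℚ * s² * (a₁ * a₁) - 4ℚ * s * (a₂ * a₁)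
  hyperbola-ring-23 = solve-∀ ℚ-ring
  hyperbola-ring-24 : ∀ t d → ι (ℤ.+ 8) * (t * (t * t) * (t * (t * t) * (t * (t * t)))) * (t * (t * t) * (t * (t * t))) * d ≡ (2ℚ * (t * t * (t * (t * t)))) * ((2ℚ * (t * t * (t * (t * t)))) * (2ℚ * (t * t * (t * (t * t))))) * d
  hyperbola-ring-24 = solve-∀ ℚ-ring
  hyperbola-ring-25 : ∀ n y → ι (ℤ.+ 8) * y + n * y ≡ (ι (ℤ.+ 8) + n) * y
  hyperbola-ring-25 = solve-∀ ℚ-ring
  hyperbola-ring-26 : ∀ s → 2ℚ * s ≡ s + s
  hyperbola-ring-26 = solve-∀ ℚ-ring
  hyperbola-ring-27 : ∀ s t → 2ℚ * s ≡ s + t + (s - t)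
  hyperbola-ring-27 = solve-∀ ℚ-ring
  hyperbola-ring-28 : ∀ a e → (a + e) * (a + e) - a * a - 2ℚ * e * a ≡ e * e
  hyperbola-ring-28 = solve-∀ ℚ-ring
  hyperbola-ring-29 : ∀ a t → a - 0ℚ - 2ℚ * t * 0ℚ ≡ a
  hyperbola-ring-29 = solve-∀ ℚ-ring
  hyperbola-ring-30 : ∀ a b c → a - b - (a - b - c) ≡ c
  hyperbola-ring-30 = solve-∀ ℚ-ring
  hyperbola-ring-31 : ∀ t k b h → 2ℚ * (t * t) * ((2ℚ * k + 2ℚ * b) * (t * t * (t * t * (t * (t * t)))) * h) ≡
         k * (t * (t * t) * (t * (t * t) * (t * (t * t)))) + k * (t * (t * t) * (t * (t * t) * (t * (t * t)))) + b * (t * t * (t * t) * (2ℚ * (t * t * (t * (t * t))))) * h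
         + (2ℚ * k * (t * (t * t) * (t * (t * t) * (t * (t * t)))) * (h - 1ℚ) + (2ℚ * k + 2ℚ * b) * (t * (t * t) * (t * (t * t) * (t * (t * t)))) * h)
  hyperbola-ring-31 = solve-∀ ℚ-ring
  hyperbola-ring-32 : ∀ t k b c h →
    let t³ = t * (t * t) ; σ = t * t * t³ ; τ⁹ = t³ * (t³ * t³) ; τ²⁴ = τ⁹ * (τ⁹ * (t³ * t³)) ; τ⁷ = t * t * (t * t * t³) in
    (4ℚ * (b * k) + k * k + 2ℚ * (c * c) + 4ℚ * (k * c)) * (τ²⁴ * (h * h)) ≡
    b * (k * τ²⁴) * h + b * (k * τ²⁴) * h + (2ℚ * (σ * σ) * (k * τ⁹ * (b * σ * h)) + k * τ⁹ * (k * τ⁹) + 2ℚ * (σ * σ) * (c * τ⁷ * h * (c * τ⁷ * h)) + 4ℚ * σ * (k * τ⁹ * (c * τ⁷ * h)))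
    + (4ℚ * (b * k) * τ²⁴ * (h * (h - 1ℚ)) + k * k * (τ⁹ * τ⁹ * (t³ * t³ * (h * h - 1ℚ) + (t³ * t³ - 1ℚ))) + 4ℚ * (k * c) * (τ⁹ * τ⁹ * t³ * h * (t³ * (h - 1ℚ) + (t³ - 1ℚ))))
  hyperbola-ring-32 = solve-∀ ℚ-ring

harmonic : ℕ → ℚ
harmonic N = ∑ N (λ i → inv (# i))

-- The smoothed fourfold sum, bounded with the hyperbola method
module QuadrupleSum (n : ℕ) {{_ : NonZero n}} (f : ℕ → ℚ) (f-per : Per n f) (f-sum : ∑ n f ≡ 0ℚ) (f-moment : ∑ n (λ i → # i * f i) ≡ 0ℚ)
    {B} (B≥0 : 0ℚ ≤ B) (∣f∣≤B : ∀ i → ∣ f i ∣ ≤ B) (f-0 : f 0 ≡ 0ℚ)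
    (u : ℕ → ℚ) (u-per : Per n u) (∣u∣≤1 : ∀ k → ∣ u k ∣ ≤ 1ℚ) (u-0 : u 0 ≡ 0ℚ)
    (reciprocal : ∀ q → 1 ℕ.≤ q → ∣ ∑ (q ℕ.* n) (λ m → f m * inv (# m)) ∣ ≤ (# n * (# n * B)) * (inv (# (q ℕ.* n)) * inv (# (q ℕ.* n))))
    (N : ℕ) where

  private
    A₂ : ℕ → ℕ → ℕ → ℚ
    A₂ = SmoothBound.A₂ n f f-per f-sum f-moment B≥0 ∣f∣≤B f-0 u u-per ∣u∣≤1 u-0

  -- The summation functional of the Dirichlet convolution of `f` and `u`, truncated at `N` in each
  -- factor. Being linear it can be applied in two variables, which produces the fourfold sum.
  E : (ℕ → ℚ) → ℚ
  E g = ∑ N (λ d → f d * ∑ N (λ k → u k * g (d ℕ.* k)))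

  private
    0≤2 : 0ℚ ≤ 2ℚ
    0≤2 = nonNegative⁻¹ 2ℚ
    H = harmonic N
    H≥0 : 0ℚ ≤ H
    H≥0 = ∑-nonneg N (λ i _ → inv-nonneg (#≥0 i))

  E-cong : ∀ {g g′} → (∀ m → g m ≡ g′ m) → E g ≡ E g′
  E-cong e = ∑-cong′ N (λ d → cong (f d *_) (∑-cong′ N (λ k → cong (u k *_) (e (d ℕ.* k)))))

  E-+ : ∀ g g′ → E (λ m → g m + g′ m) ≡ E g + E g′
  E-+ g g′ = trans (∑-cong′ N (λ d → trans (cong (f d *_) (trans (∑-cong′ N (λ k → *-distribˡ-+ (u k) (g (d ℕ.* k)) (g′ (d ℕ.* k)))) (∑-+ N (λ k → u k * g (d ℕ.* k)) (λ k → u k * g′ (d ℕ.* k)))))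
       (*-distribˡ-+ (f d) (∑ N (λ k → u k * g (d ℕ.* k))) (∑ N (λ k → u k * g′ (d ℕ.* k))))))
    (∑-+ N (λ d → f d * ∑ N (λ k → u k * g (d ℕ.* k))) (λ d → f d * ∑ N (λ k → u k * g′ (d ℕ.* k))))

  E-*ˡ : ∀ c g → E (λ m → c * g m) ≡ c * E g
  E-*ˡ c g = trans (∑-cong′ N (λ d → trans (cong (f d *_) (trans (∑-cong′ N (λ k → hyperbola-ring-1 (u k) c (g (d ℕ.* k)))) (∑-*ˡ N c (λ k → u k * g (d ℕ.* k))))) (hyperbola-ring-1 (f d) c (∑ N (λ k → u k * g (d ℕ.* k))))))
    (∑-*ˡ N c (λ d → f d * ∑ N (λ k → u k * g (d ℕ.* k))))

  E-*ʳ : ∀ c g → E (λ m → g m * c) ≡ E g * c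
  E-*ʳ c g = trans (E-cong (λ m → *-comm (g m) c)) (trans (E-*ˡ c g) (*-comm c (E g)))

  E-neg : ∀ g → E (λ m → - g m) ≡ - E g
  E-neg g = trans (E-cong (λ m → hyperbola-ring-2 (g m))) (trans (E-*ˡ (- 1ℚ) g) (sym (hyperbola-ring-2 (E g))))

  E-- : ∀ g g′ → E (λ m → g m - g′ m) ≡ E g - E g′
  E-- g g′ = trans (E-+ g (λ m → - g′ m)) (cong (E g +_) (E-neg g′))

  E-∑ : ∀ L (G : ℕ → ℕ → ℚ) → E (λ m → ∑ L (λ j → G j m)) ≡ ∑ L (λ j → E (G j))
  E-∑ zero    G = trans (E-cong {λ _ → 0ℚ} {λ _ → 0ℚ * 0ℚ} (λ _ → refl)) (trans (E-*ˡ 0ℚ (λ _ → 0ℚ)) (*-zeroˡ (E (λ _ → 0ℚ))))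
  E-∑ (suc L) G = trans (E-+ (λ m → ∑ L (λ j → G j m)) (G L)) (cong (_+ E (G L)) (E-∑ L G))

  E-swap : ∀ (g : ℕ → ℕ → ℚ) → E (λ a → E (λ b → g a b)) ≡ E (λ b → E (λ a → g a b))
  E-swap g = trans (E-∑ N (λ d a → f d * ∑ N (λ k → u k * g a (d ℕ.* k))))
    (∑-cong′ N (λ d → trans (E-*ˡ (f d) (λ a → ∑ N (λ k → u k * g a (d ℕ.* k)))) (cong (f d *_) (trans (E-∑ N (λ k a → u k * g a (d ℕ.* k))) (∑-cong′ N (λ k → E-*ˡ (u k) (λ a → g a (d ℕ.* k))))))))

  E-bound : ∀ g K → 0ℚ ≤ K → (∀ m → 1 ℕ.≤ m → ∣ g m ∣ ≤ K * inv (# m)) → ∣ E g ∣ ≤ B * K * (H * H)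
  E-bound g K K≥0 h = ≤-trans (∑-abs N row) (≤-reflexive (trans (∑-*ˡ N (B * K * H) (λ d → inv (# d))) (hyperbola-ring-3 (B * K) H)))
    where
    i≥0 : ∀ m → 0ℚ ≤ inv (# m)
    i≥0 m = inv-nonneg (#≥0 m)
    row : ∀ d → d ℕ.< N → ∣ f d * ∑ N (λ k → u k * g (d ℕ.* k)) ∣ ≤ B * K * H * inv (# d)
    row zero    _ = ≤-trans (≤-reflexive (cong ∣_∣ (trans (cong (_* ∑ N (λ k → u k * g 0)) f-0) (*-zeroˡ (∑ N (λ k → u k * g 0)))))) (0≤* (0≤* (0≤* B≥0 K≥0) H≥0) (i≥0 0))
    row d@(suc d′) _ = subst (∣ f d * ∑ N (λ k → u k * g (d ℕ.* k)) ∣ ≤_) (hyperbola-ring-4 B K (inv (# d)) H) (∣*∣≤ (∣f∣≤B d) (≤-trans (∑-abs N term) (≤-reflexive (∑-*ˡ N (K * inv (# d)) (λ k → inv (# k))))))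
      where
      term : ∀ k → k ℕ.< N → ∣ u k * g (d ℕ.* k) ∣ ≤ K * inv (# d) * inv (# k)
      term zero    _ = ≤-trans (≤-reflexive (cong ∣_∣ (trans (cong (_* g (d ℕ.* 0)) u-0) (*-zeroˡ (g (d ℕ.* 0)))))) (0≤* (0≤* K≥0 (i≥0 d)) (i≥0 0))
      term k@(suc k′) _ = subst (∣ u k * g (d ℕ.* k) ∣ ≤_) (trans (*-identityˡ (K * inv (# (d ℕ.* k)))) (trans (cong (K *_) (trans (cong inv (#-* d k)) (inv-* (# d) (# k)))) (sym (*-assoc K (inv (# d)) (inv (# k))))))
        (∣*∣≤ (∣u∣≤1 k) (h (d ℕ.* k) (s≤s z≤n)))

  E-A₂ : ∀ X h → E (λ m → w X (h ℕ.* m)) ≡ A₂ N X h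
  E-A₂ X h = ∑-cong′ N (λ d → cong (f d *_) (∑-cong′ N (λ k → cong (λ z → u k * w X z) (sym (ℕₚ.*-assoc h d k)))))

  private
    K₀ = 3ℚ * (# n * (# n * B)) + 2ℚ * (# n * (# n * # n)) * B
    K₀≥0 : 0ℚ ≤ K₀
    K₀≥0 = 0≤+ (0≤* (nonNegative⁻¹ 3ℚ) (0≤* (#≥0 n) (0≤* (#≥0 n) B≥0))) (0≤* (0≤* 0≤2 (0≤* (#≥0 n) (0≤sq (# n)))) B≥0)
    Kₙ = K₀ * (ι (ℤ.+ 8) + # n * (# n * # n))
    n³≥0 : 0ℚ ≤ # n * (# n * # n)
    n³≥0 = 0≤* (#≥0 n) (0≤sq (# n))
    Kₙ≥0 : 0ℚ ≤ Kₙ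
    Kₙ≥0 = 0≤* K₀≥0 (0≤+ (nonNegative⁻¹ (ι (ℤ.+ 8))) n³≥0)
    C₁ = 2ℚ * Kₙ + 2ℚ * B

  constant : ℚ
  constant = 4ℚ * (B * Kₙ) + Kₙ * Kₙ + 2ℚ * (C₁ * C₁) + 4ℚ * (Kₙ * C₁)

  module _ (τ : ℕ) (1≤τ : 1 ℕ.≤ τ) (X<N : (τ ℕ.* τ) ℕ.* (τ ℕ.* (τ ℕ.* τ)) ℕ.* ((τ ℕ.* τ) ℕ.* (τ ℕ.* (τ ℕ.* τ))) ℕ.< N) (1≤H : 1ℚ ≤ H) where
    private
      p₂ = τ ℕ.* τ
      p₃ = τ ℕ.* p₂
      s = p₂ ℕ.* p₃
      X = s ℕ.* s
      1≤p₂ : 1 ℕ.≤ p₂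
      1≤p₂ = ℕₚ.*-mono-≤ 1≤τ 1≤τ
      1≤p₃ : 1 ℕ.≤ p₃
      1≤p₃ = ℕₚ.*-mono-≤ 1≤τ 1≤p₂
      1≤s : 1 ℕ.≤ s
      1≤s = ℕₚ.*-mono-≤ 1≤p₂ 1≤p₃
      t = # τ
      t≥0 : 0ℚ ≤ t
      t≥0 = #≥0 τ
      t² = t * t
      t³ = t * t²
      σ = t² * t³
      #p₂ : # p₂ ≡ t²
      #p₂ = #-* τ τ
      #p₃ : # p₃ ≡ t³
      #p₃ = trans (#-* τ p₂) (cong (t *_) #p₂)
      #s : # s ≡ σ
      #s = trans (#-* p₂ p₃) (cong₂ _*_ #p₂ #p₃)
      #X : # X ≡ σ * σ
      #X = trans (#-* s s) (cong₂ _*_ #s #s)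
      t²≥0 = 0≤sq t
      t³≥0 : 0ℚ ≤ t³
      t³≥0 = 0≤* t≥0 t²≥0
      σ≥0 : 0ℚ ≤ σ
      σ≥0 = 0≤* t²≥0 t³≥0
      -- With this cut, `X = τ¹⁰` and `h ≤ τ⁵`, both terms of `A₂-bound` are at most a constant
      -- times τ²⁴/h.
      D = p₃ ℕ.* n
      #D : # D ≡ t³ * # n
      #D = trans (#-* p₃ n) (cong (_* # n) #p₃)
      iD² = inv (# D) * inv (# D)
      H² = H * H
      H²≥1 : 1ℚ ≤ H²
      H²≥1 = ≤-trans 1≤H (subst (_≤ H²) (*-identityʳ H) (*-monoˡ H H≥0 1≤H))
      H²≥0 = 0≤sq H
      τ⁹ = t³ * (t³ * t³)
      τ⁹≥0 : 0ℚ ≤ τ⁹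
      τ⁹≥0 = 0≤* t³≥0 (0≤sq t³)
      τ²⁴ = τ⁹ * (τ⁹ * (t³ * t³))
      τ²⁴≥0 : 0ℚ ≤ τ²⁴
      τ²⁴≥0 = 0≤* τ⁹≥0 (0≤* τ⁹≥0 (0≤sq t³))
      t³>0 : 0ℚ < t³
      t³>0 = subst (0ℚ <_) #p₃ (#>0 1≤p₃)
      n³ = # n * (# n * # n)

      cancel : ∀ y → 0ℚ ≤ y → y * (t³ * t³) * iD² ≤ y
      cancel y y≥0 = subst (_≤ y) (sym eq) (≤-trans (*-monoˡ y y≥0 (*-mono j≥0 j≥0 j≤1 j≤1)) (≤-reflexive (hyperbola-ring-6 y)))
        where
        j = inv (# n)
        j≥0 = inv-nonneg (#≥0 n)
        j≤1 : j ≤ 1ℚ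
        j≤1 = subst (_≤ 1ℚ) (*-identityˡ j) (inv-≤ {1ℚ} {1ℚ} (#>0 (ℕ.>-nonZero⁻¹ n)) (subst (1ℚ ≤_) (sym (*-identityˡ (# n))) (#≥1 (ℕ.>-nonZero⁻¹ n))))
        iD≡ : inv (# D) ≡ inv t³ * j
        iD≡ = trans (cong inv #D) (inv-* t³ (# n))
        eq : y * (t³ * t³) * iD² ≡ y * (j * j)
        eq = trans (cong (λ z → y * (t³ * t³) * (z * z)) iD≡) (trans (hyperbola-ring-5 y t³ (inv t³) j) (trans (cong (λ z → y * (j * j) * (z * z)) (inv-r> t³>0)) (hyperbola-ring-7 (y * (j * j)))))

      lin : ∀ Y h → Y ℕ.< N → 1 ℕ.≤ h → ∣ A₂ N Y h ∣ ≤ K₀ * (pow3 (# Y) * inv (# h) * iD² + # h * # h * pow3 (# D))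
      lin Y h l l′ = SmoothBound.A₂-bound n f f-per f-sum f-moment B≥0 ∣f∣≤B f-0 u u-per ∣u∣≤1 u-0 reciprocal N Y h p₃ l l′ 1≤p₃

      pow3D : pow3 (# D) ≡ n³ * τ⁹
      pow3D = trans (cong pow3 #D) (hyperbola-ring-8 t³ (# n))

      G : ℕ → ℕ → ℚ
      G a b = w X (a ℕ.* b)

      c : ℕ → ℚ
      c a = χ (a ℕ.≤? s)

      S₁ S₃ : ℚ
      S₁ = E (λ a → c a * A₂ N X a)
      S₃ = E (λ a → E (λ b → c a * c b * G a b))

      -- Inclusion and exclusion on the conditions `a ≤ s` and `b ≤ s`. If both fail, then `a b` is
      -- at least `s² = X` and the weight is 0.
      hyperbola : ∀ a b → G a b ≡ c a * G a b + c b * G a b - c a * c b * G a b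
      hyperbola a b with a ℕ.≤? s | b ℕ.≤? s
      ... | yes _ | yes _ = hyperbola-ring-9 (G a b)
      ... | yes _ | no _ = hyperbola-ring-10 (G a b)
      ... | no _ | yes _ = hyperbola-ring-11 (G a b)
      ... | no p | no q = trans z (sym (trans (cong (λ g → 0ℚ * g + 0ℚ * g - 0ℚ * 0ℚ * g) z) refl))
        where
        z : G a b ≡ 0ℚ
        z = w-vanish {X} {a ℕ.* b} (ℕₚ.*-mono-≤ (ℕₚ.<⇒≤ (ℕₚ.≰⇒> p)) (ℕₚ.<⇒≤ (ℕₚ.≰⇒> q)))

      split : E (λ a → E (λ b → G a b)) ≡ S₁ + S₁ - S₃
      split = trans (E-cong (λ a → trans (E-cong (λ b → hyperbola a b)) (trans (E-- (λ b → c a * G a b + c b * G a b) (λ b → c a * c b * G a b)) (cong (_- E (λ b → c a * c b * G a b)) (E-+ (λ b → c a * G a b) (λ b → c b * G a b))))))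
        (trans (E-- (λ a → E (λ b → c a * G a b) + E (λ b → c b * G a b)) (λ a → E (λ b → c a * c b * G a b)))
          (cong (_- S₃) (trans (E-+ (λ a → E (λ b → c a * G a b)) (λ a → E (λ b → c b * G a b))) (cong₂ _+_ first second))))
        where
        first : E (λ a → E (λ b → c a * G a b)) ≡ S₁
        first = E-cong (λ a → trans (E-*ˡ (c a) (G a)) (cong (c a *_) (E-A₂ X a)))
        second : E (λ a → E (λ b → c b * G a b)) ≡ S₁
        second = trans (E-swap (λ a b → c b * G a b)) (E-cong (λ b → trans (E-*ˡ (c b) (λ a → G a b)) (cong (c b *_) (trans (E-cong (λ a → cong (w X) (ℕₚ.*-comm a b))) (E-A₂ X b)))))

      S₁≤ : ∣ S₁ ∣ ≤ B * (Kₙ * τ²⁴) * H²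
      S₁≤ = E-bound (λ a → c a * A₂ N X a) (Kₙ * τ²⁴) (0≤* Kₙ≥0 τ²⁴≥0) bound
        where
        bound : ∀ a → 1 ℕ.≤ a → ∣ c a * A₂ N X a ∣ ≤ Kₙ * τ²⁴ * inv (# a)
        bound a 1≤a with a ℕ.≤? s
        ... | no _  = ≤-trans (≤-reflexive (cong ∣_∣ (*-zeroˡ (A₂ N X a)))) (0≤* (0≤* Kₙ≥0 τ²⁴≥0) (inv-nonneg (#≥0 a)))
        ... | yes a≤s = subst (λ z → ∣ z ∣ ≤ Kₙ * τ²⁴ * i) (sym (*-identityˡ (A₂ N X a))) (≤-trans (lin X a X<N 1≤a)
             (subst (K₀ * (pow3 (# X) * i * iD² + α * α * pow3 (# D)) ≤_) (sym (trans (cong (_* i) (*-assoc K₀ (ι (ℤ.+ 8) + n³) τ²⁴)) (*-assoc K₀ ((ι (ℤ.+ 8) + n³) * τ²⁴) i))) (*-monoˡ K₀ K₀≥0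
               (≤-trans (+-mono-≤ e₁ e₂) (≤-by (ι (ℤ.+ 7) * (τ²⁴ * i)) (0≤* (nonNegative⁻¹ (ι (ℤ.+ 7))) (0≤* τ²⁴≥0 i≥0)) (hyperbola-ring-15 n³ τ²⁴ i))))))
          where
          α = # a
          i = inv α
          i≥0 = inv-nonneg (#≥0 a)
          e₁ : pow3 (# X) * i * iD² ≤ τ²⁴ * i
          e₁ = subst (_≤ τ²⁴ * i) (sym (trans (cong (λ z → pow3 z * i * iD²) #X) (hyperbola-ring-12 t i iD²))) (cancel (τ²⁴ * i) (0≤* τ²⁴≥0 i≥0))
          α≤σ : α ≤ σ
          α≤σ = subst (α ≤_) #s (#-mono a≤s)
          αi : α * i ≡ 1ℚ
          αi = inv-r> (#>0 1≤a)
          -- One more factor `α ≤ τ⁵` is spent to gain `1 / α`, so that the sum over `a` is only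
          -- logarithmic.
          e₂ : α * α * pow3 (# D) ≤ n³ * τ²⁴ * i
          e₂ = subst₂ _≤_ (trans (hyperbola-ring-13 α i (pow3 (# D))) (trans (cong (α * α * pow3 (# D) *_) αi) (*-identityʳ (α * α * pow3 (# D))))) (trans (cong (λ z → σ * (σ * σ) * z * i) pow3D) (hyperbola-ring-14 t n³ i))
            (*-monoʳ i i≥0 (*-monoʳ (pow3 (# D)) (0≤* (#≥0 D) (0≤sq (# D))) (*-mono (#≥0 a) (0≤sq α) α≤σ (*-mono (#≥0 a) (#≥0 a) α≤σ α≤σ))))

      a₀ a₁ a₂ : ℚ
      a₀ = E c
      a₁ = E (λ m → # (s ℕ.∸ m))
      a₂ = E (w s)

      -- For `a, b ≤ s` nothing is truncated, and `s² - a b = s (s - a) + s (s - b) - (s - a)(s -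
      -- b)`. Its square is a sum of products of one-variable functions, on which the two
      -- functionals `E` act separately.
      S₃≡ : S₃ ≡ 2ℚ * (σ * σ) * (a₂ * a₀) + a₂ * a₂ + 2ℚ * (σ * σ) * (a₁ * a₁) - 4ℚ * σ * (a₂ * a₁)
      S₃≡ = trans (E-cong (λ a → trans (E-cong (λ b → corner a b)) (row a)))
        (trans (E-+ (λ a → z₁ a + z₂ a) z₃) (trans (cong₂ _+_ (E-+ z₁ z₂) refl)
          (trans (cong₂ _+_ (cong₂ _+_ ez₁ ez₂) ez₃) (hyperbola-ring-23 (σ * σ) σ a₀ a₁ a₂))))
        where
        p = λ m → # (s ℕ.∸ m)
        corner : ∀ a b → c a * c b * G a b ≡ σ * σ * w s a * c b + (σ * σ * c a + w s a - 2ℚ * σ * p a) * w s b + (2ℚ * (σ * σ) * p a - 2ℚ * σ * w s a) * p b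
        corner a b with a ℕ.≤? s | b ℕ.≤? s
        ... | yes l | yes l′ = trans (hyperbola-ring-17 (G a b)) (trans (cong (λ z → z * z) eq) (hyperbola-ring-16 σ (p a) (p b)))
          where
          eq : # (X ℕ.∸ a ℕ.* b) ≡ σ * p a + σ * p b - p a * p b
          eq = trans (#-∸ (ℕₚ.*-mono-≤ l l′)) (trans (cong₂ _-_ #X (#-* a b)) (trans (hyperbola-ring-18 σ (# a) (# b))
                 (cong₂ (λ u v → σ * u + σ * v - u * v) (sym (trans (#-∸ l) (cong (_- # a) #s))) (sym (trans (#-∸ l′) (cong (_- # b) #s))))))
        ... | yes l | no l′ = trans (hyperbola-ring-19 (G a b)) (sym (trans (cong₂ (λ u v → σ * σ * w s a * 0ℚ + (σ * σ * 1ℚ + w s a - 2ℚ * σ * p a) * u + (2ℚ * (σ * σ) * p a - 2ℚ * σ * w s a) * v) wb pb) (hyperbola-ring-20 σ (w s a) (p a))))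
          where
          b>s = ℕₚ.<⇒≤ (ℕₚ.≰⇒> l′)
          wb : w s b ≡ 0ℚ
          wb = w-vanish {s} {b} b>s
          pb : p b ≡ 0ℚ
          pb = trans (cong #_ (ℕₚ.m≤n⇒m∸n≡0 b>s)) #0≡0
        ... | no l | d = trans (hyperbola-ring-21 (χ d) (G a b)) (sym (trans (cong₂ (λ u v → σ * σ * u * χ d + (σ * σ * 0ℚ + u - 2ℚ * σ * v) * w s b + (2ℚ * (σ * σ) * v - 2ℚ * σ * u) * p b) wa pa) (hyperbola-ring-22 σ (χ d) (w s b) (p b))))
          where
          a>s = ℕₚ.<⇒≤ (ℕₚ.≰⇒> l)
          wa : w s a ≡ 0ℚ
          wa = w-vanish {s} {a} a>s
          pa : p a ≡ 0ℚ
          pa = trans (cong #_ (ℕₚ.m≤n⇒m∸n≡0 a>s)) #0≡0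
        z₁ z₂ z₃ : ℕ → ℚ
        z₁ a = σ * σ * w s a * a₀
        z₂ a = (σ * σ * c a + w s a - 2ℚ * σ * p a) * a₂
        z₃ a = (2ℚ * (σ * σ) * p a - 2ℚ * σ * w s a) * a₁
        row : ∀ a → E (λ b → σ * σ * w s a * c b + (σ * σ * c a + w s a - 2ℚ * σ * p a) * w s b + (2ℚ * (σ * σ) * p a - 2ℚ * σ * w s a) * p b) ≡ z₁ a + z₂ a + z₃ a
        row a = trans (E-+ (λ b → y₁ * c b + y₂ * w s b) (λ b → y₃ * p b)) (cong₂ _+_ (trans (E-+ (λ b → y₁ * c b) (λ b → y₂ * w s b)) (cong₂ _+_ (E-*ˡ y₁ c) (E-*ˡ y₂ (w s)))) (E-*ˡ y₃ p))
          where
          y₁ = σ * σ * w s a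
          y₂ = σ * σ * c a + w s a - 2ℚ * σ * p a
          y₃ = 2ℚ * (σ * σ) * p a - 2ℚ * σ * w s a
        ez₁ : E z₁ ≡ σ * σ * a₂ * a₀
        ez₁ = trans (E-*ʳ a₀ (λ a → σ * σ * w s a)) (cong (_* a₀) (E-*ˡ (σ * σ) (w s)))
        ez₂ : E z₂ ≡ (σ * σ * a₀ + a₂ - 2ℚ * σ * a₁) * a₂
        ez₂ = trans (E-*ʳ a₂ (λ a → σ * σ * c a + w s a - 2ℚ * σ * p a)) (cong (_* a₂) (trans (E-- (λ a → σ * σ * c a + w s a) (λ a → 2ℚ * σ * p a))
                (cong₂ _-_ (trans (E-+ (λ a → σ * σ * c a) (w s)) (cong (_+ a₂) (E-*ˡ (σ * σ) c))) (E-*ˡ (2ℚ * σ) p))))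
        ez₃ : E z₃ ≡ (2ℚ * (σ * σ) * a₁ - 2ℚ * σ * a₂) * a₁
        ez₃ = trans (E-*ʳ a₁ (λ a → 2ℚ * (σ * σ) * p a - 2ℚ * σ * w s a)) (cong (_* a₁) (trans (E-- (λ a → 2ℚ * (σ * σ) * p a) (λ a → 2ℚ * σ * w s a)) (cong₂ _-_ (E-*ˡ (2ℚ * (σ * σ)) p) (E-*ˡ (2ℚ * σ) (w s)))))

      s<N : s ℕ.< N
      s<N = ℕₚ.≤-<-trans (ℕₚ.m≤m*n s s {{ℕ.>-nonZero 1≤s}}) X<N

      a₀≤ : ∣ a₀ ∣ ≤ B * σ * H²
      a₀≤ = E-bound c σ σ≥0 bound
        where
        bound : ∀ a → 1 ℕ.≤ a → ∣ c a ∣ ≤ σ * inv (# a)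
        bound a 1≤a with a ℕ.≤? s
        ... | no _  = 0≤* σ≥0 (inv-nonneg (#≥0 a))
        ... | yes l = ≤-inv {1ℚ} (#>0 1≤a) (subst₂ _≤_ (sym (*-identityˡ (# a))) #s (#-mono l))

      A₂-near : ∀ Y → Y ℕ.< N → # Y ≤ 2ℚ * σ → ∣ A₂ N Y 1 ∣ ≤ Kₙ * τ⁹
      A₂-near Y Y<N Y≤ = ≤-trans (lin Y 1 Y<N ℕₚ.≤-refl) (subst (K₀ * (pow3 (# Y) * inv (# 1) * iD² + # 1 * # 1 * pow3 (# D)) ≤_) (sym (*-assoc K₀ (ι (ℤ.+ 8) + n³) τ⁹)) (*-monoˡ K₀ K₀≥0
          (subst₂ _≤_ (cong₂ _+_ (trans (sym (cong (_* iD²) (trans (cong (pow3 (# Y) *_) inv1) (*-identityʳ (pow3 (# Y)))))) refl) (trans (sym (*-identityˡ (pow3 (# D)))) (cong (λ z → z * z * pow3 (# D)) (sym #1≡1)))) (hyperbola-ring-25 n³ τ⁹)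
            (+-mono-≤ (≤-trans (*-monoʳ iD² (0≤sq (inv (# D))) (*-mono (#≥0 Y) (0≤sq (# Y)) Y≤ (*-mono (#≥0 Y) (#≥0 Y) Y≤ Y≤))) (subst (_≤ ι (ℤ.+ 8) * τ⁹) (hyperbola-ring-24 t iD²) (cancel (ι (ℤ.+ 8) * τ⁹) (0≤* (nonNegative⁻¹ (ι (ℤ.+ 8))) τ⁹≥0)))) (≤-reflexive pow3D)))))
        where
        inv1 : inv (# 1) ≡ 1ℚ
        inv1 = inv-unique (trans (*-identityʳ (# 1)) #1≡1)

      E-w : ∀ Y → E (w Y) ≡ A₂ N Y 1
      E-w Y = trans (E-cong (λ m → cong (w Y) (sym (ℕₚ.*-identityˡ m)))) (E-A₂ Y 1)

      a₂≤ : ∣ a₂ ∣ ≤ Kₙ * τ⁹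
      a₂≤ = subst (λ z → ∣ z ∣ ≤ Kₙ * τ⁹) (sym (E-w s)) (A₂-near s s<N (≤-by σ σ≥0 (trans (hyperbola-ring-26 σ) (cong (_+ σ) (sym #s)))))

      -- a₁ by interpolation between the smoothed sums at s and s + t²
      s₂ = s ℕ.+ p₂
      #s₂ : # s₂ ≡ σ + t²
      #s₂ = trans (#-+ s p₂) (cong₂ _+_ #s #p₂)
      t³≥1 : 1ℚ ≤ t³
      t³≥1 = subst (1ℚ ≤_) #p₃ (#≥1 1≤p₃)
      t²≤σ : t² ≤ σ
      t²≤σ = subst (_≤ σ) (*-identityʳ t²) (*-monoˡ t² t²≥0 t³≥1)
      s₂≤2σ : # s₂ ≤ 2ℚ * σ
      s₂≤2σ = subst (_≤ 2ℚ * σ) (sym #s₂) (≤-by (σ - t²) (0≤-sub t²≤σ) (hyperbola-ring-27 σ t²))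

      -- The step τ² is a compromise: division by `2 t²` leaves τ⁹/τ² from the smoothed sums and τ⁴
      -- τ⁵/τ² from `rem`, both of order τ⁷ up to logarithms.
      rem : ℕ → ℚ
      rem m = w s₂ m - w s m - 2ℚ * t² * # (s ℕ.∸ m)

      rem≤ : ∀ m → 1 ℕ.≤ m → ∣ rem m ∣ ≤ t² * t² * (2ℚ * σ) * inv (# m)
      rem≤ m 1≤m with m ℕ.≤? s
      ... | yes l = subst (λ z → ∣ z ∣ ≤ t² * t² * (2ℚ * σ) * i) (sym eq) (0≤⇒∣∣≤ (0≤sq t²) (≤-trans (≤-reflexive (trans (sym (*-identityʳ (t² * t²))) (trans (cong (t² * t² *_) (sym mi)) (sym (*-assoc (t² * t²) (# m) i))))) (*-monoʳ i i≥0 (*-monoˡ (t² * t²) (0≤sq t²) (≤-trans (#-mono (ℕₚ.≤-trans l (ℕₚ.m≤m+n s p₂))) s₂≤2σ)))))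
        where
        i = inv (# m)
        i≥0 = inv-nonneg (#≥0 m)
        mi = inv-r> (#>0 1≤m)
        eq : rem m ≡ t² * t²
        eq = trans (cong (λ z → z * z - w s m - 2ℚ * t² * # (s ℕ.∸ m)) (trans (cong #_ (trans (cong (ℕ._∸ m) (ℕₚ.+-comm s p₂)) (trans (ℕₚ.+-∸-assoc p₂ l) (ℕₚ.+-comm p₂ (s ℕ.∸ m))))) (trans (#-+ (s ℕ.∸ m) p₂) (cong (# (s ℕ.∸ m) +_) #p₂)))) (hyperbola-ring-28 (# (s ℕ.∸ m)) t²)
      ... | no ¬l = subst (λ z → ∣ z ∣ ≤ t² * t² * (2ℚ * σ) * i) (sym eq) (0≤⇒∣∣≤ (w-≥0 s₂ m) bound)
        where
        i = inv (# m)
        i≥0 = inv-nonneg (#≥0 m)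
        mi = inv-r> (#>0 1≤m)
        s<m = ℕₚ.≰⇒> ¬l
        s≤m = ℕₚ.<⇒≤ s<m
        eq : rem m ≡ w s₂ m
        eq = trans (cong₂ (λ y z → w s₂ m - y - 2ℚ * t² * z) (w-vanish {s} {m} s≤m) (trans (cong #_ (ℕₚ.m≤n⇒m∸n≡0 s≤m)) #0≡0)) (hyperbola-ring-29 (w s₂ m) t²)
        bound : w s₂ m ≤ t² * t² * (2ℚ * σ) * i
        bound with m ℕ.≤? s₂
        ... | yes l₂ = ≤-trans (subst (w s₂ m ≤_) (cong₂ _*_ #p₂ #p₂) (*-mono (#≥0 (s₂ ℕ.∸ m)) (#≥0 (s₂ ℕ.∸ m)) le le)) (≤-trans (≤-reflexive (trans (sym (*-identityʳ (t² * t²))) (trans (cong (t² * t² *_) (sym mi)) (sym (*-assoc (t² * t²) (# m) i))))) (*-monoʳ i i≥0 (*-monoˡ (t² * t²) (0≤sq t²) (≤-trans (#-mono l₂) s₂≤2σ))))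
          where
          le : # (s₂ ℕ.∸ m) ≤ # p₂
          le = #-mono (subst (s₂ ℕ.∸ m ℕ.≤_) (ℕₚ.m+n∸m≡n s p₂) (ℕₚ.∸-monoʳ-≤ s₂ s≤m))
        ... | no ¬l₂ = ≤-trans (≤-reflexive (w-vanish {s₂} {m} (ℕₚ.<⇒≤ (ℕₚ.≰⇒> ¬l₂)))) (0≤* (0≤* (0≤sq t²) (0≤* 0≤2 σ≥0)) i≥0)

      τ⁷ = t² * (t² * t³)
      2t²>0 : 0ℚ < 2ℚ * t²
      2t²>0 = 0<* (positive⁻¹ 2ℚ) (subst (0ℚ <_) #p₂ (#>0 1≤p₂))
      C₁≥0 : 0ℚ ≤ C₁
      C₁≥0 = 0≤+ (0≤* 0≤2 Kₙ≥0) (0≤* 0≤2 B≥0)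

      a₁≤ : s₂ ℕ.< N → ∣ a₁ ∣ ≤ C₁ * τ⁷ * H²
      a₁≤ s₂<N = *-cancelˡ (2ℚ * t²) 2t²>0 (subst₂ _≤_ (trans (cong ∣_∣ (sym eq)) (trans (∣p*q∣≡∣p∣*∣q∣ (2ℚ * t²) a₁) (cong (_* ∣ a₁ ∣) (0≤p⇒∣p∣≡p (<⇒≤ 2t²>0))))) refl
          (≤-trans (∣-∣≤ (∣-∣≤ (A₂-near s₂ s₂<N s₂≤2σ) a₂≤) (E-bound rem (t² * t² * (2ℚ * σ)) (0≤* (0≤sq t²) (0≤* 0≤2 σ≥0)) rem≤))
            (≤-by (2ℚ * Kₙ * τ⁹ * (H² - 1ℚ) + C₁ * τ⁹ * H²) (0≤+ (0≤* (0≤* (0≤* 0≤2 Kₙ≥0) τ⁹≥0) (0≤-sub H²≥1)) (0≤* (0≤* C₁≥0 τ⁹≥0) H²≥0)) (hyperbola-ring-31 t Kₙ B H²))))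
        where
        eq : 2ℚ * t² * a₁ ≡ A₂ N s₂ 1 - a₂ - E rem
        eq = sym (trans (cong₂ _-_ (cong (_- a₂) (sym (E-w s₂))) (trans (E-- (λ m → w s₂ m - w s m) (λ m → 2ℚ * t² * # (s ℕ.∸ m))) (cong₂ _-_ (E-- (w s₂) (w s)) (E-*ˡ (2ℚ * t²) (λ m → # (s ℕ.∸ m))))))
               (hyperbola-ring-30 (E (w s₂)) a₂ (2ℚ * t² * a₁)))

    -- Up to powers of `H`, the moments `a₀`, `a₁`, `a₂` are of orders τ⁵, τ⁷, τ⁹, so the four terms
    -- of `S₃` are of orders τ²⁴, τ¹⁸, τ²⁴ and τ²¹.
    quadruple-bound : s₂ ℕ.< N → ∣ E (λ a → E (λ b → w X (a ℕ.* b))) ∣ ≤ constant * (τ²⁴ * ((H * H) * (H * H)))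
    quadruple-bound s₂<N = subst (λ z → ∣ z ∣ ≤ constant * (τ²⁴ * (H² * H²))) (sym split)
        (≤-trans (∣-∣≤ (∣+∣≤ S₁≤ S₁≤) (subst (λ z → ∣ z ∣ ≤ b₃) (sym S₃≡)
            (∣-∣≤ (∣+∣≤ (∣+∣≤ (∣*∣≤ {2ℚ * (σ * σ)} {a₂ * a₀} c₁ (∣*∣≤ a₂≤ a₀≤)) (∣*∣≤ a₂≤ a₂≤)) (∣*∣≤ {2ℚ * (σ * σ)} {a₁ * a₁} c₁ (∣*∣≤ A₁ A₁))) (∣*∣≤ {4ℚ * σ} {a₂ * a₁} c₂ (∣*∣≤ a₂≤ A₁)))))
          (≤-by gap gap≥0 (hyperbola-ring-32 t Kₙ B C₁ H²)))
      where
      A₁ = a₁≤ s₂<N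
      b₃ = 2ℚ * (σ * σ) * (Kₙ * τ⁹ * (B * σ * H²)) + Kₙ * τ⁹ * (Kₙ * τ⁹) + 2ℚ * (σ * σ) * (C₁ * τ⁷ * H² * (C₁ * τ⁷ * H²)) + 4ℚ * σ * (Kₙ * τ⁹ * (C₁ * τ⁷ * H²))
      c₁ : ∣ 2ℚ * (σ * σ) ∣ ≤ 2ℚ * (σ * σ)
      c₁ = 0≤⇒∣∣≤ (0≤* 0≤2 (0≤sq σ)) ≤-refl
      c₂ : ∣ 4ℚ * σ ∣ ≤ 4ℚ * σ
      c₂ = 0≤⇒∣∣≤ (0≤* (nonNegative⁻¹ 4ℚ) σ≥0) ≤-refl
      t⁶≥1 : 1ℚ ≤ t³ * t³
      t⁶≥1 = ≤-trans t³≥1 (subst (_≤ t³ * t³) (*-identityʳ t³) (*-monoˡ t³ t³≥0 t³≥1))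
      h-1 = H² - 1ℚ
      h-1≥0 : 0ℚ ≤ h-1
      h-1≥0 = 0≤-sub H²≥1
      H⁴-1≥0 : 0ℚ ≤ H² * H² - 1ℚ
      H⁴-1≥0 = 0≤-sub (≤-trans H²≥1 (subst (_≤ H² * H²) (*-identityʳ H²) (*-monoˡ H² H²≥0 H²≥1)))
      t⁶ = t³ * t³
      τ¹⁸ = τ⁹ * τ⁹
      gap = 4ℚ * (B * Kₙ) * τ²⁴ * (H² * h-1) + Kₙ * Kₙ * (τ¹⁸ * (t⁶ * (H² * H² - 1ℚ) + (t⁶ - 1ℚ))) + 4ℚ * (Kₙ * C₁) * (τ¹⁸ * t³ * H² * (t³ * h-1 + (t³ - 1ℚ)))
      gap≥0 : 0ℚ ≤ gap
      gap≥0 = 0≤+ (0≤+ (0≤* (0≤* (0≤* (nonNegative⁻¹ 4ℚ) (0≤* B≥0 Kₙ≥0)) τ²⁴≥0) (0≤* H²≥0 h-1≥0))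
                       (0≤* (0≤* Kₙ≥0 Kₙ≥0) (0≤* (0≤sq τ⁹) (0≤+ (0≤* (0≤sq t³) H⁴-1≥0) (0≤-sub t⁶≥1)))))
                  (0≤* (0≤* (nonNegative⁻¹ 4ℚ) (0≤* Kₙ≥0 C₁≥0)) (0≤* (0≤* (0≤* (0≤sq τ⁹) t³≥0) H²≥0) (0≤+ (0≤* t³≥0 h-1≥0) (0≤-sub t³≥1))))

private
  square-ring-1 : ∀ x y → x * (0ℚ * y) ≡ 0ℚ
  square-ring-1 = solve-∀ ℚ-ring
  square-ring-2 : ∀ x y → x * (y * 0ℚ) ≡ 0ℚ
  square-ring-2 = solve-∀ ℚ-ring
  square-ring-3 : ∀ c x y p → c * (x * y) * p ≡ c * (x * (y * p))
  square-ring-3 = solve-∀ ℚ-ring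
  square-ring-4 : ∀ p q s t → p * q * (s * t) ≡ p * s * (q * t)
  square-ring-4 = solve-∀ ℚ-ring
  square-ring-5 : ∀ a b c → a * (b * c) ≡ b * (a * c)
  square-ring-5 = solve-∀ ℚ-ring
  square-ring-6 : ∀ a b → 0ℚ * a * b ≡ 0ℚ
  square-ring-6 = solve-∀ ℚ-ring
  square-ring-7 : ∀ a b → a * 0ℚ * b ≡ 0ℚ
  square-ring-7 = solve-∀ ℚ-ring
  square-ring-8 : ∀ c u p v → c * (u * p * v) ≡ u * (c * (p * v))
  square-ring-8 = solve-∀ ℚ-ring
  square-ring-9 : ∀ a b → 0ℚ * a * b ≡ 0ℚ
  square-ring-9 = solve-∀ ℚ-ring
  square-ring-10 : ∀ a b → a * 0ℚ * b ≡ 0ℚ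
  square-ring-10 = solve-∀ ℚ-ring
  square-ring-11 : ∀ a b → a * (0ℚ * b) ≡ 0ℚ
  square-ring-11 = solve-∀ ℚ-ring
  square-ring-12 : ∀ h d p → h * (1ℚ * (d * p)) ≡ p * (d * h)
  square-ring-12 = solve-∀ ℚ-ring
  square-ring-13 : ∀ p u s → p * (u * s) ≡ u * p * s
  square-ring-13 = solve-∀ ℚ-ring
  square-ring-14 : ∀ g p q s → g * p * (g * q * s) ≡ g * g * (p * q) * s
  square-ring-14 = solve-∀ ℚ-ring
  square-ring-15 : ∀ a p b q → a * p * (b * q) ≡ a * b * (p * q)
  square-ring-15 = solve-∀ ℚ-ring
  square-ring-16 : ∀ a b → 0ℚ * a * b ≡ 0ℚ
  square-ring-16 = solve-∀ ℚ-ring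
  square-ring-17 : ∀ a b → a * 0ℚ * b ≡ 0ℚ
  square-ring-17 = solve-∀ ℚ-ring
  square-ring-18 : ∀ a → 1ℚ * 1ℚ * a ≡ a
  square-ring-18 = solve-∀ ℚ-ring

-- Sums over pairs, sorted by greatest common divisor

∑₃ : ℕ → (ℕ → ℕ → ℕ → ℚ) → ℚ
∑₃ N F = ∑ N (λ t → ∑ N (λ α → ∑ N (λ β → F t α β)))

∑₃-cong : ∀ N {F G} → (∀ t α β → F t α β ≡ G t α β) → ∑₃ N F ≡ ∑₃ N G
∑₃-cong N h = ∑-cong′ N (λ t → ∑-cong′ N (λ α → ∑-cong′ N (λ β → h t α β)))

∑₃-∑ : ∀ N M (G : ℕ → ℕ → ℕ → ℕ → ℚ) → ∑₃ N (λ t α β → ∑ M (G t α β)) ≡ ∑ M (λ a → ∑₃ N (λ t α β → G t α β a))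
∑₃-∑ N M G = trans (∑-cong′ N (λ t → trans (∑-cong′ N (λ α → ∑-swap N M (λ β a → G t α β a))) (∑-swap N M (λ α a → ∑ N (λ β → G t α β a)))))
  (∑-swap N M (λ t a → ∑ N (λ α → ∑ N (λ β → G t α β a))))

∑₃-*ʳ : ∀ N k F → ∑₃ N (λ t α β → F t α β * k) ≡ ∑₃ N F * k
∑₃-*ʳ N k F = trans (∑-cong′ N (λ t → trans (∑-cong′ N (λ α → ∑-*ʳ N k (F t α))) (∑-*ʳ N k (λ α → ∑ N (F t α)))))
  (∑-*ʳ N k (λ t → ∑ N (λ α → ∑ N (F t α))))

cop : ℕ → ℕ → ℚ
cop α β = χ (coprime? α β)

∑-delta : ∀ N a (φ : ℕ → ℚ) → (∀ i → N ℕ.≤ i → φ i ≡ 0ℚ) → ∑ N (λ i → χ (i ℕ.≟ a) * φ i) ≡ φ a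
∑-delta N a φ z with a ℕ.<? N
... | yes l = trans (∑-single N a l (λ i _ ne → trans (cong (_* φ i) (χ-no (i ℕ.≟ a) ne)) (*-zeroˡ (φ i)))) (trans (cong (_* φ a) (χ-yes (a ℕ.≟ a) refl)) (*-identityˡ (φ a)))
... | no ¬l = trans (∑-zero N (λ i i<N → trans (cong (_* φ i) (χ-no (i ℕ.≟ a) (λ { refl → ¬l i<N }))) (*-zeroˡ (φ i)))) (sym (z a (ℕₚ.≮⇒≥ ¬l)))

-- For coprime `α` and `β` the gcd of `t α` and `t β` is `t`; so `t` must be `gcd a b`, and this
-- determines `α` and `β`.
gcd-count : ∀ N a b → 1 ℕ.≤ a → 1 ℕ.≤ b → a ℕ.< N → b ℕ.< N →
  ∑₃ N (λ t α β → cop α β * (χ (a ℕ.≟ t ℕ.* α) * χ (b ℕ.≟ t ℕ.* β))) ≡ 1ℚ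
gcd-count N a b 1≤a 1≤b a<N b<N = trans (∑-single N g g<N (λ t _ t≢g → ∑-zero N (λ α _ → ∑-zero N (λ β _ → other t t≢g α β))))
  (trans (∑-single N a′ a′<N (λ α _ α≢ → ∑-zero N (λ β _ → trans (cong (λ z → cop α β * (z * χ (b ℕ.≟ g ℕ.* β))) (χ-no (a ℕ.≟ g ℕ.* α) (λ e → α≢ (ℕₚ.*-cancelˡ-≡ α a′ g (trans (sym e) ga′))))) (square-ring-1 (cop α β) (χ (b ℕ.≟ g ℕ.* β))))))
  (trans (∑-single N b′ b′<N (λ β _ β≢ → trans (cong (λ z → cop a′ β * (χ (a ℕ.≟ g ℕ.* a′) * z)) (χ-no (b ℕ.≟ g ℕ.* β) (λ e → β≢ (ℕₚ.*-cancelˡ-≡ β b′ g (trans (sym e) gb′))))) (square-ring-2 (cop a′ β) (χ (a ℕ.≟ g ℕ.* a′)))))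
  (trans (cong₂ _*_ (χ-yes (coprime? a′ b′) (Cop.coprime-/gcd a b)) (cong₂ _*_ (χ-yes (a ℕ.≟ g ℕ.* a′) ga′) (χ-yes (b ℕ.≟ g ℕ.* b′) gb′))) refl)))
  where
  g = gcd a b
  instance
    a-nz : NonZero a
    a-nz = ℕ.>-nonZero 1≤a
    b-nz : NonZero b
    b-nz = ℕ.>-nonZero 1≤b
    g-nz : NonZero g
    g-nz = ℕ.≢-nonZero (λ e → ℕ.≢-nonZero⁻¹ a (Data.Nat.GCD.gcd[m,n]≡0⇒m≡0 e))
  a′ = a / g
  b′ = b / g
  ga′ : a ≡ g ℕ.* a′
  ga′ = sym (Data.Nat.DivMod.m*[n/m]≡n (gcd[m,n]∣m a b))
  gb′ : b ≡ g ℕ.* b′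
  gb′ = sym (Data.Nat.DivMod.m*[n/m]≡n (gcd[m,n]∣n a b))
  g<N : g ℕ.< N
  g<N = ℕₚ.≤-<-trans (Data.Nat.GCD.gcd[m,n]≤n a b) b<N
  a′<N : a′ ℕ.< N
  a′<N = ℕₚ.≤-<-trans (Data.Nat.DivMod.m/n≤m a g) a<N
  b′<N : b′ ℕ.< N
  b′<N = ℕₚ.≤-<-trans (Data.Nat.DivMod.m/n≤m b g) b<N
  other : ∀ t → t ≢ g → ∀ α β → cop α β * (χ (a ℕ.≟ t ℕ.* α) * χ (b ℕ.≟ t ℕ.* β)) ≡ 0ℚ
  other t t≢g α β with coprime? α β | a ℕ.≟ t ℕ.* α | b ℕ.≟ t ℕ.* β
  ... | no _  | p     | q     = *-zeroˡ (χ p * χ q)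
  ... | yes _ | no _  | q     = trans (*-identityˡ (0ℚ * χ q)) (*-zeroˡ (χ q))
  ... | yes _ | yes _ | no _  = refl
  ... | yes c | yes e | yes e′ = contradiction (sym (trans (cong₂ gcd e e′) (trans (sym (Data.Nat.GCD.c*gcd[m,n]≡gcd[cm,cn] t α β)) (trans (cong (t ℕ.*_) (Cop.coprime⇒gcd≡1 c)) (ℕₚ.*-identityʳ t))))) t≢g

gcd-sum : ∀ N (φ : ℕ → ℕ → ℚ) → (∀ b → φ 0 b ≡ 0ℚ) → (∀ a → φ a 0 ≡ 0ℚ) → (∀ a b → N ℕ.≤ a → φ a b ≡ 0ℚ) → (∀ a b → N ℕ.≤ b → φ a b ≡ 0ℚ) →
  ∑₃ N (λ t α β → cop α β * φ (t ℕ.* α) (t ℕ.* β)) ≡ ∑ N (λ a → ∑ N (λ b → φ a b))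
gcd-sum N φ z₁ z₂ z₃ z₄ = begin
  ∑₃ N (λ t α β → cop α β * φ (t ℕ.* α) (t ℕ.* β))
    ≡⟨ ∑₃-cong N (λ t α β → expand t α β) ⟩
  ∑₃ N (λ t α β → ∑ N (λ a → ∑ N (λ b → I t α β a b * φ a b)))
    ≡⟨ ∑₃-∑ N N (λ t α β a → ∑ N (λ b → I t α β a b * φ a b)) ⟩
  ∑ N (λ a → ∑₃ N (λ t α β → ∑ N (λ b → I t α β a b * φ a b)))
    ≡⟨ ∑-cong′ N (λ a → ∑₃-∑ N N (λ t α β b → I t α β a b * φ a b)) ⟩
  ∑ N (λ a → ∑ N (λ b → ∑₃ N (λ t α β → I t α β a b * φ a b)))
    ≡⟨ ∑-cong N (λ a a< → ∑-cong N (λ b b< → trans (∑₃-*ʳ N (φ a b) (λ t α β → I t α β a b)) (collapse a b a< b<))) ⟩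
  ∑ N (λ a → ∑ N (λ b → φ a b)) ∎
  where
  open ≡-Reasoning
  I : ℕ → ℕ → ℕ → ℕ → ℕ → ℚ
  I t α β a b = cop α β * (χ (a ℕ.≟ t ℕ.* α) * χ (b ℕ.≟ t ℕ.* β))
  expand : ∀ t α β → cop α β * φ (t ℕ.* α) (t ℕ.* β) ≡ ∑ N (λ a → ∑ N (λ b → I t α β a b * φ a b))
  expand t α β = sym (trans (∑-cong′ N (λ a → trans (∑-cong′ N (λ b → square-ring-3 (cop α β) (χ (a ℕ.≟ t ℕ.* α)) (χ (b ℕ.≟ t ℕ.* β)) (φ a b)))
      (trans (∑-*ˡ N (cop α β) (λ b → χ (a ℕ.≟ t ℕ.* α) * (χ (b ℕ.≟ t ℕ.* β) * φ a b))) (cong (cop α β *_) (trans (∑-*ˡ N (χ (a ℕ.≟ t ℕ.* α)) (λ b → χ (b ℕ.≟ t ℕ.* β) * φ a b))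
         (cong (χ (a ℕ.≟ t ℕ.* α) *_) (∑-delta N (t ℕ.* β) (φ a) (z₄ a))))))))
    (trans (∑-*ˡ N (cop α β) (λ a → χ (a ℕ.≟ t ℕ.* α) * φ a (t ℕ.* β))) (cong (cop α β *_) (∑-delta N (t ℕ.* α) (λ a → φ a (t ℕ.* β)) (λ a l → z₃ a (t ℕ.* β) l)))))
  collapse : ∀ a b → a ℕ.< N → b ℕ.< N → ∑₃ N (λ t α β → I t α β a b) * φ a b ≡ φ a b
  collapse zero    b a< b< = trans (cong (∑₃ N (λ t α β → I t α β 0 b) *_) (z₁ b)) (trans (*-zeroʳ (∑₃ N (λ t α β → I t α β 0 b))) (sym (z₁ b)))
  collapse (suc a) zero a< b< = trans (cong (∑₃ N (λ t α β → I t α β (suc a) 0) *_) (z₂ (suc a))) (trans (*-zeroʳ (∑₃ N (λ t α β → I t α β (suc a) 0))) (sym (z₂ (suc a))))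
  collapse (suc a) (suc b) a< b< = trans (cong (_* φ (suc a) (suc b)) (gcd-count N (suc a) (suc b) (s≤s z≤n) (s≤s z≤n) a< b<)) (*-identityˡ (φ (suc a) (suc b)))

∑-multiples : ∀ N y → 1 ℕ.≤ y → (h : ℕ → ℚ) → (∀ m → N ℕ.≤ m → h m ≡ 0ℚ) → ∑ N (λ m → χ (y ∣? m) * h m) ≡ ∑ N (λ k → h (y ℕ.* k))
∑-multiples N y 1≤y h z = sym (trans (∑-cong′ N (λ k → sym (∑-delta N (y ℕ.* k) h z))) (trans (∑-swap N N (λ k m → χ (m ℕ.≟ y ℕ.* k) * h m)) (∑-cong N col)))
  where
  instance _ = ℕ.>-nonZero 1≤y
  col : ∀ m → m ℕ.< N → ∑ N (λ k → χ (m ℕ.≟ y ℕ.* k) * h m) ≡ χ (y ∣? m) * h m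
  col m m<N with y ∣? m
  ... | yes (divides k e) = trans (∑-single N k (ℕₚ.≤-<-trans (subst (k ℕ.≤_) (sym e) (ℕₚ.m≤m*n k y)) m<N) (λ k′ _ ne → trans (cong (_* h m) (χ-no (m ℕ.≟ y ℕ.* k′) (λ e′ → ne (ℕₚ.*-cancelˡ-≡ k′ k y (trans (sym e′) (trans e (ℕₚ.*-comm k y))))))) (*-zeroˡ (h m))))
                             (cong (_* h m) (χ-yes (m ℕ.≟ y ℕ.* k) (trans e (ℕₚ.*-comm k y))))
  ... | no ¬d = trans (∑-zero N (λ k _ → trans (cong (_* h m) (χ-no (m ℕ.≟ y ℕ.* k) (λ e → ¬d (divides k (trans e (ℕₚ.*-comm y k)))))) (*-zeroˡ (h m)))) (sym (*-zeroˡ (h m)))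

-- The fourfold sum is a sum of squares
module SumOfSquares (n : ℕ) {{_ : NonZero n}} (2≤n : 2 ℕ.≤ n) (r : ℕ → ℚ) (r-per : Per n r) (r-supp : ∀ m → ¬ Coprime m n → r m ≡ 0ℚ) where

  u : ℕ → ℚ
  u k = χ (coprime? k n)

  private
    ¬cop0 : ¬ Coprime 0 n
    ¬cop0 c = ℕₚ.<-irrefl (sym (Cop.0-coprimeTo-m⇒m≡1 c)) 2≤n

  u-0 : u 0 ≡ 0ℚ
  u-0 = χ-no (coprime? 0 n) ¬cop0

  u-1 : u 1 ≡ 1ℚ
  u-1 = χ-yes (coprime? 1 n) (Cop.1-coprimeTo n)

  cop-factorˡ : ∀ {a b} → Coprime (a ℕ.* b) n → Coprime a n
  cop-factorˡ {a} {b} c (d∣a , d∣n) = c (ℕd.∣m⇒∣m*n b d∣a , d∣n)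

  cop-factorʳ : ∀ {a b} → Coprime (a ℕ.* b) n → Coprime b n
  cop-factorʳ {a} {b} c (d∣b , d∣n) = c (ℕd.∣n⇒∣m*n a d∣b , d∣n)

  u-* : ∀ a b → u (a ℕ.* b) ≡ u a * u b
  u-* a b with coprime? a n | coprime? b n
  ... | yes p | yes q = χ-yes (coprime? (a ℕ.* b) n) (coprime-* {a} {b} {n} p q)
  ... | yes p | no ¬q = χ-no (coprime? (a ℕ.* b) n) (λ c → ¬q (cop-factorʳ {a} {b} c))
  ... | no ¬p | yes q = χ-no (coprime? (a ℕ.* b) n) (λ c → ¬p (cop-factorˡ {a} {b} c))
  ... | no ¬p | no q  = χ-no (coprime? (a ℕ.* b) n) (λ c → ¬p (cop-factorˡ {a} {b} c))

  u-idem : ∀ a → u a * u a ≡ u a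
  u-idem a with coprime? a n
  ... | yes _ = refl
  ... | no _  = refl

  u-r : ∀ x a → r (x ℕ.* a) * u a ≡ r (x ℕ.* a)
  u-r x a with coprime? a n
  ... | yes _ = *-identityʳ (r (x ℕ.* a))
  ... | no ¬p = trans (*-zeroʳ (r (x ℕ.* a))) (sym (r-supp (x ℕ.* a) (λ c → ¬p (cop-factorʳ {x} {a} c))))

  r-0 : ∀ x → r (x ℕ.* 0) ≡ 0ℚ
  r-0 x = r-supp (x ℕ.* 0) (λ c → ¬cop0 (subst (λ z → Coprime z n) (ℕₚ.*-zeroʳ x) c))

  -- A Gram matrix of the dilates of `r`. The sum over all `x` makes it invariant under a common
  -- factor prime to `n`, and its quadratic forms are sums of squares.
  Φ : ℕ → ℕ → ℚ
  Φ a b = ∑ n (λ x → r (x ℕ.* a) * r (x ℕ.* b))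

  Φ-0ˡ : ∀ b → Φ 0 b ≡ 0ℚ
  Φ-0ˡ b = ∑-zero n (λ x _ → trans (cong (_* r (x ℕ.* b)) (r-0 x)) (*-zeroˡ (r (x ℕ.* b))))

  Φ-0ʳ : ∀ a → Φ a 0 ≡ 0ℚ
  Φ-0ʳ a = ∑-zero n (λ x _ → trans (cong (r (x ℕ.* a) *_) (r-0 x)) (*-zeroʳ (r (x ℕ.* a))))

  Φ-u : ∀ a b → Φ a b * (u a * u b) ≡ Φ a b
  Φ-u a b = trans (sym (∑-*ʳ n (u a * u b) (λ x → r (x ℕ.* a) * r (x ℕ.* b)))) (∑-cong′ n (λ x → trans (square-ring-4 (r (x ℕ.* a)) (r (x ℕ.* b)) (u a) (u b)) (cong₂ _*_ (u-r x a) (u-r x b))))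

  Φ-scale : ∀ t a b → Φ (t ℕ.* a) (t ℕ.* b) ≡ u t * Φ a b
  Φ-scale t a b with coprime? t n
  ... | no ¬p = trans (∑-zero n (λ x _ → trans (cong (_* r (x ℕ.* (t ℕ.* b))) (r-supp (x ℕ.* (t ℕ.* a)) (λ c → ¬p (cop-factorˡ {t} {a} (cop-factorʳ {x} {t ℕ.* a} c))))) (*-zeroˡ (r (x ℕ.* (t ℕ.* b)))))) (sym (*-zeroˡ (Φ a b)))
  ... | yes p = trans (∑-cong′ n (λ x → cong₂ (λ y z → r y * r z) (lem x t a) (lem x t b))) (trans (∑-dilate n {λ x → r (x ℕ.* a) * r (x ℕ.* b)} t per p) (sym (*-identityˡ (Φ a b))))
    where
    lem : ∀ x t a → x ℕ.* (t ℕ.* a) ≡ t ℕ.* x ℕ.* a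
    lem = ℕring.solve-∀
    lem₂ : ∀ j n a → (j ℕ.+ n) ℕ.* a ≡ j ℕ.* a ℕ.+ a ℕ.* n
    lem₂ = ℕring.solve-∀
    per : Per n (λ x → r (x ℕ.* a) * r (x ℕ.* b))
    per j = cong₂ _*_ (trans (cong r (lem₂ j n a)) (per-mult {n} {r} r-per a (j ℕ.* a))) (trans (cong r (lem₂ j n b)) (per-mult {n} {r} r-per b (j ℕ.* b)))

  module _ (N X : ℕ) (X<N : X ℕ.< N) where

    V : ℕ → ℚ
    V y = ∑ N (λ g → ∑ N (λ k → u g * u k * w X (y ℕ.* (g ℕ.* k))))

    fourfold : ℕ → ℚ
    fourfold x = ∑ N (λ d → r (x ℕ.* d) * ∑ N (λ k → u k * ∑ N (λ d′ → r (x ℕ.* d′) * ∑ N (λ k′ → u k′ * w X (d ℕ.* k ℕ.* (d′ ℕ.* k′))))))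

    private
      fourfold≡ : ∀ x → fourfold x ≡ ∑ N (λ d → ∑ N (λ d′ → r (x ℕ.* d) * r (x ℕ.* d′) * V (d ℕ.* d′)))
      fourfold≡ x = ∑-cong′ N (λ d → trans (cong (r (x ℕ.* d) *_) (inner d)) (trans (sym (∑-*ˡ N (r (x ℕ.* d)) (λ d′ → r (x ℕ.* d′) * V (d ℕ.* d′)))) (∑-cong′ N (λ d′ → sym (*-assoc (r (x ℕ.* d)) (r (x ℕ.* d′)) (V (d ℕ.* d′)))))))
        where
        inner : ∀ d → ∑ N (λ k → u k * ∑ N (λ d′ → r (x ℕ.* d′) * ∑ N (λ k′ → u k′ * w X (d ℕ.* k ℕ.* (d′ ℕ.* k′))))) ≡ ∑ N (λ d′ → r (x ℕ.* d′) * V (d ℕ.* d′))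
        inner d = trans (∑-cong′ N (λ k → sym (∑-*ˡ N (u k) (λ d′ → r (x ℕ.* d′) * ∑ N (λ k′ → u k′ * w X (d ℕ.* k ℕ.* (d′ ℕ.* k′)))))))
          (trans (∑-swap N N (λ k d′ → u k * (r (x ℕ.* d′) * ∑ N (λ k′ → u k′ * w X (d ℕ.* k ℕ.* (d′ ℕ.* k′))))))
            (∑-cong′ N (λ d′ → trans (∑-cong′ N (λ k → trans (square-ring-5 (u k) (r (x ℕ.* d′)) (∑ N (λ k′ → u k′ * w X (d ℕ.* k ℕ.* (d′ ℕ.* k′))))) (cong (r (x ℕ.* d′) *_) (trans (sym (∑-*ˡ N (u k) (λ k′ → u k′ * w X (d ℕ.* k ℕ.* (d′ ℕ.* k′)))))
                 (∑-cong′ N (λ k′ → trans (sym (*-assoc (u k) (u k′) (w X (d ℕ.* k ℕ.* (d′ ℕ.* k′))))) (cong (λ z → u k * u k′ * w X z) (e d k d′ k′))))))))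
               (∑-*ˡ N (r (x ℕ.* d′)) (λ k → ∑ N (λ k′ → u k * u k′ * w X (d ℕ.* d′ ℕ.* (k ℕ.* k′))))))))
          where
          e : ∀ d k d′ k′ → d ℕ.* k ℕ.* (d′ ℕ.* k′) ≡ d ℕ.* d′ ℕ.* (k ℕ.* k′)
          e = ℕring.solve-∀

      total : ∑ n fourfold ≡ ∑ N (λ d → ∑ N (λ d′ → Φ d d′ * V (d ℕ.* d′)))
      total = trans (∑-cong′ n fourfold≡) (trans (∑-swap n N (λ x d → ∑ N (λ d′ → r (x ℕ.* d) * r (x ℕ.* d′) * V (d ℕ.* d′))))
        (∑-cong′ N (λ d → trans (∑-swap n N (λ x d′ → r (x ℕ.* d) * r (x ℕ.* d′) * V (d ℕ.* d′))) (∑-cong′ N (λ d′ → ∑-*ʳ n (V (d ℕ.* d′)) (λ x → r (x ℕ.* d) * r (x ℕ.* d′)))))))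

      V-vanish : ∀ y → N ℕ.≤ y → V y ≡ 0ℚ
      V-vanish y N≤y = ∑-zero N (λ g _ → ∑-zero N (λ k _ → term g k))
        where
        term : ∀ g k → u g * u k * w X (y ℕ.* (g ℕ.* k)) ≡ 0ℚ
        term zero    k = trans (cong (λ z → z * u k * w X (y ℕ.* 0)) u-0) (square-ring-6 (u k) (w X (y ℕ.* 0)))
        term (suc g) zero = trans (cong (λ z → u (suc g) * z * w X (y ℕ.* (suc g ℕ.* 0))) u-0) (square-ring-7 (u (suc g)) (w X (y ℕ.* (suc g ℕ.* 0))))
        term (suc g) (suc k) = trans (cong (u (suc g) * u (suc k) *_) (w-vanish {X} {y ℕ.* (suc g ℕ.* suc k)} (ℕₚ.≤-trans (ℕₚ.≤-trans (ℕₚ.<⇒≤ X<N) N≤y) (ℕₚ.m≤m*n y (suc g ℕ.* suc k))))) (*-zeroʳ (u (suc g) * u (suc k)))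

      -- The pairs `(d , d′)` with gcd `t` contribute `u t * Y t` to the sum; the factor over `t` is
      -- the L(2s, u) of Ingham's identity.
      Y : ℕ → ℚ
      Y t = ∑ N (λ α → ∑ N (λ β → cop α β * (Φ α β * V (t ℕ.* α ℕ.* (t ℕ.* β)))))

      sorted : ∑ n fourfold ≡ ∑ N (λ t → u t * Y t)
      sorted = trans total (trans (sym (gcd-sum N (λ a b → Φ a b * V (a ℕ.* b)) (λ b → trans (cong (_* V 0) (Φ-0ˡ b)) (*-zeroˡ (V 0))) (λ a → trans (cong (_* V (a ℕ.* 0)) (Φ-0ʳ a)) (*-zeroˡ (V (a ℕ.* 0)))) far₁ far₂))
          (∑-cong′ N (λ t → trans (∑-cong′ N (λ α → trans (∑-cong′ N (λ β → trans (cong (λ z → cop α β * (z * V (t ℕ.* α ℕ.* (t ℕ.* β)))) (Φ-scale t α β)) (square-ring-8 (cop α β) (u t) (Φ α β) (V (t ℕ.* α ℕ.* (t ℕ.* β)))))) (∑-*ˡ N (u t) (λ β → cop α β * (Φ α β * V (t ℕ.* α ℕ.* (t ℕ.* β)))))))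
             (∑-*ˡ N (u t) (λ α → ∑ N (λ β → cop α β * (Φ α β * V (t ℕ.* α ℕ.* (t ℕ.* β)))))))))
        where
        far₁ : ∀ a b → N ℕ.≤ a → Φ a b * V (a ℕ.* b) ≡ 0ℚ
        far₁ a zero    l = trans (cong (_* V (a ℕ.* 0)) (Φ-0ʳ a)) (*-zeroˡ (V (a ℕ.* 0)))
        far₁ a (suc b) l = trans (cong (Φ a (suc b) *_) (V-vanish (a ℕ.* suc b) (ℕₚ.≤-trans l (ℕₚ.m≤m*n a (suc b))))) (*-zeroʳ (Φ a (suc b)))
        far₂ : ∀ a b → N ℕ.≤ b → Φ a b * V (a ℕ.* b) ≡ 0ℚ
        far₂ zero    b l = trans (cong (_* V 0) (Φ-0ˡ b)) (*-zeroˡ (V 0))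
        far₂ (suc a) b l = trans (cong (Φ (suc a) b *_) (V-vanish (suc a ℕ.* b) (ℕₚ.≤-trans l (ℕₚ.m≤n*m b (suc a))))) (*-zeroʳ (Φ (suc a) b))

      module _ (t : ℕ) (1≤t : 1 ℕ.≤ t) where
        h : ℕ → ℚ
        h m = u m * w X (t ℕ.* t ℕ.* m)

        h-far : ∀ m → N ℕ.≤ m → h m ≡ 0ℚ
        h-far m l = trans (cong (u m *_) (w-vanish {X} {t ℕ.* t ℕ.* m} (ℕₚ.≤-trans (ℕₚ.≤-trans (ℕₚ.<⇒≤ X<N) l) (ℕₚ.m≤n*m m (t ℕ.* t) {{ℕ.>-nonZero (ℕₚ.*-mono-≤ 1≤t 1≤t)}})))) (*-zeroʳ (u m))

        dv : ℕ → ℕ → ℚ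
        dv d m = χ (d ∣? m)

        -- This is the sum over `x` of the squares (Σ r(x d))², the inner sum being over the
        -- divisors `d < N` of `m`; hence it is nonnegative.
        square : ℕ → ℚ
        square m = ∑ N (λ d → ∑ N (λ d′ → dv d m * dv d′ m * Φ d d′))

        Z : ℚ
        Z = ∑ N (λ m → h m * square m)

        row : ∀ m → m ℕ.< N → h m * square m ≡ ∑₃ N (λ g α β → h m * (cop α β * (dv (g ℕ.* α) m * dv (g ℕ.* β) m * Φ (g ℕ.* α) (g ℕ.* β))))
        row zero    _ = trans (cong (_* square 0) h0) (trans (*-zeroˡ (square 0)) (sym (∑-zero N (λ g _ → ∑-zero N (λ α _ → ∑-zero N (λ β _ → trans (cong (_* (cop α β * (dv (g ℕ.* α) 0 * dv (g ℕ.* β) 0 * Φ (g ℕ.* α) (g ℕ.* β)))) h0) (*-zeroˡ (cop α β * (dv (g ℕ.* α) 0 * dv (g ℕ.* β) 0 * Φ (g ℕ.* α) (g ℕ.* β))))))))))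
          where
          h0 : h 0 ≡ 0ℚ
          h0 = trans (cong (_* w X (t ℕ.* t ℕ.* 0)) u-0) (*-zeroˡ (w X (t ℕ.* t ℕ.* 0)))
        row m@(suc m′) m<N = trans (cong (h m *_) (sym (gcd-sum N (λ d d′ → dv d m * dv d′ m * Φ d d′)
              (λ b → trans (cong (dv 0 m * dv b m *_) (Φ-0ˡ b)) (*-zeroʳ (dv 0 m * dv b m))) (λ a → trans (cong (dv a m * dv 0 m *_) (Φ-0ʳ a)) (*-zeroʳ (dv a m * dv 0 m)))
              (λ a b l → trans (cong (λ z → z * dv b m * Φ a b) (far a l)) (square-ring-9 (dv b m) (Φ a b))) (λ a b l → trans (cong (λ z → dv a m * z * Φ a b) (far b l)) (square-ring-10 (dv a m) (Φ a b))))))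
            (sym (trans (∑₃-cong N (λ g α β → *-comm (h m) (cop α β * (dv (g ℕ.* α) m * dv (g ℕ.* β) m * Φ (g ℕ.* α) (g ℕ.* β))))) (trans (∑₃-*ʳ N (h m) (λ g α β → cop α β * (dv (g ℕ.* α) m * dv (g ℕ.* β) m * Φ (g ℕ.* α) (g ℕ.* β)))) (*-comm (∑₃ N (λ g α β → cop α β * (dv (g ℕ.* α) m * dv (g ℕ.* β) m * Φ (g ℕ.* α) (g ℕ.* β)))) (h m)))))
          where
          far : ∀ a → N ℕ.≤ a → dv a m ≡ 0ℚ
          far a l = χ-no (a ∣? m) (λ d → ℕₚ.<-irrefl refl (ℕₚ.<-≤-trans m<N (ℕₚ.≤-trans l (ℕd.∣⇒≤ d))))

        lcm-dv : ∀ g α β m → Coprime α β → dv (g ℕ.* α) m * dv (g ℕ.* β) m ≡ dv (g ℕ.* (α ℕ.* β)) m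
        lcm-dv g α β m c with g ℕ.* α ∣? m | g ℕ.* β ∣? m
        ... | no ¬p | e = trans (*-zeroˡ (χ e)) (sym (χ-no (g ℕ.* (α ℕ.* β) ∣? m) (λ d → ¬p (ℕd.∣-trans (ℕd.*-monoʳ-∣ g (ℕd.m∣m*n β)) d))))
        ... | yes p | no ¬q = sym (χ-no (g ℕ.* (α ℕ.* β) ∣? m) (λ d → ¬q (ℕd.∣-trans (ℕd.*-monoʳ-∣ g (ℕd.n∣m*n α)) d)))
        ... | yes p | yes q = sym (χ-yes (g ℕ.* (α ℕ.* β) ∣? m) (join g p q))
          where
          join : ∀ g → g ℕ.* α ∣ m → g ℕ.* β ∣ m → g ℕ.* (α ℕ.* β) ∣ m
          join zero      p q = p
          join g@(suc _) (divides z e) q = subst (g ℕ.* (α ℕ.* β) ∣_) (sym (trans e (e₁ z g α))) (ℕd.*-monoʳ-∣ g (ℕd.*-monoʳ-∣ α β∣z))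
            where
            e₁ : ∀ z g a → z ℕ.* (g ℕ.* a) ≡ g ℕ.* (a ℕ.* z)
            e₁ = ℕring.solve-∀
            β∣z : β ∣ z
            β∣z = Cop.coprime-divisor (Cop.sym c) (ℕd.*-cancelˡ-∣ g (subst (g ℕ.* β ∣_) (trans e (e₁ z g α)) q))

        cell : ∀ g α β → ∑ N (λ m → h m * (cop α β * (dv (g ℕ.* α) m * dv (g ℕ.* β) m * Φ (g ℕ.* α) (g ℕ.* β)))) ≡ cop α β * (Φ α β * ∑ N (λ k → u g * u k * w X (t ℕ.* α ℕ.* (t ℕ.* β) ℕ.* (g ℕ.* k))))
        cell g α β with coprime? α β
        ... | no _ = trans (∑-zero N (λ m _ → square-ring-11 (h m) (dv (g ℕ.* α) m * dv (g ℕ.* β) m * Φ (g ℕ.* α) (g ℕ.* β)))) (sym (*-zeroˡ (Φ α β * ∑ N (λ k → u g * u k * w X (t ℕ.* α ℕ.* (t ℕ.* β) ℕ.* (g ℕ.* k))))))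
        ... | yes c = trans (∑-cong′ N (λ m → trans (cong₂ (λ y z → h m * (1ℚ * (y * z))) (lcm-dv g α β m c) (Φ-scale g α β)) (square-ring-12 (h m) (dv y m) (u g * Φ α β))))
                (trans (∑-*ˡ N (u g * Φ α β) (λ m → dv y m * h m)) (trans (inner g α β) (sym (*-identityˡ (Φ α β * ∑ N (λ k → u g * u k * w X (t ℕ.* α ℕ.* (t ℕ.* β) ℕ.* (g ℕ.* k))))))))
          where
          y = g ℕ.* (α ℕ.* β)
          wt : ℕ → ℕ → ℕ → ℕ → ℚ
          wt g α β k = w X (t ℕ.* α ℕ.* (t ℕ.* β) ℕ.* (g ℕ.* k))
          right : ∀ g α β → Φ α β * ∑ N (λ k → u g * u k * wt g α β k) ≡ u g * Φ α β * ∑ N (λ k → u k * wt g α β k)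
          right g α β = trans (cong (Φ α β *_) (trans (∑-cong′ N (λ k → *-assoc (u g) (u k) (wt g α β k))) (∑-*ˡ N (u g) (λ k → u k * wt g α β k)))) (square-ring-13 (Φ α β) (u g) (∑ N (λ k → u k * wt g α β k)))
          degenerate : ∀ g α β → u g * Φ α β ≡ 0ℚ → u g * Φ α β * ∑ N (λ m → dv (g ℕ.* (α ℕ.* β)) m * h m) ≡ Φ α β * ∑ N (λ k → u g * u k * wt g α β k)
          degenerate g α β e = trans (cong (_* ∑ N (λ m → dv (g ℕ.* (α ℕ.* β)) m * h m)) e) (trans (*-zeroˡ (∑ N (λ m → dv (g ℕ.* (α ℕ.* β)) m * h m)))
            (sym (trans (right g α β) (trans (cong (_* ∑ N (λ k → u k * wt g α β k)) e) (*-zeroˡ (∑ N (λ k → u k * wt g α β k)))))))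
          inner : ∀ g α β → u g * Φ α β * ∑ N (λ m → dv (g ℕ.* (α ℕ.* β)) m * h m) ≡ Φ α β * ∑ N (λ k → u g * u k * wt g α β k)
          inner zero    α β = degenerate 0 α β (trans (cong (_* Φ α β) u-0) (*-zeroˡ (Φ α β)))
          inner (suc g) zero β = degenerate (suc g) 0 β (trans (cong (u (suc g) *_) (Φ-0ˡ β)) (*-zeroʳ (u (suc g))))
          inner (suc g) (suc α) zero = degenerate (suc g) (suc α) 0 (trans (cong (u (suc g) *_) (Φ-0ʳ (suc α))) (*-zeroʳ (u (suc g))))
          -- At the multiple `g α β k` the function `h` also carries `u α * u β`, which `Φ α β`
          -- absorbs because `r` is supported on residues prime to `n`; the repeated `u g` is
          -- idempotent.
          inner g@(suc _) α@(suc _) β@(suc _) = trans (cong (u g * Φ α β *_) (trans (∑-multiples N y′ (ℕₚ.*-mono-≤ {1} {g} {1} {α ℕ.* β} (s≤s z≤n) (ℕₚ.*-mono-≤ {1} {α} {1} {β} (s≤s z≤n) (s≤s z≤n))) h h-far) (trans (∑-cong′ N mult) (∑-*ˡ N (u g * (u α * u β)) (λ k → u k * wt g α β k)))))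
              (trans (square-ring-14 (u g) (Φ α β) (u α * u β) (∑ N (λ k → u k * wt g α β k))) (trans (cong₂ (λ a b → a * b * ∑ N (λ k → u k * wt g α β k)) (u-idem g) (Φ-u α β)) (sym (right g α β))))
            where
            y′ = g ℕ.* (α ℕ.* β)
            e : ∀ t a b g k → t ℕ.* t ℕ.* (g ℕ.* (a ℕ.* b) ℕ.* k) ≡ t ℕ.* a ℕ.* (t ℕ.* b) ℕ.* (g ℕ.* k)
            e = ℕring.solve-∀
            mult : ∀ k → h (y′ ℕ.* k) ≡ u g * (u α * u β) * (u k * wt g α β k)
            mult k = trans (cong₂ _*_ (trans (u-* y′ k) (cong (_* u k) (trans (u-* g (α ℕ.* β)) (cong (u g *_) (u-* α β))))) (cong (w X) (e t α β g k))) (*-assoc (u g * (u α * u β)) (u k) (wt g α β k))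

        -- Sort the pairs of divisors of `m` by their gcd `g`: for coprime `α` and `β`, both `g α`
        -- and `g β` divide `m` exactly when `m = g α β k`.
        Z≡Y : Z ≡ Y t
        Z≡Y = begin
          Z                                                                   ≡⟨ ∑-cong N row ⟩
          ∑ N (λ m → ∑₃ N (λ g α β → h m * (cop α β * (dv (g ℕ.* α) m * dv (g ℕ.* β) m * Φ (g ℕ.* α) (g ℕ.* β)))))
            ≡⟨ sym (∑₃-∑ N N (λ g α β m → h m * (cop α β * (dv (g ℕ.* α) m * dv (g ℕ.* β) m * Φ (g ℕ.* α) (g ℕ.* β))))) ⟩
          ∑₃ N (λ g α β → ∑ N (λ m → h m * (cop α β * (dv (g ℕ.* α) m * dv (g ℕ.* β) m * Φ (g ℕ.* α) (g ℕ.* β)))))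
            ≡⟨ ∑₃-cong N cell ⟩
          ∑₃ N (λ g α β → cop α β * (Φ α β * vg g α β))                       ≡⟨ ∑-swap N N (λ g α → ∑ N (λ β → cop α β * (Φ α β * vg g α β))) ⟩
          ∑ N (λ α → ∑ N (λ g → ∑ N (λ β → cop α β * (Φ α β * vg g α β))))    ≡⟨ ∑-cong′ N (λ α → ∑-swap N N (λ g β → cop α β * (Φ α β * vg g α β))) ⟩
          ∑ N (λ α → ∑ N (λ β → ∑ N (λ g → cop α β * (Φ α β * vg g α β))))    ≡⟨ ∑-cong′ N (λ α → ∑-cong′ N (λ β → trans (∑-*ˡ N (cop α β) (λ g → Φ α β * vg g α β)) (cong (cop α β *_) (∑-*ˡ N (Φ α β) (λ g → vg g α β))))) ⟩
          Y t                                                                 ∎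
          where
          open ≡-Reasoning
          vg : ℕ → ℕ → ℕ → ℚ
          vg g α β = ∑ N (λ k → u g * u k * w X (t ℕ.* α ℕ.* (t ℕ.* β) ℕ.* (g ℕ.* k)))

        square≥0 : ∀ m → 0ℚ ≤ square m
        square≥0 m = subst (0ℚ ≤_) eq (∑-nonneg n (λ x _ → 0≤sq (A x)))
          where
          A : ℕ → ℚ
          A x = ∑ N (λ d → dv d m * r (x ℕ.* d))
          eq : ∑ n (λ x → A x * A x) ≡ square m
          eq = trans (∑-cong′ n (λ x → trans (sym (∑-*ʳ N (A x) (λ d → dv d m * r (x ℕ.* d)))) (∑-cong′ N (λ d → trans (sym (∑-*ˡ N (dv d m * r (x ℕ.* d)) (λ d′ → dv d′ m * r (x ℕ.* d′)))) (∑-cong′ N (λ d′ → square-ring-15 (dv d m) (r (x ℕ.* d)) (dv d′ m) (r (x ℕ.* d′))))))))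
            (trans (∑-swap n N (λ x d → ∑ N (λ d′ → dv d m * dv d′ m * (r (x ℕ.* d) * r (x ℕ.* d′)))))
              (∑-cong′ N (λ d → trans (∑-swap n N (λ x d′ → dv d m * dv d′ m * (r (x ℕ.* d) * r (x ℕ.* d′)))) (∑-cong′ N (λ d′ → ∑-*ˡ n (dv d m * dv d′ m) (λ x → r (x ℕ.* d) * r (x ℕ.* d′)))))))

        square-1 : 1 ℕ.< N → square 1 ≡ Φ 1 1
        square-1 1<N = trans (∑-single N 1 1<N (λ d _ d≢1 → ∑-zero N (λ d′ _ → trans (cong (λ z → z * dv d′ 1 * Φ d d′) (dv1 d d≢1)) (square-ring-16 (dv d′ 1) (Φ d d′)))))
          (trans (∑-single N 1 1<N (λ d′ _ d′≢1 → trans (cong (λ z → dv 1 1 * z * Φ 1 d′) (dv1 d′ d′≢1)) (square-ring-17 (dv 1 1) (Φ 1 d′))))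
            (trans (cong (λ z → z * z * Φ 1 1) (χ-yes (1 ∣? 1) ℕd.∣-refl)) (square-ring-18 (Φ 1 1))))
          where
          dv1 : ∀ d → d ≢ 1 → dv d 1 ≡ 0ℚ
          dv1 d ne = χ-no (d ∣? 1) (λ d∣1 → ne (ℕd.∣1⇒≡1 d∣1))

        -- Of the nonnegative terms only `m = 1` is kept; its only divisor is 1.
        Y-lower : 1 ℕ.< N → w X (t ℕ.* t) * Φ 1 1 ≤ Y t
        Y-lower 1<N = subst₂ _≤_ (cong₂ _*_ (trans (cong₂ (λ a b → a * w X b) u-1 (ℕₚ.*-identityʳ (t ℕ.* t))) (*-identityˡ (w X (t ℕ.* t)))) (square-1 1<N)) Z≡Y
          (∑-term≤ N {λ m → h m * square m} 1 1<N (λ m _ → 0≤* (0≤* (χ≥0 (coprime? m n)) (w-≥0 X (t ℕ.* t ℕ.* m))) (square≥0 m)))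

    sum-of-squares : 1 ℕ.< N → ∑ N (λ t → u t * w X (t ℕ.* t)) * Φ 1 1 ≤ ∑ n fourfold
    sum-of-squares 1<N = subst₂ _≤_ (∑-*ʳ N (Φ 1 1) (λ t → u t * w X (t ℕ.* t))) (sym sorted) (∑-mono N (λ t _ → term t))
      where
      term : ∀ t → u t * w X (t ℕ.* t) * Φ 1 1 ≤ u t * Y t
      term zero    = ≤-reflexive (trans (*-assoc (u 0) (w X 0) (Φ 1 1)) (trans (cong (_* (w X 0 * Φ 1 1)) u-0) (trans (*-zeroˡ (w X 0 * Φ 1 1)) (sym (trans (cong (_* Y 0) u-0) (*-zeroˡ (Y 0)))))))
      term t@(suc t′) = subst (_≤ u t * Y t) (sym (*-assoc (u t) (w X (t ℕ.* t)) (Φ 1 1))) (*-monoˡ (u t) (χ≥0 (coprime? t n)) (Y-lower t (s≤s z≤n) 1<N))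

-- Growth of harmonic sums and the final comparison

private
  h′ : ℕ → ℚ
  h′ m = harmonic (suc m)

-- The block of `a` reciprocals after `a (b + 1)` adds at most `1 / (b + 1)`. This stands in for
-- log(ab) = log a + log b.
harmonic-* : ∀ a b → 1 ℕ.≤ a → harmonic (suc (a ℕ.* suc b)) ≤ harmonic (suc a) + harmonic (suc b)
harmonic-* a zero    1≤a = subst₂ _≤_ (cong (λ z → harmonic (suc z)) (sym (ℕₚ.*-identityʳ a))) refl (≤-by (harmonic 1) (∑-nonneg 1 (λ i _ → inv-nonneg (#≥0 i))) refl)
harmonic-* a (suc b) 1≤a = subst (λ z → h′ z ≤ h′ a + h′ (suc b)) (sym (eq a b)) (subst (_≤ h′ a + h′ (suc b)) (sym (∑-split (suc (a ℕ.* suc b)) a (λ i → inv (# i))))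
    (≤-trans (+-mono-≤ (harmonic-* a b 1≤a) block) (≤-reflexive (+-assoc (h′ a) (h′ b) (inv (# (suc b)))))))
  where
  eq : ∀ a b → a ℕ.* suc (suc b) ≡ a ℕ.* suc b ℕ.+ a
  eq = ℕring.solve-∀
  m = a ℕ.* suc b
  m>0 : 0ℚ < # m
  m>0 = #>0 (ℕₚ.*-mono-≤ {1} {a} {1} {suc b} 1≤a (s≤s z≤n))
  block : ∑ a (λ i → inv (# (suc m ℕ.+ i))) ≤ inv (# (suc b))
  block = ≤-trans (∑-mono a (λ i _ → inv-anti m>0 (#-mono (ℕₚ.≤-trans (ℕₚ.n≤1+n m) (ℕₚ.m≤m+n (suc m) i)))))
    (≤-reflexive (trans (∑-const a (inv (# m))) (trans (cong (# a *_) (trans (cong inv (#-* a (suc b))) (inv-* (# a) (# (suc b))))) (trans (sym (*-assoc (# a) (inv (# a)) (inv (# (suc b))))) (trans (cong (_* inv (# (suc b))) (inv-r> (#>0 1≤a))) (*-identityˡ (inv (# (suc b)))))))))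

harmonic-≤ : ∀ m → harmonic (suc m) ≤ # m
harmonic-≤ zero    = ≤-reflexive (trans (+-identityˡ (inv (# 0))) (trans (cong inv #0≡0) (trans inv-0 (sym #0≡0))))
harmonic-≤ (suc m) = subst (h′ (suc m) ≤_) (sym (#-suc m)) (+-mono-≤ (harmonic-≤ m) (subst₂ _≤_ (*-identityˡ (inv (# (suc m)))) refl (inv-≤ {1ℚ} {1ℚ} (#>0 (s≤s z≤n)) (subst (1ℚ ≤_) (sym (*-identityˡ (# (suc m)))) (#≥1 (s≤s z≤n))))))

private
  h′-* : ∀ a b → 1 ℕ.≤ a → 1 ℕ.≤ b → h′ (a ℕ.* b) ≤ h′ a + h′ b
  h′-* a (suc b) 1≤a _ = ≤-trans (harmonic-* a b 1≤a) (+-monoʳ-≤ (h′ a) (≤-by (inv (# (suc b))) (inv-nonneg (#≥0 (suc b))) refl))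

Anti : ℕ → (ℕ → ℚ) → Set
Anti n f = ∀ a b → n ∣ a ℕ.+ b → f b ≡ - f a

anti-sum : ∀ n {{_ : NonZero n}} {f} → Per n f → Anti n f → ∑ n f ≡ 0ℚ
anti-sum n {f} per anti = self-neg (∑ n f) (begin
  ∑ n f                              ≡⟨ sym (∑-rev n f) ⟩
  ∑ n (λ i → f (n ℕ.∸ suc i))        ≡⟨ ∑-cong n (λ i l → anti (suc i) (n ℕ.∸ suc i) (subst (n ∣_) (sym (ℕₚ.m+[n∸m]≡n l)) ℕd.∣-refl)) ⟩
  ∑ n (λ i → - f (suc i))            ≡⟨ ∑-neg n (λ i → f (suc i)) ⟩
  - ∑ n (λ i → f (suc i))            ≡⟨ cong -_ (∑-shift n {f} per 1) ⟩
  - ∑ n f                            ∎)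
  where open ≡-Reasoning

coprime-pow : ∀ {a n} k → Coprime a n → Coprime a (n ℕ.^ k)
coprime-pow zero    c = Cop.sym (Cop.1-coprimeTo _)
coprime-pow {a} {n} (suc k) c = Cop.sym (coprime-* {n} {n ℕ.^ k} {a} (Cop.sym c) (Cop.sym (coprime-pow k c)))

n<b^n : ∀ {b} → 2 ℕ.≤ b → ∀ n → n ℕ.< b ℕ.^ n
n<b^n     2≤b zero    = s≤s z≤n
n<b^n {b} 2≤b (suc n) = ℕₚ.≤-trans (subst (ℕ._≤ suc n ℕ.+ suc n) (ℕₚ.+-comm (suc n) 1) (ℕₚ.+-monoʳ-≤ (suc n) {1} {suc n} (s≤s z≤n)))
  (ℕₚ.≤-trans (ℕₚ.+-mono-≤ (n<b^n 2≤b n) (n<b^n 2≤b n)) (subst (ℕ._≤ b ℕ.* b ℕ.^ n) (cong (b ℕ.^ n ℕ.+_) (ℕₚ.+-identityʳ (b ℕ.^ n))) (ℕₚ.*-monoˡ-≤ (b ℕ.^ n) 2≤b)))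

-- By Fourier inversion on (ℤ/n)^×, vanish says that no generalised Bernoulli number B₁(χ) of an odd
-- character χ modulo n vanishes.
module SawtoothNonvanishing (n : ℕ) {{n-nz : NonZero n}} (2≤n : 2 ℕ.≤ n) (c : ℕ → ℚ) (c-per : Per n c)
    (c-supp : ∀ a → ¬ Coprime a n → c a ≡ 0ℚ) (c-anti : Anti n c)
    (c-saw : ∀ k → ∑ n (λ a → c a * # ((k ℕ.* a) % n)) ≡ 0ℚ) where

  private
    1≤n : 1 ℕ.≤ n
    1≤n = ℕ.>-nonZero⁻¹ n

    c-sum : ∑ n c ≡ 0ℚ
    c-sum = anti-sum n c-per c-anti

    R : ℕ → ℚ
    R = autocorr n c c-per c-supp

    R-per : Per n R
    R-per m = ∑-cong′ n (λ a → cong (c a *_) (trans (cong c (ℕₚ.*-distribˡ-+ a m n)) (per-mult {n} {c} c-per a (a ℕ.* m))))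

    R-supp : ∀ m → ¬ Coprime m n → R m ≡ 0ℚ
    R-supp m ¬p = ∑-zero n (λ a _ → trans (cong (c a *_) (c-supp (a ℕ.* m) (λ q → ¬p (λ (d∣m , d∣n) → q (ℕd.∣n⇒∣m*n a d∣m , d∣n))))) (*-zeroʳ (c a)))

    R-anti : Anti n R
    R-anti m m′ d = trans (∑-cong′ n (λ a → trans (cong (c a *_) (c-anti (a ℕ.* m) (a ℕ.* m′) (subst (n ∣_) (ℕₚ.*-distribˡ-+ a m m′) (ℕd.∣n⇒∣m*n a d)))) (lem (c a) (c (a ℕ.* m))))) (∑-neg n (λ a → c a * c (a ℕ.* m)))
      where
      lem : ∀ x y → x * - y ≡ - (x * y)
      lem = solve-∀ ℚ-ring

    B : ℚ
    B = ∑ n (λ i → ∣ R i ∣)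
    B≥0 : 0ℚ ≤ B
    B≥0 = ∑-nonneg n (λ i _ → 0≤∣p∣ (R i))
    ∣R∣≤B : ∀ m → ∣ R m ∣ ≤ B
    ∣R∣≤B m = subst (λ z → ∣ z ∣ ≤ B) (sym (per-% {n} {R} R-per m)) (∑-term≤ n {λ i → ∣ R i ∣} (m % n) (m%n<n m n) (λ i _ → 0≤∣p∣ (R i)))

    open SumOfSquares n 2≤n R R-per R-supp

    f : ℕ → ℕ → ℚ
    f x d = R (x ℕ.* d)

    f-per : ∀ x → Per n (f x)
    f-per x d = trans (cong R (ℕₚ.*-distribˡ-+ x d n)) (per-mult {n} {R} R-per x (x ℕ.* d))

    f-anti : ∀ x → Anti n (f x)
    f-anti x a b d = R-anti (x ℕ.* a) (x ℕ.* b) (subst (n ∣_) (ℕₚ.*-distribˡ-+ x a b) (ℕd.∣n⇒∣m*n x d))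

    f-sum : ∀ x → ∑ n (f x) ≡ 0ℚ
    f-sum x = anti-sum n (f-per x) (f-anti x)

    module _ (x : ℕ) (cop-x : Coprime x n) where

      -- For each unit `a` put `b = a x` and let `y` invert `b`. Replacing `d` by `y d` turns Σ d
      -- c(b d) into Σ c(d) ((y d) mod n), a sawtooth relation.
      f-moment : ∑ n (λ d → # d * f x d) ≡ 0ℚ
      f-moment = begin
        ∑ n (λ d → # d * ∑ n (λ a → c a * c (a ℕ.* (x ℕ.* d))))        ≡⟨ ∑-cong′ n (λ d → sym (∑-*ˡ n (# d) (λ a → c a * c (a ℕ.* (x ℕ.* d))))) ⟩
        ∑ n (λ d → ∑ n (λ a → # d * (c a * c (a ℕ.* (x ℕ.* d)))))      ≡⟨ ∑-swap n n (λ d a → # d * (c a * c (a ℕ.* (x ℕ.* d)))) ⟩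
        ∑ n (λ a → ∑ n (λ d → # d * (c a * c (a ℕ.* (x ℕ.* d)))))      ≡⟨ ∑-zero n (λ a _ → col a (coprime? a n)) ⟩
        0ℚ                                                              ∎
        where
        open ≡-Reasoning
        lem : ∀ d a b → d * (a * b) ≡ a * (b * d)
        lem = solve-∀ ℚ-ring
        lem₀ : ∀ d b → d * (0ℚ * b) ≡ 0ℚ
        lem₀ = solve-∀ ℚ-ring
        col : ∀ a → Dec (Coprime a n) → ∑ n (λ d → # d * (c a * c (a ℕ.* (x ℕ.* d)))) ≡ 0ℚ
        col a (no ¬p) = ∑-zero n (λ d _ → trans (cong (λ z → # d * (z * c (a ℕ.* (x ℕ.* d)))) (c-supp a ¬p)) (lem₀ (# d) (c (a ℕ.* (x ℕ.* d)))))
        col a (yes p) = trans (∑-cong n (λ d l → trans (lem (# d) (c a) (c (a ℕ.* (x ℕ.* d)))) (cong₂ (λ y z → c a * (c y * # z)) (sym (ℕₚ.*-assoc a x d)) (sym (m<n⇒m%n≡m l)))))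
            (trans (∑-*ˡ n (c a) (λ d → c (b ℕ.* d) * # (d % n))) (trans (cong (c a *_) zero′) (*-zeroʳ (c a))))
          where
          b = a ℕ.* x
          cop-b : Coprime b n
          cop-b = coprime-* {a} {x} {n} p cop-x
          y = proj₁ (coprime-inverse n b cop-b)
          yb : (y ℕ.* b) % n ≡ 1 % n
          yb = proj₂ (coprime-inverse n b cop-b)
          cop-y : Coprime y n
          cop-y {d} (d∣y , d∣n) = Cop.1-coprimeTo n (d∣1 , d∣n)
            where
            d∣1 : d ∣ 1
            d∣1 = ℕd.∣m+n∣m⇒∣n (subst (d ∣_) (trans (m≡m%n+[m/n]*n (y ℕ.* b) n) (trans (cong (ℕ._+ (y ℕ.* b) / n ℕ.* n) (trans yb (m<n⇒m%n≡m 2≤n))) (ℕₚ.+-comm 1 ((y ℕ.* b) / n ℕ.* n)))) (ℕd.∣m⇒∣m*n b d∣y)) (ℕd.∣n⇒∣m*n ((y ℕ.* b) / n) d∣n)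
          per : Per n (λ d → c (b ℕ.* d) * # (d % n))
          per d = cong₂ (λ p q → p * # q) (trans (cong c (ℕₚ.*-distribˡ-+ b d n)) (per-mult {n} {c} c-per b (b ℕ.* d))) (Data.Nat.DivMod.[m+n]%n≡m%n d n)
          e : ∀ b y d → b ℕ.* (y ℕ.* d) ≡ d ℕ.* (y ℕ.* b)
          e = ℕring.solve-∀
          zero′ : ∑ n (λ d → c (b ℕ.* d) * # (d % n)) ≡ 0ℚ
          zero′ = trans (sym (∑-dilate n {λ d → c (b ℕ.* d) * # (d % n)} y per cop-y))
            (trans (∑-cong′ n (λ d → cong (_* # ((y ℕ.* d) % n)) (trans (cong c (e b y d)) (per-≡ {n} {c} c-per (trans (%-*-cong n d yb) (cong (_% n) (ℕₚ.*-identityʳ d))))))) (c-saw y))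

      -- The moduli are powers of `n`, so being prime to `M` and being prime to `n` agree. The
      -- autocorrelation modulo `M` is then a multiple of `R`, and the factor can be cancelled.
      large : ∀ N → ∃ λ M → N ℕ.≤ M × (∀ m → m ℕ.≤ M → f x (M ℕ.∸ m) ≡ - f x m) × Annihilates M (f x)
      large N = M , ℕₚ.≤-trans (ℕₚ.<⇒≤ (n<b^n 2≤n N)) (ℕₚ.m≤m*n l n) , odd , ann
        where
        l = n ℕ.^ N
        M = l ℕ.* n
        instance
          l-nz : NonZero l
          l-nz = ℕₚ.m^n≢0 n N
          M-nz : NonZero M
          M-nz = ℕₚ.m*n≢0 l n
        odd : ∀ m → m ℕ.≤ M → f x (M ℕ.∸ m) ≡ - f x m
        odd m m≤M = f-anti x m (M ℕ.∸ m) (subst (n ∣_) (sym (ℕₚ.m+[n∸m]≡n m≤M)) (ℕd.n∣m*n l))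
        c-per-M : Per M c
        c-per-M = per-mult {n} {c} c-per l
        cop-M : ∀ {a} → Coprime a n → Coprime a M
        cop-M {a} p = Cop.sym (coprime-* {l} {n} {a} (Cop.sym (coprime-pow N p)) (Cop.sym p))
        c-supp-M : ∀ a → ¬ Coprime a M → c a ≡ 0ℚ
        c-supp-M a ¬p = c-supp a (λ p → ¬p (cop-M p))
        scale : ∀ m → autocorr M c c-per-M c-supp-M m ≡ # l * R m
        scale m = ∑-periods l n {λ a → c a * c (a ℕ.* m)} (λ a → cong₂ _*_ (c-per a) (trans (cong c (e a n m)) (per-mult {n} {c} c-per m (a ℕ.* m))))
          where
          e : ∀ a n m → (a ℕ.+ n) ℕ.* m ≡ a ℕ.* m ℕ.+ m ℕ.* n
          e = ℕring.solve-∀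
        l>0 : 0ℚ < # l
        l>0 = #>0 (ℕ.>-nonZero⁻¹ l)
        ann : Annihilates M (f x)
        ann {s} s-per = begin
          T                        ≡⟨ sym (*-identityˡ T) ⟩
          1ℚ * T                   ≡⟨ cong (_* T) (trans (sym (inv-r> l>0)) (*-comm (# l) (inv (# l)))) ⟩
          inv (# l) * # l * T      ≡⟨ *-assoc (inv (# l)) (# l) T ⟩
          inv (# l) * (# l * T)    ≡⟨ cong (inv (# l) *_) (trans (sym (∑-*ˡ M (# l) (λ m → f x m * K m))) (trans (∑-cong′ M (λ m → trans (sym (*-assoc (# l) (f x m) (K m))) (cong (_* K m) (sym (scale (x ℕ.* m)))))) (sawtooth-annihilates M c c-per-M c-supp-M (λ k → sawtooth-lift n c-per c-sum c-saw l k) {s} s-per x (cop-M cop-x)))) ⟩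
          inv (# l) * 0ℚ           ≡⟨ *-zeroʳ (inv (# l)) ⟩
          0ℚ                       ∎
          where
          open ≡-Reasoning
          K : ℕ → ℚ
          K m = ∑ M (λ r → # r * s (r ℕ.* m))
          T = ∑ M (λ m → f x m * K m)

      f-0 : f x 0 ≡ 0ℚ
      f-0 = r-0 x

      ∣f∣≤B : ∀ d → ∣ f x d ∣ ≤ B
      ∣f∣≤B d = ∣R∣≤B (x ℕ.* d)

      module Prim = Primitives n (f x) (f-per x) (f-sum x) f-moment B≥0 ∣f∣≤B

      reciprocal : ∀ q → 1 ℕ.≤ q → ∣ ∑ (q ℕ.* n) (λ m → f x m * inv (# m)) ∣ ≤ (# n * (# n * B)) * (inv (# (q ℕ.* n)) * inv (# (q ℕ.* n)))
      reciprocal = Prim.reciprocal-sum (reciprocal-sum-weak (f x) f-0 B≥0 ∣f∣≤B Prim.P≥0 Prim.∣F∣≤P large)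

    u-per : Per n u
    u-per k = χ-⇔ (coprime? (k ℕ.+ n) n) (coprime? k n) (λ p {d} (d∣k , d∣n) → p (ℕd.∣m∣n⇒∣m+n d∣k d∣n , d∣n))
      (λ p {d} (d∣k , d∣n) → p (ℕd.∣m+n∣m⇒∣n (subst (d ∣_) (ℕₚ.+-comm k n) d∣k) d∣n , d∣n))

    ∣u∣≤1 : ∀ k → ∣ u k ∣ ≤ 1ℚ
    ∣u∣≤1 k = 0≤⇒∣∣≤ (χ≥0 (coprime? k n)) (χ≤1 (coprime? k n))

    K₀ Kₙ C₁ K : ℚ
    K₀ = 3ℚ * (# n * (# n * B)) + 2ℚ * (# n * (# n * # n)) * B
    Kₙ = K₀ * (ι (ℤ.+ 8) + # n * (# n * # n))
    C₁ = 2ℚ * Kₙ + 2ℚ * B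
    K  = 4ℚ * (B * Kₙ) + Kₙ * Kₙ + 2ℚ * (C₁ * C₁) + 4ℚ * (Kₙ * C₁)

    K≥0 : 0ℚ ≤ K
    K≥0 = 0≤+ (0≤+ (0≤+ (0≤* 0≤4 (0≤* B≥0 Kₙ≥0)) (0≤sq Kₙ)) (0≤* 0≤2 (0≤sq C₁))) (0≤* 0≤4 (0≤* Kₙ≥0 (0≤+ (0≤* 0≤2 Kₙ≥0) (0≤* 0≤2 B≥0))))
      where
      0≤2 : 0ℚ ≤ 2ℚ
      0≤2 = nonNegative⁻¹ 2ℚ
      0≤4 : 0ℚ ≤ 4ℚ
      0≤4 = nonNegative⁻¹ 4ℚ
      n³≥0 : 0ℚ ≤ # n * (# n * # n)
      n³≥0 = 0≤* (#≥0 n) (0≤sq (# n))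
      Kₙ≥0 : 0ℚ ≤ Kₙ
      Kₙ≥0 = 0≤* (0≤+ (0≤* (nonNegative⁻¹ 3ℚ) (0≤* (#≥0 n) (0≤* (#≥0 n) B≥0))) (0≤* (0≤* 0≤2 n³≥0) B≥0)) (0≤+ (nonNegative⁻¹ (ι (ℤ.+ 8))) n³≥0)

    fourfold-bound : ∀ N τ → 1 ℕ.≤ τ → let p₂ = τ ℕ.* τ ; s = p₂ ℕ.* (τ ℕ.* p₂) ; X = s ℕ.* s ; t³ = # τ * (# τ * # τ) ; τ⁹ = t³ * (t³ * t³) ; H = harmonic N in
      (X<N : X ℕ.< N) → 1ℚ ≤ H → s ℕ.+ p₂ ℕ.< N → ∀ x → fourfold N X X<N x ≤ K * (τ⁹ * (τ⁹ * (t³ * t³)) * ((H * H) * (H * H)))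
    fourfold-bound N τ 1≤τ X<N 1≤H s₂<N x with coprime? x n
    ... | yes p = ≤-trans (p≤∣p∣ (fourfold N X X<N x)) (QuadrupleSum.quadruple-bound n (f x) (f-per x) (f-sum x) (f-moment x p) B≥0 (∣f∣≤B x p) (f-0 x p) u u-per ∣u∣≤1 u-0 (reciprocal x p) N τ 1≤τ X<N 1≤H s₂<N)
      where
      X = τ ℕ.* τ ℕ.* (τ ℕ.* (τ ℕ.* τ)) ℕ.* (τ ℕ.* τ ℕ.* (τ ℕ.* (τ ℕ.* τ)))
    ... | no ¬p = ≤-trans (≤-reflexive (∑-zero N (λ d _ → trans (cong (_* rest d) (R-supp (x ℕ.* d) (λ q → ¬p (cop-factorˡ {x} {d} q)))) (*-zeroˡ (rest d))))) (0≤* K≥0 (0≤* (0≤* τ⁹≥0 (0≤* τ⁹≥0 (0≤sq t³))) (0≤sq (harmonic N * harmonic N))))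
      where
      X = τ ℕ.* τ ℕ.* (τ ℕ.* (τ ℕ.* τ)) ℕ.* (τ ℕ.* τ ℕ.* (τ ℕ.* (τ ℕ.* τ)))
      t³ = # τ * (# τ * # τ)
      τ⁹≥0 : 0ℚ ≤ t³ * (t³ * t³)
      τ⁹≥0 = 0≤* (0≤* (#≥0 τ) (0≤sq (# τ))) (0≤sq t³)
      rest : ℕ → ℚ
      rest d = ∑ N (λ k → u k * ∑ N (λ d′ → R (x ℕ.* d′) * ∑ N (λ k′ → u k′ * w X (d ℕ.* k ℕ.* (d′ ℕ.* k′)))))

    module Contradiction (v′ : ℕ) (1≤v′ : 1 ℕ.≤ v′) where
      v v₂ v₄ τ p₂ p₃ s X : ℕ
      -- The factor `2 n` makes `s` equal to `2 m` with `m` a multiple of `n`. Taking τ = v⁸ makes X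
      -- = v⁸⁰, so subadditivity gives `H ≤ 80 v`; then H⁴ costs v⁴, against a gain of τ = v⁸.
      v = (n ℕ.+ n) ℕ.* v′
      1≤v : 1 ℕ.≤ v
      1≤v = ℕₚ.*-mono-≤ {1} {n ℕ.+ n} (ℕₚ.≤-trans 1≤n (ℕₚ.m≤m+n n n)) 1≤v′
      v₂ = v ℕ.* v
      v₄ = v₂ ℕ.* v₂
      τ = v₄ ℕ.* v₄
      p₂ = τ ℕ.* τ
      p₃ = τ ℕ.* p₂
      s = p₂ ℕ.* p₃
      X = s ℕ.* s
      1≤v₂ = ℕₚ.*-mono-≤ 1≤v 1≤v
      1≤v₄ = ℕₚ.*-mono-≤ 1≤v₂ 1≤v₂
      1≤τ = ℕₚ.*-mono-≤ 1≤v₄ 1≤v₄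
      1≤p₂ = ℕₚ.*-mono-≤ 1≤τ 1≤τ
      1≤p₃ = ℕₚ.*-mono-≤ 1≤τ 1≤p₂
      1≤s = ℕₚ.*-mono-≤ 1≤p₂ 1≤p₃
      1≤X = ℕₚ.*-mono-≤ 1≤s 1≤s
      p₂≤s : p₂ ℕ.≤ s
      p₂≤s = ℕₚ.m≤m*n p₂ p₃ {{ℕ.>-nonZero 1≤p₃}}
      L = v′ ℕ.* (v ℕ.* (v₂ ℕ.* v₄)) ℕ.* (τ ℕ.* p₃)
      m = L ℕ.* n
      s≡ : s ≡ m ℕ.+ m
      s≡ = e (n ℕ.+ n) n v′ v v₂ v₄ τ p₃ refl
        where
        e : ∀ k n v′ v v₂ v₄ τ p₃ → k ≡ n ℕ.+ n → k ℕ.* v′ ℕ.* v ℕ.* v₂ ℕ.* v₄ ℕ.* τ ℕ.* p₃ ≡ v′ ℕ.* (v ℕ.* (v₂ ℕ.* v₄)) ℕ.* (τ ℕ.* p₃) ℕ.* n ℕ.+ v′ ℕ.* (v ℕ.* (v₂ ℕ.* v₄)) ℕ.* (τ ℕ.* p₃) ℕ.* n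
        e _ n v′ v v₂ v₄ τ p₃ refl = e′ n v′ v v₂ v₄ τ p₃
          where
          e′ : ∀ n v′ v v₂ v₄ τ p₃ → (n ℕ.+ n) ℕ.* v′ ℕ.* v ℕ.* v₂ ℕ.* v₄ ℕ.* τ ℕ.* p₃ ≡ v′ ℕ.* (v ℕ.* (v₂ ℕ.* v₄)) ℕ.* (τ ℕ.* p₃) ℕ.* n ℕ.+ v′ ℕ.* (v ℕ.* (v₂ ℕ.* v₄)) ℕ.* (τ ℕ.* p₃) ℕ.* n
          e′ = ℕring.solve-∀
      1≤L : 1 ℕ.≤ L
      1≤L = ℕₚ.*-mono-≤ (ℕₚ.*-mono-≤ 1≤v′ (ℕₚ.*-mono-≤ 1≤v (ℕₚ.*-mono-≤ 1≤v₂ 1≤v₄))) (ℕₚ.*-mono-≤ 1≤τ 1≤p₃)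
      1≤m : 1 ℕ.≤ m
      1≤m = ℕₚ.*-mono-≤ 1≤L 1≤n
      2≤s : 2 ℕ.≤ s
      2≤s = subst (2 ℕ.≤_) (sym s≡) (ℕₚ.+-mono-≤ 1≤m 1≤m)
      module Truncated (N : ℕ) (N≡ : N ≡ suc X) where
        H = harmonic N
        1<N : 1 ℕ.< N
        1<N = subst (1 ℕ.<_) (sym N≡) (s≤s 1≤X)
        1≤H : 1ℚ ≤ H
        1≤H = subst (_≤ H) (inv-unique (trans (*-identityʳ (# 1)) #1≡1)) (∑-term≤ N {λ i → inv (# i)} 1 1<N (λ i _ → inv-nonneg (#≥0 i)))
        H≤ : H ≤ ι (ℤ.+ 80) * # v
        H≤ = subst (λ z → harmonic z ≤ ι (ℤ.+ 80) * # v) (sym N≡) (≤-trans (dbl 1≤s (add (dbl 1≤τ hτ) (add hτ (dbl 1≤τ hτ) 1≤τ 1≤p₂) 1≤p₂ 1≤p₃)) (≤-reflexive (lem (# v))))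
          where
          hv : h′ v ≤ # v
          hv = harmonic-≤ v
          add : ∀ {a b p q} → h′ a ≤ p → h′ b ≤ q → 1 ℕ.≤ a → 1 ℕ.≤ b → h′ (a ℕ.* b) ≤ p + q
          add {a} {b} x y l l′ = ≤-trans (h′-* a b l l′) (+-mono-≤ x y)
          dbl : ∀ {a p} → 1 ℕ.≤ a → h′ a ≤ p → h′ (a ℕ.* a) ≤ p + p
          dbl l x = add x x l l
          hτ = dbl 1≤v₄ (dbl 1≤v₂ (dbl 1≤v hv))
          lem : ∀ v → let a = v + v + (v + v) + (v + v + (v + v)) in (a + a + (a + (a + a))) + (a + a + (a + (a + a))) ≡ ι (ℤ.+ 80) * v
          lem = solve-∀ ℚ-ring
        s₂<N : s ℕ.+ p₂ ℕ.< N
        s₂<N = subst (s ℕ.+ p₂ ℕ.<_) (sym N≡) (s≤s (ℕₚ.≤-trans (ℕₚ.+-monoʳ-≤ s p₂≤s) (subst (ℕ._≤ s ℕ.* s) (cong (s ℕ.+_) (ℕₚ.+-identityʳ s)) (ℕₚ.*-monoˡ-≤ s 2≤s))))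
        X<N : X ℕ.< N
        X<N = subst (X ℕ.<_) (sym N≡) (ℕₚ.n<1+n X)

        t = # τ
        t³ = t * (t * t)
        τ⁹ = t³ * (t³ * t³)
        τ²⁴ = τ⁹ * (τ⁹ * (t³ * t³))

        φ = Φ 1 1
        μ = # m
        ν = # n
        g : ℕ → ℚ
        g y = u y * w X (y ℕ.* y)
        g≥0 : ∀ y → 0ℚ ≤ g y
        g≥0 y = 0≤* (χ≥0 (coprime? y n)) (w-≥0 X (y ℕ.* y))

        -- Only arguments congruent to 1 modulo `n` and at most `m = s / 2` are kept: they are
        -- units, and `X - y² ≥ 4 m² - m²`.
        g-lower : ∀ l → l ℕ.< L → (3ℚ * (μ * μ)) * (3ℚ * (μ * μ)) ≤ g (suc (l ℕ.* n ℕ.+ 0))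
        g-lower l l<L = subst ((3ℚ * (μ * μ)) * (3ℚ * (μ * μ)) ≤_) (sym (trans (cong (_* w X (y ℕ.* y)) uy) (*-identityˡ (w X (y ℕ.* y))))) (*-mono b≥0 b≥0 b b)
          where
          y = suc (l ℕ.* n ℕ.+ 0)
          uy : u y ≡ 1ℚ
          uy = trans (cong (λ z → u (suc z)) (ℕₚ.+-identityʳ (l ℕ.* n))) (trans (per-mult {n} {u} u-per l 1) u-1)
          y≤m : y ℕ.≤ m
          y≤m = ℕₚ.≤-trans (subst (ℕ._≤ l ℕ.* n ℕ.+ n) (trans (ℕₚ.+-comm (l ℕ.* n) 1) (cong suc (sym (ℕₚ.+-identityʳ (l ℕ.* n))))) (ℕₚ.+-monoʳ-≤ (l ℕ.* n) 1≤n)) (subst (ℕ._≤ m) (ℕₚ.+-comm n (l ℕ.* n)) (ℕₚ.*-monoˡ-≤ n l<L))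
          b≥0 : 0ℚ ≤ 3ℚ * (μ * μ)
          b≥0 = 0≤* (nonNegative⁻¹ 3ℚ) (0≤sq μ)
          yy≤X : y ℕ.* y ℕ.≤ X
          yy≤X = ℕₚ.*-mono-≤ (ℕₚ.≤-trans y≤m (subst (m ℕ.≤_) (sym s≡) (ℕₚ.m≤m+n m m))) (ℕₚ.≤-trans y≤m (subst (m ℕ.≤_) (sym s≡) (ℕₚ.m≤m+n m m)))
          lem : ∀ m → (m + m) * (m + m) - m * m ≡ 3ℚ * (m * m)
          lem = solve-∀ ℚ-ring
          b : 3ℚ * (μ * μ) ≤ # (X ℕ.∸ y ℕ.* y)
          b = subst₂ _≤_ (lem μ) (sym (trans (#-∸ yy≤X) (cong₂ _-_ (trans (#-* s s) (cong (λ z → z * z) (trans (cong #_ s≡) (#-+ m m)))) (#-* y y))))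
                (+-monoʳ-≤ ((μ + μ) * (μ + μ)) (neg-antimono-≤ (*-mono (#≥0 y) (#≥0 y) (#-mono y≤m) (#-mono y≤m))))

        lower : # L * ((3ℚ * (μ * μ)) * (3ℚ * (μ * μ))) ≤ ∑ N g
        lower = ≤-trans (≤-reflexive (sym (∑-const L ((3ℚ * (μ * μ)) * (3ℚ * (μ * μ)))))) (≤-trans (∑-mono L (λ l l< → ≤-trans (g-lower l l<) (∑-term≤ n {λ k → g (suc (l ℕ.* n ℕ.+ k))} 0 1≤n (λ k _ → g≥0 (suc (l ℕ.* n ℕ.+ k))))))
          (≤-trans (≤-reflexive (sym (∑-block L n (λ i → g (suc i))))) (≤-trans (≤-by (g 0) (g≥0 0) (trans (∑-first m g) (+-comm (g 0) (∑ m (λ i → g (suc i))))))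
            (subst (∑ (suc m) g ≤_) (trans (sym (∑-split (suc m) (N ℕ.∸ suc m) g)) (cong (λ z → ∑ z g) (ℕₚ.m+[n∸m]≡n m<N))) (≤-by (∑ (N ℕ.∸ suc m) (λ i → g (suc m ℕ.+ i))) (∑-nonneg (N ℕ.∸ suc m) (λ i _ → g≥0 (suc m ℕ.+ i))) refl)))))
          where
          m<N : suc m ℕ.≤ N
          m<N = subst (suc m ℕ.≤_) (sym N≡) (s≤s (ℕₚ.≤-trans (subst (m ℕ.≤_) (sym s≡) (ℕₚ.m≤m+n m m)) (ℕₚ.m≤m*n s s {{ℕ.>-nonZero 1≤s}})))

        q q⁴ : ℚ
        q = # v
        q⁴ = q * q * (q * q)

        -- The factor `32 ν` completes `L m⁴` to (2m)⁵ = s⁵ = τ²⁵. Cancelling τ²⁴ and then v⁴ leaves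
        -- v⁴ against a constant; 40960000 is 80⁴.
        main : φ * (ι (ℤ.+ 9)) * q⁴ ≤ ι (ℤ.+ 32) * (ν * ν) * K * (ι (ℤ.+ 40960000))
        main = *-cancelˡ q⁴ q⁴>0 (≤-trans (≤-reflexive (trans (lem₀ φ q) (cong (φ * ι (ℤ.+ 9) *_) (sym t≡))))
            (≤-trans (*-cancelˡ τ²⁴ τ²⁴>0 (subst₂ _≤_ (trans (cong (λ m → ι (ℤ.+ 32) * ν * (# L * (3ℚ * (m * m) * (3ℚ * (m * m))) * φ)) μ≡) (trans (lem₁ (# L) ν φ) (trans (cong (λ z → φ * ι (ℤ.+ 9) * (z * (z * (z * (z * z))))) (sym σ≡)) (lem₂ t φ)))) (lem₃ ν K τ²⁴ (H * H * (H * H)))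
              (*-monoˡ (ι (ℤ.+ 32) * ν) (0≤* (nonNegative⁻¹ (ι (ℤ.+ 32))) (#≥0 n)) (≤-trans (*-monoʳ {# L * ((3ℚ * (μ * μ)) * (3ℚ * (μ * μ)))} {∑ N g} φ φ≥0 lower) (≤-trans (sum-of-squares N X X<N 1<N) (≤-trans (∑-mono n (λ x _ → fourfold-bound N τ 1≤τ X<N 1≤H s₂<N x)) (≤-reflexive (∑-const n (K * (τ²⁴ * ((H * H) * (H * H)))))))))))) 
              (≤-trans (*-monoˡ (ι (ℤ.+ 32) * (ν * ν) * K) (0≤* (0≤* (nonNegative⁻¹ (ι (ℤ.+ 32))) (0≤sq ν)) K≥0) (*-mono (0≤sq H) (0≤sq H) H²≤ H²≤)) (≤-reflexive (lem₄ (ι (ℤ.+ 32) * (ν * ν) * K) q)))))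
          where
          V>0 : 0ℚ < q
          V>0 = #>0 1≤v
          q⁴>0 : 0ℚ < q⁴
          q⁴>0 = 0<* (0<* V>0 V>0) (0<* V>0 V>0)
          φ≥0 : 0ℚ ≤ φ
          φ≥0 = ∑-nonneg n (λ x _ → 0≤sq (R (x ℕ.* 1)))
          H²≤ : H * H ≤ (ι (ℤ.+ 80) * q) * (ι (ℤ.+ 80) * q)
          H²≤ = *-mono (≤-trans 0≤1 1≤H) (≤-trans 0≤1 1≤H) H≤ H≤
          t≡ : t ≡ q⁴ * q⁴
          t≡ = trans (#-* v₄ v₄) (cong (λ z → z * z) (trans (#-* v₂ v₂) (cong (λ z → z * z) (#-* v v))))
          μ≡ : μ ≡ # L * ν
          μ≡ = #-* L n
          σ≡ : t * t * (t * (t * t)) ≡ # L * ν + # L * ν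
          σ≡ = trans (sym (trans (#-* p₂ p₃) (cong₂ _*_ (#-* τ τ) (trans (#-* τ p₂) (cong (t *_) (#-* τ τ)))))) (trans (cong #_ s≡) (trans (#-+ m m) (cong₂ _+_ μ≡ μ≡)))
          τ²⁴>0 : 0ℚ < τ²⁴
          τ²⁴>0 = 0<* (0<* t³>0 (0<* t³>0 t³>0)) (0<* (0<* t³>0 (0<* t³>0 t³>0)) (0<* t³>0 t³>0))
            where
            t>0 : 0ℚ < t
            t>0 = #>0 1≤τ
            t³>0 : 0ℚ < t * (t * t)
            t³>0 = 0<* t>0 (0<* t>0 t>0)
          lem₀ : ∀ p v → v * v * (v * v) * (p * ι (ℤ.+ 9) * (v * v * (v * v))) ≡ p * ι (ℤ.+ 9) * (v * v * (v * v) * (v * v * (v * v)))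
          lem₀ = solve-∀ ℚ-ring
          lem₁ : ∀ l n p → ι (ℤ.+ 32) * n * (l * (3ℚ * (l * n * (l * n)) * (3ℚ * (l * n * (l * n)))) * p) ≡ p * ι (ℤ.+ 9) * ((l * n + l * n) * ((l * n + l * n) * ((l * n + l * n) * ((l * n + l * n) * (l * n + l * n)))))
          lem₁ = solve-∀ ℚ-ring
          lem₂ : ∀ t p → let t³ = t * (t * t) ; τ⁹ = t³ * (t³ * t³) ; σ = t * t * t³ in p * ι (ℤ.+ 9) * (σ * (σ * (σ * (σ * σ)))) ≡ τ⁹ * (τ⁹ * (t³ * t³)) * (p * ι (ℤ.+ 9) * t)
          lem₂ = solve-∀ ℚ-ring
          lem₃ : ∀ n k t h → ι (ℤ.+ 32) * n * (n * (k * (t * h))) ≡ t * (ι (ℤ.+ 32) * (n * n) * k * h)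
          lem₃ = solve-∀ ℚ-ring
          lem₄ : ∀ a v → a * (ι (ℤ.+ 80) * v * (ι (ℤ.+ 80) * v) * (ι (ℤ.+ 80) * v * (ι (ℤ.+ 80) * v))) ≡ v * v * (v * v) * (a * ι (ℤ.+ 40960000))
          lem₄ = solve-∀ ℚ-ring

    Φ₁₁≤0 : ¬ (0ℚ < Φ 1 1)
    Φ₁₁≤0 φ>0 = contradiction (<-≤-trans strict (Contradiction.Truncated.main v′ (s≤s z≤n) (suc X) refl)) (<-irrefl refl)
      where
      Y = ι (ℤ.+ 32) * (# n * # n) * K * (ι (ℤ.+ 40960000))
      p = Φ 1 1 * ι (ℤ.+ 9)
      p>0 : 0ℚ < p
      p>0 = 0<* φ>0 (positive⁻¹ (ι (ℤ.+ 9)))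
      v₀ = proj₁ (archimedean (Y * inv p))
      v′ = suc v₀
      open Contradiction v′ (s≤s z≤n) using (v; X; 1≤v)
      q q⁴ : ℚ
      q = # v
      q⁴ = q * q * (q * q)
      V≥1 : 1ℚ ≤ q
      V≥1 = #≥1 1≤v
      V≥0 : 0ℚ ≤ q
      V≥0 = ≤-trans 0≤1 V≥1
      V²≥q : q ≤ q * q
      V²≥q = subst (_≤ q * q) (*-identityʳ q) (*-monoˡ q V≥0 V≥1)
      q⁴≥ : q ≤ q⁴
      q⁴≥ = ≤-trans V²≥q (subst (_≤ q⁴) (*-identityʳ (q * q)) (*-monoˡ (q * q) (0≤sq q) (≤-trans V≥1 V²≥q)))
      v₀<v : # v₀ < q
      v₀<v = <-≤-trans (<-by 1ℚ 0<1 (#-suc v₀)) (#-mono (ℕₚ.m≤n*m v′ (n ℕ.+ n) {{ℕ.>-nonZero (ℕₚ.≤-trans 1≤n (ℕₚ.m≤m+n n n))}}))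
      strict : Y < Φ 1 1 * ι (ℤ.+ 9) * q⁴
      strict = subst (_< p * q⁴) (trans (lem p Y (inv p)) (trans (cong (Y *_) (inv-r> p>0)) (*-identityʳ Y)))
        (*-monoʳ-<-pos p {{ℚ.positive p>0}} (≤-<-trans (proj₂ (archimedean (Y * inv p))) (<-≤-trans v₀<v q⁴≥)))
        where
        lem : ∀ p y i → p * (y * i) ≡ y * (p * i)
        lem = solve-∀ ℚ-ring

  -- `R 1` is the sum of the squares of `c`, so a nonzero value of `c` would make `R 1` and with it
  -- `Φ 1 1` positive.
  vanish : ∀ a → c a ≡ 0ℚ
  vanish a with c a ≟ℚ 0ℚ
  ... | yes e = e
  ... | no ne = contradiction (<-≤-trans (0<* R1>0 R1>0) (subst (_≤ Φ 1 1) (cong (λ z → R z * R z) refl) (∑-term≤ n {λ x → R (x ℕ.* 1) * R (x ℕ.* 1)} 1 2≤n (λ x _ → 0≤sq (R (x ℕ.* 1)))))) Φ₁₁≤0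
    where
    b = a % n
    cb≢0 : c b ≢ 0ℚ
    cb≢0 e = ne (trans (per-% {n} {c} c-per a) e)
    cb²>0 : 0ℚ < c b * c b
    cb²>0 with <-cmp 0ℚ (c b * c b)
    ... | tri< l _ _ = l
    ... | tri≈ _ e _ = contradiction (zero-product (sym e)) cb≢0
      where
      zero-product : c b * c b ≡ 0ℚ → c b ≡ 0ℚ
      zero-product e = trans (sym (*-identityʳ (c b))) (trans (cong (c b *_) (sym (inv-r cb≢0))) (trans (sym (*-assoc (c b) (c b) (inv (c b)))) (trans (cong (_* inv (c b)) e) (*-zeroˡ (inv (c b))))))
    ... | tri> _ _ g = contradiction (<-≤-trans g (0≤sq (c b))) (<-irrefl refl)
    R1>0 : 0ℚ < R 1
    R1>0 = <-≤-trans cb²>0 (subst₂ _≤_ (cong (λ z → c b * c z) (ℕₚ.*-identityʳ b)) refl (∑-term≤ n {λ x → c x * c (x ℕ.* 1)} b (m%n<n a n) (λ x _ → subst (λ z → 0ℚ ≤ c x * c z) (sym (ℕₚ.*-identityʳ x)) (0≤sq (c x)))))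

-- Sums over finite index types

Σ-cong : ∀ {k} {f g : Fin k → ℚ} → (∀ i → f i ≡ g i) → Σℚ f ≡ Σℚ g
Σ-cong {zero}  h = refl
Σ-cong {suc k} h = cong₂ _+_ (h zero) (Σ-cong (λ i → h (suc i)))

Σ-zero : ∀ {k} {f : Fin k → ℚ} → (∀ i → f i ≡ 0ℚ) → Σℚ f ≡ 0ℚ
Σ-zero {zero}  h = refl
Σ-zero {suc k} h = cong₂ _+_ (h zero) (Σ-zero (λ i → h (suc i)))

Σ-+ : ∀ {k} (f g : Fin k → ℚ) → Σℚ (λ i → f i + g i) ≡ Σℚ f + Σℚ g
Σ-+ {zero}  f g = refl
Σ-+ {suc k} f g = trans (cong (f zero + g zero +_) (Σ-+ (f ∘ suc) (g ∘ suc))) (lem (f zero) (g zero) (Σℚ (f ∘ suc)) (Σℚ (g ∘ suc)))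
  where
  lem : ∀ a b c d → a + b + (c + d) ≡ a + c + (b + d)
  lem = solve-∀ ℚ-ring

Σ-*ˡ : ∀ {k} c (f : Fin k → ℚ) → Σℚ (λ i → c * f i) ≡ c * Σℚ f
Σ-*ˡ {zero}  c f = sym (*-zeroʳ c)
Σ-*ˡ {suc k} c f = trans (cong (c * f zero +_) (Σ-*ˡ c (f ∘ suc))) (sym (*-distribˡ-+ c (f zero) (Σℚ (f ∘ suc))))

Σ-*ʳ : ∀ {k} c (f : Fin k → ℚ) → Σℚ (λ i → f i * c) ≡ Σℚ f * c
Σ-*ʳ c f = trans (Σ-cong (λ i → *-comm (f i) c)) (trans (Σ-*ˡ c f) (*-comm c (Σℚ f)))

Σ-neg : ∀ {k} (f : Fin k → ℚ) → Σℚ (λ i → - f i) ≡ - Σℚ f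
Σ-neg f = trans (Σ-cong (λ i → lem (f i))) (trans (Σ-*ˡ (- 1ℚ) f) (sym (lem (Σℚ f))))
  where
  lem : ∀ a → - a ≡ - 1ℚ * a
  lem = solve-∀ ℚ-ring

Σ-- : ∀ {k} (f g : Fin k → ℚ) → Σℚ (λ i → f i - g i) ≡ Σℚ f - Σℚ g
Σ-- f g = trans (Σ-+ f (λ i → - g i)) (cong (Σℚ f +_) (Σ-neg g))

Σ-swap : ∀ {k l} (f : Fin k → Fin l → ℚ) → Σℚ (λ i → Σℚ (f i)) ≡ Σℚ (λ j → Σℚ (λ i → f i j))
Σ-swap {zero} {l} f = sym (Σ-zero {l} {λ j → Σℚ (λ i → f i j)} (λ _ → refl))
Σ-swap {suc k} f = trans (cong (Σℚ (f zero) +_) (Σ-swap (f ∘ suc))) (sym (Σ-+ (f zero) (λ j → Σℚ (λ i → f (suc i) j))))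

Σ-punch : ∀ {k} (j : Fin (suc k)) (f : Fin (suc k) → ℚ) → Σℚ f ≡ f j + Σℚ (f ∘ punchIn j)
Σ-punch         zero    f = refl
Σ-punch {suc k} (suc j) f = trans (cong (f zero +_) (Σ-punch j (f ∘ suc))) (lem (f zero) (f (suc j)) (Σℚ (λ i → f (suc (punchIn j i)))))
  where
  lem : ∀ a b c → a + (b + c) ≡ b + (a + c)
  lem = solve-∀ ℚ-ring

Σ-last : ∀ {k} (f : Fin (suc k) → ℚ) → Σℚ f ≡ Σℚ (f ∘ inject₁) + f (fromℕ k)
Σ-last {zero}  f = +-comm (f zero) 0ℚ
Σ-last {suc k} f = trans (cong (f zero +_) (Σ-last (f ∘ suc))) (sym (+-assoc (f zero) (Σℚ (λ i → f (suc (inject₁ i)))) (f (fromℕ (suc k)))))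

Σ-const : ∀ k c → Σℚ {k} (λ _ → c) ≡ # k * c
Σ-const zero    c = sym (trans (cong (_* c) #0≡0) (*-zeroˡ c))
Σ-const (suc k) c = trans (cong (c +_) (Σ-const k c)) (trans (lem c (# k)) (cong (_* c) (sym (#-suc k))))
  where
  lem : ∀ c k → c + k * c ≡ (k + 1ℚ) * c
  lem = solve-∀ ℚ-ring

Σ-nonneg : ∀ {k} {f : Fin k → ℚ} → (∀ i → 0ℚ ≤ f i) → 0ℚ ≤ Σℚ f
Σ-nonneg {zero}  h = ≤-refl
Σ-nonneg {suc k} h = 0≤+ (h zero) (Σ-nonneg (λ i → h (suc i)))

Σ-mono : ∀ {k} {f g : Fin k → ℚ} → (∀ i → f i ≤ g i) → Σℚ f ≤ Σℚ g
Σ-mono {zero}  h = ≤-refl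
Σ-mono {suc k} h = +-mono-≤ (h zero) (Σ-mono (λ i → h (suc i)))

Σ-term≤ : ∀ {k} {f : Fin k → ℚ} j → (∀ i → 0ℚ ≤ f i) → f j ≤ Σℚ f
Σ-term≤ {suc k} {f} j h = subst (f j ≤_) (sym (Σ-punch j f)) (≤-by (Σℚ (f ∘ punchIn j)) (Σ-nonneg (λ i → h (punchIn j i))) refl)

Σ-abs : ∀ {k} {f g : Fin k → ℚ} → (∀ i → ∣ f i ∣ ≤ g i) → ∣ Σℚ f ∣ ≤ Σℚ g
Σ-abs {zero}  h = ≤-refl
Σ-abs {suc k} h = ∣+∣≤ (h zero) (Σ-abs (λ i → h (suc i)))

Σ-ι : ∀ {k} (f : Fin k → ℤ) → ι (Σℤ f) ≡ Σℚ (λ i → ι (f i))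
Σ-ι {zero}  f = refl
Σ-ι {suc k} f = trans (ι-+ (f zero) (Σℤ (f ∘ suc))) (cong (ι (f zero) +_) (Σ-ι (f ∘ suc)))

δ : ∀ {k} → Fin k → Fin k → ℚ
δ i j = χ (i Fin.≟ j)

δ-refl : ∀ {k} (i : Fin k) → δ i i ≡ 1ℚ
δ-refl i = χ-yes (i Fin.≟ i) refl

δ-≢ : ∀ {k} {i j : Fin k} → i ≢ j → δ i j ≡ 0ℚ
δ-≢ {i = i} {j} = χ-no (i Fin.≟ j)

δ-sym : ∀ {k} (i j : Fin k) → δ i j ≡ δ j i
δ-sym i j = χ-⇔ (i Fin.≟ j) (j Fin.≟ i) sym sym

Σ-δ : ∀ {k} (j : Fin k) (f : Fin k → ℚ) → Σℚ (λ i → δ i j * f i) ≡ f j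
Σ-δ {suc k} j f = trans (Σ-punch j (λ i → δ i j * f i)) (trans (cong₂ _+_ (trans (cong (_* f j) (δ-refl j)) (*-identityˡ (f j)))
  (Σ-zero (λ i → trans (cong (_* f (punchIn j i)) (δ-≢ (Finₚ.punchInᵢ≢i j i))) (*-zeroˡ (f (punchIn j i)))))) (+-identityʳ (f j)))

Σ-δ′ : ∀ {k} (j : Fin k) (f : Fin k → ℚ) → Σℚ (λ i → δ j i * f i) ≡ f j
Σ-δ′ j f = trans (Σ-cong (λ i → cong (_* f i) (δ-sym j i))) (Σ-δ j f)

-- Induction by deleting the value at `zero`. The missed index will be the basis vector transverse
-- to a facet.
complement : ∀ {k} (f : Fin k → Fin (suc k)) → (∀ i j → f i ≡ f j → i ≡ j) →
  Σ (Fin (suc k)) λ r → (∀ i → f i ≢ r) × (∀ (F : Fin (suc k) → ℚ) → Σℚ F ≡ F r + Σℚ (F ∘ f))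
complement {zero}  f inj = zero , (λ ()) , (λ F → refl)
complement {suc k} f inj = punchIn t r′ , miss , sum
  where
  t = f zero
  t≢ : ∀ i → t ≢ f (suc i)
  t≢ i e with inj zero (suc i) e
  ... | ()
  g : Fin k → Fin (suc k)
  g i = punchOut (t≢ i)
  g-inj : ∀ i j → g i ≡ g j → i ≡ j
  g-inj i j e = Finₚ.suc-injective (inj (suc i) (suc j) (Finₚ.punchOut-injective (t≢ i) (t≢ j) e))
  ih = complement g g-inj
  r′ = proj₁ ih
  back : ∀ i → punchIn t (g i) ≡ f (suc i)
  back i = Finₚ.punchIn-punchOut (t≢ i)
  miss : ∀ i → f i ≢ punchIn t r′
  miss zero    e = Finₚ.punchInᵢ≢i t r′ (sym e)
  miss (suc i) e = proj₁ (proj₂ ih) i (Finₚ.punchIn-injective t (g i) r′ (trans (back i) e))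
  sum : ∀ (F : Fin (suc (suc k)) → ℚ) → Σℚ F ≡ F (punchIn t r′) + Σℚ (F ∘ f)
  sum F = trans (Σ-punch t F) (trans (cong (F t +_) (trans (proj₂ (proj₂ ih) (F ∘ punchIn t)) (cong (F (punchIn t r′) +_) (Σ-cong (λ i → cong F (back i))))))
    (lem (F t) (F (punchIn t r′)) (Σℚ (λ i → F (f (suc i))))))
    where
    lem : ∀ a b c → a + (b + c) ≡ b + (a + c)
    lem = solve-∀ ℚ-ring

-- Integrality and lattice bases

int-ι : ∀ z → IsInt (ι z)
int-ι z = z , refl

int-+ : ∀ {p q} → IsInt p → IsInt q → IsInt (p + q)
int-+ (a , refl) (b , refl) = a ℤ.+ b , sym (ι-+ a b)

int-* : ∀ {p q} → IsInt p → IsInt q → IsInt (p * q)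
int-* (a , refl) (b , refl) = a ℤ.* b , sym (ι-* a b)

int-neg : ∀ {p} → IsInt p → IsInt (- p)
int-neg (a , refl) = ℤ.- a , sym (ι-neg a)

int-- : ∀ {p q} → IsInt p → IsInt q → IsInt (p - q)
int-- p q = int-+ p (int-neg q)

int-Σ : ∀ {k} {f : Fin k → ℚ} → (∀ i → IsInt (f i)) → IsInt (Σℚ f)
int-Σ {zero}  h = ℤ.+ 0 , refl
int-Σ {suc k} h = int-+ (h zero) (int-Σ (λ i → h (suc i)))

int-# : ∀ n → IsInt (# n)
int-# n = ℤ.+ n , #≡ι n

int-χ : ∀ {P : Set} (d : Dec P) → IsInt (χ d)
int-χ (yes _) = ℤ.+ 1 , refl
int-χ (no _)  = ℤ.+ 0 , refl

lookup-ext : ∀ {A : Set} {k} {x y : Vec A k} → (∀ i → lookup x i ≡ lookup y i) → x ≡ y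
lookup-ext {x = x} {y} h = trans (sym (Vecₚ.tabulate∘lookup x)) (trans (Vecₚ.tabulate-cong h) (Vecₚ.tabulate∘lookup y))

unit-δ : ∀ {k} (i c : Fin k) → ι (lookup (unit i) c) ≡ δ c i
unit-δ i c = trans (cong ι (Vecₚ.lookup∘tabulate (λ c → if does (c Fin.≟ i) then ℤ.+ 1 else ℤ.+ 0) c)) (go (c Fin.≟ i))
  where
  go : ∀ {P : Set} (d : Dec P) → ι (if does d then ℤ.+ 1 else ℤ.+ 0) ≡ χ d
  go (yes _) = refl
  go (no _)  = refl

pt : ∀ {m} → Pt m → Fin m → ℚ
pt x c = ι (lookup x c)

comb : ∀ {k m} → (Fin k → ℚ) → (Fin k → Pt m) → Fin m → ℚ
comb λ' g c = Σℚ (λ i → λ' i * pt (g i) c)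

combQ-elim : ∀ {k m} {λ' : Fin k → ℚ} {g : Fin k → Pt m} {y} → combQ λ' g ≡ y → ∀ c → comb λ' g c ≡ lookup y c
combQ-elim {λ' = λ'} {g} e c = trans (sym (Vecₚ.lookup∘tabulate (comb λ' g) c)) (cong (λ z → lookup z c) e)

combQ-intro : ∀ {k m} {λ' : Fin k → ℚ} {g : Fin k → Pt m} {y} → (∀ c → comb λ' g c ≡ lookup y c) → combQ λ' g ≡ y
combQ-intro {λ' = λ'} {g} h = lookup-ext (λ c → trans (Vecₚ.lookup∘tabulate (comb λ' g) c) (h c))

module DualBasis {m} (b : Fin m → Pt m) (basis : IsLatticeBasis b) where

  M : Fin m → Fin m → ℤ
  M c = proj₁ (proj₁ basis (unit c))

  expand : ∀ c r → Σℚ (λ k → ι (M c k) * pt (b k) r) ≡ δ r c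
  expand c r = trans (sym (trans (Σ-ι (λ k → M c k ℤ.* lookup (b k) r)) (Σ-cong (λ k → ι-* (M c k) (lookup (b k) r)))))
    (trans (cong ι (trans (sym (Vecₚ.lookup∘tabulate (λ r → Σℤ (λ i → M c i ℤ.* lookup (b i) r)) r)) (cong (λ z → lookup z r) (proj₂ (proj₁ basis (unit c)))))) (unit-δ c r))

  -- The coordinate functionals of the basis on rational vectors. They are integral on integral
  -- vectors because the `M c k` are the integer coordinates of the unit vectors.
  ℓ : Fin m → (Fin m → ℚ) → ℚ
  ℓ k z = Σℚ (λ c → z c * ι (M c k))

  ℓ-expand : ∀ z r → Σℚ (λ k → ℓ k z * pt (b k) r) ≡ z r
  ℓ-expand z r = trans (Σ-cong (λ k → trans (sym (Σ-*ʳ (pt (b k) r) (λ c → z c * ι (M c k)))) (Σ-cong (λ c → *-assoc (z c) (ι (M c k)) (pt (b k) r)))))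
    (trans (Σ-swap (λ k c → z c * (ι (M c k) * pt (b k) r))) (trans (Σ-cong (λ c → trans (Σ-*ˡ (z c) (λ k → ι (M c k) * pt (b k) r)) (trans (cong (z c *_) (expand c r)) (*-comm (z c) (δ r c))))) (Σ-δ′ r z)))

  -- The differences of the two sides over all `k` are integers, and they are the coefficients of a
  -- vanishing combination of the basis; so independence over ℤ suffices.
  ℓ-dual : ∀ j k → ℓ k (pt (b j)) ≡ δ j k
  ℓ-dual j k = trans (lem (ℓ k (pt (b j))) (δ j k)) (trans (cong (_+ δ j k) (trans (sym (ιd k)) (cong ι (proj₂ basis d zero-comb k)))) (+-identityˡ (δ j k)))
    where
    lem : ∀ a b → a ≡ a - b + b
    lem = solve-∀ ℚ-ring
    int-δ : ∀ j k → IsInt (δ {m} j k)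
    int-δ j k = int-χ (j Fin.≟ k)
    int-d : ∀ k → IsInt (ℓ k (pt (b j)) - δ j k)
    int-d k = int-- (int-Σ {f = λ c → pt (b j) c * ι (M c k)} (λ c → int-* (int-ι (lookup (b j) c)) (int-ι (M c k)))) (int-δ j k)
    d : Fin m → ℤ
    d k = proj₁ (int-d k)
    ιd : ∀ k → ι (d k) ≡ ℓ k (pt (b j)) - δ j k
    ιd k = sym (proj₂ (int-d k))
    lem₂ : ∀ a b c → (a - b) * c ≡ a * c - b * c
    lem₂ = solve-∀ ℚ-ring
    zero-comb : combZ d b ≡ replicate m (ℤ.+ 0)
    zero-comb = lookup-ext (λ r → trans (Vecₚ.lookup∘tabulate (λ r → Σℤ (λ i → d i ℤ.* lookup (b i) r)) r) (trans (ι-injective (trans (Σ-ι (λ i → d i ℤ.* lookup (b i) r))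
      (trans (Σ-cong (λ i → trans (ι-* (d i) (lookup (b i) r)) (trans (cong (_* pt (b i) r) (ιd i)) (lem₂ (ℓ i (pt (b j))) (δ j i) (pt (b i) r)))))
        (trans (Σ-- (λ i → ℓ i (pt (b j)) * pt (b i) r) (λ i → δ j i * pt (b i) r)) (trans (cong₂ _-_ (ℓ-expand (pt (b j)) r) (Σ-δ′ j (λ i → pt (b i) r))) (+-inverseʳ (pt (b j) r))))))) (sym (Vecₚ.lookup-replicate r (ℤ.+ 0)))))

  ℓ-* : ∀ k s z → ℓ k (λ c → s * z c) ≡ s * ℓ k z
  ℓ-* k s z = trans (Σ-cong (λ c → *-assoc s (z c) (ι (M c k)))) (Σ-*ˡ s (λ c → z c * ι (M c k)))

  ℓ-Σ : ∀ k {l} (s : Fin l → ℚ) (z : Fin l → Fin m → ℚ) → ℓ k (λ c → Σℚ (λ i → s i * z i c)) ≡ Σℚ (λ i → s i * ℓ k (z i))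
  ℓ-Σ k s z = trans (Σ-cong (λ c → trans (sym (Σ-*ʳ (ι (M c k)) (λ i → s i * z i c))) (Σ-cong (λ i → *-assoc (s i) (z i c) (ι (M c k))))))
    (trans (Σ-swap (λ c i → s i * (z i c * ι (M c k)))) (Σ-cong (λ i → Σ-*ˡ (s i) (λ c → z i c * ι (M c k)))))

  ℓ-cong : ∀ k {y z} → (∀ c → y c ≡ z c) → ℓ k y ≡ ℓ k z
  ℓ-cong k h = Σ-cong (λ c → cong (_* ι (M c k)) (h c))

  ℓ-int : ∀ k {z} → (∀ c → IsInt (z c)) → IsInt (ℓ k z)
  ℓ-int k h = int-Σ (λ c → int-* (h c) (int-ι (M c k)))

lookup--ᵥ : ∀ {m} (x y : Pt m) c → pt (x -ᵥ y) c ≡ pt x c - pt y c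
lookup--ᵥ x y c = trans (cong ι (Vecₚ.lookup-zipWith ℤ._-_ c x y)) (ι-- (lookup x c) (lookup y c))

-- Relative to the last vertex, the other coefficients are values of dual functionals at an integral
-- vector. The last one is what remains of the integral sum.
basic-integral : ∀ {k m} (w : Fin (suc k) → Pt m) → IsBasicSimplex w → ∀ (λ' : Fin (suc k) → ℚ) →
  IsInt (Σℚ λ') → (∀ c → IsInt (comb λ' w c)) → ∀ i → IsInt (λ' i)
basic-integral {k} {m} w (b , basis , f , f-inj , bf) λ' int-sum int-comb = all
  where
  open DualBasis b basis
  L = fromℕ k
  z : Fin m → ℚ
  z c = comb λ' w c - Σℚ λ' * pt (w L) c
  z≡ : ∀ c → z c ≡ Σℚ (λ i → λ' (inject₁ i) * pt (b (f i)) c)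
  z≡ c = trans (cong₂ (λ p q → p - q * pt (w L) c) (Σ-last (λ i → λ' i * pt (w i) c)) (Σ-last λ'))
    (trans (lem (Σℚ (λ i → λ' (inject₁ i) * pt (w (inject₁ i)) c)) (λ' L) (pt (w L) c) (Σℚ (λ' ∘ inject₁)))
      (trans (cong (λ y → Σℚ (λ i → λ' (inject₁ i) * pt (w (inject₁ i)) c) - y) (sym (Σ-*ʳ (pt (w L) c) (λ' ∘ inject₁))))
        (trans (sym (Σ-- (λ i → λ' (inject₁ i) * pt (w (inject₁ i)) c) (λ i → λ' (inject₁ i) * pt (w L) c)))
          (Σ-cong (λ i → trans (lem₂ (λ' (inject₁ i)) (pt (w (inject₁ i)) c) (pt (w L) c)) (cong (λ' (inject₁ i) *_) (trans (sym (lookup--ᵥ (w (inject₁ i)) (w L) c)) (cong (λ y → pt y c) (sym (bf i))))))))))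
    where
    lem : ∀ a l p s → a + l * p - (s + l) * p ≡ a - s * p
    lem = solve-∀ ℚ-ring
    lem₂ : ∀ a b c → a * b - a * c ≡ a * (b - c)
    lem₂ = solve-∀ ℚ-ring
  coord : ∀ i → λ' (inject₁ i) ≡ ℓ (f i) z
  coord i = sym (trans (ℓ-cong (f i) z≡) (trans (ℓ-Σ (f i) (λ' ∘ inject₁) (λ j → pt (b (f j)))) (trans (Σ-cong (λ j → trans (cong (λ' (inject₁ j) *_) (trans (ℓ-dual (f j) (f i)) (χ-⇔ (f j Fin.≟ f i) (j Fin.≟ i) (f-inj j i) (cong f)))) (*-comm (λ' (inject₁ j)) (δ j i)))) (Σ-δ i (λ' ∘ inject₁)))))
  first : ∀ i → IsInt (λ' (inject₁ i))
  first i = subst IsInt (sym (coord i)) (ℓ-int (f i) (λ c → int-- (int-comb c) (int-* int-sum (int-ι (lookup (w L) c)))))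
  last : IsInt (λ' L)
  last = subst IsInt (trans (cong (_- Σℚ (λ' ∘ inject₁)) (Σ-last λ')) (lem (Σℚ (λ' ∘ inject₁)) (λ' L))) (int-- int-sum (int-Σ first))
    where
    lem : ∀ a b → a + b - a ≡ b
    lem = solve-∀ ℚ-ring
  all : ∀ i → IsInt (λ' i)
  all i with view i
  ... | ‵fromℕ     = last
  ... | ‵inject₁ j = first j

-- Barycentric coordinates of a simplex with basic facets

caseLast-inject : ∀ {e} {A : Set} (f : Fin e → A) x i → caseLast f x (inject₁ i) ≡ f i
caseLast-inject {suc e} f x zero    = refl
caseLast-inject {suc e} f x (suc i) = caseLast-inject (f ∘ suc) x i

caseLast-last : ∀ {A : Set} e (f : Fin e → A) x → caseLast f x (fromℕ e) ≡ x
caseLast-last zero    f x = refl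
caseLast-last (suc e) f x = caseLast-last e (f ∘ suc) x

sign-factor : ∀ A → A ≢ ℤ.+ 0 → Σ ℤ λ s → Σ ℕ λ n → 1 ℕ.≤ n × ι s * ι A ≡ # n × ι s * ι s ≡ 1ℚ
sign-factor (ℤ.+ zero)    h = contradiction refl h
sign-factor (ℤ.+ (suc n)) h = ℤ.+ 1 , suc n , s≤s z≤n , trans (*-identityˡ (ι (ℤ.+ (suc n)))) (sym (#≡ι (suc n))) , refl
sign-factor -[1+ n ]      h = -[1+ 0 ] , suc n , s≤s z≤n , trans (sym (ι-* -[1+ 0 ] -[1+ n ])) (trans (cong ι (ℤₚ.-1*i≡-i -[1+ n ])) (sym (#≡ι (suc n)))) , refl

module Simplex (k : ℕ) (v : Fin (suc (suc k)) → Pt (suc k)) (indep : AffinelyIndependent v)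
               (facets : ∀ j → IsBasicSimplex (v ∘ punchIn j)) where

  private
    m = suc k

  unique : ∀ {λ' λ″ : Fin (suc m) → ℚ} → Σℚ λ' ≡ Σℚ λ″ → (∀ c → comb λ' v c ≡ comb λ″ v c) → ∀ i → λ' i ≡ λ″ i
  unique {λ'} {λ″} es ec i = trans (lem (λ' i) (λ″ i)) (trans (cong (_+ λ″ i) (indep (λ i → λ' i - λ″ i) zc zs i)) (+-identityˡ (λ″ i)))
    where
    lem : ∀ a b → a ≡ a - b + b
    lem = solve-∀ ℚ-ring
    lem₂ : ∀ a b c → (a - b) * c ≡ a * c - b * c
    lem₂ = solve-∀ ℚ-ring
    zs : Σℚ (λ i → λ' i - λ″ i) ≡ 0ℚ
    zs = trans (Σ-- λ' λ″) (trans (cong (_- Σℚ λ″) es) (+-inverseʳ (Σℚ λ″)))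
    zc : combQ (λ i → λ' i - λ″ i) v ≡ replicate m 0ℚ
    zc = combQ-intro {λ' = λ i → λ' i - λ″ i} {v} {replicate m 0ℚ} (λ c → trans (Σ-cong (λ i → lem₂ (λ' i) (λ″ i) (pt (v i) c))) (trans (Σ-- (λ i → λ' i * pt (v i) c) (λ i → λ″ i * pt (v i) c))
      (trans (cong (_- comb λ″ v c) (ec c)) (trans (+-inverseʳ (comb λ″ v c)) (sym (Vecₚ.lookup-replicate c 0ℚ))))))

  private
    fac = facets zero
    b = proj₁ fac
    basis = proj₁ (proj₂ fac)
    f = proj₁ (proj₂ (proj₂ fac))
    f-inj = proj₁ (proj₂ (proj₂ (proj₂ fac)))
    bf = proj₂ (proj₂ (proj₂ (proj₂ fac)))
    open DualBasis b basis
    vᶠ : Fin m → Pt m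
    vᶠ i = v (suc i)
    vL = vᶠ (fromℕ k)
    com = complement f f-inj
    r = proj₁ com
    p : Fin m → ℚ
    p c = pt (v zero) c - pt vL c
    -- The signed lattice distance of `v zero` from the opposite facet. As that facet is basic, its
    -- absolute value is the normalised volume.
    a = ℓ r p

    bf-pt : ∀ i c → pt (b (f i)) c ≡ pt (vᶠ (inject₁ i)) c - pt vL c
    bf-pt i c = trans (cong (λ z → pt z c) (bf i)) (lookup--ᵥ (vᶠ (inject₁ i)) vL c)

    decompose : ∀ z c → z c ≡ ℓ r z * pt (b r) c + Σℚ (λ i → ℓ (f i) z * (pt (vᶠ (inject₁ i)) c - pt vL c))
    decompose z c = trans (sym (ℓ-expand z c)) (trans (proj₂ (proj₂ com) (λ k → ℓ k z * pt (b k) c)) (cong (ℓ r z * pt (b r) c +_) (Σ-cong (λ i → cong (ℓ (f i) z *_) (bf-pt i c)))))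

    -- Weights of total `κ` from the weight `l` of `v zero` and coefficients along the edges of the
    -- opposite facet; the last vertex takes the rest.
    assemble : ℚ → ℚ → (Fin k → ℚ) → Fin (suc m) → ℚ
    assemble κ l A zero    = l
    assemble κ l A (suc i) = caseLast A (κ - l - Σℚ A) i

    assemble-sum : ∀ κ l A → Σℚ (assemble κ l A) ≡ κ
    assemble-sum κ l A = trans (cong (l +_) (trans (Σ-last (caseLast A (κ - l - Σℚ A))) (cong₂ _+_ (Σ-cong (caseLast-inject A (κ - l - Σℚ A))) (caseLast-last k A (κ - l - Σℚ A))))) (lem κ l (Σℚ A))
      where
      lem : ∀ κ l s → l + (s + (κ - l - s)) ≡ κ
      lem = solve-∀ ℚ-ring

    assemble-comb : ∀ κ l A c → comb (assemble κ l A) v c ≡ κ * pt vL c + (l * p c + Σℚ (λ i → A i * (pt (vᶠ (inject₁ i)) c - pt vL c)))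
    assemble-comb κ l A c = trans (cong (l * pt (v zero) c +_) (trans (Σ-last (λ i → caseLast A e i * pt (vᶠ i) c)) (cong₂ _+_ (Σ-cong (λ i → cong (_* pt (vᶠ (inject₁ i)) c) (caseLast-inject A e i))) (cong (_* pt vL c) (caseLast-last k A e)))))
      (trans (lem κ l (Σℚ A) (pt (v zero) c) (pt vL c) (Σℚ (λ i → A i * pt (vᶠ (inject₁ i)) c))) (cong (λ y → κ * pt vL c + (l * p c + y)) (sym (trans (Σ-cong (λ i → lem₂ (A i) (pt (vᶠ (inject₁ i)) c) (pt vL c))) (trans (Σ-- (λ i → A i * pt (vᶠ (inject₁ i)) c) (λ i → A i * pt vL c)) (cong (λ y → Σℚ (λ i → A i * pt (vᶠ (inject₁ i)) c) - y) (Σ-*ʳ (pt vL c) A)))))))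
      where
      e = κ - l - Σℚ A
      lem : ∀ κ l s v0 vl t → l * v0 + (t + (κ - l - s) * vl) ≡ κ * vl + (l * (v0 - vl) + (t - s * vl))
      lem = solve-∀ ℚ-ring
      lem₂ : ∀ a b c → a * (b - c) ≡ a * b - a * c
      lem₂ = solve-∀ ℚ-ring

    -- Otherwise `v zero` would lie in the hyperplane of the opposite facet, and expanding it in the
    -- edges there would be an affine dependence with coefficient 1 at `v zero`.
    a≢0 : a ≢ 0ℚ
    a≢0 e = 1≢0 (trans (unique {assemble 0ℚ 1ℚ (λ i → - ℓ (f i) p)} {λ _ → 0ℚ} (trans (assemble-sum 0ℚ 1ℚ (λ i → - ℓ (f i) p)) (sym (Σ-zero {suc m} {λ _ → 0ℚ} (λ _ → refl))))
        (λ c → trans (assemble-comb 0ℚ 1ℚ (λ i → - ℓ (f i) p) c) (trans (cong (λ y → 0ℚ * pt vL c + (1ℚ * y + Σℚ (λ i → - ℓ (f i) p * (pt (vᶠ (inject₁ i)) c - pt vL c)))) (trans (decompose p c) (cong (λ y → y * pt (b r) c + Σℚ (λ i → ℓ (f i) p * (pt (vᶠ (inject₁ i)) c - pt vL c))) e)))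
           (trans (cong (λ y → 0ℚ * pt vL c + (1ℚ * (0ℚ * pt (b r) c + Σℚ (λ i → ℓ (f i) p * (pt (vᶠ (inject₁ i)) c - pt vL c))) + y)) (trans (Σ-cong (λ i → lem₂ (ℓ (f i) p) (pt (vᶠ (inject₁ i)) c - pt vL c))) (Σ-neg (λ i → ℓ (f i) p * (pt (vᶠ (inject₁ i)) c - pt vL c)))))
             (trans (lem (pt vL c) (pt (b r) c) (Σℚ (λ i → ℓ (f i) p * (pt (vᶠ (inject₁ i)) c - pt vL c)))) (sym (Σ-zero {suc m} {λ i → 0ℚ * pt (v i) c} (λ i → *-zeroˡ (pt (v i) c))))))))
        zero) refl)
      where
      lem : ∀ x y s → 0ℚ * x + (1ℚ * (0ℚ * y + s) + - s) ≡ 0ℚ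
      lem = solve-∀ ℚ-ring
      lem₂ : ∀ a b → - a * b ≡ - (a * b)
      lem₂ = solve-∀ ℚ-ring

    off : (Fin m → ℚ) → ℚ → Fin m → ℚ
    off y κ c = y c - κ * pt vL c

  abstract
    -- Coordinates of the vector (y, κ) in the basis of the (v i, 1). Allowing every height `κ`
    -- treats points of all multiples kΔ and differences of points, which have height 0, alike.
    coords : (Fin m → ℚ) → ℚ → Fin (suc m) → ℚ
    coords y κ = assemble κ (ℓ r (off y κ) * inv a) (λ i → ℓ (f i) (off y κ) - ℓ r (off y κ) * inv a * ℓ (f i) p)

    private
      coords-zero : ∀ y κ → coords y κ zero ≡ ℓ r (off y κ) * inv a
      coords-zero y κ = refl

    coords-sum : ∀ y κ → Σℚ (coords y κ) ≡ κ
    coords-sum y κ = assemble-sum κ (ℓ r (off y κ) * inv a) (λ i → ℓ (f i) (off y κ) - ℓ r (off y κ) * inv a * ℓ (f i) p)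

    coords-comb : ∀ y κ c → comb (coords y κ) v c ≡ y c
    coords-comb y κ c = trans (assemble-comb κ l (λ i → ℓ (f i) z - l * ℓ (f i) p) c)
      (trans (cong₂ (λ s t → κ * pt vL c + (l * s + t)) (decompose p c) (trans (Σ-cong (λ i → lem₁ (ℓ (f i) z) l (ℓ (f i) p) (q i))) (trans (Σ-- (λ i → ℓ (f i) z * q i) (λ i → l * (ℓ (f i) p * q i))) (cong (λ t → Σℚ (λ i → ℓ (f i) z * q i) - t) (Σ-*ˡ l (λ i → ℓ (f i) p * q i))))))
        (trans (lem₂ (κ * pt vL c) l a (pt (b r) c) (Σℚ (λ i → ℓ (f i) p * q i)) (Σℚ (λ i → ℓ (f i) z * q i)))
          (trans (cong (λ t → κ * pt vL c + (t * pt (b r) c + Σℚ (λ i → ℓ (f i) z * q i))) la) (trans (cong (κ * pt vL c +_) (sym (decompose z c))) (lem₃ (κ * pt vL c) (y c))))))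
      where
      z : Fin m → ℚ
      z = off y κ
      l : ℚ
      l = ℓ r z * inv a
      q : Fin k → ℚ
      q i = pt (vᶠ (inject₁ i)) c - pt vL c
      la : l * a ≡ ℓ r z
      la = trans (*-assoc (ℓ r z) (inv a) a) (trans (cong (ℓ r z *_) (trans (*-comm (inv a) a) (inv-r a≢0))) (*-identityʳ (ℓ r z)))
      lem₁ : ∀ a l b q → (a - l * b) * q ≡ a * q - l * (b * q)
      lem₁ = solve-∀ ℚ-ring
      lem₂ : ∀ k l a b s t → k + (l * (a * b + s) + (t - l * s)) ≡ k + (l * a * b + t)
      lem₂ = solve-∀ ℚ-ring
      lem₃ : ∀ k y → k + (y - k) ≡ y
      lem₃ = solve-∀ ℚ-ring

  coords-unique : ∀ {λ'} y κ → Σℚ λ' ≡ κ → (∀ c → comb λ' v c ≡ y c) → ∀ i → λ' i ≡ coords y κ i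
  coords-unique {λ'} y κ es ec = unique {λ'} {coords y κ} (trans es (sym (coords-sum y κ))) (λ c → trans (ec c) (sym (coords-comb y κ c)))

  coords-0 : ∀ i → coords (λ _ → 0ℚ) 0ℚ i ≡ 0ℚ
  coords-0 i = sym (coords-unique {λ _ → 0ℚ} (λ _ → 0ℚ) 0ℚ (Σ-zero {suc m} (λ _ → refl)) (λ c → Σ-zero (λ i → *-zeroˡ (pt (v i) c))) i)

  coords-cong : ∀ {y y′ κ κ′} → (∀ c → y c ≡ y′ c) → κ ≡ κ′ → ∀ i → coords y κ i ≡ coords y′ κ′ i
  coords-cong {y} {y′} {κ} h refl = coords-unique {coords y κ} y′ κ (coords-sum y κ) (λ c → trans (coords-comb y κ c) (h c))

  coords-affine : ∀ y κ s z τ i → coords (λ c → y c + s * z c) (κ + s * τ) i ≡ coords y κ i + s * coords z τ i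
  coords-affine y κ s z τ i = sym (coords-unique {λ i → coords y κ i + s * coords z τ i} (λ c → y c + s * z c) (κ + s * τ)
      (trans (Σ-+ (coords y κ) (λ i → s * coords z τ i)) (cong₂ _+_ (coords-sum y κ) (trans (Σ-*ˡ s (coords z τ)) (cong (s *_) (coords-sum z τ)))))
      (λ c → trans (Σ-cong (λ i → lem (coords y κ i) s (coords z τ i) (pt (v i) c))) (trans (Σ-+ (λ i → coords y κ i * pt (v i) c) (λ i → s * (coords z τ i * pt (v i) c)))
         (cong₂ _+_ (coords-comb y κ c) (trans (Σ-*ˡ s (λ i → coords z τ i * pt (v i) c)) (cong (s *_) (coords-comb z τ c)))))) i)
    where
    lem : ∀ a s b p → (a + s * b) * p ≡ a * p + s * (b * p)
    lem = solve-∀ ℚ-ring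

  coords-Σ : ∀ {l} y κ (s : Fin l → ℚ) (z : Fin l → Fin m → ℚ) (τ : Fin l → ℚ) i →
    coords (λ c → y c + Σℚ (λ j → s j * z j c)) (κ + Σℚ (λ j → s j * τ j)) i ≡ coords y κ i + Σℚ (λ j → s j * coords (z j) (τ j) i)
  coords-Σ {zero}  y κ s z τ i = trans (coords-cong (λ c → +-identityʳ (y c)) (+-identityʳ κ) i) (sym (+-identityʳ (coords y κ i)))
  coords-Σ {suc l} y κ s z τ i = trans (coords-cong (λ c → sym (+-assoc (y c) (s zero * z zero c) (Σℚ (λ j → s (suc j) * z (suc j) c)))) (sym (+-assoc κ (s zero * τ zero) (Σℚ (λ j → s (suc j) * τ (suc j))))) i)
    (trans (coords-Σ (λ c → y c + s zero * z zero c) (κ + s zero * τ zero) (s ∘ suc) (z ∘ suc) (τ ∘ suc) i)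
      (trans (cong (_+ Σℚ (λ j → s (suc j) * coords (z (suc j)) (τ (suc j)) i)) (coords-affine y κ (s zero) (z zero) (τ zero) i)) (+-assoc (coords y κ i) (s zero * coords (z zero) (τ zero) i) (Σℚ (λ j → s (suc j) * coords (z (suc j)) (τ (suc j)) i)))))

  coords-vertex : ∀ j i → coords (pt (v j)) 1ℚ i ≡ δ i j
  coords-vertex j i = sym (coords-unique {λ i → δ i j} (pt (v j)) 1ℚ (trans (Σ-cong (λ i → sym (*-identityʳ (δ i j)))) (Σ-δ j (λ _ → 1ℚ))) (λ c → Σ-δ j (λ i → pt (v i) c)) i)

  gradient : Fin m → Fin (suc m) → ℚ
  gradient c = coords (λ c′ → δ c′ c) 0ℚ

  coords-gradient : ∀ y z κ i → coords z κ i ≡ coords y κ i + Σℚ (λ c → (z c - y c) * gradient c i)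
  coords-gradient y z κ i = trans (coords-cong {z} {λ c → y c + Σℚ (λ c′ → (z c′ - y c′) * δ c c′)} {κ} {κ + Σℚ (λ c → (z c - y c) * 0ℚ)}
      (λ c → sym (trans (cong (y c +_) (trans (Σ-cong (λ c′ → *-comm (z c′ - y c′) (δ c c′))) (Σ-δ′ c (λ c′ → z c′ - y c′)))) (lem (y c) (z c))))
      (sym (trans (cong (κ +_) (Σ-zero (λ c → *-zeroʳ (z c - y c)))) (+-identityʳ κ))) i)
    (coords-Σ y κ (λ c → z c - y c) (λ c c′ → δ c′ c) (λ _ → 0ℚ) i)
    where
    lem : ∀ a b → a + (b - a) ≡ b
    lem = solve-∀ ℚ-ring

  Lattice : (Fin m → ℚ) → ℚ → Set
  Lattice y κ = (∀ c → IsInt (y c)) × IsInt κ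

  -- A vanishing coordinate makes the vector a combination of the vertices of one facet, where
  -- `basic-integral` applies.
  facet-integral : ∀ {y κ} → Lattice y κ → ∀ j → coords y κ j ≡ 0ℚ → ∀ i → IsInt (coords y κ i)
  facet-integral {y} {κ} (iy , iκ) j e i with j Fin.≟ i
  ... | yes refl = ℤ.+ 0 , e
  ... | no j≢i = subst (λ z → IsInt (coords y κ z)) (Finₚ.punchIn-punchOut j≢i) (basic-integral (v ∘ punchIn j) (facets j) (coords y κ ∘ punchIn j)
      (subst IsInt (trans (sym (coords-sum y κ)) (drop (coords y κ) e)) iκ)
      (λ c → subst IsInt (trans (sym (coords-comb y κ c)) (drop (λ i → coords y κ i * pt (v i) c) (trans (cong (_* pt (v j) c) e) (*-zeroˡ (pt (v j) c))))) (iy c)) (punchOut j≢i))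
    where
    drop : ∀ (F : Fin (suc m) → ℚ) → F j ≡ 0ℚ → Σℚ F ≡ Σℚ (F ∘ punchIn j)
    drop F z = trans (Σ-punch j F) (trans (cong (_+ Σℚ (F ∘ punchIn j)) z) (+-identityˡ (Σℚ (F ∘ punchIn j))))

  private
    p-int : ∀ c → IsInt (p c)
    p-int c = int-- (int-ι (lookup (v zero) c)) (int-ι (lookup vL c))
    a-int = ℓ-int r p-int
    A = proj₁ a-int
    A≡ : a ≡ ι A
    A≡ = proj₂ a-int
    sf = sign-factor A (λ e → a≢0 (trans A≡ (cong ι e)))

  abstract
    n : ℕ
    n = proj₁ (proj₂ sf)

    1≤n : 1 ℕ.≤ n
    1≤n = proj₁ (proj₂ (proj₂ sf))

    private
      sg : ℤ
      sg = proj₁ sf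
      sA : ι sg * a ≡ # n
      sA = trans (cong (ι sg *_) A≡) (proj₁ (proj₂ (proj₂ (proj₂ sf))))
      ss : ι sg * ι sg ≡ 1ℚ
      ss = proj₂ (proj₂ (proj₂ (proj₂ sf)))

  private
    n-factor : ∀ x → # n * (x * inv a) ≡ ι sg * x
    n-factor x = trans (cong (_* (x * inv a)) (sym sA)) (trans (lem (ι sg) a x (inv a)) (trans (cong (ι sg * x *_) (inv-r a≢0)) (*-identityʳ (ι sg * x))))
      where
      lem : ∀ s a x i → s * a * (x * i) ≡ s * x * (a * i)
      lem = solve-∀ ℚ-ring

  -- a lattice vector at height 1 over the facet opposite v zero
  g : Fin m → ℚ
  g c = ι sg * pt (b r) c

  g-lattice : Lattice g 0ℚ
  g-lattice = (λ c → int-* (int-ι sg) (int-ι (lookup (b r) c))) , (ℤ.+ 0 , refl)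

  θ : Fin (suc m) → ℚ
  θ = coords g 0ℚ

  nθ₀ : # n * θ zero ≡ 1ℚ
  nθ₀ = trans (trans (cong (# n *_) (coords-zero g 0ℚ)) (n-factor (ℓ r (off g 0ℚ)))) (trans (cong (ι sg *_) (trans (ℓ-cong r (λ c → lem (ι sg * pt (b r) c) (pt vL c))) (trans (ℓ-* r (ι sg) (pt (b r))) (trans (cong (ι sg *_) (trans (ℓ-dual r r) (δ-refl r))) (*-identityʳ (ι sg)))))) ss)
    where
    lem : ∀ x y → x - 0ℚ * y ≡ x
    lem = solve-∀ ℚ-ring

  height-integral : ∀ {y κ} → Lattice y κ → IsInt (# n * coords y κ zero)
  height-integral {y} {κ} (iy , iκ) = subst IsInt (sym (trans (cong (# n *_) (coords-zero y κ)) (n-factor (ℓ r (off y κ))))) (int-* (int-ι sg) (ℓ-int r (λ c → int-- (iy c) (int-* iκ (int-ι (lookup vL c))))))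

  lattice-affine : ∀ {y κ s z τ} → Lattice y κ → IsInt s → Lattice z τ → Lattice (λ c → y c + s * z c) (κ + s * τ)
  lattice-affine (iy , iκ) is (iz , iτ) = (λ c → int-+ (iy c) (int-* is (iz c))) , int-+ iκ (int-* is iτ)

  vertex-lattice : ∀ j → Lattice (pt (v j)) 1ℚ
  vertex-lattice j = (λ c → int-ι (lookup (v j) c)) , (ℤ.+ 1 , refl)

  zero-lattice : Lattice (λ _ → 0ℚ) 0ℚ
  zero-lattice = (λ _ → ℤ.+ 0 , refl) , (ℤ.+ 0 , refl)

  -- the lattice is generated by g and the vertices
  generated : ∀ {y κ} → Lattice y κ → ∀ i → IsInt (coords y κ i - # n * coords y κ zero * θ i)
  generated {y} {κ} lat i = subst IsInt (trans (coords-affine y κ (- h) g 0ℚ i) (lem (coords y κ i) h (θ i)))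
      (facet-integral (lattice-affine lat (int-neg (height-integral lat)) g-lattice) zero vanish i)
    where
    -- This is the lattice height over the facet opposite `v zero`, in steps of `g`; subtracting `h`
    -- copies of `g` leads into the span of that facet.
    h = # n * coords y κ zero
    lem : ∀ a h t → a + - h * t ≡ a - h * t
    lem = solve-∀ ℚ-ring
    vanish : coords (λ c → y c + - h * g c) (κ + - h * 0ℚ) zero ≡ 0ℚ
    vanish = trans (coords-affine y κ (- h) g 0ℚ zero) (trans (lem₂ (coords y κ zero) (# n) (θ zero)) (trans (cong (λ z → coords y κ zero - coords y κ zero * z) nθ₀) (lem₃ (coords y κ zero))))
      where
      lem₂ : ∀ c n t → c + - (n * c) * t ≡ c - c * (n * t)
      lem₂ = solve-∀ ℚ-ring
      lem₃ : ∀ c → c - c * 1ℚ ≡ 0ℚ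
      lem₃ = solve-∀ ℚ-ring

  -- The lattice vector `n g - v zero` has coordinate 0 at `v zero`, so all its coordinates are
  -- integral.
  nθ-integral : ∀ i → IsInt (# n * θ i)
  nθ-integral i = subst IsInt (trans (cong (_+ δ i zero) (trans (coords-affine y₀ κ₀ (# n) g 0ℚ i) (cong (_+ # n * θ i) (y₀-coords i)))) (lem (# n * θ i) (δ i zero)))
      (int-+ (facet-integral (lattice-affine y₀-lattice (int-# n) g-lattice) zero vanish i) (int-χ (i Fin.≟ zero)))
    where
    y₀ : Fin m → ℚ
    y₀ c = 0ℚ + - 1ℚ * pt (v zero) c
    κ₀ = 0ℚ + - 1ℚ * 1ℚ
    y₀-lattice : Lattice y₀ κ₀
    y₀-lattice = lattice-affine zero-lattice (ℤ.- (ℤ.+ 1) , refl) (vertex-lattice zero)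
    y₀-coords : ∀ i → coords y₀ κ₀ i ≡ - δ i zero
    y₀-coords i = trans (coords-affine (λ _ → 0ℚ) 0ℚ (- 1ℚ) (pt (v zero)) 1ℚ i) (trans (cong₂ (λ p q → p + - 1ℚ * q) (coords-0 i) (coords-vertex zero i)) (lem₁ (δ i zero)))
      where
      lem₁ : ∀ d → 0ℚ + - 1ℚ * d ≡ - d
      lem₁ = solve-∀ ℚ-ring
    lem : ∀ t d → - d + t + d ≡ t
    lem = solve-∀ ℚ-ring
    vanish : coords (λ c → y₀ c + # n * g c) (κ₀ + # n * 0ℚ) zero ≡ 0ℚ
    vanish = trans (coords-affine y₀ κ₀ (# n) g 0ℚ zero) (trans (cong₂ _+_ (y₀-coords zero) nθ₀) refl)

  -- Subtract `s θ j` copies of `v j` from `s g`: the coordinate at `j` becomes 0, and the basic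
  -- facet opposite `v j` makes the coordinate at `zero` integral. This is what makes every residue
  -- prime to `n`.
  θ-faithful : ∀ {s} → IsInt s → ∀ j → IsInt (s * θ j) → IsInt (s * θ zero)
  θ-faithful {s} is zero    it = it
  θ-faithful {s} is (suc j) it = subst IsInt (trans (co zero) (trans (cong (λ z → s * θ zero - s * θ (suc j) * z) (δ-≢ {i = zero} {suc j} (λ ()))) (lem₂ (s * θ zero) (s * θ (suc j)))))
      (facet-integral lat (suc j) (trans (co (suc j)) (trans (cong (λ z → s * θ (suc j) - s * θ (suc j) * z) (δ-refl (suc j))) (lem₃ (s * θ (suc j))))) zero)
    where
    t = s * θ (suc j)
    y : Fin m → ℚ
    y c = 0ℚ + s * g c + - t * pt (v (suc j)) c
    κ = 0ℚ + s * 0ℚ + - t * 1ℚ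
    lat : Lattice y κ
    lat = lattice-affine (lattice-affine zero-lattice is g-lattice) (int-neg it) (vertex-lattice (suc j))
    lem₂ : ∀ a b → a - b * 0ℚ ≡ a
    lem₂ = solve-∀ ℚ-ring
    lem₃ : ∀ a → a - a * 1ℚ ≡ 0ℚ
    lem₃ = solve-∀ ℚ-ring
    co : ∀ i → coords y κ i ≡ s * θ i - t * δ i (suc j)
    co i = trans (coords-affine (λ c → 0ℚ + s * g c) (0ℚ + s * 0ℚ) (- t) (pt (v (suc j))) 1ℚ i)
      (trans (cong₂ (λ p q → p + - t * q) (trans (coords-affine (λ _ → 0ℚ) 0ℚ s g 0ℚ i) (cong (_+ s * θ i) (coords-0 i))) (coords-vertex (suc j) i)) (lem₁ (s * θ i) t (δ i (suc j))))
      where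
      lem₁ : ∀ a t d → 0ℚ + a + - t * d ≡ a - t * d
      lem₁ = solve-∀ ℚ-ring

-- Lattice points of multiples of the simplex

neg-involutive : ∀ p → - - p ≡ p
neg-involutive = solve-∀ ℚ-ring

natural : ∀ {q} → IsInt q → 0ℚ ≤ q → ∃ λ a → q ≡ # a
natural (ℤ.+ a , e)    _ = a , trans e (sym (#≡ι a))
natural (-[1+ a ] , e) h = contradiction (ι-cancel-≤ {ℤ.+ 0} { -[1+ a ]} (subst (0ℚ ≤_) e h)) (λ ())

#-injective : ∀ {a b} → # a ≡ # b → a ≡ b
#-injective e = ℕₚ.≤-antisym (#-cancel (≤-reflexive e)) (#-cancel (≤-reflexive (sym e)))

Σ-zero⁻ : ∀ {k} {f : Fin k → ℚ} → (∀ i → 0ℚ ≤ f i) → Σℚ f ≡ 0ℚ → ∀ i → f i ≡ 0ℚ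
Σ-zero⁻ {f = f} h e i = ≤-antisym (subst (f i ≤_) e (Σ-term≤ {f = f} i h)) (h i)

Σ-≥1 : ∀ {k} {f : Fin k → ℚ} → (∀ i → IsInt (f i)) → (∀ i → 0ℚ ≤ f i) → ¬ (∃ λ i → f i ≡ 0ℚ) → # k ≤ Σℚ f
Σ-≥1 {k} {f} int pos ¬z = subst (_≤ Σℚ f) (trans (Σ-const k 1ℚ) (*-identityʳ (# k))) (Σ-mono {f = λ _ → 1ℚ} (λ i → go i (natural (int i) (pos i))))
  where
  go : ∀ i → (∃ λ a → f i ≡ # a) → 1ℚ ≤ f i
  go i (zero  , e) = contradiction (i , trans e #0≡0) ¬z
  go i (suc a , e) = subst (1ℚ ≤_) (sym e) (#≥1 (s≤s z≤n))

integral-point : ∀ {m} {y : Fin m → ℚ} → (∀ c → IsInt (y c)) → Σ (Pt m) λ x → ∀ c → lookup (Vec.map ι x) c ≡ y c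
integral-point {y = y} h = x , λ c → trans (Vecₚ.lookup-map c ι x) (trans (cong ι (Vecₚ.lookup∘tabulate (λ c → proj₁ (h c)) c)) (sym (proj₂ (h c))))
  where x = tabulate (λ c → proj₁ (h c))

-- The class of a lattice vector modulo the vertices: `point`, at height `level`, is the
-- representative in Par(Δ), with the fractional parts as coordinates.
record Reduction {k m} (n : ℕ) (coords : (Fin m → ℚ) → ℚ → Fin k → ℚ) (y : Fin m → ℚ) (κ : ℚ) : Set where
  field
    q r     : Fin k → ℕ
    r<n     : ∀ i → r i ℕ.< n
    split   : ∀ i → coords y κ i ≡ # (q i) + # (r i) * inv (# n)
    point   : Pt m
    level   : ℕ
    coords′ : ∀ i → coords (lookup (Vec.map ι point)) (# level) i ≡ # (r i) * inv (# n)
    level≤  : # level ≤ κ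

module Points (k : ℕ) (v : Fin (suc (suc k)) → Pt (suc k)) (indep : AffinelyIndependent v)
              (facets : ∀ j → IsBasicSimplex (v ∘ punchIn j)) where

  open Simplex k v indep facets public

  private
    m = suc k

  instance
    n-nonZero : NonZero n
    n-nonZero = ℕ.>-nonZero 1≤n

  n>0 : 0ℚ < # n
  n>0 = #>0 1≤n

  abstract
    β : Fin (suc m) → ℤ
    β i = proj₁ (nθ-integral i)

    β≡ : ∀ i → # n * θ i ≡ ι (β i)
    β≡ i = proj₂ (nθ-integral i)

  divide-n : ∀ {c z} → # n * c ≡ z → c ≡ z * inv (# n)
  divide-n {c} {z} e = trans (sym (*-identityʳ c)) (trans (cong (c *_) (sym (inv-r> n>0))) (trans (lem c (# n) (inv (# n))) (cong (_* inv (# n)) e)))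
    where
    lem : ∀ c n i → c * (n * i) ≡ n * c * i
    lem = solve-∀ ℚ-ring

  n-coords-integral : ∀ {y κ} → Lattice y κ → ∀ i → IsInt (# n * coords y κ i)
  n-coords-integral {y} {κ} lat i = subst IsInt (lem (# n) (coords y κ i) (# n * coords y κ zero) (θ i)) (int-+ (int-* (int-# n) (generated lat i)) (int-* (height-integral lat) (nθ-integral i)))
    where
    lem : ∀ n c h t → n * (c - h * t) + h * (n * t) ≡ n * c
    lem = solve-∀ ℚ-ring

  translate : ∀ {y κ} → Lattice y κ → (q : Fin (suc m) → ℤ) → ∃₂ λ y′ κ′ → Lattice y′ κ′ × κ′ ≡ κ - Σℚ (ι ∘ q) × (∀ i → coords y′ κ′ i ≡ coords y κ i - ι (q i))
  translate {y} {κ} (iy , iκ) q = (λ c → y c + Σℚ (λ j → - ι (q j) * pt (v j) c)) , κ + Σℚ (λ j → - ι (q j) * 1ℚ) ,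
    ((λ c → int-+ (iy c) (int-Σ (λ j → int-* (int-neg (int-ι (q j))) (int-ι (lookup (v j) c))))) , int-+ iκ (int-Σ (λ j → int-* (int-neg (int-ι (q j))) (int-ι (ℤ.+ 1))))) ,
    cong (κ +_) (trans (Σ-cong (λ j → *-identityʳ (- ι (q j)))) (Σ-neg (ι ∘ q))) ,
    (λ i → trans (coords-Σ y κ (λ j → - ι (q j)) (λ j → pt (v j)) (λ _ → 1ℚ) i) (cong (coords y κ i +_) (trans (Σ-cong (λ j → trans (cong (- ι (q j) *_) (coords-vertex j i)) (*-comm (- ι (q j)) (δ i j)))) (Σ-δ′ i (λ j → - ι (q j))))))

  bary : Pt m → ℚ → Fin (suc m) → ℚ
  bary x κ = coords (lookup (Vec.map ι x)) κ

  point-lattice : ∀ x {κ} → IsInt κ → Lattice (lookup (Vec.map ι x)) κ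
  point-lattice x iκ = (λ c → lookup x c , Vecₚ.lookup-map c ι x) , iκ

  hull-coords : ∀ {λ' κ} y → Σℚ λ' ≡ κ → combQ λ' v ≡ y → ∀ i → λ' i ≡ coords (lookup y) κ i
  hull-coords {λ'} {κ} y es ec = coords-unique {λ'} (lookup y) κ es (combQ-elim {λ' = λ'} {v} {y} ec)

  coords-hull : ∀ y κ → combQ (coords (lookup y) κ) v ≡ y
  coords-hull y κ = combQ-intro {λ' = coords (lookup y) κ} {v} {y} (coords-comb (lookup y) κ)

  realize : ∀ {y κ} → Lattice y κ → (∀ i → 0ℚ ≤ coords y κ i) → Σ (Pt m) λ x → ∃ λ l → (∀ i → bary x (# l) i ≡ coords y κ i) × # l ≡ κ
  realize {y} {κ} (iy , iκ) h = proj₁ x , proj₁ l , coords-cong (proj₂ x) (sym (proj₂ l)) , sym (proj₂ l)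
    where
    x = integral-point iy
    l : ∃ λ a → κ ≡ # a
    l = natural iκ (subst (0ℚ ≤_) (coords-sum y κ) (Σ-nonneg {f = coords y κ} h))

  remove-integers : ∀ {y κ} → Lattice y κ → (q r : Fin (suc m) → ℕ) → (∀ i → r i ℕ.< n) → (∀ i → coords y κ i ≡ # (q i) + # (r i) * inv (# n)) → Reduction n coords y κ
  remove-integers {y} {κ} lat q r r<n split = finish (translate lat (λ i → ℤ.+ (q i)))
    where
    lem₂ : ∀ a b → a ≡ a - b + b
    lem₂ = solve-∀ ℚ-ring
    lem₃ : ∀ a b → a + b - a ≡ b
    lem₃ = solve-∀ ℚ-ring
    Q : ℚ
    Q = Σℚ (λ i → ι (ℤ.+ (q i)))
    Q≥0 : 0ℚ ≤ Q
    Q≥0 = Σ-nonneg {f = λ i → ι (ℤ.+ (q i))} (λ i → subst (0ℚ ≤_) (#≡ι (q i)) (#≥0 (q i)))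
    finish : (∃₂ λ y′ κ′ → Lattice y′ κ′ × κ′ ≡ κ - Q × (∀ i → coords y′ κ′ i ≡ coords y κ i - ι (ℤ.+ (q i)))) → Reduction n coords y κ
    finish (y′ , κ′ , lat′ , κ≡ , co′) = build (realize lat′ (λ i → subst (0ℚ ≤_) (sym (co i)) (0≤* (#≥0 (r i)) (inv-nonneg (#≥0 n)))))
      where
      co : ∀ i → coords y′ κ′ i ≡ # (r i) * inv (# n)
      co i = trans (co′ i) (trans (cong₂ _-_ (split i) (sym (#≡ι (q i)))) (lem₃ (# (q i)) (# (r i) * inv (# n))))
      build : (Σ (Pt m) λ x → ∃ λ l → (∀ i → bary x (# l) i ≡ coords y′ κ′ i) × # l ≡ κ′) → Reduction n coords y κ
      build (x , l , cx , l≡) = record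
        { q = q ; r = r ; r<n = r<n ; split = split ; point = x ; level = l
        ; coords′ = λ i → trans (cx i) (co i)
        ; level≤ = subst (_≤ κ) (sym l≡) (≤-by Q Q≥0 (trans (lem₂ κ Q) (cong (_+ Q) (sym κ≡)))) }

  reduce : ∀ {y κ} → Lattice y κ → (∀ i → 0ℚ ≤ coords y κ i) → Reduction n coords y κ
  reduce {y} {κ} lat h = remove-integers lat (λ i → proj₁ (nat i) / n) (λ i → proj₁ (nat i) % n) (λ i → m%n<n (proj₁ (nat i)) n) (λ i → split i (proj₁ (nat i)) (proj₂ (nat i)))
    where
    nat : ∀ i → ∃ λ a → # n * coords y κ i ≡ # a
    nat i = natural (n-coords-integral lat i) (0≤* (#≥0 n) (h i))
    lem : ∀ r q n i → (r + q * n) * i ≡ q * (n * i) + r * i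
    lem = solve-∀ ℚ-ring
    split : ∀ i a → # n * coords y κ i ≡ # a → coords y κ i ≡ # (a / n) + # (a % n) * inv (# n)
    split i a e = trans (divide-n e) (trans (cong (_* inv (# n)) (trans (cong #_ (m≡m%n+[m/n]*n a n)) (trans (#-+ (a % n) (a / n ℕ.* n)) (cong (# (a % n) +_) (#-* (a / n) n)))))
      (trans (lem (# (a % n)) (# (a / n)) (# n) (inv (# n))) (cong (_+ # (a % n) * inv (# n)) (trans (cong (# (a / n) *_) (inv-r> n>0)) (*-identityʳ (# (a / n)))))))

  slope : Fin (suc m) → ℚ
  slope i = Σℚ (λ c → ∣ gradient c i ∣)

  private
    W : ℚ
    W = Σℚ slope

  slope≥0 : ∀ i → 0ℚ ≤ slope i
  slope≥0 i = Σ-nonneg {f = λ c → ∣ gradient c i ∣} (λ c → 0≤∣p∣ (gradient c i))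

  -- Each coordinate is affine with gradient of size at most `W`, so within a distance of
  -- `1 / (n (W + 1))` it drops by less than `1 / n`.
  interior : ∀ x κ → (∀ i → inv (# n) ≤ bary x κ i) → InInterior (InScaledConv κ v) (Vec.map ι x)
  interior x κ h = ε , inv-pos nW>0 , λ z near → coords (lookup z) κ , pos z near , coords-sum (lookup z) κ , coords-hull z κ
    where
    W≥0 : 0ℚ ≤ W
    W≥0 = Σ-nonneg {f = slope} slope≥0
    W+1>0 : 0ℚ < W + 1ℚ
    W+1>0 = <-≤-trans 0<1 (≤-by W W≥0 (+-comm W 1ℚ))
    nW>0 : 0ℚ < # n * (W + 1ℚ)
    nW>0 = 0<* n>0 W+1>0
    ε = inv (# n * (W + 1ℚ))
    ε≥0 : 0ℚ ≤ ε
    ε≥0 = <⇒≤ (inv-pos nW>0)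
    lem : ∀ a b e → (a * b) * (e) ≡ a * (e * b)
    lem = solve-∀ ℚ-ring
    εW : ε * (W + 1ℚ) ≡ inv (# n)
    εW = sym (inv-unique (trans (sym (lem (# n) (W + 1ℚ) ε)) (inv-r> nW>0)))
    pos : ∀ z → (∀ c → ∣ lookup z c - lookup (Vec.map ι x) c ∣ < ε) → ∀ i → 0ℚ ≤ coords (lookup z) κ i
    pos z near i = subst (0ℚ ≤_) (sym (coords-gradient y₀ (lookup z) κ i)) (subst (_≤ bary x κ i + s) (+-inverseʳ (inv (# n))) (+-mono-≤ (h i) (subst (- inv (# n) ≤_) (neg-involutive s) (neg-antimono-≤ (≤-trans (p≤∣p∣ (- s)) (subst (_≤ inv (# n)) (sym (∣-p∣≡∣p∣ s)) small))))))
      where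
      y₀ = lookup (Vec.map ι x)
      s = Σℚ (λ c → (lookup z c - y₀ c) * gradient c i)
      small : ∣ s ∣ ≤ inv (# n)
      small = ≤-trans (Σ-abs {f = λ c → (lookup z c - y₀ c) * gradient c i} {λ c → ε * ∣ gradient c i ∣} (λ c → ∣*∣≤ {lookup z c - y₀ c} {gradient c i} (<⇒≤ (near c)) ≤-refl))
        (subst₂ _≤_ (sym (Σ-*ˡ ε (λ c → ∣ gradient c i ∣))) εW (*-monoˡ ε ε≥0 (≤-trans (Σ-term≤ {f = slope} i slope≥0) (≤-by 1ℚ 0≤1 refl))))

  -- If the coordinate at `j` were 0, a short move along `v a - v j` would stay in the ball and make
  -- it `- η`.
  interior-positive : ∀ x κ → InInterior (InScaledConv κ v) (Vec.map ι x) → ∀ j → bary x κ j ≢ 0ℚ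
  interior-positive x κ (ε , ε>0 , inside) j e = contradiction (<-≤-trans η>0 (subst (_≤ 0ℚ) (neg-involutive η) (neg-antimono-≤ {0ℚ} { - η} (subst (0ℚ ≤_) value (pos j))))) (<-irrefl refl)
    where
    a = punchIn j zero
    t : Fin m → ℚ
    t c = pt (v a) c - pt (v j) c
    D = Σℚ (λ c → ∣ t c ∣)
    D≥0 : 0ℚ ≤ D
    D≥0 = Σ-nonneg {f = λ c → ∣ t c ∣} (λ c → 0≤∣p∣ (t c))
    D+1>0 : 0ℚ < D + 1ℚ
    D+1>0 = <-≤-trans 0<1 (≤-by D D≥0 (+-comm D 1ℚ))
    η = ε * inv (D + 1ℚ)
    η>0 : 0ℚ < η
    η>0 = 0<* ε>0 (inv-pos D+1>0)
    y₀ = lookup (Vec.map ι x)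
    zf : Fin m → ℚ
    zf c = (y₀ c + η * pt (v a) c) + - η * pt (v j) c
    z : PtQ m
    z = tabulate zf
    lz : ∀ c → lookup z c ≡ zf c
    lz c = Vecₚ.lookup∘tabulate zf c
    lem : ∀ y e a b → (y + e * a) + - e * b - y ≡ e * (a - b)
    lem = solve-∀ ℚ-ring
    lem₂ : ∀ e d → e * d + e ≡ e * (d + 1ℚ)
    lem₂ = solve-∀ ℚ-ring
    lem₃ : ∀ e i d → e * i * d ≡ e * (d * i)
    lem₃ = solve-∀ ℚ-ring
    near : ∀ c → ∣ lookup z c - y₀ c ∣ < ε
    near c = ≤-<-trans (subst (λ s → ∣ s ∣ ≤ η * D) (sym (trans (cong (_- y₀ c) (lz c)) (lem (y₀ c) η (pt (v a) c) (pt (v j) c)))) (∣*∣≤ {η} {t c} (0≤⇒∣∣≤ (<⇒≤ η>0) ≤-refl) (Σ-term≤ {f = λ c → ∣ t c ∣} c (λ c → 0≤∣p∣ (t c)))))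
      (<-by η η>0 (sym (trans (lem₂ η D) (trans (lem₃ ε (inv (D + 1ℚ)) (D + 1ℚ)) (trans (cong (ε *_) (inv-r> D+1>0)) (*-identityʳ ε))))))
    inz = inside z near
    pos : ∀ i → 0ℚ ≤ coords (lookup z) κ i
    pos i = subst (0ℚ ≤_) (hull-coords {proj₁ inz} {κ} z (proj₁ (proj₂ (proj₂ inz))) (proj₂ (proj₂ (proj₂ inz))) i) (proj₁ (proj₂ inz) i)
    lem₄ : ∀ k e → k ≡ (k + e * 1ℚ) + - e * 1ℚ
    lem₄ = solve-∀ ℚ-ring
    lem₅ : ∀ e → (0ℚ + e * 0ℚ) + - e * 1ℚ ≡ - e
    lem₅ = solve-∀ ℚ-ring
    value : coords (lookup z) κ j ≡ - η
    value = trans (coords-cong {lookup z} {zf} {κ} {(κ + η * 1ℚ) + - η * 1ℚ} lz (lem₄ κ η) j)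
      (trans (coords-affine (λ c → y₀ c + η * pt (v a) c) (κ + η * 1ℚ) (- η) (pt (v j)) 1ℚ j)
        (trans (cong₂ (λ p q → p + - η * q) (trans (coords-affine y₀ κ η (pt (v a)) 1ℚ j) (cong₂ (λ p q → p + η * q) e (trans (coords-vertex a j) (δ-≢ (λ e → Finₚ.punchInᵢ≢i j zero (sym e)))))) (trans (coords-vertex j j) (δ-refl j)))
          (lem₅ η)))

-- The conditions compared with integrality of coordinates

vertex∈conv : ∀ {k m} (g : Fin k → Pt m) i → InConv g (Vec.map ι (g i))
vertex∈conv g i = (λ j → δ j i) , (λ j → χ≥0 (j Fin.≟ i)) , trans (Σ-cong (λ j → sym (*-identityʳ (δ j i)))) (Σ-δ i (λ _ → 1ℚ)) ,
  combQ-intro {λ' = λ j → δ j i} {g} {Vec.map ι (g i)} (λ c → trans (Σ-δ i (λ j → pt (g j) c)) (sym (Vecₚ.lookup-map c ι (g i))))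

lookup-take : ∀ {A : Set} r {d} (y : Vec A (r ℕ.+ d)) j → lookup (take r y) j ≡ lookup y (j ↑ˡ d)
lookup-take r {d} y j = trans (sym (Vecₚ.lookup-++ˡ (take r y) (Vec.drop r y) j)) (cong (λ z → lookup z (j ↑ˡ d)) (Vecₚ.take++drop≡id r y))

gens-top : ∀ {r d} (seg : Fin r → Pt d × Pt d) g → ∃ λ j′ → ∀ j → lookup (CayleyGens seg g) (j ↑ˡ d) ≡ lookup (unit j′) j
gens-top {r} seg g with splitAt r g
... | inj₁ j′ = j′ , Vecₚ.lookup-++ˡ (unit j′) (proj₁ (seg j′))
... | inj₂ j′ = j′ , Vecₚ.lookup-++ˡ (unit j′) (proj₂ (seg j′))

gens-↑ˡ : ∀ {r d} (seg : Fin r → Pt d × Pt d) j → CayleyGens seg (j ↑ˡ r) ≡ unit j Vec.++ proj₁ (seg j)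
gens-↑ˡ {r} seg j rewrite Finₚ.splitAt-↑ˡ r j r = refl

gens-↑ʳ : ∀ {r d} (seg : Fin r → Pt d × Pt d) j → CayleyGens seg (r ↑ʳ j) ≡ unit j Vec.++ proj₂ (seg j)
gens-↑ʳ {r} seg j rewrite Finₚ.splitAt-↑ʳ r r j = refl

row : ∀ {m N} (φ : AffZ m N) (x : PtQ m) r → lookup (applyQ φ x) r ≡ ι (lookup (AffZ.b φ) r) + Σℚ (λ c → ι (AffZ.A φ r c) * lookup x c)
row φ x r = Vecₚ.lookup∘tabulate (λ r → ι (lookup (AffZ.b φ) r) + Σℚ (λ c → ι (AffZ.A φ r c) * lookup x c)) r

affine-comb : ∀ {k m N} (φ : AffZ m N) (v : Fin k → Pt m) r (λ' : Fin k → ℚ) →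
  Σℚ (λ i → λ' i * lookup (applyQ φ (Vec.map ι (v i))) r) ≡ Σℚ λ' * ι (lookup (AffZ.b φ) r) + Σℚ (λ c → ι (AffZ.A φ r c) * comb λ' v c)
affine-comb φ v r λ' = trans (Σ-cong (λ i → trans (cong (λ' i *_) (trans (row φ (Vec.map ι (v i)) r) (cong (b +_) (Σ-cong (λ c → cong (a c *_) (Vecₚ.lookup-map c ι (v i))))))) (trans (*-distribˡ-+ (λ' i) b (Σℚ (λ c → a c * pt (v i) c))) (cong (λ' i * b +_) (trans (sym (Σ-*ˡ (λ' i) (λ c → a c * pt (v i) c))) (Σ-cong (λ c → lem (λ' i) (a c) (pt (v i) c))))))))
    (trans (Σ-+ (λ i → λ' i * b) (λ i → Σℚ (λ c → a c * (λ' i * pt (v i) c)))) (cong₂ _+_ (Σ-*ʳ b λ') (trans (Σ-swap (λ i c → a c * (λ' i * pt (v i) c))) (Σ-cong (λ c → Σ-*ˡ (a c) (λ i → λ' i * pt (v i) c))))))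
  where
  b = ι (lookup (AffZ.b φ) r)
  a : Fin _ → ℚ
  a c = ι (AffZ.A φ r c)
  lem : ∀ x y z → x * (y * z) ≡ y * (x * z)
  lem = solve-∀ ℚ-ring

≡ᵇ-≢ : ∀ {a b} → a ≢ b → (a ℕ.≡ᵇ b) ≡ false
≡ᵇ-≢ {a} {b} a≢b with a ℕ.≡ᵇ b in eq
... | false = refl
... | true  = contradiction (ℕₚ.≡ᵇ⇒≡ a b (subst Bool.T (sym eq) tt)) a≢b

no-elements : ∀ {A : Set} {P : A → Set} → HasCard P 0 → ∀ x → ¬ P x
no-elements ([] , _ , iff , _) x p with proj₂ (iff x) p
... | ()

module Conditions (e : ℕ) (v : Fin (suc (suc (2 ℕ.* e))) → Pt (suc (2 ℕ.* e))) (indep : AffinelyIndependent v)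
                  (facets : ∀ j → IsBasicSimplex (v ∘ punchIn j)) where

  open Points (2 ℕ.* e) v indep facets public

  private
    m d : ℕ
    m = suc (2 ℕ.* e)
    d = suc e

  -- Condition (1) in terms of the canonical coordinates, with height 0 included because a reduction
  -- can end there. All the other conditions are compared with this form.
  Integral : Set
  Integral = ∀ k → k ℕ.≤ e → ∀ x → (∀ i → 0ℚ ≤ bary x (# k) i) → ∀ i → IsInt (bary x (# k) i)

  cond1⇒integral : Cond1 e v → Integral
  cond1⇒integral c zero    k≤e x h i = ℤ.+ 0 , Σ-zero⁻ {f = bary x (# 0)} h (trans (coords-sum (lookup (Vec.map ι x)) (# 0)) #0≡0) i
  cond1⇒integral c (suc k) k≤e x h i = c (suc k) (s≤s z≤n) k≤e x (bary x (# (suc k))) h (trans (coords-sum (lookup (Vec.map ι x)) (# (suc k))) (#≡ι (suc k))) (coords-hull (Vec.map ι x) (# (suc k))) i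

  integral⇒cond1 : Integral → Cond1 e v
  integral⇒cond1 c k 1≤k k≤e x λ' h es ec i = subst IsInt (sym (co i)) (c k k≤e x (λ i → subst (0ℚ ≤_) (co i) (h i)) i)
    where
    co : ∀ i → λ' i ≡ bary x (# k) i
    co = hull-coords {λ'} (Vec.map ι x) (trans es (sym (#≡ι k))) ec

  fraction<1 : ∀ {r} → r ℕ.< n → # r * inv (# n) < 1ℚ
  fraction<1 {r} r<n = <-≤-trans (<-by (inv (# n)) (inv-pos n>0) (lem (# r) (inv (# n)))) (inv-≤ n>0 (subst₂ _≤_ (#-suc r) (sym (*-identityˡ (# n))) (#-mono r<n)))
    where
    lem : ∀ r i → (r + 1ℚ) * i ≡ r * i + i
    lem = solve-∀ ℚ-ring

  fraction≥0 : ∀ r → 0ℚ ≤ # r * inv (# n)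
  fraction≥0 r = 0≤* (#≥0 r) (inv-nonneg (#≥0 n))

  level-zero : ∀ x → (∀ i → 0ℚ ≤ bary x (# 0) i) → ∀ i → bary x (# 0) i ≡ 0ℚ
  level-zero x h = Σ-zero⁻ {f = bary x (# 0)} h (trans (coords-sum (lookup (Vec.map ι x)) (# 0)) #0≡0)

  -- If some residue of the reduced point is 0, that point lies over a facet. Otherwise all its
  -- coordinates are at least `1 / n`, and it is an interior lattice point of positive height at
  -- most `e`, against (2).
  cond2⇒integral : Cond2 e v → Integral
  cond2⇒integral c2 k k≤e x h i = go (Finₚ.any? (λ j → r j ℕ.≟ 0))
    where
    open Reduction (reduce (point-lattice x (int-# k)) h)
    go : Dec (∃ λ j → r j ≡ 0) → IsInt (bary x (# k) i)
    go (yes (j , rj)) = subst IsInt (sym (trans (split i) (cong (# (q i) +_) (sym (coords′ i))))) (int-+ (int-# (q i))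
      (facet-integral (point-lattice point (int-# level)) j (trans (coords′ j) (trans (cong (_* inv (# n)) (trans (cong #_ rj) #0≡0)) (*-zeroˡ (inv (# n))))) i))
    go (no ¬z) = contradiction (subst (λ κ → InInterior (InScaledConv κ v) (Vec.map ι point)) (#≡ι level) (interior point (# level) far)) (c2 level (pos level far) (ℕₚ.≤-trans (#-cancel level≤) k≤e) point)
      where
      far : ∀ i → inv (# n) ≤ bary point (# level) i
      far i = subst₂ _≤_ (*-identityˡ (inv (# n))) (sym (coords′ i)) (*-monoʳ (inv (# n)) (inv-nonneg (#≥0 n)) (#≥1 (ℕₚ.n≢0⇒n>0 (λ z → ¬z (i , z)))))
      pos : ∀ l → (∀ i → inv (# n) ≤ bary point (# l) i) → 1 ℕ.≤ l
      pos zero    f = contradiction (<-≤-trans (inv-pos n>0) (subst (inv (# n) ≤_) (level-zero point (λ i → ≤-trans (inv-nonneg (#≥0 n)) (f i)) zero) (f zero))) (<-irrefl refl)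
      pos (suc l) f = s≤s z≤n

  -- Coordinates of an interior point are nonzero; being also integral they are at least 1, and
  -- there are `2 d > k` of them.
  integral⇒cond2 : Integral → Cond2 e v
  integral⇒cond2 c k 1≤k k≤e x int@(ε , ε>0 , inside) = go (Finₚ.any? (λ j → bary x (# k) j ≟ℚ 0ℚ))
    where
    y = Vec.map ι x
    in-y = inside y (λ c → subst (λ z → ∣ z ∣ < ε) (sym (+-inverseʳ (lookup y c))) ε>0)
    h : ∀ i → 0ℚ ≤ bary x (# k) i
    h i = subst (0ℚ ≤_) (hull-coords {proj₁ in-y} y (trans (proj₁ (proj₂ (proj₂ in-y))) (sym (#≡ι k))) (proj₂ (proj₂ (proj₂ in-y))) i) (proj₁ (proj₂ in-y) i)
    go : Dec (∃ λ j → bary x (# k) j ≡ 0ℚ) → ⊥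
    go (yes (j , z)) = interior-positive x (# k) (subst (λ κ → InInterior (InScaledConv κ v) y) (sym (#≡ι k)) int) j z
    go (no ¬z) = ℕₚ.<-irrefl refl (ℕₚ.≤-trans (s≤s k≤e) (ℕₚ.≤-trans (s≤s (ℕₚ.m≤n*m e 2)) (ℕₚ.≤-trans (ℕₚ.n≤1+n m) (#-cancel (subst (# (suc m) ≤_) (coords-sum (lookup y) (# k)) (Σ-≥1 {f = bary x (# k)} (c k k≤e x h) h ¬z))))))

  par-point : ∀ x l → (∀ i → 0ℚ ≤ bary x (# l) i × bary x (# l) i < 1ℚ) → ParAt v l (x , ℤ.+ l)
  par-point x l h = refl , bary x (# l) , h , coords-hull (Vec.map ι x) (# l) , trans (coords-sum (lookup (Vec.map ι x)) (# l)) (#≡ι l)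

  cond3⇒integral : Cond3 e v → Integral
  cond3⇒integral (n′ , _ , hstar) k k≤e x h i = subst IsInt (sym (trans (split i) (cong (# (q i) +_) (sym (coords′ i))))) (int-+ (int-# (q i)) (go level coords′ (ℕₚ.≤-trans (#-cancel level≤) k≤e)))
    where
    open Reduction (reduce (point-lattice x (int-# k)) h)
    go : ∀ l → (∀ i → bary point (# l) i ≡ # (r i) * inv (# n)) → l ℕ.≤ e → IsInt (bary point (# l) i)
    go zero    co _   = ℤ.+ 0 , level-zero point (λ i → subst (0ℚ ≤_) (sym (co i)) (fraction≥0 (r i))) i
    go (suc l) co l≤e = contradiction (par-point point (suc l) (λ i → subst (λ z → 0ℚ ≤ z × z < 1ℚ) (sym (co i)) (fraction≥0 (r i) , fraction<1 (r<n i)))) (no-elements (subst (HasCard (ParAt v (suc l))) coeff≡0 (hstar (suc l))) (point , ℤ.+ (suc l)))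
      where
      coeff≡0 : coeff-1+[n-1]t^d n′ (suc e) (suc l) ≡ 0
      coeff≡0 = cong (λ b → if b then n′ ℕ.∸ 1 else 0) (≡ᵇ-≢ {l} {e} (λ l≡e → ℕₚ.<-irrefl l≡e l≤e))

  cond5⇒integral : Cond5 e v → Integral
  cond5⇒integral (seg , _ , φ , (onH , _ , _) , image) k k≤e x h i = go (Finₚ.any? (λ j → X j ≟ℚ 0ℚ))
    where
    y = lookup (Vec.map ι x)
    f : Fin d → Fin (suc m) → ℚ
    f j i = lookup (applyQ φ (Vec.map ι (v i))) (j ↑ˡ d)
    gen≥0 : ∀ g j → 0ℚ ≤ pt (CayleyGens seg g) (j ↑ˡ d)
    gen≥0 g j = subst (0ℚ ≤_) (sym (trans (cong ι (proj₂ (gens-top seg g) j)) (unit-δ (proj₁ (gens-top seg g)) j))) (χ≥0 (j Fin.≟ proj₁ (gens-top seg g)))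
    f≥0 : ∀ j i → 0ℚ ≤ f j i
    f≥0 j i = subst (0ℚ ≤_) (combQ-elim {λ' = proj₁ c} {CayleyGens seg} (proj₂ (proj₂ (proj₂ c))) (j ↑ˡ d)) (Σ-nonneg {f = λ g → proj₁ c g * pt (CayleyGens seg g) (j ↑ˡ d)} (λ g → 0≤* (proj₁ (proj₂ c) g) (gen≥0 g j)))
      where
      c : InCayley seg (applyQ φ (Vec.map ι (v i)))
      c = proj₁ (image (applyQ φ (Vec.map ι (v i)))) (Vec.map ι (v i) , vertex∈conv v i , refl)
    X : Fin d → ℚ
    X j = Σℚ (λ i → bary x (# k) i * f j i)
    X≥0 : ∀ j → 0ℚ ≤ X j
    X≥0 j = Σ-nonneg {f = λ i → bary x (# k) i * f j i} (λ i → 0≤* (h i) (f≥0 j i))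
    X-int : ∀ j → IsInt (X j)
    X-int j = subst IsInt (sym (affine-comb φ v (j ↑ˡ d) (bary x (# k))))
      (int-+ (int-* (subst IsInt (sym (coords-sum y (# k))) (int-# k)) (int-ι (lookup (AffZ.b φ) (j ↑ˡ d))))
             (int-Σ (λ c → int-* (int-ι (AffZ.A φ (j ↑ˡ d) c)) (subst IsInt (sym (coords-comb y (# k) c)) (lookup x c , Vecₚ.lookup-map c ι x)))))
    X-sum : Σℚ X ≡ # k
    X-sum = trans (Σ-swap (λ j i → bary x (# k) i * f j i)) (trans (Σ-cong (λ i → trans (Σ-*ˡ (bary x (# k) i) (λ j → f j i)) (trans (cong (bary x (# k) i *_) (trans (Σ-cong (λ j → sym (lookup-take d (applyQ φ (Vec.map ι (v i))) j))) (onH (Vec.map ι (v i))))) (*-identityʳ (bary x (# k) i))))) (coords-sum y (# k)))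
    go : Dec (∃ λ j → X j ≡ 0ℚ) → IsInt (bary x (# k) i)
    go (no ¬z) = contradiction (ℕₚ.≤-trans (#-cancel (subst (# d ≤_) X-sum (Σ-≥1 {f = X} X-int X≥0 ¬z))) k≤e) (ℕₚ.<-irrefl refl)
    go (yes (j , Xj)) = go′ (Finₚ.any? (λ i → bary x (# k) i ≟ℚ 0ℚ))
      where
      products : ∀ i → bary x (# k) i * f j i ≡ 0ℚ
      products = Σ-zero⁻ {f = λ i → bary x (# k) i * f j i} (λ i → 0≤* (h i) (f≥0 j i)) Xj
      go′ : Dec (∃ λ i → bary x (# k) i ≡ 0ℚ) → IsInt (bary x (# k) i)
      go′ (yes (i₀ , z)) = facet-integral (point-lattice x (int-# k)) i₀ z i
      -- If no barycentric coordinate vanishes, then the `j`-th Cayley coordinate is 0 at every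
      -- vertex and hence on all of Δ; yet the generator over the `j`-th unit vector is in the image
      -- and has coordinate 1.
      go′ (no ¬z) = contradiction (trans (sym one) nought) 1≢0
        where
        lem : ∀ b i f → b * i * f ≡ b * f * i
        lem = solve-∀ ℚ-ring
        fz : ∀ i → f j i ≡ 0ℚ
        fz i = trans (sym (*-identityˡ (f j i))) (trans (cong (_* f j i) (sym (inv-r {bary x (# k) i} (λ z → ¬z (i , z))))) (trans (lem (bary x (# k) i) (inv (bary x (# k) i)) (f j i)) (trans (cong (_* inv (bary x (# k) i)) (products i)) (*-zeroˡ (inv (bary x (# k) i))))))
        y₁ = Vec.map ι (CayleyGens seg (j ↑ˡ d))
        pre = proj₂ (image y₁) (vertex∈conv (CayleyGens seg) (j ↑ˡ d))
        x₁ = proj₁ pre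
        λ₁ = proj₁ (proj₁ (proj₂ pre))
        one : lookup (applyQ φ x₁) (j ↑ˡ d) ≡ 1ℚ
        one = trans (cong (λ z → lookup z (j ↑ˡ d)) (proj₂ (proj₂ pre))) (trans (Vecₚ.lookup-map (j ↑ˡ d) ι (CayleyGens seg (j ↑ˡ d))) (trans (cong (λ z → ι (lookup z (j ↑ˡ d))) (gens-↑ˡ seg j)) (trans (cong ι (Vecₚ.lookup-++ˡ (unit j) (proj₁ (seg j)) j)) (trans (unit-δ j j) (δ-refl j)))))
        b = ι (lookup (AffZ.b φ) (j ↑ˡ d))
        nought : lookup (applyQ φ x₁) (j ↑ˡ d) ≡ 0ℚ
        nought = trans (row φ x₁ (j ↑ˡ d)) (trans (sym (trans (affine-comb φ v (j ↑ˡ d) λ₁) (cong₂ _+_ (trans (cong (_* b) (proj₁ (proj₂ (proj₂ (proj₁ (proj₂ pre)))))) (*-identityˡ b)) (Σ-cong (λ c → cong (ι (AffZ.A φ (j ↑ˡ d) c) *_) (combQ-elim {λ' = λ₁} {v} (proj₂ (proj₂ (proj₂ (proj₁ (proj₂ pre))))) c))))))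
          (Σ-zero (λ i → trans (cong (λ₁ i *_) (fz i)) (*-zeroʳ (λ₁ i)))))

-- The cyclic group of lattice points of Par(Δ)

private
  integer-step : ∀ {p q} → IsInt (p - q) → p < 1ℚ → 0ℚ ≤ q → q ≤ p → p ≡ q
  integer-step {p} {q} int p<1 q≥0 q≤p = go (natural int (0≤-sub q≤p))
    where
    lem : ∀ p q → p ≡ p - q + q
    lem = solve-∀ ℚ-ring
    go : (∃ λ a → p - q ≡ # a) → p ≡ q
    go (zero  , e) = trans (lem p q) (trans (cong (_+ q) (trans e #0≡0)) (+-identityˡ q))
    go (suc a , e) = contradiction (<-≤-trans p<1 (≤-trans (#≥1 {suc a} (s≤s z≤n)) (subst (_≤ p) e (≤-by q q≥0 (lem p q))))) (<-irrefl refl)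

unit-interval : ∀ {p q} → IsInt (p - q) → 0ℚ ≤ p → p < 1ℚ → 0ℚ ≤ q → q < 1ℚ → p ≡ q
unit-interval {p} {q} int p≥0 p<1 q≥0 q<1 with ≤-total q p
... | inj₁ q≤p = integer-step int p<1 q≥0 q≤p
... | inj₂ p≤q = sym (integer-step (subst IsInt (lem p q) (int-neg int)) q<1 p≥0 p≤q)
  where
  lem : ∀ p q → - (p - q) ≡ q - p
  lem = solve-∀ ℚ-ring

%-complement : ∀ n .{{_ : NonZero n}} x y → n ∣ x ℕ.+ y → x % n ≢ 0 → x % n ℕ.+ y % n ≡ n
%-complement n x y d x≢0 = go (ℕd.m%n≡0⇒n∣m (x % n ℕ.+ y % n) n (trans (sym (%-distribˡ-+ x y n)) (ℕd.n∣m⇒m%n≡0 (x ℕ.+ y) n d)))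
  where
  s = x % n ℕ.+ y % n
  s<2n : s ℕ.< 2 ℕ.* n
  s<2n = subst (s ℕ.<_) (cong (n ℕ.+_) (sym (ℕₚ.+-identityʳ n))) (ℕₚ.+-mono-< (m%n<n x n) (m%n<n y n))
  go : n ∣ s → s ≡ n
  go (divides zero e)          = contradiction (ℕₚ.m+n≡0⇒m≡0 (x % n) e) x≢0
  go (divides (suc zero) e)    = trans e (ℕₚ.+-identityʳ n)
  go (divides (suc (suc q)) e) = contradiction (ℕₚ.<-≤-trans s<2n (subst (2 ℕ.* n ℕ.≤_) (sym e) (ℕₚ.*-monoˡ-≤ n (s≤s (s≤s (z≤n {q})))))) (ℕₚ.<-irrefl refl)

module Residues (e : ℕ) (v : Fin (suc (suc (2 ℕ.* e))) → Pt (suc (2 ℕ.* e))) (indep : AffinelyIndependent v)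
                (facets : ∀ j → IsBasicSimplex (v ∘ punchIn j)) where

  open Conditions e v indep facets public

  private
    m d : ℕ
    m = suc (2 ℕ.* e)
    d = suc e

  abstract
    b : Fin (suc m) → ℕ
    b i = β i ℤ.%ℕ n

    t : Fin (suc m) → ℤ
    t i = β i ℤ./ℕ n

    b<n : ∀ i → b i ℕ.< n
    b<n i = ℤdm.n%ℕd<d (β i) n

    β-split : ∀ i → β i ≡ ℤ.+ (b i) ℤ.+ t i ℤ.* ℤ.+ n
    β-split i = ℤdm.a≡a%ℕn+[a/ℕn]*n (β i) n

    -- The residue is written `1 % n` because `n = 1` is allowed, and then it is 0.
    b-zero : b zero ≡ 1 % n
    b-zero = cong (ℤ._%ℕ n) (ι-injective {β zero} {ℤ.+ 1} (trans (sym (β≡ zero)) nθ₀))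

  nθ≡ : ∀ i → # n * θ i ≡ # (b i) + ι (t i) * # n
  nθ≡ i = trans (β≡ i) (trans (cong ι (β-split i)) (trans (ι-+ (ℤ.+ (b i)) (t i ℤ.* ℤ.+ n)) (cong₂ _+_ (sym (#≡ι (b i))) (trans (ι-* (t i) (ℤ.+ n)) (cong (ι (t i) *_) (sym (#≡ι n)))))))

  θ≡ : ∀ i → θ i ≡ (# (b i) + ι (t i) * # n) * inv (# n)
  θ≡ i = divide-n (nθ≡ i)

  -- If `c` divides `b i` and `n = n′ c`, then `n′ θ i` is integral, hence `n′ θ zero` is too by
  -- `θ-faithful`. But `c` times the latter is `n θ zero = 1`.
  b-coprime : ∀ i → Coprime (b i) n
  b-coprime i {c} (divides b′ b≡ , divides n′ n≡) = ℕₚ.m*n≡1⇒m≡1 c ℤ.∣ proj₁ int ∣ (trans (sym (ℤₚ.abs-* (ℤ.+ c) (proj₁ int))) (cong ℤ.∣_∣ (ι-injective {ℤ.+ c ℤ.* proj₁ int} {ℤ.+ 1}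
      (trans (ι-* (ℤ.+ c) (proj₁ int)) (trans (cong₂ _*_ (sym (#≡ι c)) (sym (proj₂ int))) (trans (lem₂ (# c) (# n′) (θ zero)) (trans (cong (_* θ zero) (sym n≡#)) nθ₀)))))))
    where
    n≡# : # n ≡ # n′ * # c
    n≡# = trans (cong #_ n≡) (#-* n′ c)
    lem : ∀ n′ b′ c t n i → n′ * ((b′ * c + t * n) * i) ≡ b′ * ((n′ * c) * i) + n′ * t * (n * i)
    lem = solve-∀ ℚ-ring
    lem₂ : ∀ c n t → c * (n * t) ≡ n * c * t
    lem₂ = solve-∀ ℚ-ring
    one : # n * inv (# n) ≡ 1ℚ
    one = inv-r> n>0
    int : IsInt (# n′ * θ zero)
    int = θ-faithful (int-# n′) i (subst IsInt (sym (trans (cong (# n′ *_) (trans (θ≡ i) (cong (λ z → (z + ι (t i) * # n) * inv (# n)) (trans (cong #_ b≡) (#-* b′ c)))))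
      (trans (lem (# n′) (# b′) (# c) (ι (t i)) (# n) (inv (# n))) (cong₂ _+_ (trans (cong (λ z → # b′ * (z * inv (# n))) (sym n≡#)) (trans (cong (# b′ *_) one) (*-identityʳ (# b′)))) (trans (cong (# n′ * ι (t i) *_) one) (*-identityʳ (# n′ * ι (t i))))))))
      (int-+ (int-# b′) (int-* (int-# n′) (int-ι (t i)))))

  private
    -- Removing the integral parts `quot` of the coordinates of `s g` leaves its representative in
    -- Par(Δ).
    multiple : ∀ s → Σ (Pt m) λ x → ∃ λ l → ∀ i → bary x (# l) i ≡ # ((s ℕ.* b i) % n) * inv (# n)
    multiple s = finish (translate (lattice-affine zero-lattice (int-# s) g-lattice) quot)
      where
      quot : Fin (suc m) → ℤ
      quot i = ℤ.+ ((s ℕ.* b i) / n) ℤ.+ ℤ.+ s ℤ.* t i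
      y = λ c → 0ℚ + # s * g c
      κ = 0ℚ + # s * 0ℚ
      lem : ∀ s b t n i → s * ((b + t * n) * i) ≡ s * b * i + s * t * (n * i)
      lem = solve-∀ ℚ-ring
      lem₂ : ∀ r q n i u → (r + q * n) * i + u * (n * i) - (q + u) ≡ r * i + (q + u) * (n * i) - (q + u)
      lem₂ = solve-∀ ℚ-ring
      lem₃ : ∀ r q → r + q * 1ℚ - q ≡ r
      lem₃ = solve-∀ ℚ-ring
      value : ∀ i → coords y κ i - ι (quot i) ≡ # ((s ℕ.* b i) % n) * inv (# n)
      value i = trans (cong₂ _-_ (trans (coords-affine (λ _ → 0ℚ) 0ℚ (# s) g 0ℚ i) (trans (cong (_+ # s * θ i) (coords-0 i)) (trans (+-identityˡ (# s * θ i)) (trans (cong (# s *_) (θ≡ i)) (lem (# s) (# (b i)) (ι (t i)) (# n) (inv (# n)))))))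
            (trans (ι-+ (ℤ.+ ((s ℕ.* b i) / n)) (ℤ.+ s ℤ.* t i)) (cong₂ _+_ (sym (#≡ι ((s ℕ.* b i) / n))) (trans (ι-* (ℤ.+ s) (t i)) (cong (_* ι (t i)) (sym (#≡ι s)))))))
          (trans (cong (λ z → z * inv (# n) + # s * ι (t i) * (# n * inv (# n)) - (# ((s ℕ.* b i) / n) + # s * ι (t i))) (trans (sym (#-* s (b i))) (trans (cong #_ (m≡m%n+[m/n]*n (s ℕ.* b i) n)) (trans (#-+ ((s ℕ.* b i) % n) ((s ℕ.* b i) / n ℕ.* n)) (cong (# ((s ℕ.* b i) % n) +_) (#-* ((s ℕ.* b i) / n) n))))))
            (trans (lem₂ (# ((s ℕ.* b i) % n)) (# ((s ℕ.* b i) / n)) (# n) (inv (# n)) (# s * ι (t i)))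
              (trans (cong (λ z → # ((s ℕ.* b i) % n) * inv (# n) + (# ((s ℕ.* b i) / n) + # s * ι (t i)) * z - (# ((s ℕ.* b i) / n) + # s * ι (t i))) (inv-r> n>0))
                (lem₃ (# ((s ℕ.* b i) % n) * inv (# n)) (# ((s ℕ.* b i) / n) + # s * ι (t i))))))
      finish : (∃₂ λ y′ κ′ → Lattice y′ κ′ × κ′ ≡ κ - Σℚ (ι ∘ quot) × (∀ i → coords y′ κ′ i ≡ coords y κ i - ι (quot i))) → Σ (Pt m) λ x → ∃ λ l → ∀ i → bary x (# l) i ≡ # ((s ℕ.* b i) % n) * inv (# n)
      finish (y′ , κ′ , lat , _ , co) = build (realize lat (λ i → subst (0ℚ ≤_) (sym (trans (co i) (value i))) (fraction≥0 ((s ℕ.* b i) % n))))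
        where
        build : (Σ (Pt m) λ x → ∃ λ l → (∀ i → bary x (# l) i ≡ coords y′ κ′ i) × # l ≡ κ′) → Σ (Pt m) λ x → ∃ λ l → ∀ i → bary x (# l) i ≡ # ((s ℕ.* b i) % n) * inv (# n)
        build (x , l , h , _) = x , l , λ i → trans (h i) (trans (co i) (value i))

  abstract
    P : ℕ → Pt m
    P s = proj₁ (multiple s)

    K : ℕ → ℕ
    K s = proj₁ (proj₂ (multiple s))

    P-coords : ∀ s i → bary (P s) (# (K s)) i ≡ # ((s ℕ.* b i) % n) * inv (# n)
    P-coords s = proj₂ (proj₂ (multiple s))

  K-sum : ∀ s → Σℚ (λ i → # ((s ℕ.* b i) % n)) ≡ # n * # (K s)
  K-sum s = sym (trans (cong (# n *_) (trans (sym (coords-sum (lookup (Vec.map ι (P s))) (# (K s)))) (trans (Σ-cong (P-coords s)) (Σ-*ʳ (inv (# n)) (λ i → # ((s ℕ.* b i) % n))))))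
    (trans (lem (# n) (Σℚ (λ i → # ((s ℕ.* b i) % n))) (inv (# n))) (trans (cong (Σℚ (λ i → # ((s ℕ.* b i) % n)) *_) (inv-r> n>0)) (*-identityʳ (Σℚ (λ i → # ((s ℕ.* b i) % n)))))))
    where
    lem : ∀ n s i → n * (s * i) ≡ s * (n * i)
    lem = solve-∀ ℚ-ring

  residue-zero : ∀ {s} → s ℕ.< n → (s ℕ.* b zero) % n ≡ s
  residue-zero {s} s<n = trans (cong (λ z → (s ℕ.* z) % n) b-zero) (trans (%-*-cong n s (m%n%n≡m%n 1 n)) (trans (cong (_% n) (ℕₚ.*-identityʳ s)) (m<n⇒m%n≡m s<n)))

  residue≢0 : ∀ {s} → 0 ℕ.< s → s ℕ.< n → ∀ i → (s ℕ.* b i) % n ≢ 0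
  residue≢0 {s} 0<s s<n i z = ℕₚ.<-irrefl refl (ℕₚ.<-≤-trans s<n (ℕd.∣⇒≤ {{ℕ.>-nonZero 0<s}} (Cop.coprime-divisor (Cop.sym (b-coprime i)) (subst (n ∣_) (ℕₚ.*-comm s (b i)) (ℕd.m%n≡0⇒n∣m (s ℕ.* b i) n z)))))

  #n-cancel : ∀ {a b} → # n * # a ≡ # n * # b → a ≡ b
  #n-cancel {a} {b} h = #-injective (≤-antisym (*-cancelˡ (# n) n>0 (≤-reflexive h)) (*-cancelˡ (# n) n>0 (≤-reflexive (sym h))))

  -- The `b i` are units, so no `s b i` is 0 modulo `n`; the residues for `s` and `n - s` therefore
  -- add up to `n` at each vertex.
  K-complement : ∀ {s} → 0 ℕ.< s → s ℕ.< n → K s ℕ.+ K (n ℕ.∸ s) ≡ suc m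
  K-complement {s} 0<s s<n = #n-cancel (trans (cong (# n *_) (#-+ (K s) (K (n ℕ.∸ s)))) (trans (*-distribˡ-+ (# n) (# (K s)) (# (K (n ℕ.∸ s)))) (trans (cong₂ _+_ (sym (K-sum s)) (sym (K-sum (n ℕ.∸ s))))
    (trans (sym (Σ-+ (λ i → # ((s ℕ.* b i) % n)) (λ i → # (((n ℕ.∸ s) ℕ.* b i) % n)))) (trans (Σ-cong (λ i → trans (sym (#-+ ((s ℕ.* b i) % n) (((n ℕ.∸ s) ℕ.* b i) % n))) (cong #_ (pair i)))) (trans (Σ-const (suc m) (# n)) (*-comm (# (suc m)) (# n))))))))
    where
    pair : ∀ i → (s ℕ.* b i) % n ℕ.+ ((n ℕ.∸ s) ℕ.* b i) % n ≡ n
    pair i = %-complement n (s ℕ.* b i) ((n ℕ.∸ s) ℕ.* b i) (subst (n ∣_) (trans (cong (ℕ._* b i) (sym (ℕₚ.m+[n∸m]≡n (ℕₚ.<⇒≤ s<n)))) (ℕₚ.*-distribʳ-+ (b i) s (n ℕ.∸ s))) (ℕd.m∣m*n (b i))) (residue≢0 0<s s<n i)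

  fraction-int : ∀ {r} → r ℕ.< n → IsInt (# r * inv (# n)) → r ≡ 0
  fraction-int {r} r<n int = #-injective (trans (divide (unit-interval {# r * inv (# n)} {0ℚ} (subst IsInt (lem (# r * inv (# n))) int) (fraction≥0 r) (fraction<1 r<n) ≤-refl 0<1)) (sym #0≡0))
    where
    lem : ∀ a → a ≡ a - 0ℚ
    lem = solve-∀ ℚ-ring
    lem₂ : ∀ r n i → r * (n * i) ≡ n * (r * i)
    lem₂ = solve-∀ ℚ-ring
    divide : # r * inv (# n) ≡ 0ℚ → # r ≡ 0ℚ
    divide z = trans (sym (*-identityʳ (# r))) (trans (cong (# r *_) (sym (inv-r> n>0))) (trans (lem₂ (# r) (# n) (inv (# n))) (trans (cong (# n *_) z) (*-zeroʳ (# n)))))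

  2d≡ : d ℕ.+ d ≡ suc m
  2d≡ = cong suc (trans (ℕₚ.+-suc e e) (cong (λ z → suc (e ℕ.+ z)) (sym (ℕₚ.+-identityʳ e))))

  module _ (integral : Integral) where

    -- At a smaller height the coordinates would be integral, but the one at `zero` is a proper
    -- fraction.
    K≥d : ∀ {s} → 0 ℕ.< s → s ℕ.< n → d ℕ.≤ K s
    K≥d {s} 0<s s<n with suc e ℕ.≤? K s
    ... | yes p = p
    ... | no ¬p = contradiction (fraction-int (m%n<n (s ℕ.* b zero) n) (subst IsInt (P-coords s zero) (integral (K s) (ℕₚ.≤-pred (ℕₚ.≰⇒> ¬p)) (P s) (λ i → subst (0ℚ ≤_) (sym (P-coords s i)) (fraction≥0 ((s ℕ.* b i) % n))) zero))) (residue≢0 0<s s<n zero)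

    K≡d : ∀ {s} → 0 ℕ.< s → s ℕ.< n → K s ≡ d
    K≡d {s} 0<s s<n = ℕₚ.≤-antisym (ℕₚ.+-cancelʳ-≤ d (K s) d (subst (K s ℕ.+ d ℕ.≤_) (trans (K-complement 0<s s<n) (sym 2d≡)) (ℕₚ.+-monoʳ-≤ (K s) (K≥d (ℕₚ.m<n⇒0<n∸m s<n) (ℕₚ.∸-monoʳ-< 0<s (ℕₚ.<⇒≤ s<n)))))) (K≥d 0<s s<n)

  K0≡0 : K 0 ≡ 0
  K0≡0 = #n-cancel (trans (sym (K-sum 0)) (trans (Σ-zero {suc m} {λ i → # ((0 ℕ.* b i) % n)} (λ i → trans (cong #_ (m<n⇒m%n≡m {n} {0} 1≤n)) #0≡0)) (sym (trans (cong (# n *_) #0≡0) (*-zeroʳ (# n))))))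

  Q : ℕ → Pt m × ℤ
  Q s = P s , ℤ.+ (K s)

  Q-par : ∀ s → ParAt v (K s) (Q s)
  Q-par s = par-point (P s) (K s) (λ i → subst (λ z → 0ℚ ≤ z × z < 1ℚ) (sym (P-coords s i)) (fraction≥0 ((s ℕ.* b i) % n) , fraction<1 (m%n<n (s ℕ.* b i) n)))

  #-cancel-< : ∀ {a b} → # a < # b → a ℕ.< b
  #-cancel-< h = ℕₚ.≰⇒> (λ b≤a → <-irrefl refl (<-≤-trans h (#-mono b≤a)))

  -- The coordinate `s / n` at `v zero` decides everything: relative to the multiple `s` of the
  -- generator all coordinates differ by integers, and both sets lie in [0, 1).
  Q-complete : ∀ l x → ParAt v l x → ∃ λ s → s ℕ.< n × x ≡ Q s × l ≡ K s
  Q-complete l (x , .(ℤ.+ l)) (refl , λ' , bd , ec , es) = find (natural (n-coords-integral lat zero) (0≤* (#≥0 n) (proj₁ (bound zero))))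
    where
    lat : Lattice (lookup (Vec.map ι x)) (# l)
    lat = point-lattice x (int-# l)
    bound : ∀ i → 0ℚ ≤ bary x (# l) i × bary x (# l) i < 1ℚ
    bound i = subst (λ z → 0ℚ ≤ z × z < 1ℚ) (hull-coords {λ'} (Vec.map ι x) (trans es (sym (#≡ι l))) ec i) (bd i)
    find : (∃ λ s → # n * bary x (# l) zero ≡ # s) → ∃ λ s → s ℕ.< n × (x , ℤ.+ l) ≡ Q s × l ≡ K s
    find (s , s≡) = s , s<n , cong₂ _,_ x≡ (cong ℤ.+_ l≡) , l≡
      where
      s<n : s ℕ.< n
      s<n = #-cancel-< (subst₂ _<_ s≡ (*-identityʳ (# n)) (*-monoʳ-<-pos (# n) {{ℚ.positive n>0}} (proj₂ (bound zero))))
      lem : ∀ a b s t → a - s * t - (b - s * t) ≡ a - b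
      lem = solve-∀ ℚ-ring
      lem₂ : ∀ n s i → n * (s * i) ≡ s * (n * i)
      lem₂ = solve-∀ ℚ-ring
      P₀ : # n * bary (P s) (# (K s)) zero ≡ # s
      P₀ = trans (cong (# n *_) (trans (P-coords s zero) (cong (λ z → # z * inv (# n)) (residue-zero s<n)))) (trans (lem₂ (# n) (# s) (inv (# n))) (trans (cong (# s *_) (inv-r> n>0)) (*-identityʳ (# s))))
      same : ∀ i → bary x (# l) i ≡ bary (P s) (# (K s)) i
      same i = unit-interval (subst IsInt (trans (cong₂ (λ p q → bary x (# l) i - p * θ i - (bary (P s) (# (K s)) i - q * θ i)) s≡ P₀) (lem (bary x (# l) i) (bary (P s) (# (K s)) i) (# s) (θ i))) (int-- (generated lat i) (generated (point-lattice (P s) (int-# (K s))) i)))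
        (proj₁ (bound i)) (proj₂ (bound i)) (subst (0ℚ ≤_) (sym (P-coords s i)) (fraction≥0 ((s ℕ.* b i) % n))) (subst (_< 1ℚ) (sym (P-coords s i)) (fraction<1 (m%n<n (s ℕ.* b i) n)))
      l≡ : l ≡ K s
      l≡ = #-injective (trans (sym (coords-sum (lookup (Vec.map ι x)) (# l))) (trans (Σ-cong same) (coords-sum (lookup (Vec.map ι (P s))) (# (K s)))))
      x≡ : x ≡ P s
      x≡ = lookup-ext (λ c → ι-injective (trans (sym (Vecₚ.lookup-map c ι x)) (trans (sym (coords-comb (lookup (Vec.map ι x)) (# l) c)) (trans (Σ-cong (λ i → cong (_* pt (v i) c) (same i))) (trans (coords-comb (lookup (Vec.map ι (P s))) (# (K s)) c) (Vecₚ.lookup-map c ι (P s)))))))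

  Q-injective : ∀ {s s′} → s ℕ.< n → s′ ℕ.< n → Q s ≡ Q s′ → s ≡ s′
  Q-injective {s} {s′} s<n s′<n h = #-injective (trans (sym (height s<n)) (trans (cong₂ (λ x l → # n * bary x (# l) zero) (cong proj₁ h) (ℤₚ.+-injective (cong proj₂ h))) (height s′<n)))
    where
    lem : ∀ n s i → n * (s * i) ≡ s * (n * i)
    lem = solve-∀ ℚ-ring
    height : ∀ {s} → s ℕ.< n → # n * bary (P s) (# (K s)) zero ≡ # s
    height {s} s<n = trans (cong (# n *_) (trans (P-coords s zero) (cong (λ z → # z * inv (# n)) (residue-zero s<n)))) (trans (lem (# n) (# s) (inv (# n))) (trans (cong (# s *_) (inv-r> n>0)) (*-identityʳ (# s))))

  integral⇒cond3 : Integral → Cond3 e v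
  integral⇒cond3 integral = n , 1≤n , hstar
    where
    suc< : ∀ {i} → i ℕ.< n ℕ.∸ 1 → suc i ℕ.< n
    suc< {i} i< = subst (suc (suc i) ℕ.≤_) (ℕₚ.m+[n∸m]≡n 1≤n) (s≤s i<)
    hstar : HStarIs v (coeff-1+[n-1]t^d n d)
    hstar zero = Q 0 ∷ [] , [] ∷ [] , (λ x → (λ { (here refl) → subst (λ l → ParAt v l (Q 0)) K0≡0 (Q-par 0) }) , λ p → from x (Q-complete 0 x p)) , refl
      where
      from : ∀ x → (∃ λ s → s ℕ.< n × x ≡ Q s × 0 ≡ K s) → x ∈ Q 0 ∷ []
      from x (zero  , _   , x≡ , _) = here x≡
      from x (suc s , s<n , _ , z)  = contradiction (trans z (K≡d integral (s≤s z≤n) s<n)) (λ ())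
    hstar (suc l) with l ℕ.≟ e
    -- The multiple `s = 0` is the origin, counted at height 0; the other `n - 1` multiples all have
    -- height `d`.
    ... | yes refl = applyUpTo (Q ∘ suc) (n ℕ.∸ 1) , applyUpTo⁺₁ (Q ∘ suc) (n ℕ.∸ 1) distinct , (λ x → (λ i → to x (∈-applyUpTo⁻ (Q ∘ suc) i)) , λ p → from x (Q-complete (suc l) x p)) ,
        trans (length-applyUpTo (Q ∘ suc) (n ℕ.∸ 1)) (cong (λ b → if b then n ℕ.∸ 1 else 0) (sym ≡ᵇ-refl))
      where
      ≡ᵇ-refl : (e ℕ.≡ᵇ e) ≡ true
      ≡ᵇ-refl with e ℕ.≡ᵇ e in eq
      ... | true  = refl
      ... | false = contradiction (subst Bool.T eq (ℕₚ.≡⇒≡ᵇ e e refl)) (λ ())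
      distinct : ∀ {i j} → i ℕ.< j → j ℕ.< n ℕ.∸ 1 → Q (suc i) ≢ Q (suc j)
      distinct i<j j<n h = ℕₚ.<-irrefl (ℕₚ.suc-injective (Q-injective (suc< (ℕₚ.<-trans i<j j<n)) (suc< j<n) h)) i<j
      to : ∀ x → (∃ λ i → i ℕ.< n ℕ.∸ 1 × x ≡ Q (suc i)) → ParAt v (suc l) x
      to x (i , i< , x≡) = subst₂ (ParAt v) (K≡d integral (s≤s z≤n) (suc< i<)) (sym x≡) (Q-par (suc i))
      from : ∀ x → (∃ λ s → s ℕ.< n × x ≡ Q s × suc l ≡ K s) → x ∈ applyUpTo (Q ∘ suc) (n ℕ.∸ 1)
      from x (zero  , _   , _ , z)  = contradiction (trans z K0≡0) (λ ())
      from x (suc s , s<n , x≡ , _) = subst (_∈ applyUpTo (Q ∘ suc) (n ℕ.∸ 1)) (sym x≡) (∈-applyUpTo⁺ (Q ∘ suc) (ℕₚ.≤-pred (subst (suc s ℕ.<_) (sym (ℕₚ.m+[n∸m]≡n 1≤n)) s<n)))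
    ... | no l≢e = [] , [] , (λ x → (λ ()) , λ p → contradiction (Q-complete (suc l) x p) (absent x)) , cong (λ b → if b then n ℕ.∸ 1 else 0) (sym (≡ᵇ-≢ l≢e))
      where
      absent : ∀ x → ¬ (∃ λ s → s ℕ.< n × x ≡ Q s × suc l ≡ K s)
      absent x (zero  , _   , _ , z) = contradiction (trans z K0≡0) (λ ())
      absent x (suc s , s<n , _ , z) = l≢e (ℕₚ.suc-injective (trans z (K≡d integral (s≤s z≤n) s<n)))

-- Pairing opposite residues

∣+-cancel-% : ∀ n .{{_ : NonZero n}} x {y z} → n ∣ x ℕ.+ y → n ∣ x ℕ.+ z → y % n ≡ z % n
∣+-cancel-% n x {y} {z} p q = trans (sym (%-remove-+ʳ y q)) (trans (cong (_% n) (lem x y z)) (%-remove-+ʳ z p))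
  where
  lem : ∀ x y z → y ℕ.+ (x ℕ.+ z) ≡ z ℕ.+ (x ℕ.+ y)
  lem = ℕring.solve-∀

∣+-transport : ∀ n .{{_ : NonZero n}} x {y z} → y % n ≡ z % n → n ∣ x ℕ.+ y → n ∣ x ℕ.+ z
∣+-transport n x {y} {z} e p = ℕd.m%n≡0⇒n∣m (x ℕ.+ z) n (trans (cong (_% n) (ℕₚ.+-comm x z)) (trans (sym (%-+-cong n x e)) (trans (cong (_% n) (ℕₚ.+-comm y x)) (ℕd.n∣m⇒m%n≡0 (x ℕ.+ y) n p))))

∣+-comm : ∀ {n} x y → n ∣ x ℕ.+ y → n ∣ y ℕ.+ x
∣+-comm {n} x y = subst (n ∣_) (ℕₚ.+-comm x y)

-- Modulo 1 or 2 there is a single unit, and it is its own opposite. Balance carries no information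
-- there, so `partner` treats this case apart.
small-modulus : ∀ n {x y} → n ∣ 2 → Coprime x n → Coprime y n → n ∣ x ℕ.+ y
small-modulus 0 d _ _ = contradiction (ℕd.0∣⇒≡0 d) (λ ())
small-modulus 1 {x} {y} _ _ _ = ℕd.1∣ (x ℕ.+ y)
small-modulus 2 {x} {y} _ p q = ℕd.m%n≡0⇒n∣m (x ℕ.+ y) 2 (trans (%-distribˡ-+ x y 2) (cong₂ (λ r s → (r ℕ.+ s) % 2) (odd x p) (odd y q)))
  where
  odd : ∀ x → Coprime x 2 → x % 2 ≡ 1
  odd x p with x % 2 in eq | m%n<n x 2
  ... | 0 | _ = contradiction (p (ℕd.m%n≡0⇒n∣m x 2 eq , ℕd.∣-refl)) (λ ())
  ... | 1 | _ = refl
  ... | suc (suc _) | s≤s (s≤s ())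
small-modulus (suc (suc (suc n))) d _ _ = contradiction (ℕd.∣⇒≤ d) (λ { (s≤s (s≤s ())) })

-- σ n β a is [a ≡ β] − [a ≡ −β] for residues modulo n
σ : ∀ n .{{_ : NonZero n}} → ℕ → ℕ → ℚ
σ n β a = χ (β ℕ.≟ a % n) - χ ((β ℕ.+ a) % n ℕ.≟ 0)

module _ (n : ℕ) {{_ : NonZero n}} where

  private
    reduced : ∀ {β} → β ℕ.< n → β % n ≡ β
    reduced = m<n⇒m%n≡m

    reflect : ∀ {β a a′} → β ℕ.< n → n ∣ a ℕ.+ a′ → χ (β ℕ.≟ a′ % n) ≡ χ ((β ℕ.+ a) % n ℕ.≟ 0)
    reflect {β} {a} {a′} β<n d = χ-⇔ (β ℕ.≟ a′ % n) ((β ℕ.+ a) % n ℕ.≟ 0)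
      (λ e → ℕd.n∣m⇒m%n≡0 (β ℕ.+ a) n (∣+-comm a β (∣+-transport n a {a′} {β} (trans (sym e) (sym (reduced β<n))) d)))
      (λ e → trans (sym (reduced β<n)) (∣+-cancel-% n a (∣+-comm β a (ℕd.m%n≡0⇒n∣m (β ℕ.+ a) n e)) d))

    reflect′ : ∀ {β β′} a → β ℕ.< n → n ∣ β′ ℕ.+ β → χ (β ℕ.≟ a % n) ≡ χ ((β′ ℕ.+ a) % n ℕ.≟ 0)
    reflect′ {β} {β′} a β<n d = χ-⇔ (β ℕ.≟ a % n) ((β′ ℕ.+ a) % n ℕ.≟ 0)
      (λ e → ℕd.n∣m⇒m%n≡0 (β′ ℕ.+ a) n (∣+-transport n β′ {β} {a} (trans (reduced β<n) e) d))
      (λ e → trans (sym (reduced β<n)) (∣+-cancel-% n β′ d (ℕd.m%n≡0⇒n∣m (β′ ℕ.+ a) n e)))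

  σ-anti : ∀ {β a a′} → β ℕ.< n → n ∣ a ℕ.+ a′ → σ n β a′ ≡ - σ n β a
  σ-anti {β} {a} {a′} β<n d = trans (cong₂ _-_ (reflect β<n d) (sym (reflect β<n (∣+-comm a a′ d)))) (lem (χ ((β ℕ.+ a) % n ℕ.≟ 0)) (χ (β ℕ.≟ a % n)))
    where
    lem : ∀ x y → x - y ≡ - (y - x)
    lem = solve-∀ ℚ-ring

  σ-opposite : ∀ {β β′} a → β ℕ.< n → β′ ℕ.< n → n ∣ β ℕ.+ β′ → σ n β a + σ n β′ a ≡ 0ℚ
  σ-opposite {β} {β′} a β<n β′<n d = trans (cong₂ (λ p q → p - y + (q - x)) (reflect′ a β<n (∣+-comm β β′ d)) (reflect′ a β′<n d)) (lem x y)
    where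
    x = χ ((β′ ℕ.+ a) % n ℕ.≟ 0)
    y = χ ((β ℕ.+ a) % n ℕ.≟ 0)
    lem : ∀ x y → x - y + (y - x) ≡ 0ℚ
    lem = solve-∀ ℚ-ring

  Balanced : ∀ {M} → (Fin M → ℕ) → Set
  Balanced b = ∀ a → Σℚ (λ i → σ n (b i) a) ≡ 0ℚ

  -- Evaluate the balance at `b zero`: that residue occurs, so its opposite occurs as well. The
  -- occurrence can only be `zero` itself if `b zero` is its own opposite, and for a unit this means
  -- `n ∣ 2`.
  partner : ∀ {N} (b : Fin (suc (suc N)) → ℕ) → (∀ i → b i ℕ.< n) → (∀ i → Coprime (b i) n) → Balanced b → ∃ λ j → n ∣ b zero ℕ.+ b (suc j)
  partner {N} b b<n cop bal with Finₚ.any? (λ j → n ∣? b zero ℕ.+ b (suc j))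
  ... | yes found = found
  ... | no none = contradiction (zero , small-modulus n n∣2 (cop zero) (cop (suc zero))) none
    where
    b₀ = b zero
    A B : Fin (suc (suc N)) → ℚ
    A i = χ (b i ℕ.≟ b₀ % n)
    B i = χ ((b i ℕ.+ b₀) % n ℕ.≟ 0)
    lem : ∀ x y → x ≡ x - y + y
    lem = solve-∀ ℚ-ring
    A≡B : Σℚ A ≡ Σℚ B
    A≡B = trans (lem (Σℚ A) (Σℚ B)) (trans (cong (_+ Σℚ B) (trans (sym (Σ-- A B)) (bal b₀))) (+-identityˡ (Σℚ B)))
    A≥1 : 1ℚ ≤ Σℚ A
    A≥1 = subst (_≤ Σℚ A) (χ-yes (b₀ ℕ.≟ b₀ % n) (sym (reduced (b<n zero)))) (Σ-term≤ {f = A} zero (λ i → χ≥0 (b i ℕ.≟ b₀ % n)))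
    B≡ : Σℚ B ≡ B zero
    B≡ = trans (cong (B zero +_) (Σ-zero {f = λ i → B (suc i)} (λ i → χ-no ((b (suc i) ℕ.+ b₀) % n ℕ.≟ 0) (λ e → none (i , ∣+-comm (b (suc i)) b₀ (ℕd.m%n≡0⇒n∣m (b (suc i) ℕ.+ b₀) n e)))))) (+-identityʳ (B zero))
    n∣2b₀ : n ∣ b₀ ℕ.+ b₀
    n∣2b₀ with (b₀ ℕ.+ b₀) % n ℕ.≟ 0
    ... | yes z = ℕd.m%n≡0⇒n∣m (b₀ ℕ.+ b₀) n z
    ... | no ¬z = contradiction (<-≤-trans 0<1 (subst (1ℚ ≤_) (trans A≡B (trans B≡ (χ-no ((b₀ ℕ.+ b₀) % n ℕ.≟ 0) ¬z))) A≥1)) (<-irrefl refl)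
    n∣2 : n ∣ 2
    n∣2 = Cop.coprime-divisor (Cop.sym (cop zero)) (subst (n ∣_) (lem₂ b₀) n∣2b₀)
      where
      lem₂ : ∀ x → x ℕ.+ x ≡ x ℕ.* 2
      lem₂ = ℕring.solve-∀

record Pairing {M} (n d : ℕ) (b : Fin M → ℕ) : Set where
  field
    p q      : Fin d → Fin M
    index    : Fin M → Fin d ⊎ Fin d
    index-p  : ∀ j → index (p j) ≡ inj₁ j
    index-q  : ∀ j → index (q j) ≡ inj₂ j
    cover    : ∀ i → [ p , q ]′ (index i) ≡ i
    sum      : ∀ (F : Fin M → ℚ) → Σℚ F ≡ Σℚ (λ j → F (p j) + F (q j))
    opposite : ∀ j → n ∣ b (p j) ℕ.+ b (q j)

-- The new pair is put last with `zero` as its `q`-end, since `v zero` has to become the end (a, n)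
-- of the last segment.
extend : ∀ {n d M} {b : Fin (suc (suc M)) → ℕ} j → n ∣ b zero ℕ.+ b (suc j) → Pairing n d (b ∘ suc ∘ punchIn j) →
  Σ (Pairing n (suc d) b) λ π → Pairing.q π (fromℕ d) ≡ zero
extend {n} {d} {M} {b} j opp π = record
  { p = p ; q = q ; index = index ; index-p = index-p ; index-q = index-q ; cover = cover ; sum = sum ; opposite = opposite } , caseLast-last d q₀ zero
  where
  module π = Pairing π
  p₀ q₀ : Fin d → Fin (suc (suc M))
  p₀ x = suc (punchIn j (π.p x))
  q₀ x = suc (punchIn j (π.q x))
  p q : Fin (suc d) → Fin (suc (suc M))
  p = caseLast p₀ (suc j)
  q = caseLast q₀ zero
  up : Fin d ⊎ Fin d → Fin (suc d) ⊎ Fin (suc d)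
  up (inj₁ x) = inj₁ (inject₁ x)
  up (inj₂ x) = inj₂ (inject₁ x)
  index-suc : ∀ {i} → Dec (j ≡ i) → Fin (suc d) ⊎ Fin (suc d)
  index-suc (yes _)   = inj₁ (fromℕ d)
  index-suc (no j≢i) = up (π.index (punchOut j≢i))
  index : Fin (suc (suc M)) → Fin (suc d) ⊎ Fin (suc d)
  index zero    = inj₂ (fromℕ d)
  index (suc i) = index-suc (j Fin.≟ i)
  index-new : index (suc j) ≡ inj₁ (fromℕ d)
  index-new with j Fin.≟ j
  ... | yes _ = refl
  ... | no ne = contradiction refl ne
  index-old : ∀ x → index (suc (punchIn j x)) ≡ up (π.index x)
  index-old x with j Fin.≟ punchIn j x
  ... | yes e = contradiction (sym e) (Finₚ.punchInᵢ≢i j x)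
  ... | no ne = cong (λ z → up (π.index z)) (trans (Finₚ.punchOut-cong j {i≢j = ne} {i≢k = Finₚ.punchInᵢ≢i j x ∘ sym} refl) (Finₚ.punchOut-punchIn j))
  index-p : ∀ k → index (p k) ≡ inj₁ k
  index-p k with view k
  ... | ‵fromℕ     = trans (cong index (caseLast-last d p₀ (suc j))) index-new
  ... | ‵inject₁ x = trans (cong index (caseLast-inject p₀ (suc j) x)) (trans (index-old (π.p x)) (cong up (π.index-p x)))
  index-q : ∀ k → index (q k) ≡ inj₂ k
  index-q k with view k
  ... | ‵fromℕ     = cong index (caseLast-last d q₀ zero)
  ... | ‵inject₁ x = trans (cong index (caseLast-inject q₀ zero x)) (trans (index-old (π.q x)) (cong up (π.index-q x)))
  cover-old : ∀ z → [ p , q ]′ (up z) ≡ suc (punchIn j ([ π.p , π.q ]′ z))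
  cover-old (inj₁ x) = caseLast-inject p₀ (suc j) x
  cover-old (inj₂ x) = caseLast-inject q₀ zero x
  cover : ∀ i → [ p , q ]′ (index i) ≡ i
  cover zero    = caseLast-last d q₀ zero
  cover (suc i) = go (j Fin.≟ i)
    where
    go : ∀ (dec : Dec (j ≡ i)) → [ p , q ]′ (index-suc dec) ≡ suc i
    go (yes refl) = caseLast-last d p₀ (suc j)
    go (no j≢i)   = trans (cover-old (π.index (punchOut j≢i))) (cong suc (trans (cong (punchIn j) (π.cover (punchOut j≢i))) (Finₚ.punchIn-punchOut j≢i)))
  sum : ∀ (F : Fin (suc (suc M)) → ℚ) → Σℚ F ≡ Σℚ (λ k → F (p k) + F (q k))
  sum F = trans (cong (F zero +_) (Σ-punch j (F ∘ suc))) (trans (cong (λ z → F zero + (F (suc j) + z)) (π.sum (F ∘ suc ∘ punchIn j)))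
    (trans (lem (F zero) (F (suc j)) (Σℚ (λ x → F (p₀ x) + F (q₀ x))))
      (sym (trans (Σ-last (λ k → F (p k) + F (q k))) (cong₂ _+_ (Σ-cong (λ x → cong₂ (λ s t → F s + F t) (caseLast-inject p₀ (suc j) x) (caseLast-inject q₀ zero x))) (cong₂ (λ s t → F s + F t) (caseLast-last d p₀ (suc j)) (caseLast-last d q₀ zero)))))))
    where
    lem : ∀ a b s → a + (b + s) ≡ s + (b + a)
    lem = solve-∀ ℚ-ring
  opposite : ∀ k → n ∣ b (p k) ℕ.+ b (q k)
  opposite k with view k
  ... | ‵fromℕ     = subst₂ (λ s t → n ∣ b s ℕ.+ b t) (sym (caseLast-last d p₀ (suc j))) (sym (caseLast-last d q₀ zero)) (∣+-comm (b zero) (b (suc j)) opp)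
  ... | ‵inject₁ x = subst₂ (λ s t → n ∣ b s ℕ.+ b t) (sym (caseLast-inject p₀ (suc j) x)) (sym (caseLast-inject q₀ zero x)) (π.opposite x)

module _ (n : ℕ) {{_ : NonZero n}} where

  remove-pair : ∀ {M} {b : Fin (suc (suc M)) → ℕ} j → (∀ i → b i ℕ.< n) → n ∣ b zero ℕ.+ b (suc j) → Balanced n b → Balanced n (b ∘ suc ∘ punchIn j)
  remove-pair {b = b} j b<n opp bal a = trans (sym (+-identityˡ rest)) (trans (cong (_+ rest) (sym (σ-opposite n a (b<n zero) (b<n (suc j)) opp)))
      (trans (+-assoc (σ n (b zero) a) (σ n (b (suc j)) a) rest) (trans (cong (σ n (b zero) a +_) (sym (Σ-punch j (λ i → σ n (b (suc i)) a)))) (bal a))))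
    where rest = Σℚ (λ i → σ n (b (suc (punchIn j i))) a)

  pairing : ∀ d {M} → M ≡ d ℕ.+ d → (b : Fin M → ℕ) → (∀ i → b i ℕ.< n) → (∀ i → Coprime (b i) n) → Balanced n b → Pairing n d b
  pairing-suc : ∀ d {M} → M ≡ d ℕ.+ d → (b : Fin (suc (suc M)) → ℕ) → (∀ i → b i ℕ.< n) → (∀ i → Coprime (b i) n) → Balanced n b →
    Σ (Pairing n (suc d) b) λ π → Pairing.q π (fromℕ d) ≡ zero
  pairing zero refl b _ _ _ = record
    { p = λ () ; q = λ () ; index = λ () ; index-p = λ () ; index-q = λ () ; cover = λ () ; sum = λ _ → refl ; opposite = λ () }
  pairing (suc d) {suc (suc M)} eq b b<n cop bal = proj₁ (pairing-suc d (ℕₚ.suc-injective (trans (ℕₚ.suc-injective eq) (ℕₚ.+-suc d d))) b b<n cop bal)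
  pairing (suc d) {suc zero}    eq = contradiction (trans (ℕₚ.suc-injective eq) (ℕₚ.+-suc d d)) (λ ())
  pairing-suc d eq b b<n cop bal with partner n b b<n cop bal
  ... | j , opp = extend j opp (pairing d eq (b ∘ suc ∘ punchIn j) (λ i → b<n (suc (punchIn j i))) (λ i → cop (suc (punchIn j i))) (remove-pair {b = b} j b<n opp bal))

-- Balance from the vanishing of sawtooth sums

∑-Σ-swap : ∀ N {k} (f : ℕ → Fin k → ℚ) → ∑ N (λ a → Σℚ (f a)) ≡ Σℚ (λ i → ∑ N (λ a → f a i))
∑-Σ-swap zero    {k} f = sym (Σ-zero {k} {f = λ _ → 0ℚ} (λ _ → refl))
∑-Σ-swap (suc N) f = trans (cong (_+ Σℚ (f N)) (∑-Σ-swap N f)) (sym (Σ-+ (λ i → ∑ N (λ a → f a i)) (f N)))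

module _ (n : ℕ) {{_ : NonZero n}} {M} (b : Fin M → ℕ) (b<n : ∀ i → b i ℕ.< n) (cop : ∀ i → Coprime (b i) n) where

  private
    c : ℕ → ℚ
    c a = Σℚ (λ i → σ n (b i) a)

    c-per : Per n c
    c-per a = Σ-cong (λ i → cong₂ (λ x y → χ (b i ℕ.≟ x) - χ (y ℕ.≟ 0)) (Data.Nat.DivMod.[m+n]%n≡m%n a n)
      (trans (cong (_% n) (sym (ℕₚ.+-assoc (b i) a n))) (Data.Nat.DivMod.[m+n]%n≡m%n (b i ℕ.+ a) n)))

    c-anti : Anti n c
    c-anti a a′ d = trans (Σ-cong (λ i → σ-anti n (b<n i) d)) (Σ-neg (λ i → σ n (b i) a))

    c-supp : ∀ a → ¬ Coprime a n → c a ≡ 0ℚ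
    c-supp a ¬p = Σ-zero (λ i → cong₂ _-_
      (χ-no (b i ℕ.≟ a % n) (λ e → ¬p (λ {d} (d∣a , d∣n) → cop i (subst (d ∣_) (sym e) (ℕd.%-presˡ-∣ d∣a d∣n) , d∣n))))
      (χ-no ((b i ℕ.+ a) % n ℕ.≟ 0) (λ e → ¬p (λ {d} (d∣a , d∣n) → cop i (ℕd.∣m+n∣m⇒∣n (∣+-comm (b i) a (ℕd.∣-trans d∣n (ℕd.m%n≡0⇒n∣m (b i ℕ.+ a) n e))) d∣a , d∣n)))))

    b̄ : Fin M → ℕ
    b̄ i = (n ℕ.∸ b i) % n

    b+b̄ : ∀ i → n ∣ b i ℕ.+ b̄ i
    b+b̄ i = ∣+-transport n (b i) {n ℕ.∸ b i} {b̄ i} (sym (m%n%n≡m%n (n ℕ.∸ b i) n)) (subst (n ∣_) (sym (ℕₚ.m+[n∸m]≡n (ℕₚ.<⇒≤ (b<n i)))) ℕd.∣-refl)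

    pick : ∀ i (F : ℕ → ℚ) → ∑ n (λ a → σ n (b i) a * F a) ≡ F (b i) - F (b̄ i)
    pick i F = trans (∑-cong′ n (λ a → lem (χ (b i ℕ.≟ a % n)) (χ ((b i ℕ.+ a) % n ℕ.≟ 0)) (F a))) (trans (∑-- n (λ a → χ (b i ℕ.≟ a % n) * F a) (λ a → χ ((b i ℕ.+ a) % n ℕ.≟ 0) * F a))
      (cong₂ _-_
        (trans (∑-single n {λ a → χ (b i ℕ.≟ a % n) * F a} (b i) (b<n i) (λ a a<n a≢ → trans (cong (_* F a) (χ-no (b i ℕ.≟ a % n) (λ e → a≢ (trans (sym (m<n⇒m%n≡m a<n)) (sym e))))) (*-zeroˡ (F a))))
          (trans (cong (_* F (b i)) (χ-yes (b i ℕ.≟ b i % n) (sym (m<n⇒m%n≡m (b<n i))))) (*-identityˡ (F (b i)))))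
        (trans (∑-single n {λ a → χ ((b i ℕ.+ a) % n ℕ.≟ 0) * F a} (b̄ i) (m%n<n (n ℕ.∸ b i) n) (λ a a<n a≢ → trans (cong (_* F a) (χ-no ((b i ℕ.+ a) % n ℕ.≟ 0) (λ e → a≢ (trans (sym (m<n⇒m%n≡m a<n)) (trans (∣+-cancel-% n (b i) (ℕd.m%n≡0⇒n∣m (b i ℕ.+ a) n e) (b+b̄ i)) (m<n⇒m%n≡m (m%n<n (n ℕ.∸ b i) n))))))) (*-zeroˡ (F a))))
          (trans (cong (_* F (b̄ i)) (χ-yes ((b i ℕ.+ b̄ i) % n ℕ.≟ 0) (ℕd.n∣m⇒m%n≡0 (b i ℕ.+ b̄ i) n (b+b̄ i)))) (*-identityˡ (F (b̄ i)))))))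
      where
      lem : ∀ x y f → (x - y) * f ≡ x * f - y * f
      lem = solve-∀ ℚ-ring

  -- Summing `c` against a sawtooth picks its value at each `b i` minus its value at the opposite
  -- residue. Passing to the opposite residue amounts to replacing `s` by `n - s`, so the hypothesis
  -- is the sawtooth relation for `c`.
  balanced : (∀ {s} → 0 ℕ.< s → s ℕ.< n → Σℚ (λ i → # ((s ℕ.* b i) % n)) ≡ Σℚ (λ i → # (((n ℕ.∸ s) ℕ.* b i) % n))) → Balanced n b
  balanced sums a = go (ℕₚ.m≤n⇒m<n∨m≡n (ℕ.>-nonZero⁻¹ n))
    where
    c-saw : ∀ k → ∑ n (λ a → c a * # ((k ℕ.* a) % n)) ≡ 0ℚ
    c-saw k = trans (∑-cong′ n (λ a → sym (Σ-*ʳ (F a) (λ i → σ n (b i) a)))) (trans (∑-Σ-swap n (λ a i → σ n (b i) a * F a)) (trans (Σ-cong (λ i → pick i F)) (trans (Σ-- (F ∘ b) (F ∘ b̄)) (trans (cong (_- Σℚ (F ∘ b̄)) (equal (k % n ℕ.≟ 0))) (+-inverseʳ (Σℚ (F ∘ b̄)))))))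
      where
      F : ℕ → ℚ
      F a = # ((k ℕ.* a) % n)
      equal : Dec (k % n ≡ 0) → Σℚ (F ∘ b) ≡ Σℚ (F ∘ b̄)
      equal (yes z) = Σ-cong (λ i → cong #_ (trans (vanishes (b i)) (sym (vanishes (b̄ i)))))
        where
        vanishes : ∀ x → (k ℕ.* x) % n ≡ 0
        vanishes x = ℕd.n∣m⇒m%n≡0 (k ℕ.* x) n (ℕd.∣m⇒∣m*n x (ℕd.m%n≡0⇒n∣m k n z))
      equal (no ¬z) = trans (Σ-cong (λ i → cong #_ (first i))) (trans (sums (ℕₚ.n≢0⇒n>0 ¬z) (m%n<n k n)) (Σ-cong (λ i → cong #_ (second i))))
        where
        s = k % n
        first : ∀ i → (k ℕ.* b i) % n ≡ (s ℕ.* b i) % n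
        first i = trans (cong (_% n) (ℕₚ.*-comm k (b i))) (trans (%-*-cong n (b i) (sym (m%n%n≡m%n k n))) (cong (_% n) (ℕₚ.*-comm (b i) s)))
        n∣k+ : n ∣ k ℕ.+ (n ℕ.∸ s)
        n∣k+ = ∣+-comm (n ℕ.∸ s) k (∣+-transport n (n ℕ.∸ s) {s} {k} (m%n%n≡m%n k n) (subst (n ∣_) (sym (ℕₚ.m∸n+n≡m (ℕₚ.<⇒≤ (m%n<n k n)))) ℕd.∣-refl))
        second : ∀ i → ((n ℕ.∸ s) ℕ.* b i) % n ≡ (k ℕ.* b̄ i) % n
        second i = ∣+-cancel-% n (k ℕ.* b i) (subst (n ∣_) (ℕₚ.*-distribʳ-+ (b i) k (n ℕ.∸ s)) (ℕd.∣m⇒∣m*n (b i) n∣k+)) (subst (n ∣_) (ℕₚ.*-distribˡ-+ k (b i) (b̄ i)) (ℕd.∣n⇒∣m*n k (b+b̄ i)))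
    go : 1 ℕ.< n ⊎ 1 ≡ n → c a ≡ 0ℚ
    go (inj₁ 2≤n) = SawtoothNonvanishing.vanish n 2≤n c c-per c-supp c-anti c-saw a
    -- For `n = 1` every residue is its own opposite, so `c` equals `- c`.
    go (inj₂ 1≡n) = self-neg (c a) (c-anti a a (subst (_∣ a ℕ.+ a) 1≡n (ℕd.1∣ (a ℕ.+ a))))

-- The isomorphism onto the Cayley polytope

private
  cayley-ring-1 : ∀ x y → x + 0ℚ * y ≡ x
  cayley-ring-1 = solve-∀ ℚ-ring
  cayley-ring-2 : ∀ u w x y s t → u * (x + s) + w * (y + t) ≡ u * x + w * y + (u * s + w * t)
  cayley-ring-2 = solve-∀ ℚ-ring
  cayley-ring-3 : ∀ s u w g h → s * (u * g + w * h) ≡ u * (s * g) + w * (s * h)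
  cayley-ring-3 = solve-∀ ℚ-ring
  cayley-ring-4 : ∀ b c t u n i → (b + t * n) * i + (c + u * n) * i ≡ (b + c) * i + (t + u) * (n * i)
  cayley-ring-4 = solve-∀ ℚ-ring
  cayley-ring-5 : ∀ b i → b * i + - b * i ≡ 0ℚ
  cayley-ring-5 = solve-∀ ℚ-ring
  cayley-ring-6 : ∀ u w x y h s t → u * x + w * y ≡ u * (x - h * s) + w * (y - h * t) + h * (u * s + w * t)
  cayley-ring-6 = solve-∀ ℚ-ring
  cayley-ring-7 : ∀ l x → l * x ≡ (x - 0ℚ) * l
  cayley-ring-7 = solve-∀ ℚ-ring
  cayley-ring-8 : ∀ n y i → n * (y * i) ≡ y * (n * i)
  cayley-ring-8 = solve-∀ ℚ-ring
  cayley-ring-9 : ∀ a b → a - b + b ≡ a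
  cayley-ring-9 = solve-∀ ℚ-ring
  cayley-ring-10 : ∀ a b → a - b + b ≡ a
  cayley-ring-10 = solve-∀ ℚ-ring
  cayley-ring-11 : ∀ x s → x ≡ x + s - s
  cayley-ring-11 = solve-∀ ℚ-ring
  cayley-ring-12 : ∀ y b z i → y - - b * (z * i) - z * (b * i) ≡ y
  cayley-ring-12 = solve-∀ ℚ-ring
  cayley-ring-13 : ∀ y r z s t → y - (r - z * t) - z * (s + t) ≡ y - r - z * s
  cayley-ring-13 = solve-∀ ℚ-ring
  cayley-ring-14 : ∀ r z t v → r * v ≡ (r - z * t) * v + z * (t * v)
  cayley-ring-14 = solve-∀ ℚ-ring
  cayley-ring-15 : ∀ a b → a - b + b ≡ a
  cayley-ring-15 = solve-∀ ℚ-ring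
  cayley-ring-16 : ∀ l n → 0ℚ + l * n ≡ n * l
  cayley-ring-16 = solve-∀ ℚ-ring

Σ-↑ : ∀ r {d} (F : Fin (r ℕ.+ d) → ℚ) → Σℚ F ≡ Σℚ (λ j → F (j ↑ˡ d)) + Σℚ (λ j → F (r ↑ʳ j))
Σ-↑ zero        F = sym (+-identityˡ (Σℚ F))
Σ-↑ (suc r) {d} F = trans (cong (F zero +_) (Σ-↑ r (F ∘ suc))) (sym (+-assoc (F zero) (Σℚ (λ j → F (suc j ↑ˡ d))) (Σℚ (λ j → F (suc r ↑ʳ j)))))

applyZ-ι : ∀ {m N} (φ : AffZ m N) x r → ι (lookup (applyZ φ x) r) ≡ lookup (applyQ φ (Vec.map ι x)) r
applyZ-ι φ x r = trans (cong ι (Vecₚ.lookup∘tabulate (λ r → lookup (AffZ.b φ) r ℤ.+ Σℤ (λ c → AffZ.A φ r c ℤ.* lookup x c)) r)) (trans (ι-+ (lookup (AffZ.b φ) r) (Σℤ (λ c → AffZ.A φ r c ℤ.* lookup x c)))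
  (trans (cong (ι (lookup (AffZ.b φ) r) +_) (trans (Σ-ι (λ c → AffZ.A φ r c ℤ.* lookup x c)) (Σ-cong (λ c → trans (ι-* (AffZ.A φ r c) (lookup x c)) (cong (ι (AffZ.A φ r c) *_) (sym (Vecₚ.lookup-map c ι x))))))) (sym (row φ (Vec.map ι x) r))))

Π-coprime : ∀ {k n} (a : Fin k → ℤ) → (∀ i → Coprime ℤ.∣ a i ∣ n) → Coprime ℤ.∣ Πℤ a ∣ n
Π-coprime {zero}  {n} a h = Cop.1-coprimeTo n
Π-coprime {suc k} {n} a h = subst (λ z → Coprime z n) (sym (ℤₚ.abs-* (a zero) (Πℤ (a ∘ suc)))) (coprime-* {ℤ.∣ a zero ∣} {ℤ.∣ Πℤ (a ∘ suc) ∣} {n} (h zero) (Π-coprime (a ∘ suc) (h ∘ suc)))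

module Cayley (e : ℕ) (v : Fin (suc (suc (2 ℕ.* e))) → Pt (suc (2 ℕ.* e))) (indep : AffinelyIndependent v)
              (facets : ∀ j → IsBasicSimplex (v ∘ punchIn j)) where

  open Residues e v indep facets public

  private
    m d : ℕ
    m = suc (2 ℕ.* e)
    d = suc e

  β-coprime : ∀ i → Coprime ℤ.∣ β i ∣ n
  β-coprime i {c} (c∣β , c∣n) = b-coprime i (ℤd.∣⇒∣ᵤ {ℤ.+ c} {ℤ.+ (b i)} (ℤd.∣m+n∣n⇒∣m (subst (ℤ.+ c ℤd.∣_) (β-split i) (ℤd.∣ᵤ⇒∣ c∣β)) (ℤd.∣n⇒∣m*n (t i) (ℤd.∣ᵤ⇒∣ {ℤ.+ c} {ℤ.+ n} c∣n))) , c∣n)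

  θ-zero : θ zero ≡ inv (# n)
  θ-zero = sym (inv-unique nθ₀)

  θ-β : ∀ i → θ i ≡ ι (β i) * inv (# n)
  θ-β i = divide-n (β≡ i)

  module Iso (π : Pairing n d b) (q-last : Pairing.q π (fromℕ e) ≡ zero) where
    open Pairing π

    -- Chosen so that `θ (q c) + a c * θ zero` vanishes, as `θ i` is `β i / n` and `θ zero` is
    -- `1 / n`.
    a : Fin e → ℤ
    a c = ℤ.- β (q (inject₁ c))

    private
      w₁ w₂ : Fin d ⊎ Fin d → ℤ
      w₁ (inj₁ j) = ℤ.+ 1
      w₁ (inj₂ c) = caseLast (λ _ → ℤ.+ 1) (ℤ.+ n) c
      w₂ (inj₁ j) = ℤ.+ 1
      w₂ (inj₂ c) = caseLast a (ℤ.+ 0) c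
      i₁ i₂ : Fin d ⊎ Fin d → Fin (suc m)
      i₁ (inj₁ j) = p j
      i₁ (inj₂ c) = q c
      i₂ (inj₁ j) = q j
      i₂ (inj₂ c) = zero

    -- The linear map that sends the vertex `p j` to (e_j, 0), the vertex `q j` to (e_j, e_j) for
    -- `j < d`, and `v zero`, the last `q`, to (e_d, (a, n)).
    L : (Fin (suc m) → ℚ) → Fin d ⊎ Fin d → ℚ
    L λ' z = ι (w₁ z) * λ' (i₁ z) + ι (w₂ z) * λ' (i₂ z)

    L-top : ∀ λ' j → L λ' (inj₁ j) ≡ λ' (p j) + λ' (q j)
    L-top λ' j = cong₂ _+_ (*-identityˡ (λ' (p j))) (*-identityˡ (λ' (q j)))

    L-mid : ∀ λ' c → L λ' (inj₂ (inject₁ c)) ≡ λ' (q (inject₁ c)) + ι (a c) * λ' zero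
    L-mid λ' c = trans (cong₂ (λ x y → ι x * λ' (q (inject₁ c)) + ι y * λ' zero) (caseLast-inject (λ _ → ℤ.+ 1) (ℤ.+ n) c) (caseLast-inject a (ℤ.+ 0) c)) (cong (_+ ι (a c) * λ' zero) (*-identityˡ (λ' (q (inject₁ c)))))

    L-last : ∀ λ' → L λ' (inj₂ (fromℕ e)) ≡ # n * λ' zero
    L-last λ' = trans (cong₂ (λ x y → ι x * λ' (q (fromℕ e)) + ι y * λ' zero) (caseLast-last e (λ _ → ℤ.+ 1) (ℤ.+ n)) (caseLast-last e a (ℤ.+ 0))) (trans (cong₂ (λ x y → x * λ' y + 0ℚ * λ' zero) (sym (#≡ι n)) q-last) (cayley-ring-1 (# n * λ' zero) (λ' zero)))

    L-cong : ∀ {λ' λ″} → (∀ i → λ' i ≡ λ″ i) → ∀ z → L λ' z ≡ L λ″ z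
    L-cong h z = cong₂ (λ x y → ι (w₁ z) * x + ι (w₂ z) * y) (h (i₁ z)) (h (i₂ z))

    L-affine : ∀ {l} λ' (s : Fin l → ℚ) (G : Fin l → Fin (suc m) → ℚ) z → L (λ i → λ' i + Σℚ (λ c → s c * G c i)) z ≡ L λ' z + Σℚ (λ c → s c * L (G c) z)
    L-affine λ' s G z = trans (cayley-ring-2 u₁ u₂ (λ' (i₁ z)) (λ' (i₂ z)) (Σℚ (λ c → s c * G c (i₁ z))) (Σℚ (λ c → s c * G c (i₂ z))))
        (cong (L λ' z +_) (sym (trans (Σ-cong (λ c → cayley-ring-3 (s c) u₁ u₂ (G c (i₁ z)) (G c (i₂ z)))) (trans (Σ-+ (λ c → u₁ * (s c * G c (i₁ z))) (λ c → u₂ * (s c * G c (i₂ z)))) (cong₂ _+_ (Σ-*ˡ u₁ (λ c → s c * G c (i₁ z))) (Σ-*ˡ u₂ (λ c → s c * G c (i₂ z))))))))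
      where
      u₁ = ι (w₁ z)
      u₂ = ι (w₂ z)

    -- Here the opposite residues matter: they make the first `d` Cayley coordinates of `g`
    -- integral.
    θ-pair : ∀ j → IsInt (θ (p j) + θ (q j))
    θ-pair j = go (opposite j)
      where
      go : n ∣ b (p j) ℕ.+ b (q j) → IsInt (θ (p j) + θ (q j))
      go (divides k h) = subst IsInt (sym (trans (cong₂ _+_ (θ≡ (p j)) (θ≡ (q j))) (trans (cayley-ring-4 (# (b (p j))) (# (b (q j))) (ι (t (p j))) (ι (t (q j))) (# n) (inv (# n)))
          (cong₂ _+_ (trans (cong (_* inv (# n)) (trans (sym (#-+ (b (p j)) (b (q j)))) (trans (cong #_ h) (#-* k n)))) (trans (*-assoc (# k) (# n) (inv (# n))) (trans (cong (# k *_) (inv-r> n>0)) (*-identityʳ (# k)))))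
                     (trans (cong ((ι (t (p j)) + ι (t (q j))) *_) (inv-r> n>0)) (*-identityʳ (ι (t (p j)) + ι (t (q j)))))))))
        (int-+ (int-# k) (int-+ (int-ι (t (p j))) (int-ι (t (q j)))))

    Lθ-int : ∀ z → IsInt (L θ z)
    Lθ-int (inj₁ j) = subst IsInt (sym (L-top θ j)) (θ-pair j)
    Lθ-int (inj₂ c) with view c
    ... | ‵fromℕ     = ℤ.+ 1 , trans (L-last θ) nθ₀
    ... | ‵inject₁ c′ = ℤ.+ 0 , trans (L-mid θ c′) (trans (cong₂ _+_ (θ-β (q (inject₁ c′))) (cong₂ _*_ (ι-neg (β (q (inject₁ c′)))) θ-zero)) (cayley-ring-5 (ι (β (q (inject₁ c′)))) (inv (# n))))

    -- `L` has integer coefficients, and the lattice is generated by the vertices and `g`; it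
    -- remains to know that `L θ` is integral.
    L-int : ∀ {y κ} → Lattice y κ → ∀ z → IsInt (L (coords y κ) z)
    L-int {y} {κ} lat z = subst IsInt (sym (cayley-ring-6 (ι (w₁ z)) (ι (w₂ z)) (coords y κ (i₁ z)) (coords y κ (i₂ z)) (# n * coords y κ zero) (θ (i₁ z)) (θ (i₂ z))))
        (int-+ (int-+ (int-* (int-ι (w₁ z)) (generated lat (i₁ z))) (int-* (int-ι (w₂ z)) (generated lat (i₂ z)))) (int-* (height-integral lat) (Lθ-int z)))

    private
      axis-lattice : ∀ c → Lattice (λ c′ → δ c′ c) 0ℚ
      axis-lattice c = (λ c′ → int-χ (c′ Fin.≟ c)) , (ℤ.+ 0 , refl)
      origin-lattice : Lattice (λ _ → 0ℚ) 1ℚ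
      origin-lattice = (λ _ → ℤ.+ 0 , refl) , (ℤ.+ 1 , refl)

    abstract
      -- The matrix entries are `L` at the gradients of the coordinates, the constant term is `L` at
      -- the origin; `L-int` makes both integral.
      φ : AffZ m (d ℕ.+ d)
      φ = record { A = λ r c → proj₁ (L-int (axis-lattice c) (splitAt d r)) ; b = tabulate (λ r → proj₁ (L-int origin-lattice (splitAt d r))) }

      φ-row : ∀ x r → lookup (applyQ φ x) r ≡ L (coords (lookup x) 1ℚ) (splitAt d r)
      φ-row x r = trans (row φ x r) (trans (cong₂ _+_ (trans (cong ι (Vecₚ.lookup∘tabulate (λ r → proj₁ (L-int origin-lattice (splitAt d r))) r)) (sym (proj₂ (L-int origin-lattice (splitAt d r)))))
            (Σ-cong (λ c → trans (cong (_* lookup x c) (sym (proj₂ (L-int (axis-lattice c) (splitAt d r))))) (cayley-ring-7 (L (gradient c) (splitAt d r)) (lookup x c)))))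
          (sym (trans (L-cong (λ i → coords-gradient (λ _ → 0ℚ) (lookup x) 1ℚ i) (splitAt d r)) (L-affine (coords (λ _ → 0ℚ) 1ℚ) (λ c → lookup x c - 0ℚ) gradient (splitAt d r)))))

    R₀ : (Fin d ⊎ Fin d → ℚ) → ℚ
    R₀ y = y (inj₂ (fromℕ e)) * inv (# n)

    Rq : (Fin d ⊎ Fin d → ℚ) → Fin d → ℚ
    Rq y = caseLast (λ c → y (inj₂ (inject₁ c)) - ι (a c) * R₀ y) (R₀ y)

    Rp : (Fin d ⊎ Fin d → ℚ) → Fin d → ℚ
    Rp y j = y (inj₁ j) - Rq y j

    -- `L` is triangular and is inverted step by step: the last coordinate gives the weight of
    -- `v zero`, then come the weights of the `q j`, and then those of the `p j`.
    R : (Fin d ⊎ Fin d → ℚ) → Fin (suc m) → ℚ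
    R y i = [ Rp y , Rq y ]′ (index i)

    R-p : ∀ y j → R y (p j) ≡ Rp y j
    R-p y j = cong [ Rp y , Rq y ]′ (index-p j)

    R-q : ∀ y j → R y (q j) ≡ Rq y j
    R-q y j = cong [ Rp y , Rq y ]′ (index-q j)

    R-zero : ∀ y → R y zero ≡ R₀ y
    R-zero y = trans (cong (R y) (sym q-last)) (trans (R-q y (fromℕ e)) (caseLast-last e (λ c → y (inj₂ (inject₁ c)) - ι (a c) * R₀ y) (R₀ y)))

    n*R₀ : ∀ y → # n * R₀ y ≡ y (inj₂ (fromℕ e))
    n*R₀ y = trans (cayley-ring-8 (# n) (y (inj₂ (fromℕ e))) (inv (# n))) (trans (cong (y (inj₂ (fromℕ e)) *_) (inv-r> n>0)) (*-identityʳ (y (inj₂ (fromℕ e)))))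

    L∘R : ∀ y z → L (R y) z ≡ y z
    L∘R y (inj₁ j) = trans (L-top (R y) j) (trans (cong₂ _+_ (R-p y j) (R-q y j)) (cayley-ring-9 (y (inj₁ j)) (Rq y j)))
    L∘R y (inj₂ c) with view c
    ... | ‵fromℕ     = trans (L-last (R y)) (trans (cong (# n *_) (R-zero y)) (n*R₀ y))
    ... | ‵inject₁ c′ = trans (L-mid (R y) c′) (trans (cong₂ (λ s t → s + ι (a c′) * t) (trans (R-q y (inject₁ c′)) (caseLast-inject (λ c → y (inj₂ (inject₁ c)) - ι (a c) * R₀ y) (R₀ y) c′)) (R-zero y)) (cayley-ring-10 (y (inj₂ (inject₁ c′))) (ι (a c′) * R₀ y)))

    L-injective : ∀ {λ' λ″} → (∀ z → L λ' z ≡ L λ″ z) → ∀ i → λ' i ≡ λ″ i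
    L-injective {λ'} {λ″} h i = trans (cong λ' (sym (cover i))) (trans (by (index i)) (cong λ″ (cover i)))
      where
      l₀ : λ' zero ≡ λ″ zero
      l₀ = trans (divide-n (sym (L-last λ'))) (trans (cong (_* inv (# n)) (h (inj₂ (fromℕ e)))) (sym (divide-n (sym (L-last λ″)))))
      cancel : ∀ {x y s t} → s ≡ t → x + s ≡ y + t → x ≡ y
      cancel {x} {y} {s} refl e = trans (cayley-ring-11 x s) (trans (cong (_- s) e) (sym (cayley-ring-11 y s)))
      by-q : ∀ c → λ' (q c) ≡ λ″ (q c)
      by-q c with view c
      ... | ‵fromℕ     = trans (cong λ' q-last) (trans l₀ (cong λ″ (sym q-last)))
      ... | ‵inject₁ c′ = cancel (cong (ι (a c′) *_) l₀) (trans (sym (L-mid λ' c′)) (trans (h (inj₂ (inject₁ c′))) (L-mid λ″ c′)))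
      by : ∀ z → λ' ([ p , q ]′ z) ≡ λ″ ([ p , q ]′ z)
      by (inj₂ c) = by-q c
      by (inj₁ j) = cancel (by-q j) (trans (sym (L-top λ' j)) (trans (h (inj₁ j)) (L-top λ″ j)))

    φ-onto-H : ∀ x → InHQ d (applyQ φ x)
    φ-onto-H x = trans (Σ-cong (λ j → trans (lookup-take d (applyQ φ x) j) (trans (φ-row x (j ↑ˡ d)) (trans (cong (L (coords (lookup x) 1ℚ)) (Finₚ.splitAt-↑ˡ d j d)) (L-top (coords (lookup x) 1ℚ) j))))) (trans (sym (sum (coords (lookup x) 1ℚ))) (coords-sum (lookup x) 1ℚ))

    φ-injective : ∀ x x′ → applyQ φ x ≡ applyQ φ x′ → x ≡ x′
    φ-injective x x′ h = lookup-ext (λ c → trans (sym (coords-comb (lookup x) 1ℚ c)) (trans (Σ-cong (λ i → cong (_* pt (v i) c) (same i))) (coords-comb (lookup x′) 1ℚ c)))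
      where
      same : ∀ i → coords (lookup x) 1ℚ i ≡ coords (lookup x′) 1ℚ i
      same = L-injective (λ z → subst (λ z → L (coords (lookup x) 1ℚ) z ≡ L (coords (lookup x′) 1ℚ) z) (Finₚ.splitAt-join d d z) (trans (sym (φ-row x (Fin.join d d z))) (trans (cong (λ y → lookup y (Fin.join d d z)) h) (φ-row x′ (Fin.join d d z)))))

    -- With `Z` the last coordinate of `z`, all `R y i - Z * θ i` are integral. The preimage is thus
    -- an integral combination of the vertices plus `Z` copies of `g`, a lattice point.
    φ-surjective : ∀ z → InHZ d z → ∃ λ x → applyZ φ x ≡ z
    φ-surjective z inH = proj₁ X , lookup-ext (λ r → ι-injective (trans (applyZ-ι φ (proj₁ X) r) (trans (φ-row (Vec.map ι (proj₁ X)) r) (trans (L-cong (λ i → sym (co i)) (splitAt d r)) (trans (L∘R y (splitAt d r)) (cong (λ r → pt z r) (Finₚ.join-splitAt d d r)))))))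
      where
      y : Fin d ⊎ Fin d → ℚ
      y s = pt z (Fin.join d d s)
      y-int : ∀ s → IsInt (y s)
      y-int s = int-ι (lookup z (Fin.join d d s))
      Z : ℚ
      Z = y (inj₂ (fromℕ e))
      q-part : ∀ c → IsInt (Rq y c - Z * θ (q c))
      q-part c with view c
      ... | ‵fromℕ     = ℤ.+ 0 , trans (cong₂ _-_ (caseLast-last e (λ c → y (inj₂ (inject₁ c)) - ι (a c) * R₀ y) (R₀ y)) (cong (Z *_) (trans (cong θ q-last) θ-zero))) (+-inverseʳ (Z * inv (# n)))
      ... | ‵inject₁ c′ = subst IsInt (sym (trans (cong₂ _-_ (trans (caseLast-inject (λ c → y (inj₂ (inject₁ c)) - ι (a c) * R₀ y) (R₀ y) c′) (cong (λ s → y (inj₂ (inject₁ c′)) - s * R₀ y) (ι-neg (β (q (inject₁ c′)))))) (cong (Z *_) (θ-β (q (inject₁ c′))))) (cayley-ring-12 (y (inj₂ (inject₁ c′))) (ι (β (q (inject₁ c′)))) Z (inv (# n))))) (y-int (inj₂ (inject₁ c′)))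
      part : ∀ s → IsInt ([ Rp y , Rq y ]′ s - Z * θ ([ p , q ]′ s))
      part (inj₂ c) = q-part c
      part (inj₁ j) = subst IsInt (cayley-ring-13 (y (inj₁ j)) (Rq y j) Z (θ (p j)) (θ (q j))) (int-- (int-- (y-int (inj₁ j)) (q-part j)) (int-* (y-int (inj₂ (fromℕ e))) (θ-pair j)))
      R-int : ∀ i → IsInt (R y i - Z * θ i)
      R-int i = subst (λ k → IsInt (R y i - Z * θ k)) (cover i) (part (index i))
      comb-int : ∀ c → IsInt (comb (R y) v c)
      comb-int c = subst IsInt (sym (trans (Σ-cong (λ i → cayley-ring-14 (R y i) Z (θ i) (pt (v i) c))) (trans (Σ-+ (λ i → (R y i - Z * θ i) * pt (v i) c) (λ i → Z * (θ i * pt (v i) c))) (cong (Σℚ (λ i → (R y i - Z * θ i) * pt (v i) c) +_) (trans (Σ-*ˡ Z (λ i → θ i * pt (v i) c)) (cong (Z *_) (coords-comb g 0ℚ c)))))))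
          (int-+ (int-Σ (λ i → int-* (R-int i) (int-ι (lookup (v i) c)))) (int-* (y-int (inj₂ (fromℕ e))) (proj₁ g-lattice c)))
      X = integral-point comb-int
      R-sum : Σℚ (R y) ≡ 1ℚ
      R-sum = trans (sum (R y)) (trans (Σ-cong (λ j → trans (cong₂ _+_ (R-p y j) (R-q y j)) (trans (cayley-ring-15 (y (inj₁ j)) (Rq y j)) (cong ι (sym (lookup-take d z j)))))) (trans (sym (Σ-ι (lookup (take d z)))) (cong ι inH)))
      co : ∀ i → R y i ≡ coords (lookup (Vec.map ι (proj₁ X))) 1ℚ i
      co = coords-unique {R y} (lookup (Vec.map ι (proj₁ X))) 1ℚ R-sum (λ c → sym (proj₂ X c))

    private
      ends : Fin d → Pt d
      ends = caseLast (λ j → unit (inject₁ j)) (tabulate (caseLast a (ℤ.+ n)))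
      G : Fin (d ℕ.+ d) → Pt (d ℕ.+ d)
      G = CayleyGens (segsΔ a (ℤ.+ n))

    ends-comb : ∀ (μ : Fin d → ℚ) c → Σℚ (λ j → μ j * pt (ends j) c) ≡ Σℚ (λ j → μ (inject₁ j) * δ c (inject₁ j)) + μ (fromℕ e) * ι (caseLast a (ℤ.+ n) c)
    ends-comb μ c = trans (Σ-last (λ j → μ j * pt (ends j) c)) (cong₂ _+_
      (Σ-cong (λ j → cong (μ (inject₁ j) *_) (trans (cong (λ x → pt x c) (caseLast-inject (λ j → unit (inject₁ j)) (tabulate (caseLast a (ℤ.+ n))) j)) (unit-δ (inject₁ j) c))))
      (cong (μ (fromℕ e) *_) (trans (cong (λ x → pt x c) (caseLast-last e (λ j → unit (inject₁ j)) (tabulate (caseLast a (ℤ.+ n))))) (cong ι (Vecₚ.lookup∘tabulate (caseLast a (ℤ.+ n)) c)))))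

    gens-comb : ∀ (μ : Fin (d ℕ.+ d) → ℚ) λ' → (∀ j → λ' (p j) ≡ μ (j ↑ˡ d)) → (∀ j → λ' (q j) ≡ μ (d ↑ʳ j)) → ∀ z → comb μ G (Fin.join d d z) ≡ L λ' z
    gens-comb μ λ' hp hq z = trans (trans (Σ-↑ d (λ g → μ g * pt (G g) (Fin.join d d z))) (cong₂ _+_
          (Σ-cong (λ j → cong₂ _*_ (sym (hp j)) (cong (λ x → pt x (Fin.join d d z)) (gens-↑ˡ (segsΔ a (ℤ.+ n)) j))))
          (Σ-cong (λ j → cong₂ _*_ (sym (hq j)) (cong (λ x → pt x (Fin.join d d z)) (gens-↑ʳ (segsΔ a (ℤ.+ n)) j)))))) (by z)
      where
      zeros = replicate d (ℤ.+ 0)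
      λ₀ : λ' (q (fromℕ e)) ≡ λ' zero
      λ₀ = cong λ' q-last
      pick : ∀ {k} (F : Fin k → ℚ) c → Σℚ (λ j → F j * δ c j) ≡ F c
      pick F c = trans (Σ-cong (λ j → *-comm (F j) (δ c j))) (Σ-δ′ c F)
      by : ∀ z → Σℚ (λ j → λ' (p j) * pt (unit j Vec.++ zeros) (Fin.join d d z)) + Σℚ (λ j → λ' (q j) * pt (unit j Vec.++ ends j) (Fin.join d d z)) ≡ L λ' z
      by (inj₁ k) = trans (cong₂ _+_ (trans (Σ-cong (λ j → cong (λ' (p j) *_) (trans (cong ι (Vecₚ.lookup-++ˡ (unit j) zeros k)) (unit-δ j k)))) (pick (λ' ∘ p) k))
                                     (trans (Σ-cong (λ j → cong (λ' (q j) *_) (trans (cong ι (Vecₚ.lookup-++ˡ (unit j) (ends j) k)) (unit-δ j k)))) (pick (λ' ∘ q) k))) (sym (L-top λ' k))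
      by (inj₂ c) = trans (cong₂ _+_ (Σ-zero (λ j → trans (cong (λ' (p j) *_) (cong ι (trans (Vecₚ.lookup-++ʳ (unit j) zeros c) (Vecₚ.lookup-replicate c (ℤ.+ 0))))) (*-zeroʳ (λ' (p j)))))
                                     (trans (Σ-cong (λ j → cong (λ' (q j) *_) (cong ι (Vecₚ.lookup-++ʳ (unit j) (ends j) c)))) (ends-comb (λ' ∘ q) c))) (trans (+-identityˡ (Σℚ (λ j → λ' (q (inject₁ j)) * δ c (inject₁ j)) + λ' (q (fromℕ e)) * ι (caseLast a (ℤ.+ n) c))) (bottom c))
        where
        bottom : ∀ c → Σℚ (λ j → λ' (q (inject₁ j)) * δ c (inject₁ j)) + λ' (q (fromℕ e)) * ι (caseLast a (ℤ.+ n) c) ≡ L λ' (inj₂ c)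
        bottom c with view c
        ... | ‵fromℕ     = trans (cong₂ _+_ (Σ-zero (λ j → trans (cong (λ' (q (inject₁ j)) *_) (δ-≢ {i = fromℕ e} {inject₁ j} Finₚ.fromℕ≢inject₁)) (*-zeroʳ (λ' (q (inject₁ j)))))) (cong₂ _*_ λ₀ (trans (cong ι (caseLast-last e a (ℤ.+ n))) (sym (#≡ι n)))))
                             (trans (cayley-ring-16 (λ' zero) (# n)) (sym (L-last λ')))
        ... | ‵inject₁ c′ = trans (cong₂ _+_ (trans (Σ-cong (λ j → cong (λ' (q (inject₁ j)) *_) (χ-⇔ (inject₁ c′ Fin.≟ inject₁ j) (c′ Fin.≟ j) Finₚ.inject₁-injective (cong inject₁)))) (pick (λ' ∘ q ∘ inject₁) c′)) (trans (cong₂ _*_ λ₀ (cong ι (caseLast-inject a (ℤ.+ n) c′))) (*-comm (λ' zero) (ι (a c′))))) (sym (L-mid λ' c′))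

    gens-row : ∀ (μ : Fin (d ℕ.+ d) → ℚ) λ' → (∀ j → λ' (p j) ≡ μ (j ↑ˡ d)) → (∀ j → λ' (q j) ≡ μ (d ↑ʳ j)) → ∀ r → comb μ G r ≡ L λ' (splitAt d r)
    gens-row μ λ' hp hq r = subst (λ r′ → comb μ G r′ ≡ L λ' (splitAt d r)) (Finₚ.join-splitAt d d r) (gens-comb μ λ' hp hq (splitAt d r))

    image-⊆ : ∀ y → (∃ λ x → InConv v x × applyQ φ x ≡ y) → InCayley (segsΔ a (ℤ.+ n)) y
    image-⊆ y (x , (λ' , pos , es , ec) , φx) = μ , (λ g → μ-pos (splitAt d g)) , μ-sum , combQ-intro {λ' = μ} {G} {y} (λ r → trans (gens-row μ λ' hp hq r) (trans (L-cong (hull-coords {λ'} x es ec) (splitAt d r)) (trans (sym (φ-row x r)) (cong (λ y → lookup y r) φx))))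
      where
      μ : Fin (d ℕ.+ d) → ℚ
      μ g = [ λ' ∘ p , λ' ∘ q ]′ (splitAt d g)
      μ-pos : ∀ s → 0ℚ ≤ [ λ' ∘ p , λ' ∘ q ]′ s
      μ-pos (inj₁ j) = pos (p j)
      μ-pos (inj₂ j) = pos (q j)
      hp : ∀ j → λ' (p j) ≡ μ (j ↑ˡ d)
      hp j = cong [ λ' ∘ p , λ' ∘ q ]′ (sym (Finₚ.splitAt-↑ˡ d j d))
      hq : ∀ j → λ' (q j) ≡ μ (d ↑ʳ j)
      hq j = cong [ λ' ∘ p , λ' ∘ q ]′ (sym (Finₚ.splitAt-↑ʳ d d j))
      μ-sum : Σℚ μ ≡ 1ℚ
      μ-sum = trans (Σ-↑ d μ) (trans (cong₂ _+_ (Σ-cong (sym ∘ hp)) (Σ-cong (sym ∘ hq))) (trans (sym (Σ-+ (λ' ∘ p) (λ' ∘ q))) (trans (sym (sum λ')) es)))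

    image-⊇ : ∀ y → InCayley (segsΔ a (ℤ.+ n)) y → ∃ λ x → InConv v x × applyQ φ x ≡ y
    image-⊇ y (μ , pos , es , ec) = x , (λ' , (λ i → λ-pos (index i)) , λ-sum , refl) , lookup-ext (λ r → trans (φ-row x r) (trans (L-cong (λ i → sym (hull-coords {λ'} x λ-sum refl i)) (splitAt d r)) (trans (sym (gens-row μ λ' hp hq r)) (combQ-elim {λ' = μ} {G} {y} ec r))))
      where
      λ' : Fin (suc m) → ℚ
      λ' i = [ (λ j → μ (j ↑ˡ d)) , (λ j → μ (d ↑ʳ j)) ]′ (index i)
      x = combQ λ' v
      λ-pos : ∀ s → 0ℚ ≤ [ (λ j → μ (j ↑ˡ d)) , (λ j → μ (d ↑ʳ j)) ]′ s
      λ-pos (inj₁ j) = pos (j ↑ˡ d)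
      λ-pos (inj₂ j) = pos (d ↑ʳ j)
      hp : ∀ j → λ' (p j) ≡ μ (j ↑ˡ d)
      hp j = cong [ (λ j → μ (j ↑ˡ d)) , (λ j → μ (d ↑ʳ j)) ]′ (index-p j)
      hq : ∀ j → λ' (q j) ≡ μ (d ↑ʳ j)
      hq j = cong [ (λ j → μ (j ↑ˡ d)) , (λ j → μ (d ↑ʳ j)) ]′ (index-q j)
      λ-sum : Σℚ λ' ≡ 1ℚ
      λ-sum = trans (sum λ') (trans (Σ-cong (λ j → cong₂ _+_ (hp j) (hq j))) (trans (Σ-+ (λ j → μ (j ↑ˡ d)) (λ j → μ (d ↑ʳ j))) (trans (sym (Σ-↑ d μ)) es)))

    cond4 : Cond4 e v
    cond4 = a , ℤ.+ n , ℤ.+<+ 1≤n , cong ℤ.+_ (Cop.coprime⇒gcd≡1 (Π-coprime a (λ c → subst (λ z → Coprime z n) (sym (ℤₚ.∣-i∣≡∣i∣ (β (q (inject₁ c))))) (β-coprime (q (inject₁ c)))))) ,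
      φ , (φ-onto-H , φ-injective , φ-surjective) , (λ y → image-⊆ y , image-⊇ y)

  integral⇒cond4 : Integral → Cond4 e v
  integral⇒cond4 integral = Iso.cond4 (proj₁ paired) (proj₂ paired)
    where
    sums : ∀ {s} → 0 ℕ.< s → s ℕ.< n → Σℚ (λ i → # ((s ℕ.* b i) % n)) ≡ Σℚ (λ i → # (((n ℕ.∸ s) ℕ.* b i) % n))
    sums {s} 0<s s<n = trans (K-sum s) (trans (cong (λ z → # n * # z) (trans (K≡d integral 0<s s<n) (sym (K≡d integral (ℕₚ.m<n⇒0<n∸m s<n) (ℕₚ.∸-monoʳ-< 0<s (ℕₚ.<⇒≤ s<n)))))) (sym (K-sum (n ℕ.∸ s))))
    paired : Σ (Pairing n d b) λ π → Pairing.q π (fromℕ e) ≡ zero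
    paired = pairing-suc n e (cong (e ℕ.+_) (ℕₚ.+-identityʳ e)) b b<n b-coprime (balanced n b b<n b-coprime sums)

  cond4⇒cond5 : Cond4 e v → Cond5 e v
  cond4⇒cond5 (a , k , k>0 , _ , iso) = segsΔ a k , distinct , iso
    where
    distinct : ∀ i → replicate d (ℤ.+ 0) ≢ caseLast (λ j → unit (inject₁ j)) (tabulate (caseLast a k)) i
    distinct i h with view i
    ... | ‵fromℕ     = ℤₚ.<-irrefl (trans (sym (Vecₚ.lookup-replicate (fromℕ e) (ℤ.+ 0))) (trans (cong (λ x → lookup x (fromℕ e)) (trans h (caseLast-last e (λ j → unit (inject₁ j)) (tabulate (caseLast a k))))) (trans (Vecₚ.lookup∘tabulate (caseLast a k) (fromℕ e)) (caseLast-last e a k)))) k>0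
    ... | ‵inject₁ j = 1≢0 (sym (trans (sym (cong ι (Vecₚ.lookup-replicate (inject₁ j) (ℤ.+ 0)))) (trans (cong (λ x → pt x (inject₁ j)) (trans h (caseLast-inject (λ j → unit (inject₁ j)) (tabulate (caseLast a k)) j))) (trans (unit-δ (inject₁ j) (inject₁ j)) (δ-refl (inject₁ j))))))

theorem2p5 : ∀ (e : ℕ) (v : Fin (suc (suc (2 ℕ.* e))) → Pt (suc (2 ℕ.* e))) →
  AffinelyIndependent v →
  (∀ j → IsBasicSimplex (v ∘ punchIn j)) →
  ((Cond1 e v → Cond2 e v) × (Cond2 e v → Cond1 e v)) ×
  ((Cond1 e v → Cond3 e v) × (Cond3 e v → Cond1 e v)) ×
  ((Cond1 e v → Cond4 e v) × (Cond4 e v → Cond1 e v)) ×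
  ((Cond1 e v → Cond5 e v) × (Cond5 e v → Cond1 e v))
theorem2p5 e v indep facets =
    (integral⇒cond2 ∘ cond1⇒integral , integral⇒cond1 ∘ cond2⇒integral)
  , (integral⇒cond3 ∘ cond1⇒integral , integral⇒cond1 ∘ cond3⇒integral)
  , (integral⇒cond4 ∘ cond1⇒integral , integral⇒cond1 ∘ cond5⇒integral ∘ cond4⇒cond5)
  , (cond4⇒cond5 ∘ integral⇒cond4 ∘ cond1⇒integral , integral⇒cond1 ∘ cond5⇒integral)
  where open Cayley e v indep facets
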